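{- Let $G$ be a plane graph whose set of vertices has no accumulation point in $\mathbb{R}^2$, which has bounded vertex degrees, and which has no unbounded face. Then $G$ is hyperbolic and weakly non-amenable if and only if $G$ is non-amenable and has bounded codegree.
   Context: A plane graph is a graph together with a fixed embedding of its 1-complex in $\mathbb{R}^2$ with no two edges crossing. A face is a connected component of $\mathbb{R}^2$ minus the image of the graph; the boundary of a face $F$ is the set of vertices and edges mapped into the closure of $F$, and the length $|F|$ is the number of edges in its boundary. A face is bounded if its length is finite, and unbounded otherwise. $G$ has bounded codegree if $\Delta(G^*):=\sup\{|F| : F \text{ a bounded face of } G\}<\infty$. $G$ has bounded degree if $\Delta(G):=\sup_v \deg(v)<\infty$. For a finite vertex set $S$, $\partial S=\{v\in V(G)\setminus S : v \text{ is adjacent to some } w\in S\}$. The Cheeger constant is $c(G)=\inf\{|\partial S|/|S| : \emptyset\neq S\subset V(G) \text{ finite}\}$, and $G$ is non-amenable if $c(G)>0$. $G$ is weakly non-amenable if there is a monotone increasing diverging function $f:\mathbb{N}\to\mathbb{N}$ with $|S|\le f(|\partial S|)$ for all non-empty finite vertex sets $S$. With the graph metric, a geodetic triangle consists of three vertices and three geodesics (sides) joining them pairwise; it is $\delta$-thin if each side lies in the $\delta$-neighbourhood of the union of the other two. A connected graph is $\delta$-hyperbolic if every geodetic triangle is $\delta$-thin; a graph is hyperbolic if there is $\delta\ge 0$ such that each connected component is $\delta$-hyperbolic.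
   Formalization: In the definition of weakly non-amenable, f(0) = 0 is required, so no finite non-empty S has empty boundary; with f(0) arbitrary the claim fails, e.g. for the one-vertex graph, which is hyperbolic and satisfies the bound but has Cheeger constant 0. -}

module Defs where

open import Level using (0ℓ; Level) renaming (suc to lsuc)
open import Data.Nat.Base as ℕ using (ℕ; suc)
open import Data.Integer.Base using (+_)
open import Data.Rational.Base using (ℚ; 0ℚ; 1ℚ; _/_; _<_; _≤_)
open import Data.List.Base using (List; length)
open import Data.List.Membership.Propositional using () renaming (_∈_ to _∈ˡ_)
open import Data.List.Relation.Unary.Unique.Propositional using (Unique)
open import Data.Product.Base using (Σ-syntax; ∃-syntax; _×_; _,_)
open import Data.Sum.Base using (_⊎_)
open import Function.Bundles using (_⇔_)
open import Relation.Binary.Definitions using (Monotonic₁)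
open import Relation.Binary.PropositionalEquality using (_≡_; _≢_)
open import Relation.Nullary using (¬_)
open import Relation.Unary using (Pred; _∈_; _⊆_; _≐_; _∪_; _∩_; Satisfiable)

private
  variable
    a ℓ : Level
    A : Set a

-- P has exactly n elements.
HasSize : {A : Set a} → Pred A ℓ → ℕ → Set _
HasSize {A = A} P n =
  Σ[ xs ∈ List A ] (Unique xs × (∀ x → x ∈ˡ xs ⇔ x ∈ P) × length xs ≡ n)

------------------------------------------------------------------------
-- Real numbers as two-sided Dedekind cuts of ℚ.  Only their order and
-- topology are needed, so no arithmetic is developed.

record ℝ : Set₁ where
  field
    lower upper    : Pred ℚ 0ℓ
    lower-inhab    : Satisfiable lower
    upper-inhab    : Satisfiable upper
    lower-rounded  : ∀ q → q ∈ lower ⇔ (∃[ r ] (q < r × r ∈ lower))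
    upper-rounded  : ∀ q → q ∈ upper ⇔ (∃[ r ] (r < q × r ∈ upper))
    disjoint       : ∀ q → ¬ (q ∈ lower × q ∈ upper)
    located        : ∀ {q r} → q < r → q ∈ lower ⊎ r ∈ upper

infix 4 _<ˡ_ _<ʳ_ _≤ʳ_ _≈_ _≈²_

_<ˡ_ : ℚ → ℝ → Set
q <ˡ x = q ∈ ℝ.lower x

_<ʳ_ : ℝ → ℚ → Set
x <ʳ q = q ∈ ℝ.upper x

_≤ʳ_ : ℚ → ℝ → Set
q ≤ʳ x = ¬ (x <ʳ q)

-- The lower cut determines the upper one.
_≈_ : ℝ → ℝ → Set
x ≈ y = ℝ.lower x ≐ ℝ.lower y

Between : ℚ → ℚ → Pred ℝ 0ℓ
Between p q x = p <ˡ x × x <ʳ q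

------------------------------------------------------------------------
-- Topology of the plane

ℝ² : Set₁
ℝ² = ℝ × ℝ

_≈²_ : ℝ² → ℝ² → Set
(x , y) ≈² (x′ , y′) = x ≈ x′ × y ≈ y′

Box : ℚ → ℚ → ℚ → ℚ → Pred ℝ² 0ℓ
Box p q r s (x , y) = Between p q x × Between r s y

-- Open sets are automatically closed under _≈²_.
Open : Pred ℝ² (lsuc 0ℓ) → Set₁
Open U = ∀ z → z ∈ U →
  ∃[ p ] ∃[ q ] ∃[ r ] ∃[ s ] (z ∈ Box p q r s × Box p q r s ⊆ U)

Closure : Pred ℝ² ℓ → Pred ℝ² _
Closure P z = ∀ U → Open U → z ∈ U → Satisfiable (P ∩ U)

Connected : Pred ℝ² ℓ → Set _
Connected C = ∀ U V → Open U → Open V → C ⊆ U ∪ V →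
  Satisfiable (C ∩ U) → Satisfiable (C ∩ V) → Satisfiable (C ∩ (U ∩ V))

-- The connected component of z in X: the union of all connected subsets
-- of X containing z.
ComponentOf : Pred ℝ² (lsuc 0ℓ) → ℝ² → Pred ℝ² _
ComponentOf X z w =
  Σ[ C ∈ Pred ℝ² (lsuc 0ℓ) ] (Connected C × C ⊆ X × z ∈ C × w ∈ C)

AccumulationPoint : Pred ℝ² ℓ → Pred ℝ² _
AccumulationPoint P z =
  ∀ U → Open U → z ∈ U → ∃[ w ] (w ∈ P × w ∈ U × ¬ (w ≈² z))

------------------------------------------------------------------------
-- Simple graphs.  Every (undirected) edge carries an arbitrary
-- orientation, used only to parametrise it by the unit interval.

record Graph : Set₁ where
  field
    V E     : Set
    src tgt : E → V

  Joins : E → V → V → Set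
  Joins e u v = (src e ≡ u × tgt e ≡ v) ⊎ (src e ≡ v × tgt e ≡ u)

  field
    no-loops    : ∀ e → src e ≢ tgt e
    no-parallel : ∀ {e e′ u v} → Joins e u v → Joins e′ u v → e ≡ e′

module _ (G : Graph) where
  open Graph G

  Adj : V → V → Set
  Adj u v = ∃[ e ] Joins e u v

  IncidentTo : V → Pred E 0ℓ
  IncidentTo v e = src e ≡ v ⊎ tgt e ≡ v

  BoundedDegree : Set
  BoundedDegree =
    ∃[ Δ ] (∀ v → ∃[ n ] (HasSize (IncidentTo v) n × n ℕ.≤ Δ))

  ∂ : Pred V 0ℓ → Pred V 0ℓ
  ∂ S v = ¬ (v ∈ S) × ∃[ w ] (w ∈ S × Adj v w)

  -- The values |∂S|/|S| for finite nonempty S.  Sets S with ∂S infinite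
  -- have ratio ∞ and do not affect the infimum.
  CheegerRatio : Pred ℚ (lsuc 0ℓ)
  CheegerRatio q = Σ[ S ∈ Pred V 0ℓ ] ∃[ m ] ∃[ n ]
    (HasSize S (suc m) × HasSize (∂ S) n × q ≡ + n / suc m)

  -- The Cheeger constant c(G), an infimum in [0,∞], given by its lower
  -- cut: cheeger q means q < c(G).
  cheeger : Pred ℚ (lsuc 0ℓ)
  cheeger q = ∃[ r ] (q < r × (∀ x → x ∈ CheegerRatio → r ≤ x))

  NonAmenable : Set₁
  NonAmenable = 0ℚ ∈ cheeger

  Diverges : (ℕ → ℕ) → Set
  Diverges f = ∀ N → ∃[ n₀ ] (∀ n → n₀ ℕ.≤ n → N ℕ.≤ f n)

  -- The function is defined on the positive integers, so that the bound
  -- |S| ≤ f(|∂S|) presupposes ∂S ≠ ∅; here this is expressed by extending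
  -- f by f(0) = 0.  (If f(0) were arbitrary, a one-vertex graph, or a
  -- graph with one finite component, could be weakly non-amenable and
  -- hyperbolic although its Cheeger constant is 0.)
  WeaklyNonAmenable : Set₁
  WeaklyNonAmenable = Σ[ f ∈ (ℕ → ℕ) ]
    ( f 0 ≡ 0
    × Monotonic₁ ℕ._≤_ ℕ._≤_ f
    × Diverges f
    × (∀ (S : Pred V 0ℓ) m n →
         HasSize S (suc m) → HasSize (∂ S) n → suc m ℕ.≤ f n))

  data Walk : V → V → ℕ → Set where
    []  : ∀ {v} → Walk v v 0
    _∷_ : ∀ {u v w n} → Adj u v → Walk v w n → Walk u w (suc n)

  data OnWalk (x : V) : ∀ {u v n} → Walk u v n → Set where
    start : ∀ {v n} {p : Walk x v n} → OnWalk x p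
    later : ∀ {u v w n} {a : Adj u v} {p : Walk v w n} →
            OnWalk x p → OnWalk x (a ∷ p)

  Reachable : V → V → Set
  Reachable u v = ∃[ n ] Walk u v n

  -- d(u,v) = n.
  IsDistance : V → V → ℕ → Set
  IsDistance u v n = Walk u v n × (∀ m → Walk u v m → n ℕ.≤ m)

  record Geodesic (u v : V) : Set where
    field
      {len}    : ℕ
      walk     : Walk u v len
      shortest : ∀ m → Walk u v m → len ℕ.≤ m

    verts : Pred V 0ℓ
    verts x = OnWalk x walk

  open Geodesic using (verts)

  Neighbourhood : ℝ → Pred V 0ℓ → Pred V 0ℓ
  Neighbourhood δ P x =
    ∃[ y ] (y ∈ P × ∃[ n ] (IsDistance x y n × (+ n / 1) ≤ʳ δ))

  Thin : ∀ {u v w} → ℝ → Geodesic u v → Geodesic v w → Geodesic w u → Set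
  Thin δ α β γ =
      verts α ⊆ Neighbourhood δ (verts β ∪ verts γ)
    × verts β ⊆ Neighbourhood δ (verts γ ∪ verts α)
    × verts γ ⊆ Neighbourhood δ (verts α ∪ verts β)

  -- The component of v₀ is δ-hyperbolic.  Walks never leave a component,
  -- so its distances and geodesics are those of the whole graph.
  ComponentHyperbolic : ℝ → V → Set
  ComponentHyperbolic δ v₀ = ∀ {u v w} →
    Reachable v₀ u → Reachable v₀ v → Reachable v₀ w →
    (α : Geodesic u v) (β : Geodesic v w) (γ : Geodesic w u) →
    Thin δ α β γ

  Hyperbolic : Set₁
  Hyperbolic = Σ[ δ ∈ ℝ ] (0ℚ ≤ʳ δ × (∀ v₀ → ComponentHyperbolic δ v₀))

  -- The 1-complex: the vertices together with an open unit interval for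
  -- each edge, glued by the topology below.
  data Point : Set₁ where
    vertex : V → Point
    inner  : E → (t : ℝ) → Between 0ℚ 1ℚ t → Point

  data _≈ᵖ_ : Point → Point → Set₁ where
    vertex : ∀ {v} → vertex v ≈ᵖ vertex v
    inner  : ∀ {e t t′ i i′} → t ≈ t′ → inner e t i ≈ᵖ inner e t′ i′

  -- The CW topology: W is open iff its preimage in each closed edge
  -- [0,1] is open, where 0 is glued to src e and 1 to tgt e.
  record OpenIn1Complex (W : Pred Point (lsuc 0ℓ)) : Set₁ where
    field
      at-inner : ∀ e t i → inner e t i ∈ W →
        ∃[ p ] ∃[ q ] (Between p q t ×
          (∀ s j → Between p q s → inner e s j ∈ W))
      at-src   : ∀ e → vertex (src e) ∈ W →
        ∃[ q ] (0ℚ < q × (∀ s j → s <ʳ q → inner e s j ∈ W))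
      at-tgt   : ∀ e → vertex (tgt e) ∈ W →
        ∃[ p ] (p < 1ℚ × (∀ s j → p <ˡ s → inner e s j ∈ W))

------------------------------------------------------------------------
-- Plane graphs

-- The embedding is a homeomorphism of the 1-complex onto its image.
-- (Continuity makes it respect equality of points.)
record PlaneGraph : Set₂ where
  field
    graph : Graph

  open Graph graph public

  field
    φ          : Point graph → ℝ²
    injective  : ∀ x y → φ x ≈² φ y → _≈ᵖ_ graph x y
    continuous : ∀ U → Open U → OpenIn1Complex graph (λ x → φ x ∈ U)
    open-map   : ∀ W → OpenIn1Complex graph W →
                 Σ[ U ∈ Pred ℝ² (lsuc 0ℓ) ] (Open U × (∀ x → x ∈ W ⇔ φ x ∈ U))

module _ (G : PlaneGraph) where
  open PlaneGraph G

  VertexImage : Pred ℝ² _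
  VertexImage z = ∃[ v ] (φ (vertex v) ≈² z)

  NoVertexAccumulation : Set _
  NoVertexAccumulation = ∀ z → ¬ AccumulationPoint VertexImage z

  Complement : Pred ℝ² (lsuc 0ℓ)
  Complement z = ∀ x → ¬ (φ x ≈² z)

  -- Faces are represented by any of their points z ∈ Complement.
  Face : ℝ² → Pred ℝ² _
  Face = ComponentOf Complement

  BoundaryEdge : ℝ² → Pred E _
  BoundaryEdge z e =
      φ (vertex (src e)) ∈ Closure (Face z)
    × φ (vertex (tgt e)) ∈ Closure (Face z)
    × (∀ t i → φ (inner e t i) ∈ Closure (Face z))

  FaceLength : ℝ² → ℕ → Set _
  FaceLength z n = HasSize (BoundaryEdge z) n

  BoundedFace : ℝ² → Set _
  BoundedFace z = ∃[ n ] FaceLength z n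

  NoUnboundedFace : Set _
  NoUnboundedFace = ∀ z → z ∈ Complement → BoundedFace z

  BoundedCodegree : Set _
  BoundedCodegree =
    ∃[ Δ* ] (∀ z n → z ∈ Complement → FaceLength z n → n ℕ.≤ Δ*)

-- Planar topology enters through the winding parity of closed walks about points of the plane, a mod 2
-- crossing number.  It is locally constant off the walk and vanishes far away, and the double cover of the
-- plane branched at two points is trivial over a finite subgraph unless a closed walk in it separates them.
-- Approximating by fine lattices, where Alexander duality is summation by parts, one finds that the boundary
-- of a face is connected and contains a closed walk encircling the face.
--
-- (⇒) By Dehn's algorithm closed walks in a hyperbolic graph are mod 2 sums of short ones, and by weak
-- non-amenability a short closed walk encircles few vertices.  Some short closed walk encircles a given face,
-- hence its boundary, which is therefore short.  For finite S, the edges near ∂S contain closed walks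
-- encircling the rest of S, since otherwise one could escape from S to infinity without crossing them.
-- Averaging over the mod 2 combinations of these walks yields one cycle of length O(|∂S|) that encircles half
-- of S, and being a sum of short walks it encircles only O(|∂S|) vertices.
--
-- (⇐) Transporting an edge cochain along lattice paths shows that a closed walk is a mod 2 sum of short closed
-- walks meeting the region that it encircles, which has linear size by non-amenability.  A fat triangle
-- contains a hexagon with three geodesic sides far from each other and three short sides.  The edges at a given
-- distance from a side join its two ends: otherwise the coboundary of a component of them would vanish on short
-- walks and be odd on the hexagon.  So each of many distances accounts for almost as many edges as the side has,
-- which contradicts the linear bound.

module Submission where

open import Axiom.ExcludedMiddle using (ExcludedMiddle)
open import Data.Bool.Base using (Bool; true; false; _∧_; _∨_; _xor_; not; if_then_else_; T)
open import Data.Bool.Properties using (xor-same; xor-comm; xor-assoc; xor-identityʳ)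
open import Data.Empty using (⊥; ⊥-elim)
open import Data.Integer.Base as ℤ using (ℤ; -[1+_]) renaming (+_ to pos)
import Data.Integer.Properties as ℤP
open import Data.List.Base using (List; []; _∷_; _++_; map; concatMap; length; upTo; cartesianProduct)
open import Data.List.Membership.Propositional using () renaming (_∈_ to _∈ˡ_)
open import Data.List.Membership.Propositional.Properties using (∈-++⁺ˡ; ∈-++⁺ʳ; ∈-++⁻; ∈-map⁺; ∈-map⁻; ∈-concatMap⁺; ∈-∃++; ∈-cartesianProduct⁺; ∈-upTo⁺)
open import Data.List.Properties using (length-++; length-map)
open import Data.List.Relation.Unary.All as All using (All; []; _∷_)
open import Data.List.Relation.Unary.AllPairs using ([]; _∷_)
open import Data.List.Relation.Unary.Any as Any using (here; there)
open import Data.List.Relation.Unary.Unique.Propositional using (Unique)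
open import Data.Nat.Base using (ℕ; zero; suc; _∸_; _≡ᵇ_; _<ᵇ_; s≤s; z≤n; _≤ᵇ_; _^_) renaming (_<_ to _<ℕ_; _≤_ to _≤ℕ_; _+_ to _+ℕ_; _*_ to _*ℕ_; _⊔_ to _⊔ℕ_)
open import Data.Nat.Induction using (<-rec)
open import Data.Nat.Properties as ℕP using (*-assoc; *-cancelˡ-≤; *-comm; *-distribʳ-+; *-distribˡ-+; *-identityʳ; *-monoʳ-≤; *-monoˡ-≤; *-suc; *-zeroʳ; +-assoc; +-cancelʳ-≤; +-cancelˡ-≤; +-comm; +-identityʳ; +-mono-≤; +-monoʳ-<; +-monoʳ-≤; +-monoˡ-<; +-monoˡ-≤; +-suc; 1+n≢0; <⇒≢; <⇒≤; <⇒≱; m+1+n≰m; m+[n∸m]≡n; m∸[m∸n]≡n; m∸n+n≡m; m∸n≤m; m≤m*n; m≤m+n; m≤m⊔n; m≤n+m; m≤n⇒m<n∨m≡n; m≤n⇒m≤1+n; m≤n⊔m; n<1+n; n∸n≡0; n≤1+n; suc-injective; ≡ᵇ⇒≡; ≤-<-connex; ≤-antisym; ≤-pred; ≤-refl; ≤-reflexive; ≤-total; ≤-trans; ≤ᵇ⇒≤; ≤⇒≤ᵇ; ≰⇒>)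
open import Data.Nat.Solver using (module +-*-Solver)
open import Data.Product.Base using (Σ-syntax; ∃-syntax; _×_; _,_) renaming (proj₁ to fst; proj₂ to snd)
open import Data.Rational.Base as ℚ using (ℚ; 0ℚ; 1ℚ; _+_; _-_; -_; _<_; _≤_; _⊓_; _*_; mkℚ; Positive; positive; NonNegative; 1/_; NonZero; _/_; fromℚᵘ; *<*)
open import Data.Rational.Properties as ℚP using (<-asym; <-cmp; <-dense; <-irrefl; <-trans; <-≤-trans; positive⁻¹; p≤p⊔q; p≤q⊔p; p⊓q≤p; p⊓q≤q; ≤-<-trans)
open import Data.Rational.Unnormalised.Base as ℚᵘ using (ℚᵘ; mkℚᵘ; *≡*; *<*; *≤*)
import Data.Rational.Unnormalised.Properties as ℚᵘP
open import Data.Sum.Base using (_⊎_; [_,_]′) renaming (inj₁ to inl; inj₂ to inr)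
open import Data.Unit.Base using (⊤; tt)
open import Function.Base using (_∘_; id; case_of_)
open import Function.Bundles using (_⇔_; mk⇔; Equivalence)
open import Level using (Level; Lift; lift; 0ℓ; _⊔_; lower; Setω) renaming (suc to lsuc)
open import Relation.Binary.Definitions using (tri<; tri≈; tri>; Monotonic₁; Tri)
open import Relation.Binary.PropositionalEquality using (_≡_; _≢_; refl; sym; trans; cong; cong₂; subst; subst₂)
open import Relation.Nullary using (¬_; Dec; yes; no; does)
open import Relation.Unary using (Pred; _∈_; _⊆_; _∪_; _∩_; Satisfiable)
open import Defs

-- Edges are arbitrary arcs and may meet a ray infinitely often, so the crossing parity cannot be a
-- count. Along an arc that avoids p a branch of the double cover branched at p exists by
-- compactness, and the parity is the change of branch from one end to the other.
--
-- Separation by a finite subgraph is decided in a lattice so fine that all blocks of four by four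
-- cells are small for every local datum in play (a Lebesgue number). The subgraph is replaced by
-- the cells close to it. Let a Boolean function of the lattice points, such as membership in a
-- face, be constant on small blocks that miss the subgraph. If no closed walk of the subgraph
-- separates two points, and a lattice path joins them along which the function can change only
-- beside the subgraph, then it has the same value at both.
--
-- A further obstacle: vertices do not accumulate, but edges might, so the image of the graph is not
-- known to be closed nor a face to be open. Therefore only finite subgraphs are treated, with stubs
-- of the adjacent edges attached, and openness of a face is deduced from a closed walk that
-- encircles it.

module Booleans where

 private variable
  a b ℓ ℓ' : Level

 true≢false : {A : Set ℓ} → true ≡ false → A
 true≢false ()

 Bool-cases : ∀ b → b ≡ true ⊎ b ≡ false
 Bool-cases true = inl refl
 Bool-cases false = inr refl

 ≢true : ∀ {b} → b ≢ true → b ≡ false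
 ≢true {true} h = ⊥-elim (h refl)
 ≢true {false} h = refl

 xor-≡ : ∀ {x y} → x xor y ≡ false → x ≡ y
 xor-≡ {true} {true} h = refl
 xor-≡ {false} {false} h = refl

 same-truth : ∀ {x y} → (x ≡ true → y ≡ true) → (y ≡ true → x ≡ true) → x ≡ y
 same-truth {true} {y} f g = sym (f refl)
 same-truth {false} {true} f g = g refl
 same-truth {false} {false} f g = refl

 Fn : ℕ → Set
 Fn 0 = Bool
 Fn (suc n) = Bool → Fn n

 agree : ∀ n → Fn n → Fn n → Bool
 agree 0 a b = not (a xor b)
 agree (suc n) f g = agree n (f true) (g true) ∧ agree n (f false) (g false)

 Agree : ∀ n → Fn n → Fn n → Set
 Agree 0 a b = a ≡ b
 Agree (suc n) f g = ∀ x → Agree n (f x) (g x)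

 ∧-left : ∀ {x y} → x ∧ y ≡ true → x ≡ true
 ∧-left {true} h = refl

 ∧-right : ∀ {x y} → x ∧ y ≡ true → y ≡ true
 ∧-right {true} h = h

 ∧-both : ∀ {x y} → x ≡ true → y ≡ true → x ∧ y ≡ true
 ∧-both refl refl = refl

 -- Decision by truth tables: for closed `f` and `g` the hypothesis computes, so `refl` proves any
 -- Boolean identity in `n` variables.
 taut : ∀ n (f g : Fn n) → agree n f g ≡ true → Agree n f g
 taut 0 true true h = refl
 taut 0 false false h = refl
 taut (suc n) f g h true = taut n (f true) (g true) (∧-left h)
 taut (suc n) f g h false = taut n (f false) (g false) (∧-right {agree n (f true) (g true)} h)

 xor-cancel : ∀ x y z → (x xor y) xor (y xor z) ≡ x xor z
 xor-cancel = taut 3 (λ x y z → (x xor y) xor (y xor z)) (λ x y z → x xor z) refl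

 xor-swap : ∀ x y z w → (x xor y) xor (z xor w) ≡ (x xor z) xor (y xor w)
 xor-swap = taut 4 (λ x y z w → (x xor y) xor (z xor w)) (λ x y z w → (x xor z) xor (y xor w)) refl

open Booleans

-- The Dedekind line and plane: order, closed intervals, neighbourhoods

module Reals where

 private variable
  a b ℓ ℓ' : Level

 to : {A : Set a} {B : Set b} → A ⇔ B → A → B
 to = Equivalence.to
 from : {A : Set a} {B : Set b} → A ⇔ B → B → A
 from = Equivalence.from

 ≮⇒≥ : ∀ {p q : ℚ} → ¬ (p < q) → q ≤ p
 ≮⇒≥ = ℚP.≮⇒≥

 p<p+ε : ∀ {p ε} → 0ℚ < ε → p < p + ε
 p<p+ε {p} {ε} h = subst (_< p + ε) (ℚP.+-identityʳ p) (ℚP.+-monoʳ-< p h)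

 p-1<p : ∀ p → p - 1ℚ < p
 p-1<p p = subst (p - 1ℚ <_) (ℚP.+-identityʳ p) (ℚP.+-monoʳ-< p {(- 1ℚ)} {0ℚ} (ℚP.negative⁻¹ (- 1ℚ)))

 p<p+1 : ∀ p → p < p + 1ℚ
 p<p+1 p = p<p+ε (positive⁻¹ 1ℚ)

 0<q-p : ∀ {p q} → p < q → 0ℚ < q - p
 0<q-p {p} {q} h = subst (_< q - p) (ℚP.+-inverseʳ p) (ℚP.+-monoˡ-< (- p) h)

 p+[q-p] : ∀ p q → p + (q - p) ≡ q
 p+[q-p] p q = trans (cong (p +_) (ℚP.+-comm q (- p)))
  (trans (sym (ℚP.+-assoc p (- p) q)) (trans (cong (_+ q) (ℚP.+-inverseʳ p)) (ℚP.+-identityˡ q)))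

 module _ (x : ℝ) where
  open ℝ x

  lower-down : ∀ {q r} → q < r → r <ˡ x → q <ˡ x
  lower-down h k = from (lower-rounded _) (_ , h , k)

  upper-up : ∀ {q r} → q < r → x <ʳ q → x <ʳ r
  upper-up h k = from (upper-rounded _) (_ , h , k)

  lower-down≤ : ∀ {q r} → q ≤ r → r <ˡ x → q <ˡ x
  lower-down≤ {q} {r} h k with <-cmp q r
  ... | tri< l _ _ = lower-down l k
  ... | tri≈ _ refl _ = k
  ... | tri> _ _ g = ⊥-elim (<-irrefl refl (<-≤-trans g h))

  upper-up≤ : ∀ {q r} → q ≤ r → x <ʳ q → x <ʳ r
  upper-up≤ {q} {r} h k with <-cmp q r
  ... | tri< l _ _ = upper-up l k
  ... | tri≈ _ refl _ = k
  ... | tri> _ _ g = ⊥-elim (<-irrefl refl (<-≤-trans g h))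

  lo<up : ∀ {p q} → p <ˡ x → x <ʳ q → p < q
  lo<up {p} {q} h k with <-cmp p q
  ... | tri< l _ _ = l
  ... | tri≈ _ refl _ = ⊥-elim (disjoint p (h , k))
  ... | tri> _ _ g = ⊥-elim (disjoint p (h , upper-up g k))

  lo-round : ∀ {p} → p <ˡ x → ∃[ q ] (p < q × q <ˡ x)
  lo-round = to (lower-rounded _)

  up-round : ∀ {p} → x <ʳ p → ∃[ q ] (q < p × x <ʳ q)
  up-round = to (upper-rounded _)

 infix 4 _≤ᴿ_
 _≤ᴿ_ : ℝ → ℚ → Set
 x ≤ᴿ q = ¬ (q <ˡ x)

 ι : ℚ → ℝ
 ι q = record
  { lower = _< q ; upper = q <_
  ; lower-inhab = q - 1ℚ , p-1<p q
  ; upper-inhab = q + 1ℚ , p<p+1 q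
  ; lower-rounded = λ r → mk⇔ (λ h → let (m , u , v) = <-dense h in m , u , v) (λ (m , u , v) → <-trans u v)
  ; upper-rounded = λ r → mk⇔ (λ h → let (m , u , v) = <-dense h in m , v , u) (λ (m , u , v) → <-trans v u)
  ; disjoint = λ r (u , v) → <-asym u v
  ; located = loc }
  where
  loc : ∀ {u v} → u < v → u < q ⊎ q < v
  loc {u} {v} h with <-cmp u q
  ... | tri< l _ _ = inl l
  ... | tri≈ _ refl _ = inr h
  ... | tri> _ _ g = inr (<-trans g h)

 ≤ᴿ-<ʳ : ∀ x {p q} → x ≤ᴿ p → p < q → x <ʳ q
 ≤ᴿ-<ʳ x h k with ℝ.located x k
 ... | inl l = ⊥-elim (h l)
 ... | inr u = u

 <ˡ-≤ʳ : ∀ x {p q} → p < q → q ≤ʳ x → p <ˡ x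
 <ˡ-≤ʳ x h k with ℝ.located x h
 ... | inl l = l
 ... | inr u = ⊥-elim (k u)

 <ʳ⇒≤ᴿ : ∀ x {q} → x <ʳ q → x ≤ᴿ q
 <ʳ⇒≤ᴿ x h k = ℝ.disjoint x _ (k , h)

 <ˡ⇒≤ʳ : ∀ x {q} → q <ˡ x → q ≤ʳ x
 <ˡ⇒≤ʳ x h k = ℝ.disjoint x _ (h , k)

 ≈-sym : ∀ x y → x ≈ y → y ≈ x
 ≈-sym x y (f , g) = g , f

 ≈-trans : ∀ x y z → x ≈ y → y ≈ z → x ≈ z
 ≈-trans x y z (f , g) (f' , g') = f' ∘ f , g ∘ g'

 ≈-refl : ∀ x → x ≈ x
 ≈-refl x = id , id

 ≈-upper : ∀ x y → x ≈ y → ∀ {q} → x <ʳ q → y <ʳ q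
 ≈-upper x y (f , g) {q} h with up-round x h
 ... | r , r<q , k with ℝ.located y r<q
 ...   | inr u = u
 ...   | inl l = ⊥-elim (ℝ.disjoint x r (g l , k))

 Between-≈ : ∀ x y {p q} → x ≈ y → Between p q x → Between p q y
 Between-≈ x y e (h , k) = fst e h , ≈-upper x y e k

 -- Membership of `P` in the neighbourhood filter of `t`, with the interval as data. `P` may have
 -- any level, whereas `Open` is confined to one; likewise for `N` in the plane.
 record Nb (t : ℝ) (P : ℝ → Set ℓ) : Set (ℓ ⊔ lsuc 0ℓ) where
  constructor nb
  field
   p q : ℚ
   centre : Between p q t
   inside : ∀ s → Between p q s → P s

 record N (z : ℝ²) (P : ℝ² → Set ℓ) : Set (ℓ ⊔ lsuc 0ℓ) where
  constructor nb
  field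
   p q r s : ℚ
   centre : z ∈ Box p q r s
   inside : ∀ w → w ∈ Box p q r s → P w

 ⊓-<ʳ : ∀ x {p q} → x <ʳ p → x <ʳ q → x <ʳ (p ⊓ q)
 ⊓-<ʳ x {p} {q} h k with ℚP.≤-total p q
 ... | inl l = subst (x <ʳ_) (sym (ℚP.p≤q⇒p⊓q≡p l)) h
 ... | inr l = subst (x <ʳ_) (sym (ℚP.p≥q⇒p⊓q≡q l)) k

 ⊔-<ˡ : ∀ x {p q} → p <ˡ x → q <ˡ x → (p ℚ.⊔ q) <ˡ x
 ⊔-<ˡ x {p} {q} h k with ℚP.≤-total p q
 ... | inl l = subst (_<ˡ x) (sym (ℚP.p≤q⇒p⊔q≡q l)) k
 ... | inr l = subst (_<ˡ x) (sym (ℚP.p≥q⇒p⊔q≡p l)) h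

 Between-∩ : ∀ x {p q r s} → Between p q x → Between r s x → Between (p ℚ.⊔ r) (q ⊓ s) x
 Between-∩ x (a , b) (c , d) = ⊔-<ˡ x a c , ⊓-<ʳ x b d

 Between-mono : ∀ x {p q r s} → p ≤ r → s ≤ q → Between r s x → Between p q x
 Between-mono x h k (a , b) = lower-down≤ x h a , upper-up≤ x k b

 Nb-∩ : ∀ {t} {P : ℝ → Set ℓ} {Q : ℝ → Set ℓ'} → Nb t P → Nb t Q → Nb t (λ s → P s × Q s)
 Nb-∩ {t = t} (nb p q i f) (nb r s j g) = nb (p ℚ.⊔ r) (q ⊓ s) (Between-∩ t i j)
  λ u k → f u (Between-mono u (p≤p⊔q p r) (p⊓q≤p q s) k) , g u (Between-mono u (p≤q⊔p p r) (p⊓q≤q q s) k)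

 Nb-map : ∀ {t} {P : ℝ → Set ℓ} {Q : ℝ → Set ℓ'} → (∀ s → P s → Q s) → Nb t P → Nb t Q
 Nb-map g (nb p q i f) = nb p q i λ s k → g s (f s k)

 Nb-all : ∀ {t} {P : ℝ → Set ℓ} → (∀ s → P s) → Nb t P
 Nb-all {t = t} f = nb (fst (ℝ.lower-inhab t)) (fst (ℝ.upper-inhab t))
  (snd (ℝ.lower-inhab t) , snd (ℝ.upper-inhab t)) λ s _ → f s

 Box-∩ : ∀ z {p q r s p' q' r' s'} → z ∈ Box p q r s → z ∈ Box p' q' r' s' →
  z ∈ Box (p ℚ.⊔ p') (q ⊓ q') (r ℚ.⊔ r') (s ⊓ s')
 Box-∩ (x , y) (i , j) (i' , j') = Between-∩ x i i' , Between-∩ y j j'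

 Box-mono : ∀ z {p q r s p' q' r' s'} → p ≤ p' → q' ≤ q → r ≤ r' → s' ≤ s → z ∈ Box p' q' r' s' → z ∈ Box p q r s
 Box-mono (x , y) a b c d (i , j) = Between-mono x a b i , Between-mono y c d j

 N-∩ : ∀ {z} {P : ℝ² → Set ℓ} {Q : ℝ² → Set ℓ'} → N z P → N z Q → N z (λ s → P s × Q s)
 N-∩ {z = z} (nb p q r s i f) (nb p' q' r' s' j g) = nb _ _ _ _ (Box-∩ z {p} {q} {r} {s} {p'} {q'} {r'} {s'} i j)
  λ u k → f u (Box-mono u {p} {q} {r} {s} (p≤p⊔q p p') (p⊓q≤p q q') (p≤p⊔q r r') (p⊓q≤p s s') k) ,
   g u (Box-mono u {p'} {q'} {r'} {s'} (p≤q⊔p p p') (p⊓q≤q q q') (p≤q⊔p r r') (p⊓q≤q s s') k)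

 N-map : ∀ {z} {P : ℝ² → Set ℓ} {Q : ℝ² → Set ℓ'} → (∀ s → P s → Q s) → N z P → N z Q
 N-map g (nb p q r s i f) = nb p q r s i λ s k → g s (f s k)

 N-here : ∀ {z} {P : ℝ² → Set ℓ} → N z P → P z
 N-here {z = z} (nb p q r s i f) = f z i

 N-x : ∀ {x y} (P : ℝ → Set ℓ) → Nb x P → N (x , y) (λ w → P (fst w))
 N-x {y = y} P (nb p q i f) = let (r , k) = ℝ.lower-inhab y; (s , l) = ℝ.upper-inhab y in
  nb p q r s (i , k , l) λ w (j , _) → f (fst w) j

 N-y : ∀ {x y} (P : ℝ → Set ℓ) → Nb y P → N (x , y) (λ w → P (snd w))
 N-y {x = x} P (nb p q i f) = let (r , k) = ℝ.lower-inhab x; (s , l) = ℝ.upper-inhab x in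
  nb r s p q ((k , l) , i) λ w (_ , j) → f (snd w) j

 N-all : ∀ {z} {P : ℝ² → Set ℓ} → (∀ s → P s) → N z P
 N-all {z = x , y} f = let (r , k) = ℝ.lower-inhab x; (s , l) = ℝ.upper-inhab x
                           (r' , k') = ℝ.lower-inhab y; (s' , l') = ℝ.upper-inhab y in
  nb r s r' s' ((k , l) , (k' , l')) λ w _ → f w

 ≈²-refl : ∀ z → z ≈² z
 ≈²-refl (x , y) = ≈-refl x , ≈-refl y

 ≈²-sym : ∀ z w → z ≈² w → w ≈² z
 ≈²-sym (x , y) (u , v) (e , f) = ≈-sym x u e , ≈-sym y v f

 ≈²-trans : ∀ z w v → z ≈² w → w ≈² v → z ≈² v
 ≈²-trans (x , y) (u , v) (u' , v') (e , f) (e' , f') = ≈-trans x u u' e e' , ≈-trans y v v' f f'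

 Box-≈ : ∀ z w {p q r s} → z ≈² w → z ∈ Box p q r s → w ∈ Box p q r s
 Box-≈ (x , y) (u , v) (e , f) (i , j) = Between-≈ x u e i , Between-≈ y v f j

 N-≈ : ∀ {z w} {P : ℝ² → Set ℓ} → z ≈² w → N z P → N w P
 N-≈ {z = z} {w} e (nb p q r s i f) = nb p q r s (Box-≈ z w {p} {q} {r} {s} e i) f

 N-open : ∀ {z} {P : ℝ² → Set ℓ} → N z P → N z (λ w → N w P)
 N-open (nb p q r s i f) = nb p q r s i λ w j → nb p q r s j f

 Nb-<ʳ : ∀ {t q} → t <ʳ q → Nb t (_<ʳ q)
 Nb-<ʳ {t} h = let (p , k) = ℝ.lower-inhab t in nb p _ (k , h) λ s (_ , j) → j
 Nb-<ˡ : ∀ {t q} → q <ˡ t → Nb t (q <ˡ_)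
 Nb-<ˡ {t} h = let (p , k) = ℝ.upper-inhab t in nb _ p (h , k) λ s (j , _) → j

 In : ℚ → ℚ → ℝ → Set
 In a b t = a ≤ʳ t × t ≤ᴿ b

 In-Between : ∀ {p q} t → In p q t → ∀ {p' q'} → p' < p → q < q' → Between p' q' t
 In-Between t (h , k) u v = <ˡ-≤ʳ t u h , ≤ᴿ-<ʳ t k v

 Between-In : ∀ {p q} t → Between p q t → In p q t
 Between-In t (h , k) = <ˡ⇒≤ʳ t h , <ʳ⇒≤ᴿ t k

 In-mono : ∀ {p q p' q'} t → p' ≤ p → q ≤ q' → In p q t → In p' q' t
 In-mono t u v (h , k) = (λ x → h (upper-up≤ t u x)) , (λ x → k (lower-down≤ t v x))

 -- Roundedness of the cuts leaves room for the closed interval from `p'` to `q'` inside the open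
 -- one; this reconciles `In` with `Between`.
 shrink : ∀ {p q} t → Between p q t → ∃[ p' ] ∃[ q' ] (p < p' × q' < q × Between p' q' t)
 shrink t (h , k) = let (p' , u , v) = lo-round t h; (q' , x , y) = up-round t k in p' , q' , u , x , v , y

 ⊓-pos : ∀ {ε δ} → 0ℚ < ε → 0ℚ < δ → 0ℚ < ε ⊓ δ
 ⊓-pos {ε} {δ} h k with ℚP.≤-total ε δ
 ... | inl l = subst (0ℚ <_) (sym (ℚP.p≤q⇒p⊓q≡p l)) h
 ... | inr l = subst (0ℚ <_) (sym (ℚP.p≥q⇒p⊓q≡q l)) k

open Reals

-- Mod 2 chains and cochains of the square lattice

module LatticePaths where

 private variable
  i j a b c d M : ℕ

 -- Paths in the square lattice.  The horizontal edge (i,j)-(i+1,j), the vertical edge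
 -- (i,j)-(i,j+1) and the cell with lower left corner (i,j) are all named by (i,j).
 data LPath : ℕ → ℕ → ℕ → ℕ → Set where
  stop : LPath i j i j
  east : LPath (suc i) j a b → LPath i j a b
  west : LPath i j a b → LPath (suc i) j a b
  north : LPath i (suc j) a b → LPath i j a b
  south : LPath i j a b → LPath i (suc j) a b

 Grid : Set
 Grid = ℕ → ℕ → Bool

 none : Grid
 none _ _ = false

 infixl 6 _⊕_
 _⊕_ : Grid → Grid → Grid
 (f ⊕ g) i j = f i j xor g i j

 sumL : Grid → Grid → LPath i j a b → Bool
 sumL f g stop = false
 sumL f g (east {i} {j} L) = f i j xor sumL f g L
 sumL f g (west {i} {j} L) = f i j xor sumL f g L
 sumL f g (north {i} {j} L) = g i j xor sumL f g L
 sumL f g (south {i} {j} L) = g i j xor sumL f g L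

 AllE : (P Q : ℕ → ℕ → Set) → LPath i j a b → Set
 AllE P Q stop = ⊤
 AllE P Q (east {i} {j} L) = P i j × AllE P Q L
 AllE P Q (west {i} {j} L) = P i j × AllE P Q L
 AllE P Q (north {i} {j} L) = Q i j × AllE P Q L
 AllE P Q (south {i} {j} L) = Q i j × AllE P Q L

 infixr 5 _⊙_
 _⊙_ : LPath i j a b → LPath a b c d → LPath i j c d
 stop ⊙ K = K
 east L ⊙ K = east (L ⊙ K)
 west L ⊙ K = west (L ⊙ K)
 north L ⊙ K = north (L ⊙ K)
 south L ⊙ K = south (L ⊙ K)

 AllE-⊙ : ∀ {P Q} (L : LPath i j a b) {K : LPath a b c d} → AllE P Q L → AllE P Q K → AllE P Q (L ⊙ K)
 AllE-⊙ stop h k = k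
 AllE-⊙ (east L) (x , h) k = x , AllE-⊙ L h k
 AllE-⊙ (west L) (x , h) k = x , AllE-⊙ L h k
 AllE-⊙ (north L) (x , h) k = x , AllE-⊙ L h k
 AllE-⊙ (south L) (x , h) k = x , AllE-⊙ L h k

 AllE-map : ∀ {P Q P' Q' : ℕ → ℕ → Set} → (∀ i j → P i j → P' i j) → (∀ i j → Q i j → Q' i j) →
  (L : LPath i j a b) → AllE P Q L → AllE P' Q' L
 AllE-map f g stop h = tt
 AllE-map f g (east L) (x , h) = f _ _ x , AllE-map f g L h
 AllE-map f g (west L) (x , h) = f _ _ x , AllE-map f g L h
 AllE-map f g (north L) (x , h) = g _ _ x , AllE-map f g L h
 AllE-map f g (south L) (x , h) = g _ _ x , AllE-map f g L h

 sumL-⊙ : ∀ (f g : Grid) (L : LPath i j a b) (K : LPath a b c d) → sumL f g (L ⊙ K) ≡ sumL f g L xor sumL f g K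
 sumL-⊙ f g stop K = refl
 sumL-⊙ f g (east {i} {j} L) K = trans (cong (f i j xor_) (sumL-⊙ f g L K)) (sym (xor-assoc (f i j) _ _))
 sumL-⊙ f g (west {i} {j} L) K = trans (cong (f i j xor_) (sumL-⊙ f g L K)) (sym (xor-assoc (f i j) _ _))
 sumL-⊙ f g (north {i} {j} L) K = trans (cong (g i j xor_) (sumL-⊙ f g L K)) (sym (xor-assoc (g i j) _ _))
 sumL-⊙ f g (south {i} {j} L) K = trans (cong (g i j xor_) (sumL-⊙ f g L K)) (sym (xor-assoc (g i j) _ _))

 sumL-⊕ : ∀ (f g f' g' : Grid) (L : LPath i j a b) → sumL f g L xor sumL f' g' L ≡ sumL (f ⊕ f') (g ⊕ g') L
 sumL-⊕ f g f' g' stop = refl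
 sumL-⊕ f g f' g' (east {i} {j} L) = trans (xor-swap (f i j) _ (f' i j) _) (cong ((f i j xor f' i j) xor_) (sumL-⊕ f g f' g' L))
 sumL-⊕ f g f' g' (west {i} {j} L) = trans (xor-swap (f i j) _ (f' i j) _) (cong ((f i j xor f' i j) xor_) (sumL-⊕ f g f' g' L))
 sumL-⊕ f g f' g' (north {i} {j} L) = trans (xor-swap (g i j) _ (g' i j) _) (cong ((g i j xor g' i j) xor_) (sumL-⊕ f g f' g' L))
 sumL-⊕ f g f' g' (south {i} {j} L) = trans (xor-swap (g i j) _ (g' i j) _) (cong ((g i j xor g' i j) xor_) (sumL-⊕ f g f' g' L))

 -- Telescoping: the two cochains need to differ by the coboundary of `χ` only on the edges that `L`
 -- uses.
 sumL-cob : ∀ (f g f' g' : Grid) (χ : Grid) (P Q : ℕ → ℕ → Set) →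
  (∀ i j → P i j → f i j ≡ (χ i j xor χ (suc i) j) xor f' i j) →
  (∀ i j → Q i j → g i j ≡ (χ i j xor χ i (suc j)) xor g' i j) →
  (L : LPath i j a b) → AllE P Q L → sumL f g L ≡ (χ i j xor χ a b) xor sumL f' g' L
 sumL-cob {i} {j} f g f' g' χ P Q p q stop _ = sym (cong (_xor false) (xor-same (χ i j)))
 sumL-cob {a = a} {b} f g f' g' χ P Q p q (east {i} {j} L) (x , h) = trans (cong₂ _xor_ (p i j x) (sumL-cob f g f' g' χ P Q p q L h))
  (trans (xor-swap (χ i j xor χ (suc i) j) (f' i j) (χ (suc i) j xor χ a b) (sumL f' g' L))
   (cong (_xor (f' i j xor sumL f' g' L)) (xor-cancel (χ i j) (χ (suc i) j) (χ a b))))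
 sumL-cob {a = a} {b} f g f' g' χ P Q p q (west {i} {j} L) (x , h) = trans (cong₂ _xor_ (trans (p i j x) (cong (_xor f' i j) (xor-comm (χ i j) (χ (suc i) j)))) (sumL-cob f g f' g' χ P Q p q L h))
  (trans (xor-swap (χ (suc i) j xor χ i j) (f' i j) (χ i j xor χ a b) (sumL f' g' L))
   (cong (_xor (f' i j xor sumL f' g' L)) (xor-cancel (χ (suc i) j) (χ i j) (χ a b))))
 sumL-cob {a = a} {b} f g f' g' χ P Q p q (north {i} {j} L) (x , h) = trans (cong₂ _xor_ (q i j x) (sumL-cob f g f' g' χ P Q p q L h))
  (trans (xor-swap (χ i j xor χ i (suc j)) (g' i j) (χ i (suc j) xor χ a b) (sumL f' g' L))
   (cong (_xor (g' i j xor sumL f' g' L)) (xor-cancel (χ i j) (χ i (suc j)) (χ a b))))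
 sumL-cob {a = a} {b} f g f' g' χ P Q p q (south {i} {j} L) (x , h) = trans (cong₂ _xor_ (trans (q i j x) (cong (_xor g' i j) (xor-comm (χ i j) (χ i (suc j))))) (sumL-cob f g f' g' χ P Q p q L h))
  (trans (xor-swap (χ i (suc j) xor χ i j) (g' i j) (χ i j xor χ a b) (sumL f' g' L))
   (cong (_xor (g' i j xor sumL f' g' L)) (xor-cancel (χ i (suc j)) (χ i j) (χ a b))))

 AllE-⊤ : (L : LPath i j a b) → AllE (λ _ _ → ⊤) (λ _ _ → ⊤) L
 AllE-⊤ stop = tt
 AllE-⊤ (east L) = tt , AllE-⊤ L
 AllE-⊤ (west L) = tt , AllE-⊤ L
 AllE-⊤ (north L) = tt , AllE-⊤ L
 AllE-⊤ (south L) = tt , AllE-⊤ L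

 sumL-none : (L : LPath i j a b) → sumL none none L ≡ false
 sumL-none stop = refl
 sumL-none (east L) = sumL-none L
 sumL-none (west L) = sumL-none L
 sumL-none (north L) = sumL-none L
 sumL-none (south L) = sumL-none L

 sumL-cong : ∀ {f g f' g' : Grid} → (∀ i j → f i j ≡ f' i j) → (∀ i j → g i j ≡ g' i j) → (L : LPath i j a b) → sumL f g L ≡ sumL f' g' L
 sumL-cong p q stop = refl
 sumL-cong p q (east L) = cong₂ _xor_ (p _ _) (sumL-cong p q L)
 sumL-cong p q (west L) = cong₂ _xor_ (p _ _) (sumL-cong p q L)
 sumL-cong p q (north L) = cong₂ _xor_ (q _ _) (sumL-cong p q L)
 sumL-cong p q (south L) = cong₂ _xor_ (q _ _) (sumL-cong p q L)

 spot : ℕ → ℕ → Grid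
 spot x y i j = (i ≡ᵇ x) ∧ (j ≡ᵇ y)

 useH useV fill : LPath i j a b → Grid
 useH L x y = sumL (spot x y) none L
 useV L x y = sumL none (spot x y) L
 -- The number of horizontal steps above a cell, mod 2.
 fill L x y = sumL (λ i j → (i ≡ᵇ x) ∧ (y <ᵇ j)) none L

 private
  step : ∀ y j → (y <ᵇ j) xor (suc y <ᵇ j) ≡ (j ≡ᵇ suc y)
  step zero zero = refl
  step zero (suc zero) = refl
  step zero (suc (suc j)) = refl
  step (suc y) zero = refl
  step (suc y) (suc j) = step y j
  step' : ∀ y j → (y <ᵇ j) xor (y <ᵇ suc j) ≡ (j ≡ᵇ y)
  step' zero zero = refl
  step' zero (suc j) = refl
  step' (suc y) zero = refl
  step' (suc y) (suc j) = step' y j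

 fill-V : (L : LPath i j a b) → ∀ x y → fill L x y xor fill L x (suc y) ≡ useH L x (suc y)
 fill-V L x y = trans (sumL-⊕ _ none _ none L) (sumL-cong
  (λ i j → trans (taut 3 (λ a b c → (a ∧ b) xor (a ∧ c)) (λ a b c → a ∧ (b xor c)) refl (i ≡ᵇ x) (y <ᵇ j) (suc y <ᵇ j)) (cong ((i ≡ᵇ x) ∧_) (step y j)))
  (λ _ _ → refl) L)

 -- The vertical edges below the lattice point `(i , j)`. A path that is not closed is filled by
 -- `fill` only up to the rays below its two ends, which is also where `cut` puts the branch cuts.
 ray : ℕ → ℕ → Grid
 ray i j x y = (i ≡ᵇ x) ∧ (y <ᵇ j)

 -- The horizontal steps above the two cells differ by the coboundary of `ray`, taken as a function
 -- of the moving point, and by the vertical steps that pass between the cells.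
 fill-H : (L : LPath i j a b) → ∀ x y → fill L x y xor fill L (suc x) y ≡ (ray i j (suc x) y xor ray a b (suc x) y) xor useV L (suc x) y
 fill-H L x y = trans (sumL-⊕ _ none _ none L) (sumL-cob _ none none (spot (suc x) y) (λ i j → ray i j (suc x) y) (λ _ _ → ⊤) (λ _ _ → ⊤)
  (λ i j _ → taut 3 (λ a b c → (a ∧ c) xor (b ∧ c)) (λ a b c → ((b ∧ c) xor (a ∧ c)) xor false) refl (i ≡ᵇ x) (i ≡ᵇ suc x) (y <ᵇ j))
  (λ i j _ → trans (taut 2 (λ e f → false) (λ e f → (e ∧ f) xor (e ∧ f)) refl (i ≡ᵇ suc x) (j ≡ᵇ y))
   (cong (_xor ((i ≡ᵇ suc x) ∧ (j ≡ᵇ y))) (trans (cong ((i ≡ᵇ suc x) ∧_) (sym (step' y j)))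
    (taut 3 (λ a b c → a ∧ (b xor c)) (λ a b c → (a ∧ b) xor (a ∧ c)) refl (i ≡ᵇ suc x) (y <ᵇ j) (y <ᵇ suc j)))))
  L (AllE-⊤ L))

 xsum : ℕ → (ℕ → Bool) → Bool
 xsum zero f = false
 xsum (suc M) f = f 0 xor xsum M (f ∘ suc)

 xsum-cong : ∀ M {f g : ℕ → Bool} → (∀ i → i <ℕ M → f i ≡ g i) → xsum M f ≡ xsum M g
 xsum-cong zero h = refl
 xsum-cong (suc M) h = cong₂ _xor_ (h 0 (s≤s z≤n)) (xsum-cong M λ i k → h (suc i) (s≤s k))

 xsum-false : ∀ M {f : ℕ → Bool} → (∀ i → i <ℕ M → f i ≡ false) → xsum M f ≡ false
 xsum-false zero h = refl
 xsum-false (suc M) h rewrite h 0 (s≤s z≤n) = xsum-false M λ i k → h (suc i) (s≤s k)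

 xsum-⊕ : ∀ M (f g : ℕ → Bool) → xsum M f xor xsum M g ≡ xsum M (λ i → f i xor g i)
 xsum-⊕ zero f g = refl
 xsum-⊕ (suc M) f g = trans (xor-swap (f 0) _ (g 0) _) (cong ((f 0 xor g 0) xor_) (xsum-⊕ M (f ∘ suc) (g ∘ suc)))

 xsum-last : ∀ M (f : ℕ → Bool) → f M ≡ false → xsum (suc M) f ≡ xsum M f
 xsum-last zero f h = trans (xor-identityʳ _) h
 xsum-last (suc M) f h = cong (f 0 xor_) (xsum-last M (f ∘ suc) h)

 xsum-at : ∀ M a (f : ℕ → Bool) → a <ℕ M → xsum M (λ i → (a ≡ᵇ i) ∧ f i) ≡ f a
 xsum-at (suc M) zero f h = trans (cong (f 0 xor_) (xsum-false M λ _ _ → refl)) (xor-identityʳ (f 0))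
 xsum-at (suc M) (suc a) f (s≤s h) = xsum-at M a (f ∘ suc) h

 xsum² : ℕ → Grid → Bool
 xsum² M f = xsum M λ i → xsum M (f i)

 xsum²-cong : ∀ M {f g : Grid} → (∀ i j → i <ℕ M → j <ℕ M → f i j ≡ g i j) → xsum² M f ≡ xsum² M g
 xsum²-cong M h = xsum-cong M λ i k → xsum-cong M λ j l → h i j k l

 xsum²-⊕ : ∀ M (f g : Grid) → xsum² M f xor xsum² M g ≡ xsum² M (f ⊕ g)
 xsum²-⊕ M f g = trans (xsum-⊕ M _ _) (xsum-cong M λ i _ → xsum-⊕ M (f i) (g i))

 xsum²-false : ∀ M {f : Grid} → (∀ i j → i <ℕ M → j <ℕ M → f i j ≡ false) → xsum² M f ≡ false
 xsum²-false M h = xsum-false M λ i k → xsum-false M λ j l → h i j k l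

 xsum²-at : ∀ M a b (f : Grid) → a <ℕ M → b <ℕ M → xsum² M (λ i j → spot i j a b ∧ f i j) ≡ f a b
 xsum²-at M a b f h k = trans (xsum-cong M λ i _ → trans (xsum-cong M λ j _ → shuffle (a ≡ᵇ i) (b ≡ᵇ j) (f i j)) (pull (a ≡ᵇ i) (λ j → (b ≡ᵇ j) ∧ f i j)))
  (trans (xsum-at M a (λ i → xsum M λ j → (b ≡ᵇ j) ∧ f i j) h) (xsum-at M b (f a) k))
  where
  shuffle : ∀ x y z → (x ∧ y) ∧ z ≡ x ∧ (y ∧ z)
  shuffle true y z = refl
  shuffle false y z = refl
  pull : ∀ x (g : ℕ → Bool) → xsum M (λ j → x ∧ g j) ≡ x ∧ xsum M g
  pull true g = refl
  pull false g = xsum-false M λ _ _ → refl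

 InRange : ℕ → ℕ → ℕ → Set
 InRange M i j = i <ℕ M × j <ℕ M

 private
  add-one : ∀ M (f : Grid) i j → InRange M i j → (u : Grid) → xsum² M (λ x y → (spot x y i j xor u x y) ∧ f x y) ≡ f i j xor xsum² M (λ x y → u x y ∧ f x y)
  add-one M f i j (p , q) u = trans (xsum²-cong M λ x y _ _ → taut 3 (λ a b c → (a xor b) ∧ c) (λ a b c → (a ∧ c) xor (b ∧ c)) refl (spot x y i j) (u x y) (f x y))
   (trans (sym (xsum²-⊕ M (λ x y → spot x y i j ∧ f x y) (λ x y → u x y ∧ f x y))) (cong (_xor xsum² M (λ x y → u x y ∧ f x y)) (xsum²-at M i j f p q)))
  left-comm : ∀ a b c → a xor (b xor c) ≡ b xor (a xor c)
  left-comm = taut 3 (λ a b c → a xor (b xor c)) (λ a b c → b xor (a xor c)) refl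

 sum-use : ∀ M (f g : Grid) (L : LPath i j a b) → AllE (InRange M) (InRange M) L →
  xsum² M (λ x y → useH L x y ∧ f x y) xor xsum² M (λ x y → useV L x y ∧ g x y) ≡ sumL f g L
 sum-use M f g stop _ = cong₂ _xor_ (xsum²-false M λ _ _ _ _ → refl) (xsum²-false M λ _ _ _ _ → refl)
 sum-use M f g (east {i} {j} L) (p , h) = trans (cong (_xor xsum² M (λ x y → useV L x y ∧ g x y)) (add-one M f i j p (useH L))) (trans (xor-assoc (f i j) (xsum² M (λ x y → useH L x y ∧ f x y)) (xsum² M (λ x y → useV L x y ∧ g x y))) (cong (f i j xor_) (sum-use M f g L h)))
 sum-use M f g (west {i} {j} L) (p , h) = trans (cong (_xor xsum² M (λ x y → useV L x y ∧ g x y)) (add-one M f i j p (useH L))) (trans (xor-assoc (f i j) (xsum² M (λ x y → useH L x y ∧ f x y)) (xsum² M (λ x y → useV L x y ∧ g x y))) (cong (f i j xor_) (sum-use M f g L h)))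
 sum-use M f g (north {i} {j} L) (p , h) = trans (cong (xsum² M (λ x y → useH L x y ∧ f x y) xor_) (add-one M g i j p (useV L)))
  (trans (left-comm (xsum² M (λ x y → useH L x y ∧ f x y)) (g i j) (xsum² M (λ x y → useV L x y ∧ g x y))) (cong (g i j xor_) (sum-use M f g L h)))
 sum-use M f g (south {i} {j} L) (p , h) = trans (cong (xsum² M (λ x y → useH L x y ∧ f x y) xor_) (add-one M g i j p (useV L)))
  (trans (left-comm (xsum² M (λ x y → useH L x y ∧ f x y)) (g i j) (xsum² M (λ x y → useV L x y ∧ g x y))) (cong (g i j xor_) (sum-use M f g L h)))

 prevV prevH : Grid → Grid
 prevV C i zero = false
 prevV C i (suc j) = C i j
 prevH C zero j = false
 prevH C (suc i) j = C i j

 -- Summation by parts: the boundary of the cell chain C paired with an edge function.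
 sum-boundary : ∀ M (C f g : Grid) → (∀ i j → M ≤ℕ i ⊎ M ≤ℕ j → C i j ≡ false) →
  xsum² (suc M) (λ i j → (C i j xor prevV C i j) ∧ f i j) xor xsum² (suc M) (λ i j → (C i j xor prevH C i j) ∧ g i j) ≡
  xsum² M (λ i j → C i j ∧ ((f i j xor f i (suc j)) xor (g i j xor g (suc i) j)))
 sum-boundary M C f g out = trans (cong₂ _xor_ vertical horizontal)
  (trans (xsum²-⊕ M (λ i j → C i j ∧ (f i j xor f i (suc j))) (λ i j → C i j ∧ (g i j xor g (suc i) j))) (xsum²-cong M λ i j _ _ → taut 5 (λ c x y z w → (c ∧ (x xor y)) xor (c ∧ (z xor w))) (λ c x y z w → c ∧ ((x xor y) xor (z xor w))) refl
   (C i j) (f i j) (f i (suc j)) (g i j) (g (suc i) j)))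
  where
  dist : ∀ a b c → (a xor b) ∧ c ≡ (a ∧ c) xor (b ∧ c)
  dist = taut 3 (λ a b c → (a xor b) ∧ c) (λ a b c → (a ∧ c) xor (b ∧ c)) refl
  dist' : ∀ a b c → (a ∧ b) xor (a ∧ c) ≡ a ∧ (b xor c)
  dist' = taut 3 (λ a b c → (a ∧ b) xor (a ∧ c)) (λ a b c → a ∧ (b xor c)) refl
  kill : ∀ {x y : Bool} → x ≡ false → x ∧ y ≡ false
  kill refl = refl
  column : ∀ i → xsum (suc M) (λ j → (C i j xor prevV C i j) ∧ f i j) ≡ xsum M (λ j → C i j ∧ (f i j xor f i (suc j)))
  column i = trans (xsum-cong (suc M) λ j _ → dist (C i j) (prevV C i j) (f i j))
   (trans (sym (xsum-⊕ (suc M) (λ j → C i j ∧ f i j) (λ j → prevV C i j ∧ f i j)))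
    (trans (cong (_xor xsum M (λ j → C i j ∧ f i (suc j))) (xsum-last M (λ j → C i j ∧ f i j) (kill (out i M (inr ≤-refl)))))
     (trans (xsum-⊕ M (λ j → C i j ∧ f i j) (λ j → C i j ∧ f i (suc j))) (xsum-cong M λ j _ → dist' (C i j) (f i j) (f i (suc j))))))
  vertical : xsum² (suc M) (λ i j → (C i j xor prevV C i j) ∧ f i j) ≡ xsum² M (λ i j → C i j ∧ (f i j xor f i (suc j)))
  vertical = trans (xsum-cong (suc M) λ i _ → column i)
   (xsum-last M (λ i → xsum M (λ j → C i j ∧ (f i j xor f i (suc j)))) (xsum-false M λ j _ → kill (out M j (inl ≤-refl))))
  cut-last : xsum² (suc M) (λ i j → C i j ∧ g i j) ≡ xsum² M (λ i j → C i j ∧ g i j)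
  cut-last = trans (xsum-cong (suc M) λ i _ → xsum-last M (λ j → C i j ∧ g i j) (kill (out i M (inr ≤-refl))))
   (xsum-last M _ (xsum-false M λ j _ → kill (out M j (inl ≤-refl))))
  shift-last : xsum² (suc M) (λ i j → prevH C i j ∧ g i j) ≡ xsum² M (λ i j → C i j ∧ g (suc i) j)
  shift-last = trans (cong (_xor xsum M (λ i → xsum (suc M) (λ j → C i j ∧ g (suc i) j))) (xsum-false (suc M) {λ j → prevH C 0 j ∧ g 0 j} λ _ _ → refl))
   (xsum-cong M λ i _ → xsum-last M (λ j → C i j ∧ g (suc i) j) (kill (out i M (inr ≤-refl))))
  horizontal : xsum² (suc M) (λ i j → (C i j xor prevH C i j) ∧ g i j) ≡ xsum² M (λ i j → C i j ∧ (g i j xor g (suc i) j))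
  horizontal = trans (xsum²-cong (suc M) λ i j _ _ → dist (C i j) (prevH C i j) (g i j))
   (trans (sym (xsum²-⊕ (suc M) (λ i j → C i j ∧ g i j) (λ i j → prevH C i j ∧ g i j)))
    (trans (cong₂ _xor_ cut-last shift-last) (trans (xsum²-⊕ M (λ i j → C i j ∧ g i j) (λ i j → C i j ∧ g (suc i) j)) (xsum²-cong M λ i j _ _ → dist' (C i j) (g i j) (g (suc i) j)))))

 -- A path L whose chain is the boundary of a cell chain, except on edges where f and g vanish.
 sum-along : ∀ M (C f g : Grid) → (∀ i j → M ≤ℕ i ⊎ M ≤ℕ j → C i j ≡ false) →
  (L : LPath i j a b) → AllE (InRange (suc M)) (InRange (suc M)) L →
  (∀ i j → f i j ≡ true → useH L i j ≡ C i j xor prevV C i j) →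
  (∀ i j → g i j ≡ true → useV L i j ≡ C i j xor prevH C i j) →
  (∀ i j → C i j ≡ true → (f i j xor f i (suc j)) xor (g i j xor g (suc i) j) ≡ false) →
  sumL f g L ≡ false
 sum-along M C f g out L range hf hg closed = trans (sym (sum-use (suc M) f g L range))
  (trans (cong₂ _xor_ (xsum²-cong (suc M) λ i j _ _ → guard (f i j) (hf i j)) (xsum²-cong (suc M) λ i j _ _ → guard (g i j) (hg i j)))
   (trans (sum-boundary M C f g out) (xsum²-false M λ i j _ _ → zap (C i j) (closed i j))))
  where
  guard : ∀ f {x y : Bool} → (f ≡ true → x ≡ y) → x ∧ f ≡ y ∧ f
  guard true h = cong (_∧ true) (h refl)
  guard false {x} {y} h = trans (taut 1 (λ x → x ∧ false) (λ _ → false) refl x) (sym (taut 1 (λ x → x ∧ false) (λ _ → false) refl y))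
  zap : ∀ c {x : Bool} → (c ≡ true → x ≡ false) → c ∧ x ≡ false
  zap true h = h refl
  zap false h = refl

 reverse : ∀ {P Q : ℕ → ℕ → Set} (L : LPath i j a b) → AllE P Q L → Σ[ K ∈ LPath a b i j ] AllE P Q K
 reverse stop h = stop , tt
 reverse (east L) (x , h) = let (K , k) = reverse L h in K ⊙ west stop , AllE-⊙ K k (x , tt)
 reverse (west L) (x , h) = let (K , k) = reverse L h in K ⊙ east stop , AllE-⊙ K k (x , tt)
 reverse (north L) (x , h) = let (K , k) = reverse L h in K ⊙ south stop , AllE-⊙ K k (x , tt)
 reverse (south L) (x , h) = let (K , k) = reverse L h in K ⊙ north stop , AllE-⊙ K k (x , tt)

 Convex : (ℕ → Set) → Set
 Convex A = ∀ i j k → i ≤ℕ j → j ≤ℕ k → A i → A k → A j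

 module _ {A B : ℕ → Set} where

  private
   Path : ℕ → ℕ → ℕ → ℕ → Set
   Path i j a b = Σ[ L ∈ LPath i j a b ] AllE (λ i j → A i × A (suc i) × B j) (λ i j → A i × B j × B (suc j)) L
   eastward : ∀ k {i j} → (∀ l → l ≤ℕ k → A (l +ℕ i)) → B j → Path i j (k +ℕ i) j
   eastward zero h b = stop , tt
   eastward (suc k) {i} {j} h b = let (L , al) = eastward k {i} {j} (λ l p → h l (m≤n⇒m≤1+n p)) b in
    L ⊙ east stop , AllE-⊙ L al ((h k (n≤1+n k) , h (suc k) ≤-refl , b) , tt)
   northward : ∀ k {i j} → (∀ l → l ≤ℕ k → B (l +ℕ j)) → A i → Path i j i (k +ℕ j)
   northward zero h b = stop , tt
   northward (suc k) {i} {j} h b = let (L , al) = northward k {i} {j} (λ l p → h l (m≤n⇒m≤1+n p)) b in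
    L ⊙ north stop , AllE-⊙ L al ((b , h k (n≤1+n k) , h (suc k) ≤-refl) , tt)
   between : ∀ {A : ℕ → Set} → Convex A → i ≤ℕ a → A i → A a → ∀ l → l ≤ℕ a ∸ i → A (l +ℕ i)
   between {i} {a} conv le p q l h = conv i _ a (m≤n+m i l) (≤-trans (+-monoˡ-≤ i h) (≤-reflexive (m∸n+n≡m le))) p q
   across : Convex A → A i → A a → B j → Path i j a j
   across {i} {a} {j} conv p q b with ≤-total i a
   ... | inl le = subst (λ a → Path i j a j) (m∸n+n≡m le) (eastward _ (between conv le p q) b)
   ... | inr le = let (L , h) = subst (λ i → Path a j i j) (m∸n+n≡m le) (eastward _ (between conv le q p) b) in reverse L h
   upright : Convex B → B j → B b → A i → Path i j i b
   upright {j} {b} {i} conv p q x with ≤-total j b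
   ... | inl le = subst (λ b → Path i j i b) (m∸n+n≡m le) (northward _ (between conv le p q) x)
   ... | inr le = let (L , h) = subst (λ j → Path i b i j) (m∸n+n≡m le) (northward _ (between conv le q p) x) in reverse L h

  -- First along a row, then along a column; with convex factors the path stays in the product.
  rectangular : Convex A → Convex B → A i → B j → A a → B b → Path i j a b
  rectangular cA cB ai bj aa bb = let (L , h) = across cA ai aa bj; (K , k) = upright cB bj bb aa in L ⊙ K , AllE-⊙ L h k

-- Arithmetic progressions of rationals

module Progressions where

 fromℕ : ℕ → ℚ
 fromℕ zero = 0ℚ
 fromℕ (suc n) = 1ℚ + fromℕ n

 fromℕ-ᵘ : ∀ n → ℚ.toℚᵘ (fromℕ n) ℚᵘ.≃ mkℚᵘ (pos n) 0
 fromℕ-ᵘ zero = *≡* refl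
 fromℕ-ᵘ (suc n) = ℚᵘP.≃-trans (ℚP.toℚᵘ-homo-+ 1ℚ (fromℕ n))
  (ℚᵘP.≃-trans (ℚᵘP.+-congʳ (mkℚᵘ (pos 1) 0) (fromℕ-ᵘ n)) (*≡* (cong (ℤ._* pos 1) (cong (λ z → pos 1 ℤ.+ z) (ℤP.*-identityʳ (pos n))))))

 archimedean1 : ∀ y → Σ[ n ∈ ℕ ] y < fromℕ n
 archimedean1 (mkℚ (pos k) d _) = suc k , ℚP.toℚᵘ-cancel-< (ℚᵘP.<-respʳ-≃ (ℚᵘP.≃-sym {ℚ.toℚᵘ (fromℕ (suc k))} {mkℚᵘ (pos (suc k)) 0} (fromℕ-ᵘ (suc k)))
  (*<* (subst (ℤ._< pos (suc k) ℤ.* pos (suc d)) (sym (ℤP.*-identityʳ (pos k))) (ℤ.+<+ (ℕP.<-≤-trans (n<1+n k) (m≤m*n (suc k) (suc d)))))))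
 archimedean1 (mkℚ -[1+ k ] d _) = 0 , ℚP.toℚᵘ-cancel-< (*<* ℤ.-<+)

 fromℕ-pos : ∀ n → 0ℚ < fromℕ (suc n)
 fromℕ-nonneg : ∀ n → 0ℚ ≤ fromℕ n
 fromℕ-pos n = subst (_< fromℕ (suc n)) (ℚP.+-identityʳ 0ℚ) (ℚP.+-mono-<-≤ {0ℚ} {1ℚ} (positive⁻¹ 1ℚ) (fromℕ-nonneg n))
 fromℕ-nonneg zero = ℚP.≤-refl
 fromℕ-nonneg (suc n) = ℚP.<⇒≤ (fromℕ-pos n)

 module _ (h : ℚ) (0<h : 0ℚ < h) where
  private instance
   hpos : Positive h
   hpos = positive 0<h
   hnz : NonZero h
   hnz = ℚP.pos⇒nonZero h

  archimedean : ∀ x → Σ[ n ∈ ℕ ] x < fromℕ n * h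
  archimedean x = let (n , l) = archimedean1 (x * 1/ h) in
   n , subst (_< fromℕ n * h) (trans (ℚP.*-assoc x (1/ h) h) (trans (cong (x *_) (ℚP.*-inverseˡ h)) (ℚP.*-identityʳ x))) (ℚP.*-monoˡ-<-pos h l)

 abstract
  steps : ℚ → ℚ → ℕ → ℚ
  steps x h zero = x
  steps x h (suc i) = steps x h i + h

  steps-≡ : ∀ x h i → steps x h i ≡ x + fromℕ i * h
  steps-≡ x h zero = sym (trans (cong (x +_) (ℚP.*-zeroˡ h)) (ℚP.+-identityʳ x))
  steps-≡ x h (suc i) = trans (cong (_+ h) (steps-≡ x h i)) (trans (ℚP.+-assoc x _ h)
   (cong (x +_) (trans (ℚP.+-comm (fromℕ i * h) h) (trans (cong (_+ fromℕ i * h) (sym (ℚP.*-identityˡ h))) (sym (ℚP.*-distribʳ-+ h 1ℚ (fromℕ i)))))))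

  steps-+ : ∀ x h i j → steps x h (i +ℕ j) ≡ steps (steps x h j) h i
  steps-+ x h zero j = refl
  steps-+ x h (suc i) j = cong (_+ h) (steps-+ x h i j)

  step-< : ∀ {x h i} → 0ℚ < h → steps x h i < steps x h (suc i)
  step-< 0<h = p<p+ε 0<h

  four-steps : ∀ d → fromℕ 4 * d ≡ d + d + d + d
  four-steps d = trans (sym (ℚP.+-identityˡ (fromℕ 4 * d))) (trans (sym (steps-≡ 0ℚ d 4)) (cong (λ x → x + d + d + d) (ℚP.+-identityˡ d)))

 module _ {x h : ℚ} (0<h : 0ℚ < h) where

  steps-< : ∀ {i j} → i <ℕ j → steps x h i < steps x h j
  steps-≤ : ∀ {i j} → i ≤ℕ j → steps x h i ≤ steps x h j
  steps-< {i} {suc j} (s≤s l) = ≤-<-trans (steps-≤ l) (step-< 0<h)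
  steps-≤ {i} {j} l with m≤n⇒m<n∨m≡n l
  ... | inl l' = ℚP.<⇒≤ (steps-< l')
  ... | inr refl = ℚP.≤-refl

  steps-<⁻ : ∀ {i j} → steps x h i < steps x h j → i <ℕ j
  steps-<⁻ {i} {j} l with ℕP.<-cmp i j
  ... | tri< k _ _ = k
  ... | tri≈ _ refl _ = ⊥-elim (<-irrefl refl l)
  ... | tri> _ _ k = ⊥-elim (<-asym l (steps-< k))

 steps-back : ∀ p h k → steps (p - fromℕ k * h) h k ≡ p
 steps-back p h k = trans (steps-≡ _ h k) (trans (ℚP.+-assoc p _ _) (trans (cong (p +_) (ℚP.+-inverseˡ (fromℕ k * h))) (ℚP.+-identityʳ p)))

 -- One coordinate of a lattice. The coordinates `p` and `q` of two given points must be hit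
 -- exactly, so the step divides their difference. The three steps below `lo` keep marked cells off
 -- the border of the grid; four steps are the width of the blocks in which everything has to be
 -- simple.
 record Progression (p q lo hi ε : ℚ) : Set where
  field
   base step : ℚ
   0<step : 0ℚ < step
   count : ℕ
   covers-lo : steps base step 3 < lo
   covers-hi : hi < steps base step count
   fine : ∀ i → steps base step (4 +ℕ i) ≤ steps base step i + ε
   ip iq : ℕ
   at-p : steps base step ip ≡ p
   at-q : steps base step iq ≡ q

 private
  build : ∀ p q lo hi ε → p < q → 0ℚ < ε → Progression p q lo hi ε
  build p q lo hi ε p<q 0<ε = record
   { base = s ; step = h ; 0<step = 0<h ; count = m ; covers-lo = below-lo ; covers-hi = above-hi ; fine = fine
   ; ip = 3 +ℕ k ; iq = n +ℕ (3 +ℕ k) ; at-p = at-p ; at-q = trans (steps-+ s h n (3 +ℕ k)) (trans (cong (λ x → steps x h n) at-p) at-q) }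
   where
   d = q - p
   0<d : 0ℚ < d
   0<d = 0<q-p p<q
   n0 : ℕ
   n0 = fst (archimedean ε 0<ε (d + d + d + d))
   n = suc n0
   instance
    posn : Positive (fromℕ n)
    posn = positive (fromℕ-pos n0)
    nzn : NonZero (fromℕ n)
    nzn = ℚP.pos⇒nonZero (fromℕ n)
    posi : Positive (1/ fromℕ n)
    posi = ℚP.1/pos⇒pos (fromℕ n)
    dpos : Positive d
    dpos = positive 0<d
    εnn : NonNegative ε
    εnn = ℚP.pos⇒nonNeg ε {{positive 0<ε}}
   h : ℚ
   h = d * 1/ fromℕ n
   0<h : 0ℚ < h
   0<h = positive⁻¹ h {{ℚP.pos*pos⇒pos d (1/ fromℕ n)}}
   nh : fromℕ n * h ≡ d
   nh = trans (ℚP.*-comm (fromℕ n) h) (trans (ℚP.*-assoc d (1/ fromℕ n) (fromℕ n)) (trans (cong (d *_) (ℚP.*-inverseˡ (fromℕ n))) (ℚP.*-identityʳ d)))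
   k : ℕ
   k = fst (archimedean h 0<h (p - lo))
   s : ℚ
   s = p - fromℕ (3 +ℕ k) * h
   at-p : steps s h (3 +ℕ k) ≡ p
   at-p = steps-back p h (3 +ℕ k)
   at-q : steps p h n ≡ q
   at-q = trans (steps-≡ p h n) (trans (cong (p +_) nh) (p+[q-p] p q))
   -- s3 = p - k h < lo
   below-lo : steps s h 3 < lo
   below-lo = subst₂ _<_ eq1 eq2 (ℚP.+-monoʳ-< (lo - fromℕ k * h) (snd (archimedean h 0<h (p - lo))))
    where
    eq2 : (lo - fromℕ k * h) + fromℕ k * h ≡ lo
    eq2 = trans (ℚP.+-assoc lo _ _) (trans (cong (lo +_) (ℚP.+-inverseˡ (fromℕ k * h))) (ℚP.+-identityʳ lo))
    key : steps (steps s h 3) h k ≡ p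
    key = trans (sym (steps-+ s h k 3)) (trans (cong (steps s h) (+-comm k 3)) at-p)
    eq1 : (lo - fromℕ k * h) + (p - lo) ≡ steps s h 3
    eq1 = trans (ℚP.+-comm (lo - fromℕ k * h) (p - lo)) (trans (ℚP.+-assoc p (- lo) _) (trans (cong (p +_) (trans (sym (ℚP.+-assoc (- lo) lo _))
     (trans (cong (_+ - (fromℕ k * h)) (ℚP.+-inverseˡ lo)) (ℚP.+-identityˡ _))))
     (trans (cong (_- fromℕ k * h) (sym (trans (sym (steps-≡ (steps s h 3) h k)) key))) (trans (ℚP.+-assoc (steps s h 3) _ _)
     (trans (cong (steps s h 3 +_) (ℚP.+-inverseʳ (fromℕ k * h))) (ℚP.+-identityʳ _))))))
   m : ℕ
   m = fst (archimedean h 0<h (hi - s))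
   above-hi : hi < steps s h m
   above-hi = subst₂ _<_ (p+[q-p] s hi) (sym (steps-≡ s h m)) (ℚP.+-monoʳ-< s (snd (archimedean h 0<h (hi - s))))
   -- 4 h ≤ ε since n ε > 4 d
   4h≤ε : fromℕ 4 * h ≤ ε
   4h≤ε = ℚP.*-cancelˡ-≤-pos (fromℕ n) (subst₂ _≤_ (sym e1) refl (ℚP.≤-trans (ℚP.<⇒≤ (snd (archimedean ε 0<ε (d + d + d + d))))
    (ℚP.*-monoʳ-≤-nonNeg ε (subst (_≤ fromℕ n) (ℚP.+-identityˡ (fromℕ n0)) (ℚP.+-monoˡ-≤ (fromℕ n0) {0ℚ} {1ℚ} (ℚP.<⇒≤ (positive⁻¹ 1ℚ)))))))
    where
    e1 : fromℕ n * (fromℕ 4 * h) ≡ d + d + d + d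
    e1 = trans (sym (ℚP.*-assoc (fromℕ n) (fromℕ 4) h)) (trans (cong (_* h) (ℚP.*-comm (fromℕ n) (fromℕ 4)))
     (trans (ℚP.*-assoc (fromℕ 4) (fromℕ n) h) (trans (cong (fromℕ 4 *_) nh) (four-steps d))))
   fine : ∀ i → steps s h (4 +ℕ i) ≤ steps s h i + ε
   fine i = subst (_≤ steps s h i + ε) (sym (trans (steps-+ s h 4 i) (steps-≡ (steps s h i) h 4))) (ℚP.+-monoʳ-≤ (steps s h i) 4h≤ε)

 exchange : ∀ {p q lo hi ε} → Progression q p lo hi ε → Progression p q lo hi ε
 exchange P = record { base = base ; step = step ; 0<step = 0<step ; count = count ; covers-lo = covers-lo ; covers-hi = covers-hi ; fine = fine
  ; ip = iq ; iq = ip ; at-p = at-q ; at-q = at-p }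
  where open Progression P

 progression : ∀ p q lo hi ε → p ≢ q → 0ℚ < ε → Progression p q lo hi ε
 progression p q lo hi ε p≢q 0<ε with <-cmp p q
 ... | tri< l _ _ = build p q lo hi ε l 0<ε
 ... | tri≈ _ e _ = ⊥-elim (p≢q e)
 ... | tri> _ _ l = exchange (build q p lo hi ε l 0<ε)

open Progressions

record Given : Setω where
 constructor given
 field
  em : ∀ ℓ → ExcludedMiddle ℓ
  G : PlaneGraph

module Planar (assumed : Given) where
 open Given assumed
 open PlaneGraph G

 -- Classical logic and separation of points

 module ClassicalLogic where

  private variable
   ℓ ℓ' : Level

  -- Excluded middle at every level doubles as resizing: a statement of any level becomes a Boolean,
  -- which can enter a cut or an open set and can be tested for local constancy.
  dec : Set ℓ → Bool
  dec {ℓ} A = does (em ℓ {A})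

  dec-yes : {A : Set ℓ} → A → dec A ≡ true
  dec-yes {ℓ} {A} x with em ℓ {A}
  ... | yes _ = refl
  ... | no ¬x = ⊥-elim (¬x x)

  dec-no : {A : Set ℓ} → ¬ A → dec A ≡ false
  dec-no {ℓ} {A} ¬x with em ℓ {A}
  ... | yes x = ⊥-elim (¬x x)
  ... | no _ = refl

  dec-true : {A : Set ℓ} → dec A ≡ true → A
  dec-true {ℓ} {A} eq with em ℓ {A}
  ... | yes x = x
  dec-true () | no _

  dec-false : {A : Set ℓ} → dec A ≡ false → ¬ A
  dec-false {ℓ} {A} eq x with em ℓ {A}
  dec-false () x | yes _
  ... | no ¬x = ¬x x

  dec-⇔ : {A : Set ℓ} {B : Set ℓ'} → (A → B) → (B → A) → dec A ≡ dec B
  dec-⇔ {ℓ} {A = A} f g with em ℓ {A}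
  ... | yes x = sym (dec-yes (f x))
  ... | no ¬x = sym (dec-no (¬x ∘ g))

  by-contra : {A : Set ℓ} → ¬ ¬ A → A
  by-contra {ℓ} {A} h with em ℓ {A}
  ... | yes x = x
  ... | no ¬x = ⊥-elim (h ¬x)

  -- If no rational lies between them in either order, locatedness makes the lower cuts equal.
  apart : ∀ x y → ¬ (x ≈ y) → (∃[ q ] (x <ʳ q × q <ˡ y)) ⊎ (∃[ q ] (y <ʳ q × q <ˡ x))
  apart x y ne with em 0ℓ {∃[ q ] (x <ʳ q × q <ˡ y)} | em 0ℓ {∃[ q ] (y <ʳ q × q <ˡ x)}
  ... | yes p | _ = inl p
  ... | no _ | yes p = inr p
  ... | no n1 | no n2 = ⊥-elim (ne (sub x y n2 , sub y x n1))
   where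
   sub : ∀ x y → ¬ (∃[ q ] (y <ʳ q × q <ˡ x)) → ℝ.lower x ⊆ ℝ.lower y
   sub x y n {q} h with lo-round x h
   ... | r , q<r , k with ℝ.located y q<r
   ...   | inl l = l
   ...   | inr u = ⊥-elim (n (r , u , k))

  separate : ∀ z w → ¬ (z ≈² w) → Σ[ P ∈ (ℝ² → Set) ] (N z P × N w (λ v → ¬ P v))
  separate (x , y) (u , v) ne with em 0ℓ {x ≈ u}
  ... | no x≉u with apart x u x≉u
  ...   | inl (q , h , k) = (λ w → fst w <ʳ q) , N-x (_<ʳ q) (Nb-<ʳ {x} h) ,
   N-map (λ w i j → ℝ.disjoint (fst w) q (i , j)) (N-x (q <ˡ_) (Nb-<ˡ {u} k))
  ...   | inr (q , h , k) = (λ w → q <ˡ fst w) , N-x (q <ˡ_) (Nb-<ˡ {x} k) ,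
   N-map (λ w i j → ℝ.disjoint (fst w) q (j , i)) (N-x (_<ʳ q) (Nb-<ʳ {u} h))
  separate (x , y) (u , v) ne | yes x≈u with apart y v (λ e → ne (x≈u , e))
  ...   | inl (q , h , k) = (λ w → snd w <ʳ q) , N-y (_<ʳ q) (Nb-<ʳ {y} h) ,
   N-map (λ w i j → ℝ.disjoint (snd w) q (i , j)) (N-y (q <ˡ_) (Nb-<ˡ {v} k))
  ...   | inr (q , h , k) = (λ w → q <ˡ snd w) , N-y (q <ˡ_) (Nb-<ˡ {y} k) ,
   N-map (λ w i j → ℝ.disjoint (snd w) q (j , i)) (N-y (_<ʳ q) (Nb-<ʳ {v} h))

 open ClassicalLogic

 -- Compactness of intervals and rectangles

 module Compactness where

  private variable
   ℓ ℓ' : Level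

  -- Compactness of [a,b]: an additive property of intervals that holds locally holds globally.
  module _ (Q : ℚ → ℚ → Set ℓ)
   (add : ∀ p m q → p < m → m < q → Q p m → Q m q → Q p q)
   (a b : ℚ) (a<b : a < b)
   (loc : ∀ t → In a b t → ∃[ p ] ∃[ q ] (Between p q t ×
    (∀ p' q' → p ≤ p' → p' < q' → q' ≤ q → a ≤ p' → q' ≤ b → Q p' q')))
   where
   private
    Good : ℚ → Set
    Good r = r ≤ b × dec (a < r → Q a r) ≡ true
    L : ℚ → Set
    L q = ∃[ r ] (q < r × Good r)
    module _ (notQ : ¬ Q a b) where
     b∉ : ¬ Good b
     b∉ (_ , g) = notQ (dec-true g a<b)
     a∈ : Good a
     a∈ = ℚP.<⇒≤ a<b , dec-yes λ h → ⊥-elim (<-irrefl refl h)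
     noL : ∀ {q} → b ≤ q → ¬ L q
     noL h (r , q<r , r≤b , _) = <-irrefl refl (<-≤-trans q<r (ℚP.≤-trans r≤b h))
     downL : ∀ {p q} → p ≤ q → L q → L p
     downL h (r , k , g) = r , ≤-<-trans h k , g
     t : ℝ
     t = record
      { lower = L ; upper = λ q → ∃[ r ] (r < q × ¬ L r)
      ; lower-inhab = a - 1ℚ , a , p-1<p a , a∈
      ; upper-inhab = b + 1ℚ , b , p<p+1 b , noL ℚP.≤-refl
      ; lower-rounded = λ q → mk⇔ (λ (r , q<r , g) → let (m , u , v) = <-dense q<r in m , u , r , v , g)
       (λ (m , u , l) → downL (ℚP.<⇒≤ u) l)
      ; upper-rounded = λ q → mk⇔ (λ (r , r<q , g) → let (m , u , v) = <-dense r<q in m , v , r , u , g)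
       (λ (m , u , r , v , g) → r , <-trans v u , g)
      ; disjoint = λ q (l , r , r<q , g) → g (downL (ℚP.<⇒≤ r<q) l)
      ; located = λ {q} {r} q<r → case em 0ℓ {L q} of λ { (yes l) → inl l ; (no n) → inr (q , q<r , n) } }
     absurd : ⊥
     -- The supremum `t` of the good points lies between `a` and `b`; the local hypothesis there
     -- carries goodness from some good `r` just below `t` past `t`.
     absurd with loc t ((λ (r , r<a , n) → n (a , r<a , a∈)) , noL ℚP.≤-refl)
     ... | p , q , ((r , p<r , r≤b , g) , (r0 , r0<q , n)) , f = final
      where
      r<q : r < q
      r<q with <-cmp r q
      ... | tri< l _ _ = l
      ... | tri≈ _ refl _ = ⊥-elim (n (r , r0<q , r≤b , g))
      ... | tri> _ _ k = ⊥-elim (n (r , <-trans r0<q k , r≤b , g))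
      good : ∀ s → r < s → s ≤ q → s ≤ b → Good s
      good s r<s s≤q s≤b = s≤b , dec-yes λ a<s → h a<s
       where
       h : a < s → Q a s
       h a<s with <-cmp a r
       ... | tri< l _ _ = add a r s l r<s (dec-true g l) (f r s (ℚP.<⇒≤ p<r) r<s s≤q (ℚP.<⇒≤ l) s≤b)
       ... | tri≈ _ refl _ = f a s (ℚP.<⇒≤ p<r) a<s s≤q ℚP.≤-refl s≤b
       ... | tri> _ _ k = f a s (ℚP.<⇒≤ (<-trans p<r k)) a<s s≤q ℚP.≤-refl s≤b
      final : ⊥
      final with <-cmp b q
      ... | tri> _ _ q<b = n (q , r0<q , good q r<q ℚP.≤-refl (ℚP.<⇒≤ q<b))
      ... | tri≈ _ refl _ = b∉ (good b r<q ℚP.≤-refl ℚP.≤-refl)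
      ... | tri< b<q _ _ with <-cmp r b
      ...   | tri< r<b _ _ = b∉ (good b r<b (ℚP.<⇒≤ b<q) ℚP.≤-refl)
      ...   | tri≈ _ refl _ = b∉ (r≤b , g)
      ...   | tri> _ _ k = <-irrefl refl (<-≤-trans k r≤b)

   cousin : Q a b
   cousin = by-contra absurd

  cousin-In : (P : (ℝ → Set) → Set ℓ) (a b : ℚ) → a < b →
   (∀ {A B : ℝ → Set} → (∀ t → A t → B t) → P B → P A) →
   (∀ {A B : ℝ → Set} → P A → P B → P (λ t → A t ⊎ B t)) →
   (∀ t → In a b t → Σ[ A ∈ (ℝ → Set) ] (Nb t A × P A)) → P (In a b)
  cousin-In P a b a<b mono union loc = cousin (λ p q → P (In p q))
   (λ p m q _ _ u v → mono (λ t (h , k) → case em 0ℓ {t ≤ᴿ m} of λ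
    { (yes l) → inl (h , l) ; (no n) → inr ((λ x → n (<ʳ⇒≤ᴿ t x)) , k) }) (union u v))
   a b a<b λ t i → let (A , nb p q h f , u) = loc t i; (p' , q' , x , y , z) = shrink t h in
    p' , q' , z , λ p″ q″ c _ d _ _ → mono (λ s j → f s (In-Between s (In-mono s c d j) x y)) u

  -- Cousin's lemma for constancy on subintervals. Applied to a function of the form `dec ∘ P` it is
  -- induction along the interval: a statement with locally constant truth value that holds at one
  -- time holds at all times.
  locally-constant : ∀ {a b} → a < b → (f : ℝ → Bool) →
   (∀ t → In a b t → Nb t (λ s → In a b s → f s ≡ f t)) → ∀ s t → In a b s → In a b t → f s ≡ f t
  locally-constant {a} {b} a<b f loc = λ s t i j → cst s t i j i j
   where
   cst : ∀ s t → In a b s → In a b t → In a b s → In a b t → f s ≡ f t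
   cst = cousin (λ p q → ∀ s t → In p q s → In p q t → In a b s → In a b t → f s ≡ f t)
    (λ p m q p<m m<q u v s t → join p m q p<m m<q u v s t)
    a b a<b λ t i → let (nb p q h g) = loc t i; (p' , q' , x , y , z) = shrink t h in
     p' , q' , z , λ p″ q″ c _ d _ _ s u js ju is iu →
      trans (g s (In-Between s (In-mono s c d js) x y) is) (sym (g u (In-Between u (In-mono u c d ju) x y) iu))
    where
    join : ∀ p m q → p < m → m < q →
     (∀ s t → In p m s → In p m t → In a b s → In a b t → f s ≡ f t) →
     (∀ s t → In m q s → In m q t → In a b s → In a b t → f s ≡ f t) →
     ∀ s t → In p q s → In p q t → In a b s → In a b t → f s ≡ f t
    join p m q p<m m<q u v s t (js , ks) (jt , kt) is it with em 0ℓ {s ≤ᴿ m} | em 0ℓ {t ≤ᴿ m}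
    ... | yes h | yes k = u s t (js , h) (jt , k) is it
    ... | no h | no k = v s t ((λ x → h (<ʳ⇒≤ᴿ s x)) , ks) ((λ x → k (<ʳ⇒≤ᴿ t x)) , kt) is it
    ... | yes h | no k = trans (u s (ι m) (js , h) (<-asym p<m , <-irrefl refl) is im)
     (v (ι m) t (<-irrefl refl , <-asym m<q) ((λ x → k (<ʳ⇒≤ᴿ t x)) , kt) im it)
     where
     im : In a b (ι m)
     im = (λ m<a → k (λ m<t → h' m<a m<t)) , λ b<m → snd it (lower-down t b<m (by-contra k))
      where h' : m < a → m <ˡ t → ⊥
            h' m<a _ = fst is (≤ᴿ-<ʳ s h m<a)
    ... | no h | yes k = trans (v s (ι m) ((λ x → h (<ʳ⇒≤ᴿ s x)) , ks) (<-irrefl refl , <-asym m<q) is im)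
     (u (ι m) t (<-asym p<m , <-irrefl refl) (jt , k) im it)
     where
     im : In a b (ι m)
     im = (λ m<a → fst it (≤ᴿ-<ʳ t k m<a)) , λ b<m → snd is (lower-down s b<m (by-contra h))

  -- The tube lemma: for a fixed abscissa the inner application merges boxes into one vertical
  -- strip, and the outer one merges the strips.
  cousin² : (Q : ℚ → ℚ → ℚ → ℚ → Set ℓ) →
   (∀ p m q r s → p < m → m < q → r < s → Q p m r s → Q m q r s → Q p q r s) →
   (∀ p q r m s → p < q → r < m → m < s → Q p q r m → Q p q m s → Q p q r s) →
   (∀ z → ∃[ p ] ∃[ q ] ∃[ r ] ∃[ s ] (z ∈ Box p q r s ×
    (∀ p' q' r' s' → p ≤ p' → p' < q' → q' ≤ q → r ≤ r' → r' < s' → s' ≤ s → Q p' q' r' s'))) →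
   ∀ a b c d → a < b → c < d → Q a b c d
  cousin² Q addx addy loc a b c d a<b c<d = cousin (λ p q → Q p q c d)
   (λ p m q u v → addx p m q c d u v c<d) a b a<b λ x _ →
    let (p , q , i , f) = cousin (λ r s → ∃[ p ] ∃[ q ] (Between p q x ×
         (∀ p' q' → p ≤ p' → p' < q' → q' ≤ q → Q p' q' r s)))
         (λ r m s u v (p , q , i , f) (p1 , q1 , i1 , f1) → p ℚ.⊔ p1 , q ⊓ q1 , Between-∩ x i i1 ,
          λ p' q' e h k → addy p' q' r m s h u v
           (f p' q' (ℚP.≤-trans (p≤p⊔q p p1) e) h (ℚP.≤-trans k (p⊓q≤p q q1)))
           (f1 p' q' (ℚP.≤-trans (p≤q⊔p p p1) e) h (ℚP.≤-trans k (p⊓q≤q q q1))))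
         c d c<d λ y _ → let (p , q , r , s , (i , j) , f) = loc (x , y) in
          r , s , j , λ r' s' e h k _ _ → p , q , i , λ p' q' e' h' k' → f p' q' r' s' e' h' k' e h k
    in p , q , i , λ p' q' e h k _ _ → f p' q' e h k

  -- Having a Lebesgue number is an additive property of rectangles, as the smaller of two numbers
  -- serves the union. Only the lower left corner of a box has to lie in the rectangle.
  lebesgue : (Good : ℚ → ℚ → ℚ → ℚ → Set ℓ) →
   (∀ {p q r s p' q' r' s'} → p ≤ p' → q' ≤ q → r ≤ r' → s' ≤ s → Good p q r s → Good p' q' r' s') →
   (∀ z → ∃[ p ] ∃[ q ] ∃[ r ] ∃[ s ] (z ∈ Box p q r s × Good p q r s)) →
   ∀ a b c d → a < b → c < d → ∃[ ε ] (0ℚ < ε ×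
    (∀ p q r s → a ≤ p → p ≤ b → c ≤ r → r ≤ d → q ≤ p + ε → s ≤ r + ε → Good p q r s))
  lebesgue Good mono loc = cousin² Q
   (λ p m q r s _ _ _ (ε , h , f) (δ , k , g) → ε ⊓ δ , ⊓-pos h k , λ p1 q1 r1 s1 u v x y z w →
    case ℚP.≤-total p1 m of λ
     { (inl l) → f p1 q1 r1 s1 u l x y (le p1 z (p⊓q≤p ε δ)) (le r1 w (p⊓q≤p ε δ))
     ; (inr l) → g p1 q1 r1 s1 l v x y (le p1 z (p⊓q≤q ε δ)) (le r1 w (p⊓q≤q ε δ)) })
   (λ p q r m s _ _ _ (ε , h , f) (δ , k , g) → ε ⊓ δ , ⊓-pos h k , λ p1 q1 r1 s1 u v x y z w →
    case ℚP.≤-total r1 m of λ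
     { (inl l) → f p1 q1 r1 s1 u v x l (le p1 z (p⊓q≤p ε δ)) (le r1 w (p⊓q≤p ε δ))
     ; (inr l) → g p1 q1 r1 s1 u v l y (le p1 z (p⊓q≤q ε δ)) (le r1 w (p⊓q≤q ε δ)) })
   λ z@(x , y) → let (p , q , r , s , (i , j) , g) = loc z
                     (p1 , q1 , p<p1 , q1<q , i1) = shrink x i
                     (r1 , s1 , r<r1 , s1<s , j1) = shrink y j in
    p1 , q1 , r1 , s1 , (i1 , j1) , λ p' q' r' s' e h k e' h' k' →
     (q - q') ⊓ (s - s') , ⊓-pos (0<q-p (≤-<-trans k q1<q)) (0<q-p (≤-<-trans k' s1<s)) ,
     λ p2 q2 r2 s2 u v x' y' z' w → mono (ℚP.≤-trans (ℚP.<⇒≤ p<p1) (ℚP.≤-trans e u))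
      (ℚP.≤-trans z' (fin v (p⊓q≤p (q - q') (s - s'))))
      (ℚP.≤-trans (ℚP.<⇒≤ r<r1) (ℚP.≤-trans e' x')) (ℚP.≤-trans w (fin y' (p⊓q≤q (q - q') (s - s')))) g
   where
   Q : ℚ → ℚ → ℚ → ℚ → Set _
   Q a b c d = ∃[ ε ] (0ℚ < ε ×
    (∀ p q r s → a ≤ p → p ≤ b → c ≤ r → r ≤ d → q ≤ p + ε → s ≤ r + ε → Good p q r s))
   le : ∀ p {q ε δ} → q ≤ p + ε → ε ≤ δ → q ≤ p + δ
   le p h k = ℚP.≤-trans h (ℚP.+-monoʳ-≤ p k)
   fin : ∀ {p p' ε q} → p ≤ p' → ε ≤ q - p' → p + ε ≤ q
   fin {p} {p'} {ε} {q} h k = subst (p + ε ≤_) (p+[q-p] p' q) (ℚP.+-mono-≤ h k)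

 open Compactness

 -- Closures, connectedness and components

 module Components where

  private variable
   ℓ ℓ' : Level

  -- Predicates of any level, moved to the level used for open sets.
  record squash (P : Pred ℝ² ℓ) (z : ℝ²) : Set (lsuc 0ℓ) where
   constructor squashed
   field truth : dec (P z) ≡ true

  squash-in : {P : Pred ℝ² ℓ} → ∀ {z} → P z → squash P z
  squash-in h = squashed (dec-yes h)

  squash-out : {P : Pred ℝ² ℓ} → ∀ {z} → squash P z → P z
  squash-out (squashed h) = dec-true h

  Interior : Pred ℝ² ℓ → Pred ℝ² (lsuc 0ℓ)
  Interior P = squash (λ z → N z P)

  Interior-open : (P : Pred ℝ² ℓ) → Open (Interior P)
  Interior-open P z h = let nb p q r s i f = squash-out h in
   p , q , r , s , i , λ {w} j → squash-in (nb p q r s j f)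

  open-N : {U : Pred ℝ² (lsuc 0ℓ)} → Open U → ∀ {z} → U z → N z U
  open-N o u = let (p , q , r , s , i , f) = o _ u in nb p q r s i λ w j → f j

  closure-meets : {P : Pred ℝ² ℓ} {A : Pred ℝ² ℓ'} → ∀ {z} → Closure P z → N z A → Σ[ w ∈ ℝ² ] (P w × A w)
  closure-meets {A = A} c n = let (w , p , i) = c (Interior A) (Interior-open A) (squash-in n) in
   w , p , N-here (squash-out i)

  meets-closure : {P : Pred ℝ² ℓ} → ∀ {z} → (∀ (A : Pred ℝ² (lsuc 0ℓ)) → N z A → Σ[ w ∈ ℝ² ] (P w × A w)) → Closure P z
  meets-closure h U o u = h U (open-N o u)

  not-closure : {P : Pred ℝ² ℓ} → ∀ {z} → ¬ Closure P z → N z (λ w → ¬ P w)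
  not-closure {P = P} {z} h = by-contra λ k → h λ U o u → by-contra λ m →
   k (N-map (λ w uw pw → m (w , pw , uw)) (open-N o u))

  Locally-constant-on : Pred ℝ² ℓ → (ℝ² → Bool) → Set _
  Locally-constant-on C f = ∀ z → C z → N z (λ w → C w → f w ≡ f z)

  connected-const : {C : Pred ℝ² ℓ} → Connected C → (f : ℝ² → Bool) → Locally-constant-on C f →
   ∀ z w → C z → C w → f z ≡ f w
  connected-const {C = C} conn f loc z w cz cw = same-truth (go z w cz cw) (go w z cw cz)
   where
   U : Bool → Pred ℝ² _
   U b = Interior (λ v → C v → f v ≡ b)
   enter : ∀ {v b} → C v → f v ≡ b → U b v
   enter cv e = squash-in (N-map (λ u g cu → trans (g cu) e) (loc _ cv))
   go : ∀ z w → C z → C w → f z ≡ true → f w ≡ true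
   go z w cz cw ez with f w in ew
   ... | true = refl
   ... | false = let (v , cv , uv , vv) = conn (U true) (U false) (Interior-open _) (Interior-open _)
                      (λ {v} cv → case Bool-cases (f v) of λ { (inl e) → inl (enter cv e) ; (inr e) → inr (enter cv e) })
                      (z , cz , enter cz ez) (w , cw , enter cw ew)
    in true≢false (trans (sym (N-here (squash-out uv) cv)) (N-here (squash-out vv) cv))

  -- Converse of `connected-const`. Connectedness is handled throughout as constancy of locally
  -- constant Boolean functions, so that no open sets have to be exhibited.
  const-connected : {C : Pred ℝ² ℓ} →
   (∀ f → Locally-constant-on C f → ∀ z w → C z → C w → f z ≡ f w) → Connected C
  const-connected {C = C} h U V oU oV cover (z , cz , uz) (w , cw , vw) = by-contra λ none →
   let f = λ v → dec (U v)
       loc : Locally-constant-on C f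
       loc v cv = case em _ {U v} of λ
        { (yes u) → N-map (λ x ux _ → trans (dec-yes ux) (sym (dec-yes u))) (open-N oU u)
        ; (no n) → case cover cv of λ
         { (inl u) → ⊥-elim (n u)
         ; (inr v') → N-map (λ x vx cx → trans (dec-no λ ux → none (x , cx , ux , vx)) (sym (dec-no n))) (open-N oV v') } }
   in none (w , cw , dec-true (trans (sym (h f loc z w cz cw)) (dec-yes uz)) , vw)

  private
   inside : ∀ {p q} x x' → Between p q x → Between p q x' →
    ∃[ a ] ∃[ b ] (p < a × a < b × b < q × In a b x × In a b x')
   inside {p} {q} x x' i@(i1 , i2) j with shrink x i | shrink x' j
   ... | a , b , p<a , b<q , k | a' , b' , p<a' , b'<q , k' =
    a ⊓ a' , b ℚ.⊔ b' , low , ≤-<-trans (p⊓q≤p a a') (<-≤-trans (lo<up x (fst k) (snd k)) (p≤p⊔q b b')) , high ,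
     Between-In x (Between-mono x (p⊓q≤p a a') (p≤p⊔q b b') k) , Between-In x' (Between-mono x' (p⊓q≤q a a') (p≤q⊔p b b') k')
    where
    low : p < a ⊓ a'
    low with ℚP.≤-total a a'
    ... | inl l = subst (p <_) (sym (ℚP.p≤q⇒p⊓q≡p l)) p<a
    ... | inr l = subst (p <_) (sym (ℚP.p≥q⇒p⊓q≡q l)) p<a'
    high : b ℚ.⊔ b' < q
    high with ℚP.≤-total b b'
    ... | inl l = subst (_< q) (sym (ℚP.p≤q⇒p⊔q≡q l)) b'<q
    ... | inr l = subst (_< q) (sym (ℚP.p≥q⇒p⊔q≡p l)) b<q

  slice-x : ∀ {x y} {P : ℝ² → Set ℓ} → N (x , y) P → Nb x (λ t → P (t , y))
  slice-x (nb p q r s (i , j) f) = nb p q i λ t k → f (t , _) (k , j)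

  slice-y : ∀ {x y} {P : ℝ² → Set ℓ} → N (x , y) P → Nb y (λ t → P (x , t))
  slice-y (nb p q r s (i , j) f) = nb r s j λ t k → f (_ , t) (i , k)

  interval-const : ∀ {p q} (f : ℝ → Bool) → (∀ t → Between p q t → Nb t (λ s → Between p q s → f s ≡ f t)) →
   ∀ s t → Between p q s → Between p q t → f s ≡ f t
  interval-const f loc s t i j = let (a , b , p<a , a<b , b<q , i' , j') = inside s t i j in
   locally-constant a<b f (λ u k → Nb-map (λ v g l → g (In-Between v l p<a b<q)) (loc u (In-Between u k p<a b<q))) s t i' j'

  box-const : ∀ {p q r s} (f : ℝ² → Bool) → Locally-constant-on (Box p q r s) f →
   ∀ z w → z ∈ Box p q r s → w ∈ Box p q r s → f z ≡ f w
  box-const f loc (x , y) (x' , y') (i , j) (i' , j') = trans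
   (interval-const (λ t → f (t , y)) (λ t k → Nb-map (λ u g l → g (l , j)) (slice-x (loc (t , y) (k , j)))) x x' i i')
   (interval-const (λ t → f (x' , t)) (λ t k → Nb-map (λ u g l → g (i' , l)) (slice-y (loc (x' , t) (i' , k)))) y y' j j')

  module _ {X : Pred ℝ² (lsuc 0ℓ)} where

   component-const : (f : ℝ² → Bool) → Locally-constant-on X f → ∀ {z w} → ComponentOf X z w → f z ≡ f w
   component-const f loc {z} {w} (C , conn , sub , cz , cw) =
    connected-const conn f (λ v cv → N-map (λ u g cu → g (sub cu)) (loc v (sub cv))) z w cz cw

   component-⊆ : ∀ {z w} → ComponentOf X z w → X w
   component-⊆ (C , conn , sub , cz , cw) = sub cw

   component-self : ∀ {z} → X z → ComponentOf X z z
   component-self {z} x = (_≡ z) ,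
    const-connected (λ { f _ _ _ refl refl → refl }) , (λ { refl → x }) , refl , refl

   private
    -- Attachment of `D` to the component is expressed through locally constant functions, which
    -- covers a shared point as well as mere contact in the closure.
    extend : ∀ {ℓ} {z} (D : Pred ℝ² ℓ) → X z → D ⊆ X →
     (∀ f → Locally-constant-on (λ w → ComponentOf X z w ⊎ D w) f → ∀ w → D w → f w ≡ f z) →
     ∀ {w} → D w → ComponentOf X z w
    extend {z = z} D xz sub h {w} dw = C , const-connected (λ f loc u v cu cv →
     let loc' : Locally-constant-on (λ w → ComponentOf X z w ⊎ D w) f
         loc' u cu = N-map (λ v g cv → g (squash-in cv)) (loc u (squash-in cu))
         eq : ∀ u → C u → f u ≡ f z
         eq u cu = case squash-out cu of λ
          { (inl (C' , conn , sub' , cz , cu')) → connected-const conn f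
           (λ v cv → N-map (λ x g cx → g (inl (C' , conn , sub' , cz , cx))) (loc' v (inl (C' , conn , sub' , cz , cv)))) u z cu' cz
          ; (inr d) → h f loc' u d }
     in trans (eq u cu) (sym (eq v cv))) ,
     (λ c → [ component-⊆ , sub ]′ (squash-out c)) , squash-in (inl (component-self xz)) , squash-in (inr dw)
     where
     C : Pred ℝ² (lsuc 0ℓ)
     C = squash (λ w → ComponentOf X z w ⊎ D w)
    on-component : ∀ {ℓ} {z} {D : Pred ℝ² ℓ} f → Locally-constant-on (λ w → ComponentOf X z w ⊎ D w) f →
     ∀ {w} → ComponentOf X z w → f w ≡ f z
    on-component f loc {w} (C , conn , sub , cz , cw) = connected-const conn f
     (λ v cv → N-map (λ x g cx → g (inl (C , conn , sub , cz , cx))) (loc v (inl (C , conn , sub , cz , cv)))) w _ cw cz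

   component-X : ∀ {z w} → ComponentOf X z w → X z
   component-X (C , conn , sub , cz , cw) = sub cz

   box-in-component : ∀ {p q r s} → Box p q r s ⊆ X → ∀ {z w v} → w ∈ Box p q r s → v ∈ Box p q r s →
    ComponentOf X z w → ComponentOf X z v
   box-in-component {p} {q} {r} {s} sub {w = w} i j c = extend (Box p q r s) (component-X c) sub
    (λ f loc u k → trans (box-const f (λ x l → N-map (λ y g m → g (inr m)) (loc x (inr l))) u w k i) (on-component f loc c)) j

   closure-component : ∀ {z y} → X z → (∀ w → w ≈² y → X w) → Closure (ComponentOf X z) y → ComponentOf X z y
   closure-component {z} {y} xz xy cl = extend (_≈² y) xz (λ {w} e → xy w e)
    (λ f loc u e → let (w , c , g) = closure-meets cl (loc y (inr (≈²-refl y))) in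
     trans (N-here (N-≈ (≈²-sym u y e) (loc y (inr (≈²-refl y)))) (inr e)) (trans (sym (g (inl c))) (on-component f loc c)))
    (≈²-refl y)

   component-sym : ∀ {z w} → ComponentOf X z w → ComponentOf X w z
   component-sym (C , conn , sub , cz , cw) = C , conn , sub , cw , cz

   component-trans : ∀ {z w v} → ComponentOf X z w → ComponentOf X w v → ComponentOf X z v
   component-trans {z} {w} {v} c (C , conn , sub , cw , cv) = extend C (component-X c) sub
    (λ f loc u cu → trans (connected-const conn f (λ x cx → N-map (λ y g cy → g (inr cy)) (loc x (inr cx))) u w cu cw) (on-component f loc c)) cv

 open Components

 -- Edges as curves in the plane

 module Curves where

  private variable
   ℓ ℓ' : Level

  -- Extended to all times by staying at the ends, so that vertices and inner points of an edge are
  -- treated as times of one curve.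
  γ : E → ℝ → Point graph
  γ e t with em 0ℓ {0ℚ <ˡ t} | em 0ℓ {t <ʳ 1ℚ}
  ... | yes a | yes b = inner e t (a , b)
  ... | no _ | _ = vertex (src e)
  ... | yes _ | no _ = vertex (tgt e)

  curve : E → ℝ → ℝ²
  curve e t = φ (γ e t)

  0<1 : 0ℚ < 1ℚ
  0<1 = positive⁻¹ 1ℚ

  γ-src : ∀ e t → t ≤ᴿ 0ℚ → γ e t ≡ vertex (src e)
  γ-src e t h with em 0ℓ {0ℚ <ˡ t} | em 0ℓ {t <ʳ 1ℚ}
  ... | yes a | _ = ⊥-elim (h a)
  ... | no _ | _ = refl

  γ-tgt : ∀ e t → 1ℚ ≤ʳ t → γ e t ≡ vertex (tgt e)
  γ-tgt e t h with em 0ℓ {0ℚ <ˡ t} | em 0ℓ {t <ʳ 1ℚ}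
  ... | _ | yes b = ⊥-elim (h b)
  ... | no n | _ = ⊥-elim (n (<ˡ-≤ʳ t 0<1 h))
  ... | yes _ | no _ = refl

  γ-inner : ∀ e t → Between 0ℚ 1ℚ t → Σ[ i ∈ Between 0ℚ 1ℚ t ] γ e t ≡ inner e t i
  γ-inner e t (a , b) with em 0ℓ {0ℚ <ˡ t} | em 0ℓ {t <ʳ 1ℚ}
  ... | yes a' | yes b' = (a' , b') , refl
  ... | no n | _ = ⊥-elim (n a)
  ... | yes _ | no n = ⊥-elim (n b)

  vertex-N : ∀ v (A : Pred ℝ² ℓ) → N (φ (vertex v)) A → ∀ e →
   (src e ≡ v → ∃[ q ] (0ℚ < q × (∀ s j → s <ʳ q → A (φ (inner e s j))))) ×
   (tgt e ≡ v → ∃[ p ] (p < 1ℚ × (∀ s j → p <ˡ s → A (φ (inner e s j)))))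
  vertex-N v A n e =
   (λ { refl → let (q , h , f) = OpenIn1Complex.at-src O e (squash-in n) in q , h , λ s j k → N-here (squash-out (f s j k)) }) ,
   (λ { refl → let (q , h , f) = OpenIn1Complex.at-tgt O e (squash-in n) in q , h , λ s j k → N-here (squash-out (f s j k)) })
   where O = continuous (Interior A) (Interior-open A)

  inner-N : ∀ e t i (A : Pred ℝ² ℓ) → N (φ (inner e t i)) A → Nb t (λ s → ∀ j → A (φ (inner e s j)))
  inner-N e t i A n = let (p , q , h , f) = OpenIn1Complex.at-inner (continuous (Interior A) (Interior-open A)) e t i (squash-in n) in
   nb p q h λ s k j → N-here (squash-out (f s j k))

  -- The Hausdorff property in contrapositive form; through it continuity makes `φ` respect equality
  -- of parameters.
  close⇒≈² : ∀ {z w} → (∀ {A : Pred ℝ² 0ℓ} → N z A → A w) → z ≈² w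
  close⇒≈² {z} {w} h = by-contra λ ne → let (P , n , m) = separate z w ne in N-here m (h n)

  φ-inner : ∀ e t t' i i' → t ≈ t' → φ (inner e t i) ≈² φ (inner e t' i')
  φ-inner e t t' i i' t≈t' = close⇒≈² λ {A} n → let nb p q h f = inner-N e t i A n in f t' (Between-≈ t t' t≈t' h) i'

  curve-inner : ∀ e t i → φ (inner e t i) ≈² curve e t
  curve-inner e t i = let (j , eq) = γ-inner e t i in subst (λ x → φ (inner e t i) ≈² φ x) (sym eq) (φ-inner e t t i j (≈-refl t))

  curve-cont : ∀ e t {A : Pred ℝ² ℓ} → N (curve e t) A → Nb t (λ s → A (curve e s))
  curve-cont e t {A} n with em 0ℓ {0ℚ <ˡ t} | em 0ℓ {t <ʳ 1ℚ}
  ... | yes a | yes b = Nb-map go (Nb-∩ (inner-N e t (a , b) A n) (nb 0ℚ 1ℚ (a , b) λ s i → i))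
   where go : ∀ s → (∀ j → A (φ (inner e s j))) × Between 0ℚ 1ℚ s → A (curve e s)
         go s (f , i) = let (j , eq) = γ-inner e s i in subst (λ x → A (φ x)) (sym eq) (f j)
  ... | no h | _ = let (q , 0<q , f) = fst (vertex-N (src e) A n e) refl in
   Nb-map (go q f) (Nb-∩ (Nb-<ʳ (≤ᴿ-<ʳ t h 0<q)) (Nb-<ʳ (≤ᴿ-<ʳ t h 0<1)))
   where go : ∀ q → (∀ s j → s <ʳ q → A (φ (inner e s j))) → ∀ s → s <ʳ q × s <ʳ 1ℚ → A (curve e s)
         go q f s (s<q , s<1) with em 0ℓ {0ℚ <ˡ s} | em 0ℓ {s <ʳ 1ℚ}
         ... | yes a | yes b = f s (a , b) s<q
         ... | no _ | _ = N-here n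
         ... | yes _ | no k = ⊥-elim (k s<1)
  ... | yes a | no h = let (q , q<1 , f) = snd (vertex-N (tgt e) A n e) refl in
   Nb-map (go q f) (Nb-∩ (Nb-<ˡ (<ˡ-≤ʳ t q<1 h)) (Nb-<ˡ a))
   where go : ∀ q → (∀ s j → q <ˡ s → A (φ (inner e s j))) → ∀ s → q <ˡ s × 0ℚ <ˡ s → A (curve e s)
         go q f s (q<s , 0<s) with em 0ℓ {0ℚ <ˡ s} | em 0ℓ {s <ʳ 1ℚ}
         ... | yes a | yes b = f s (a , b) q<s
         ... | no k | _ = ⊥-elim (k 0<s)
         ... | yes _ | no _ = N-here n

  record Arc (e : E) (a b : ℚ) (z : ℝ²) : Set₁ where
   constructor arc
   field
    time : ℝ
    within : In a b time
    at : curve e time ≈² z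

  -- Compactness of the time interval: around each time the curve stays in a neighbourhood disjoint
  -- from one of `z`, and Cousin's lemma intersects the latter.
  arc-closed : ∀ e {a b} z → a < b → ¬ Arc e a b z → N z (λ w → ¬ Arc e a b w)
  arc-closed e {a} {b} z a<b h = N-map (λ w k (arc t i eq) → k (t , i , eq))
   (cousin-In (λ A → N z (λ w → ¬ (Σ[ t ∈ ℝ ] (A t × curve e t ≈² w)))) a b a<b
    (λ sub → N-map λ w k (t , i , eq) → k (t , sub t i , eq))
    (λ n m → N-map (λ { w (k , l) (t , inl i , eq) → k (t , i , eq) ; w (k , l) (t , inr i , eq) → l (t , i , eq) }) (N-∩ n m))
    λ t i → let (P , n , m) = separate (curve e t) z (λ eq → h (arc t i eq)) in
     (λ s → dec (N (curve e s) P) ≡ true) , curve-cont e t (N-map (λ _ → dec-yes) (N-open n)) ,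
     N-map (λ w np (s , ps , eq) → np (N-here (N-≈ eq (dec-true ps)))) m)

  -- A basic neighbourhood of `v` in the 1-complex; its radii depend on the edge, as the CW topology
  -- permits.
  Star : V → (E → ℚ) → (E → ℚ) → Point graph → Set₁
  Star v lo hi x = x ≡ vertex v ⊎ Σ[ e ∈ E ] Σ[ t ∈ ℝ ] Σ[ i ∈ _ ]
   (x ≡ inner e t i × ((src e ≡ v × t <ʳ lo e) ⊎ (tgt e ≡ v × hi e <ˡ t)))

  open-graph-N : (W : Pred (Point graph) (lsuc 0ℓ)) → OpenIn1Complex graph W → ∀ x → W x →
   N (φ x) (λ w → ∀ y → φ y ≈² w → W y)
  open-graph-N W o x wx = let (U , oU , f) = open-map W o; nb p q r s i g = open-N oU (to (f x) wx) in
   nb p q r s i λ w j y eq → from (f y) (N-here (N-≈ (≈²-sym (φ y) w eq) (open-N oU (g w j))))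

  -- Openness of the embedding: no part of the graph outside the star comes arbitrarily close to
  -- `v`.
  star-N : ∀ v (lo hi : E → ℚ) → (∀ e → 0ℚ < lo e) → (∀ e → hi e < 1ℚ) →
   N (φ (vertex v)) (λ w → ∀ x → φ x ≈² w → Star v lo hi x)
  star-N v lo hi l h = open-graph-N (Star v lo hi) (record
   { at-inner = λ { e t i (inr (_ , _ , _ , refl , inl (refl , k))) → 0ℚ , lo e , (fst i , k) ,
    λ s j m → inr (e , s , j , refl , inl (refl , snd m))
    ; e t i (inr (_ , _ , _ , refl , inr (refl , k))) → hi e , 1ℚ , (k , snd i) ,
     λ s j m → inr (e , s , j , refl , inr (refl , fst m)) }
   ; at-src = λ { e (inl refl) → lo e , l e , λ s j k → inr (e , s , j , refl , inl (refl , k)) }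
   ; at-tgt = λ { e (inl refl) → hi e , h e , λ s j k → inr (e , s , j , refl , inr (refl , k)) } })
   (vertex v) (inl refl)

  segment-N : ∀ e t i p q → Between p q t → N (φ (inner e t i)) (λ w → ∀ x → φ x ≈² w →
   Σ[ s ∈ ℝ ] Σ[ j ∈ _ ] (x ≡ inner e s j × Between p q s))
  segment-N e t i p q k = open-graph-N (λ x → Σ[ s ∈ ℝ ] Σ[ j ∈ _ ] (x ≡ inner e s j × Between p q s)) (record
   { at-inner = λ { e' t' i' (_ , _ , refl , m) → p , q , m , λ s j m' → s , j , refl , m' }
   ; at-src = λ { _ (_ , _ , () , _) }
   ; at-tgt = λ { _ (_ , _ , () , _) } }) (inner e t i) (t , i , refl , k)

  vertex-injective : ∀ {u v} → φ (vertex u) ≈² φ (vertex v) → u ≡ v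
  vertex-injective {u} {v} eq with injective (vertex u) (vertex v) eq
  ... | vertex = refl

  inner-injective : ∀ {e t i e' t' i'} → φ (inner e t i) ≈² φ (inner e' t' i') → e ≡ e' × t ≈ t'
  inner-injective {e} {t} {i} {e'} {t'} {i'} eq with injective (inner e t i) (inner e' t' i') eq
  ... | inner t≈t' = refl , t≈t'

  vertex≢inner : ∀ {v e t i} → ¬ (φ (vertex v) ≈² φ (inner e t i))
  vertex≢inner {v} {e} {t} {i} eq with injective (vertex v) (inner e t i) eq
  ... | ()

  OnEdge : E → ℝ² → Set₁
  OnEdge e = Arc e 0ℚ 1ℚ

  edge-closed : ∀ e z → ¬ OnEdge e z → N z (λ w → ¬ OnEdge e w)
  edge-closed e z = arc-closed e z 0<1

  src-on : ∀ e → OnEdge e (φ (vertex (src e)))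
  src-on e = arc (ι 0ℚ) (<-irrefl refl , <-asym 0<1)
   (subst (λ x → φ x ≈² φ (vertex (src e))) (sym (γ-src e (ι 0ℚ) (<-irrefl refl))) (≈²-refl (φ (vertex (src e)))))

  tgt-on : ∀ e → OnEdge e (φ (vertex (tgt e)))
  tgt-on e = arc (ι 1ℚ) (<-asym 0<1 , <-irrefl refl)
   (subst (λ x → φ x ≈² φ (vertex (tgt e))) (sym (γ-tgt e (ι 1ℚ) (<-irrefl refl))) (≈²-refl (φ (vertex (tgt e)))))

  inner-on : ∀ e t i → OnEdge e (φ (inner e t i))
  inner-on e t i = arc t (Between-In t i) (≈²-sym (φ (inner e t i)) (curve e t) (curve-inner e t i))

  data Position (e : E) (t : ℝ) : Set₁ where
   at-src : t ≤ᴿ 0ℚ → γ e t ≡ vertex (src e) → Position e t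
   at-tgt : 1ℚ ≤ʳ t → γ e t ≡ vertex (tgt e) → Position e t
   at-inner : (i : Between 0ℚ 1ℚ t) → γ e t ≡ inner e t i → Position e t

  position : ∀ e t → Position e t
  position e t with em 0ℓ {0ℚ <ˡ t} | em 0ℓ {t <ʳ 1ℚ}
  ... | no h | _ = at-src h (γ-src e t h)
  ... | yes _ | no h = at-tgt h (γ-tgt e t h)
  ... | yes a | yes b = let (i , eq) = γ-inner e t (a , b) in at-inner i eq

  vertex-on : ∀ {v e} → OnEdge e (φ (vertex v)) → src e ≡ v ⊎ tgt e ≡ v
  vertex-on {v} {e} (arc t i eq) with position e t
  ... | at-src _ p = inl (vertex-injective (subst (λ x → φ x ≈² φ (vertex v)) p eq))
  ... | at-tgt _ p = inr (vertex-injective (subst (λ x → φ x ≈² φ (vertex v)) p eq))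
  ... | at-inner j p = ⊥-elim (vertex≢inner (≈²-sym (φ (inner e t j)) (φ (vertex v)) (subst (λ x → φ x ≈² φ (vertex v)) p eq)))

  inner-on⁻ : ∀ {e t i e'} → OnEdge e' (φ (inner e t i)) → e ≡ e'
  inner-on⁻ {e} {t} {i} {e'} (arc s j eq) with position e' s
  ... | at-src _ p = ⊥-elim (vertex≢inner (subst (λ x → φ x ≈² φ (inner e t i)) p eq))
  ... | at-tgt _ p = ⊥-elim (vertex≢inner (subst (λ x → φ x ≈² φ (inner e t i)) p eq))
  ... | at-inner k p = sym (fst (inner-injective (subst (λ x → φ x ≈² φ (inner e t i)) p eq)))

  OnArcs : List (E × ℚ × ℚ) → ℝ² → Set₁
  OnArcs A z = Σ[ a ∈ E × ℚ × ℚ ] (a ∈ˡ A × Arc (fst a) (fst (snd a)) (snd (snd a)) z)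

  arcs-closed : ∀ A z → (∀ {e a b} → (e , a , b) ∈ˡ A → a < b) → ¬ OnArcs A z → N z (λ w → ¬ OnArcs A w)
  arcs-closed [] z o h = N-all λ { w (_ , () , _) }
  arcs-closed ((e , a , b) ∷ A) z o h = N-map (λ { w (k , l) (_ , here refl , m) → k m ; w (k , l) (_ , there n , m) → l (_ , n , m) })
   (N-∩ (arc-closed e z (o (here refl)) (λ m → h (_ , here refl , m)))
    (arcs-closed A z (λ m → o (there m)) (λ (_ , m , k) → h (_ , there m , k))))

  On : List E → ℝ² → Set₁
  On H z = Σ[ e ∈ E ] (e ∈ˡ H × OnEdge e z)

  on-closed : ∀ H z → ¬ On H z → N z (λ w → ¬ On H w)
  on-closed [] z h = N-all λ { w (_ , () , _) }
  on-closed (e ∷ H) z h = N-map (λ { w (k , l) (_ , here refl , m) → k m ; w (k , l) (_ , there n , m) → l (_ , n , m) })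
   (N-∩ (edge-closed e z (λ m → h (_ , here refl , m))) (on-closed H z (λ (_ , m , k) → h (_ , there m , k))))

  OnGraph : ℝ² → Set₁
  OnGraph z = Σ[ x ∈ Point graph ] φ x ≈² z

  arc-≈ : ∀ {e a b z w} → z ≈² w → Arc e a b z → Arc e a b w
  arc-≈ {e} {z = z} {w} z≈w (arc t i eq) = arc t i (≈²-trans (curve e t) z w eq z≈w)

  arc-mono : ∀ {e a b a' b' z} → a' ℚ.≤ a → b ℚ.≤ b' → Arc e a b z → Arc e a' b' z
  arc-mono h k (arc t i eq) = arc t (In-mono t h k i) eq

  curve-on : ∀ e t → In 0ℚ 1ℚ t → OnEdge e (curve e t)
  curve-on e t i = arc t i (≈²-refl (curve e t))

  onEdge⇒graph : ∀ {e a b z} → Arc e a b z → OnGraph z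
  onEdge⇒graph (arc t i eq) = γ _ t , eq

 open Curves

 -- Crossing parity of an edge with respect to a point

 module Crossings where

  private variable
   ℓ ℓ' : Level

  infix 4 _≺_
  _≺_ : ℝ → ℝ → Set
  x ≺ y = ∃[ q ] (x <ʳ q × q <ˡ y)

  -- Winding parity about p is read off from crossings of the downward ray from p.
  right below : ℝ² → ℝ² → Bool
  right p z = not (dec (fst z ≺ fst p))
  below p z = dec (snd z ≺ snd p)

  cut : ℝ² → ℝ² → ℝ² → Bool
  cut p z w = (right p z xor right p w) ∧ below p z

  right-no : ∀ {p z} → fst z ≺ fst p → right p z ≡ false
  right-no h = cong not (dec-yes h)

  ≺-no : ∀ {x y q} → q ≤ʳ x → y ≤ᴿ q → ¬ (x ≺ y)
  ≺-no {x} {y} {q} h k (r , x<r , r<y) with <-cmp q r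
  ... | tri< l _ _ = k (lower-down y l r<y)
  ... | tri≈ _ refl _ = k r<y
  ... | tri> _ _ g = h (upper-up x g x<r)

  right-yes : ∀ {p z q} → q ≤ʳ fst z → fst p ≤ᴿ q → right p z ≡ true
  right-yes {p} {z} h k = cong not (dec-no (≺-no {fst z} {fst p} h k))

  below-no : ∀ {p z q} → q ≤ʳ snd z → snd p ≤ᴿ q → below p z ≡ false
  below-no {p} {z} h k = dec-no (≺-no {snd z} {snd p} h k)

  -- On S, no crossing of the ray from p winds around p.
  Simple : ℝ² → Pred ℝ² ℓ → Set _
  Simple p S = (Σ[ b ∈ Bool ] (∀ w → S w → right p w ≡ b)) ⊎ (Σ[ b ∈ Bool ] (∀ w → S w → below p w ≡ b))

  simple-⊆ : ∀ {p} {S : Pred ℝ² ℓ} {T : Pred ℝ² ℓ'} → (∀ w → T w → S w) → Simple p S → Simple p T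
  simple-⊆ sub (inl (b , f)) = inl (b , λ w t → f w (sub w t))
  simple-⊆ sub (inr (b , f)) = inr (b , λ w t → f w (sub w t))

  cut-add : ∀ {p} {S : Pred ℝ² ℓ} → Simple p S → ∀ {z w u} → S z → S w → S u → cut p z w xor cut p w u ≡ cut p z u
  cut-add {p = p} (inl (b , f)) {z} {w} {u} sz sw su rewrite f z sz | f w sw | f u su | xor-same b = refl
  cut-add {p = p} (inr (b , f)) {z} {w} {u} sz sw su rewrite f z sz | f w sw =
   taut 4 (λ r s t b → ((r xor s) ∧ b) xor ((s xor t) ∧ b)) (λ r s t b → (r xor t) ∧ b) refl (right p z) (right p w) (right p u) b

  cut-sym : ∀ {p} {S : Pred ℝ² ℓ} → Simple p S → ∀ {z w} → S z → S w → cut p z w ≡ cut p w z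
  cut-sym {p = p} (inl (b , f)) {z} {w} sz sw rewrite f z sz | f w sw | xor-same b = refl
  cut-sym {p = p} (inr (b , f)) {z} {w} sz sw rewrite f z sz | f w sw = cong (_∧ b) (xor-comm (right p z) (right p w))

  LocSimple : ℝ² → ℝ² → Set₁
  LocSimple p z = (Σ[ b ∈ Bool ] N z (λ w → right p w ≡ b)) ⊎ (Σ[ b ∈ Bool ] N z (λ w → below p w ≡ b))

  -- A point other than `p` is strictly left or right of `p` or, failing this, strictly above or
  -- below it; accordingly one of the two functions is constant nearby.
  loc-simple : ∀ p z → ¬ (z ≈² p) → LocSimple p z
  loc-simple (a , b) (x , y) ne with em 0ℓ {x ≈ a}
  ... | no x≉a with apart x a x≉a
  ...   | inl (q , h , k) = inl (false , N-map (λ w l → right-no {a , b} {w} (q , l , k)) (N-x (_<ʳ q) (Nb-<ʳ h)))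
  ...   | inr (q , h , k) = inl (true , N-map (λ w l → right-yes {a , b} {w} (<ˡ⇒≤ʳ (fst w) l) (<ʳ⇒≤ᴿ a h)) (N-x (q <ˡ_) (Nb-<ˡ k)))
  loc-simple (a , b) (x , y) ne | yes x≈a with apart y b (λ y≈b → ne (x≈a , y≈b))
  ...   | inl (q , h , k) = inr (true , N-map (λ w l → dec-yes (q , l , k)) (N-y (_<ʳ q) (Nb-<ʳ h)))
  ...   | inr (q , h , k) = inr (false , N-map (λ w l → below-no {a , b} {w} (<ˡ⇒≤ʳ (snd w) l) (<ʳ⇒≤ᴿ b h)) (N-y (q <ˡ_) (Nb-<ˡ k)))

  -- Uniform in `p`: which of the two functions is constant near `z`, and its value, are the same
  -- for all `p` in the box. So the branch point can be moved inside the box.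
  box-side : ∀ {a b c d} z → ¬ (z ∈ Box a b c d) →
   (Σ[ β ∈ Bool ] (∀ p → p ∈ Box a b c d → N z (λ w → right p w ≡ β))) ⊎
   (Σ[ β ∈ Bool ] (∀ p → p ∈ Box a b c d → N z (λ w → below p w ≡ β)))
  box-side {a} {b} {c} {d} (x , y) ne with em 0ℓ {a <ˡ x} | em 0ℓ {x <ʳ b} | em 0ℓ {c <ˡ y} | em 0ℓ {y <ʳ d}
  ... | yes i | yes j | yes k | yes l = ⊥-elim (ne ((i , j) , (k , l)))
  ... | no h | _ | _ | _ = inl (false , λ p ((i , _) , _) → let (m , u , v) = lo-round (fst p) i in
   N-map (λ w l → right-no {p} {w} (m , l , v)) (N-x (_<ʳ m) (Nb-<ʳ (≤ᴿ-<ʳ x h u))))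
  ... | yes _ | no h | _ | _ = inl (true , λ p ((_ , i) , _) → let (m , u , v) = up-round (fst p) i in
   N-map (λ w l → right-yes {p} {w} (<ˡ⇒≤ʳ (fst w) l) (<ʳ⇒≤ᴿ (fst p) v)) (N-x (m <ˡ_) (Nb-<ˡ (<ˡ-≤ʳ x u h))))
  ... | yes _ | yes _ | no h | _ = inr (true , λ p (_ , (i , _)) → let (m , u , v) = lo-round (snd p) i in
   N-map (λ w l → dec-yes (m , l , v)) (N-y (_<ʳ m) (Nb-<ʳ (≤ᴿ-<ʳ y h u))))
  ... | yes _ | yes _ | yes _ | no h = inr (false , λ p (_ , (_ , i)) → let (m , u , v) = up-round (snd p) i in
   N-map (λ w l → below-no {p} {w} (<ˡ⇒≤ʳ (snd w) l) (<ʳ⇒≤ᴿ (snd p) v)) (N-y (m <ˡ_) (Nb-<ˡ (<ˡ-≤ʳ y u h))))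

  Coherent-on : (ℝ → Set) → ℝ² → E → (ℝ → Bool) → Set₁
  Coherent-on I p e f = ∀ t → I t → Nb t (λ s → I s → f s ≡ f t xor cut p (curve e t) (curve e s))

  -- A continuous choice of branch of the double cover branched at p along e.
  Coherent : ℝ² → E → (ℝ → Bool) → Set₁
  Coherent = Coherent-on (In 0ℚ 1ℚ)

  locally-simple-coherent : ∀ {p e} {I : ℝ → Set} t → Simple p (λ w → Σ[ s ∈ ℝ ] (I s × w ≡ curve e s)) → I t →
   Coherent-on I p e (λ s → cut p (curve e t) (curve e s))
  locally-simple-coherent {p} {e} {I} t simple it u iu = Nb-all λ s is →
   sym (cut-add {p = p} {S = λ w → Σ[ s ∈ ℝ ] (I s × w ≡ curve e s)} simple {curve e t} {curve e u} {curve e s} (t , it , refl) (u , iu , refl) (s , is , refl))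

  -- Near each time the curve lies where `cut` is additive, and there the crossings from a fixed
  -- time form a branch. Branches over adjacent intervals are glued after flipping one so that they
  -- agree at the common end. Infinitely many crossings of the ray do no harm.
  coherent-exists : ∀ p e {l r} → l < r → ¬ Arc e l r p → Σ[ f ∈ (ℝ → Bool) ] Coherent-on (In l r) p e f
  coherent-exists p e {l} {r} l<r off = cousin (λ a b → Σ[ f ∈ (ℝ → Bool) ] Coherent-on (In a b) p e f) glue l r l<r local
   where
   local : ∀ t → In l r t → ∃[ a ] ∃[ b ] (Between a b t ×
    (∀ a' b' → a ≤ a' → a' < b' → b' ≤ b → l ≤ a' → b' ≤ r → Σ[ f ∈ (ℝ → Bool) ] Coherent-on (In a' b') p e f))
   local t i = go (loc-simple p (curve e t) (λ eq → off (arc t i eq)))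
    where
    finish : (S : Pred ℝ² 0ℓ) → N (curve e t) S → Simple p S → ∃[ a ] ∃[ b ] (Between a b t ×
     (∀ a' b' → a ≤ a' → a' < b' → b' ≤ b → l ≤ a' → b' ≤ r → Σ[ f ∈ (ℝ → Bool) ] Coherent-on (In a' b') p e f))
    finish S n simple = let nb a b h f = curve-cont e t n; (a1 , b1 , x , y , z) = shrink t h in
     a1 , b1 , z , λ a' b' c a'<b' d _ _ → _ , locally-simple-coherent {p} {e} {In a' b'} (ι a')
      (simple-⊆ {p = p} {S = S} (λ { w (s , is , refl) → f s (In-Between s (In-mono s c d is) x y) }) simple) (<-irrefl refl , <-asym a'<b')
    go : LocSimple p (curve e t) → _
    go (inl (b , n)) = finish _ n (inl (b , λ w eq → eq))
    go (inr (b , n)) = finish _ n (inr (b , λ w eq → eq))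
   glue : ∀ a m b → a < m → m < b → Σ[ f ∈ (ℝ → Bool) ] Coherent-on (In a m) p e f →
    Σ[ f ∈ (ℝ → Bool) ] Coherent-on (In m b) p e f → Σ[ f ∈ (ℝ → Bool) ] Coherent-on (In a b) p e f
   glue a m b a<m m<b (f , cf) (g , cg) = h , coh
    where
    d : Bool
    d = f (ι m) xor g (ι m)
    h : ℝ → Bool
    h t = if dec (t ≤ᴿ m) then f t else (g t xor d)
    h-left : ∀ t → t ≤ᴿ m → h t ≡ f t
    h-left t l rewrite dec-yes l = refl
    h-right : ∀ t → m <ˡ t → h t ≡ g t xor d
    h-right t l rewrite dec-no {A = t ≤ᴿ m} (λ k → k l) = refl
    in-left : ∀ t → In a b t → t ≤ᴿ m → In a m t
    in-left t (u , v) l = u , l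
    in-right : ∀ t → In a b t → m ≤ʳ t → In m b t
    in-right t (u , v) l = l , v
    im : In a m (ι m)
    im = <-asym a<m , <-irrefl refl
    im' : In m b (ι m)
    im' = <-irrefl refl , <-asym m<b
    coh : Coherent-on (In a b) p e h
    coh t it with em 0ℓ {t <ʳ m} | em 0ℓ {m <ˡ t}
    ... | yes t<m | _ = Nb-map (λ s (c , s<m) is → trans (h-left s (<ʳ⇒≤ᴿ s s<m))
     (trans (c (in-left s is (<ʳ⇒≤ᴿ s s<m))) (cong (_xor _) (sym (h-left t (<ʳ⇒≤ᴿ t t<m))))))
     (Nb-∩ (cf t (in-left t it (<ʳ⇒≤ᴿ t t<m))) (Nb-<ʳ t<m))
    ... | no _ | yes m<t = Nb-map (λ s (c , m<s) is → trans (h-right s m<s)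
     (trans (cong (_xor d) (c (in-right s is (<ˡ⇒≤ʳ s m<s)))) (trans (taut 3 (λ x y z → (x xor y) xor z) (λ x y z → (x xor z) xor y) refl (g t) _ d)
      (cong (_xor _) (sym (h-right t m<t))))))
     (Nb-∩ (cg t (in-right t it (<ˡ⇒≤ʳ t m<t))) (Nb-<ˡ m<t))
    ... | no t≮m | no t≯m = let n = Nb-∩ (cf t (in-left t it t≯m)) (cg t (in-right t it t≮m)) in
     Nb-map (λ s → step s (N-here' n)) n
     where
     ιm≈t : t ≈ ι m
     ιm≈t = (λ {q} q<t → case <-cmp q m of λ { (tri< l _ _) → l ; (tri≈ _ refl _) → ⊥-elim (t≯m q<t)
      ; (tri> _ _ g) → ⊥-elim (t≯m (lower-down t g q<t)) }) , λ q<m → <ˡ-≤ʳ t q<m t≮m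
     N-here' : ∀ {P : ℝ → Set} → Nb t P → P (ι m)
     N-here' (nb p q i k) = k (ι m) (Between-≈ t (ι m) ιm≈t i)
     step : ∀ s → ((In a m (ι m) → f (ι m) ≡ f t xor cut p (curve e t) (curve e (ι m))) ×
      (In m b (ι m) → g (ι m) ≡ g t xor cut p (curve e t) (curve e (ι m)))) →
      ((In a m s → f s ≡ f t xor cut p (curve e t) (curve e s)) × (In m b s → g s ≡ g t xor cut p (curve e t) (curve e s))) →
      In a b s → h s ≡ h t xor cut p (curve e t) (curve e s)
     step s (mf , mg) (sf , sg) is = trans (by (em 0ℓ)) (cong (_xor c) (sym (h-left t t≯m)))
      where
      c c' : Bool
      c = cut p (curve e t) (curve e s)
      c' = cut p (curve e t) (curve e (ι m))
      by : Dec (s ≤ᴿ m) → h s ≡ f t xor c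
      by (yes s≤m) = trans (h-left s s≤m) (sf (in-left s is s≤m))
      by (no s≰m) = trans (h-right s (by-contra s≰m)) (trans (cong₂ _xor_ (sg (in-right s is (<ˡ⇒≤ʳ s (by-contra s≰m)))) (cong₂ _xor_ (mf im) (mg im')))
       (taut 4 (λ x y z w → (x xor y) xor ((z xor w) xor (x xor w))) (λ x y z w → z xor y) refl (g t) c (f t) c'))

  coherent-unique : ∀ {p e f g} → Coherent p e f → Coherent p e g → f (ι 0ℚ) xor f (ι 1ℚ) ≡ g (ι 0ℚ) xor g (ι 1ℚ)
  coherent-unique {p} {e} {f} {g} cf cg = taut' (f (ι 0ℚ)) (g (ι 0ℚ)) (f (ι 1ℚ)) (g (ι 1ℚ))
   (locally-constant 0<1 (λ t → f t xor g t) (λ t i → Nb-map (λ s (u , v) j →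
    trans (cong₂ _xor_ (u j) (v j)) (taut 3 (λ x y c → (x xor c) xor (y xor c)) (λ x y c → x xor y) refl (f t) (g t) _))
    (Nb-∩ (cf t i) (cg t i))) (ι 0ℚ) (ι 1ℚ) (<-irrefl refl , <-asym 0<1) (<-asym 0<1 , <-irrefl refl))
   where
   taut' : ∀ a b c d → a xor b ≡ c xor d → a xor c ≡ b xor d
   taut' a b c d h = trans (taut 4 (λ a b c d → a xor c) (λ a b c d → (a xor b) xor (b xor c)) refl a b c d)
    (trans (cong (_xor (b xor c)) h) (taut 3 (λ b c d → (c xor d) xor (b xor c)) (λ b c d → b xor d) refl b c d))

  -- The change of branch along `e`, a mod 2 crossing number. The default can only be reached when
  -- `p` lies on `e`.
  κ : ℝ² → E → Bool
  κ p e with em _ {Σ[ f ∈ (ℝ → Bool) ] Coherent p e f}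
  ... | yes (f , _) = f (ι 0ℚ) xor f (ι 1ℚ)
  ... | no _ = false

  κ-spec : ∀ {p e f} → Coherent p e f → κ p e ≡ f (ι 0ℚ) xor f (ι 1ℚ)
  κ-spec {p} {e} {f} c with em _ {Σ[ f ∈ (ℝ → Bool) ] Coherent p e f}
  ... | yes (g , d) = coherent-unique {p} {e} {g} {f} d c
  ... | no n = ⊥-elim (n (f , c))

  curve-0 : ∀ e → curve e (ι 0ℚ) ≡ φ (vertex (src e))
  curve-0 e = cong φ (γ-src e (ι 0ℚ) (<-irrefl refl))

  curve-1 : ∀ e → curve e (ι 1ℚ) ≡ φ (vertex (tgt e))
  curve-1 e = cong φ (γ-tgt e (ι 1ℚ) (<-irrefl refl))

  -- The change of branch cut between p and p'.
  shift : ℝ² → ℝ² → ℝ² → Bool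
  shift p p' z = (right p z xor right p' z) ∧ below p z

  at-vertex : ∀ {A : Set} → (ℝ² → A) → V → A
  at-vertex g v = g (φ (vertex v))

  private
   Fact : ℝ² → ℝ² → ℝ² → ℝ² → Set
   Fact p p' z w = cut p' z w ≡ (shift p p' z xor shift p p' w) xor cut p z w

   shift-local : ∀ {a b c d p p'} z → p ∈ Box a b c d → p' ∈ Box a b c d → ¬ (z ∈ Box a b c d) → N z (λ w → Fact p p' z w)
   shift-local {p = p} {p'} z i j out with box-side z out
   ... | inl (β , f) = let n = N-∩ (f p i) (f p' j); (u , v) = N-here n in N-map (λ w (u' , v') → go w u v u' v') n
    where
    go : ∀ w → right p z ≡ β → right p' z ≡ β → right p w ≡ β → right p' w ≡ β → Fact p p' z w
    go w u v u' v' rewrite u | v | u' | v' | xor-same β = refl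
   ... | inr (β , f) = let n = N-∩ (f p i) (f p' j); (u , v) = N-here n in N-map (λ w (u' , v') → go w u v u' v') n
    where
    go : ∀ w → below p z ≡ β → below p' z ≡ β → below p w ≡ β → below p' w ≡ β → Fact p p' z w
    go w u v u' v' rewrite u | v | u' =
     taut 5 (λ r r' ρ ρ' β → (ρ xor ρ') ∧ β) (λ r r' ρ ρ' β → (((r xor ρ) ∧ β) xor ((r' xor ρ') ∧ β)) xor ((r xor r') ∧ β)) refl
      (right p z) (right p w) (right p' z) (right p' w) β

  -- Adding `shift` turns a branch for `p` into one for `p'`, because off the box both points are
  -- seen on the same side. The correction is a coboundary and cancels along closed walks.
  κ-move : ∀ {a b c d p p' e} → p ∈ Box a b c d → p' ∈ Box a b c d → (∀ z → z ∈ Box a b c d → ¬ OnEdge e z) →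
   κ p' e ≡ (at-vertex (shift p p') (src e) xor at-vertex (shift p p') (tgt e)) xor κ p e
  κ-move {a} {b} {c} {d} {p} {p'} {e} i j off =
   let (f , cf) = coherent-exists p e 0<1 (off p i)
       f' = λ t → f t xor shift p p' (curve e t)
       cf' : Coherent p' e f'
       cf' t it = Nb-map (λ s (u , fact) is → trans (cong (_xor shift p p' (curve e s)) (u is))
        (trans (taut 4 (λ x c y z → (x xor c) xor z) (λ x c y z → (x xor y) xor ((y xor z) xor c)) refl (f t) _ (shift p p' (curve e t)) _)
         (cong (f' t xor_) (sym fact))))
        (Nb-∩ (cf t it) (curve-cont e t (shift-local {a} {b} {c} {d} {p} {p'} (curve e t) i j (λ z∈ → off _ z∈ (curve-on e t it)))))
   in trans (κ-spec cf') (trans (xor-swap (f (ι 0ℚ)) _ (f (ι 1ℚ)) _)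
    (trans (xor-comm (f (ι 0ℚ) xor f (ι 1ℚ)) _)
     (cong₂ _xor_ (cong₂ (λ z w → shift p p' z xor shift p p' w) (curve-0 e) (curve-1 e)) (sym (κ-spec cf)))))

  κ-right : ∀ {p e β} → (∀ z → OnEdge e z → right p z ≡ β) → κ p e ≡ false
  κ-right {p} {e} {β} h = κ-spec {f = λ _ → false} λ t i → Nb-all λ s j →
   sym (trans (cong₂ (λ x y → (x xor y) ∧ below p (curve e t)) (h _ (curve-on e t i)) (h _ (curve-on e s j)))
    (cong (_∧ below p (curve e t)) (xor-same β)))

  κ-below : ∀ {p e β} → (∀ z → OnEdge e z → below p z ≡ β) →
   κ p e ≡ at-vertex (λ z → right p z ∧ β) (src e) xor at-vertex (λ z → right p z ∧ β) (tgt e)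
  κ-below {p} {e} {β} h = trans (κ-spec {f = λ t → right p (curve e t) ∧ β} λ t i → Nb-all λ s j →
   trans (taut 3 (λ x y b → x ∧ b) (λ x y b → (y ∧ b) xor ((y xor x) ∧ b)) refl (right p (curve e s)) (right p (curve e t)) β)
    (cong (λ b → (right p (curve e t) ∧ β) xor ((right p (curve e t) xor right p (curve e s)) ∧ b)) (sym (h _ (curve-on e t i)))))
   (cong₂ (λ z w → (right p z ∧ β) xor (right p w ∧ β)) (curve-0 e) (curve-1 e))

 open Crossings

 -- Winding parity of closed walks

 module Winding where

  private variable
   ℓ ℓ' : Level
   u v x : V
   m n : ℕ

  W[_,_]_ : V → V → ℕ → Set
  W[ u , v ] n = Walk graph u v n

  edges : W[ u , v ] n → List E
  edges [] = []
  edges ((e , _) ∷ W) = e ∷ edges W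

  sumW : (E → Bool) → W[ u , v ] n → Bool
  sumW f [] = false
  sumW f ((e , _) ∷ W) = f e xor sumW f W

  wind : ℝ² → W[ u , v ] n → Bool
  wind p = sumW (κ p)

  OnWalk' : W[ u , v ] n → ℝ² → Set₁
  OnWalk' W = On (edges W)

  joins-xor : ∀ {e} → Joins e u v → (g : V → Bool) → g (src e) xor g (tgt e) ≡ g u xor g v
  joins-xor (inl (refl , refl)) g = refl
  joins-xor {e = e} (inr (refl , refl)) g = xor-comm (g (src e)) (g (tgt e))

  wind-potential : ∀ p (W : W[ u , v ] n) (g : V → Bool) →
   (∀ e → e ∈ˡ edges W → κ p e ≡ g (src e) xor g (tgt e)) → wind p W ≡ g u xor g v
  wind-potential {u} p [] g h = sym (xor-same (g u))
  wind-potential {u} {v} p (_∷_ {v = w} (e , j) W) g h = trans (cong₂ _xor_ (trans (h e (here refl)) (joins-xor j g))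
   (wind-potential p W g (λ e i → h e (there i)))) (xor-cancel (g u) (g w) (g v))

  wind-move : ∀ {a b c d p p'} (W : W[ u , v ] n) → p ∈ Box a b c d → p' ∈ Box a b c d →
   (∀ z → z ∈ Box a b c d → ¬ OnWalk' W z) →
   wind p' W ≡ (at-vertex (shift p p') u xor at-vertex (shift p p') v) xor wind p W
  wind-move {u} {p = p} {p'} [] i j off rewrite xor-same (at-vertex (shift p p') u) = refl
  wind-move {u} {v} {a = a} {b} {c} {d} {p} {p'} (_∷_ {v = w} (e , j') W) i j off = trans
   (cong₂ _xor_ (trans (κ-move {a} {b} {c} {d} i j (λ z k o → off z k (e , here refl , o)))
    (cong (_xor κ p e) (joins-xor j' (at-vertex (shift p p')))))
    (wind-move {a = a} {b} {c} {d} W i j (λ z k o → off z k (fst o , there (fst (snd o)) , snd (snd o)))))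
   (taut 5 (λ x y z k w → ((x xor y) xor k) xor ((y xor z) xor w)) (λ x y z k w → (x xor z) xor (k xor w)) refl
    (at-vertex (shift p p') u) (at-vertex (shift p p') w) (at-vertex (shift p p') v) (κ p e) (wind p W))

  wind-const : ∀ {p} (W : W[ u , u ] n) → ¬ OnWalk' W p → N p (λ p' → wind p' W ≡ wind p W)
  wind-const {u} {p = p} W off = let nb a b c d i f = on-closed (edges W) p off in
   nb a b c d i λ p' j → trans (wind-move {a = a} {b} {c} {d} W i j f) (cong (_xor wind p W) (xor-same (at-vertex (shift p p') u)))

  BoundedBy : (a b c d : ℚ) → Pred ℝ² (lsuc 0ℓ) → Set₁
  BoundedBy a b c d P = ∀ z → P z → z ∈ Box a b c d

  widen : ∀ {a b c d a' b' c' d'} z → z ∈ Box a b c d ⊎ z ∈ Box a' b' c' d' → z ∈ Box (a ⊓ a') (b ℚ.⊔ b') (c ⊓ c') (d ℚ.⊔ d')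
  widen {a} {b} {c} {d} {a'} {b'} {c'} {d'} z (inl i) = Box-mono z {_} {_} {_} {_} {a} {b} {c} {d} (p⊓q≤p a a') (p≤p⊔q b b') (p⊓q≤p c c') (p≤p⊔q d d') i
  widen {a} {b} {c} {d} {a'} {b'} {c'} {d'} z (inr i) = Box-mono z {_} {_} {_} {_} {a'} {b'} {c'} {d'} (p⊓q≤q a a') (p≤q⊔p b b') (p⊓q≤q c c') (p≤q⊔p d d') i

  edge-bounded : ∀ e → ∃[ a ] ∃[ b ] ∃[ c ] ∃[ d ] BoundedBy a b c d (OnEdge e)
  edge-bounded e = let (a , b , c , d , f) = cousin-In (λ A → ∃[ a ] ∃[ b ] ∃[ c ] ∃[ d ] (∀ t → A t → curve e t ∈ Box a b c d))
                        0ℚ 1ℚ 0<1 (λ { sub (a , b , c , d , f) → a , b , c , d , λ t i → f t (sub t i) })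
                        (λ { (a , b , c , d , f) (a' , b' , c' , d' , f') → a ⊓ a' , b ℚ.⊔ b' , c ⊓ c' , d ℚ.⊔ d' , λ
                         { t (inl i) → widen {a} {b} {c} {d} {a'} {b'} {c'} {d'} (curve e t) (inl (f t i))
                         ; t (inr i) → widen {a} {b} {c} {d} {a'} {b'} {c'} {d'} (curve e t) (inr (f' t i)) } })
                        λ t _ → let nb a b c d i _ = N-all {z = curve e t} {P = λ _ → ⊤} (λ _ → tt) in
                         _ , curve-cont e t (nb {P = _∈ Box a b c d} a b c d i λ _ j → j) , a , b , c , d , λ _ j → j
   in a , b , c , d , λ { z (arc t i eq) → Box-≈ (curve e t) z {a} {b} {c} {d} eq (f t i) }

  bounded : ∀ H → ∃[ a ] ∃[ b ] ∃[ c ] ∃[ d ] BoundedBy a b c d (On H)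
  bounded [] = 0ℚ , 0ℚ , 0ℚ , 0ℚ , λ { z (_ , () , _) }
  bounded (e ∷ H) = let (a , b , c , d , f) = edge-bounded e; (a' , b' , c' , d' , f') = bounded H in
   a ⊓ a' , b ℚ.⊔ b' , c ⊓ c' , d ℚ.⊔ d' , λ
    { z (_ , here refl , o) → widen {a} {b} {c} {d} {a'} {b'} {c'} {d'} z (inl (f z o))
    ; z (e' , there i , o) → widen {a} {b} {c} {d} {a'} {b'} {c'} {d'} z (inr (f' z (e' , i , o))) }

  -- When `p` is beyond a side of the box, `right` or `below` is constant on the walk, which makes
  -- the parity of its edges a coboundary; only for `p` above the box can it be nonzero on single
  -- edges.
  wind-outside : ∀ {a b c d p} (W : W[ u , u ] n) → BoundedBy a b c d (OnWalk' W) → ¬ (p ∈ Box a b c d) → wind p W ≡ false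
  wind-outside {u0} {a = a} {b} {c} {d} {p} W bd out
   with em 0ℓ {a <ˡ fst p} | em 0ℓ {fst p <ʳ b} | em 0ℓ {c <ˡ snd p} | em 0ℓ {snd p <ʳ d}
  ... | yes i | yes j | yes k | yes l = ⊥-elim (out ((i , j) , (k , l)))
  ... | no h | _ | _ | _ = wind-potential p W (λ _ → false) λ e i →
   κ-right λ z o → right-yes {p} {z} (<ˡ⇒≤ʳ (fst z) (fst (fst (bd z (e , i , o))))) h
  ... | yes _ | no h | _ | _ = wind-potential p W (λ _ → false) λ e i →
   κ-right λ z o → right-no {p} {z} (let (q , u , v) = up-round (fst z) (snd (fst (bd z (e , i , o)))) in q , v , <ˡ-≤ʳ (fst p) u h)
  ... | yes _ | yes _ | no h | _ = trans (wind-potential p W (at-vertex (λ z → right p z ∧ false)) λ e i →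
   κ-below λ z o → below-no {p} {z} (<ˡ⇒≤ʳ (snd z) (fst (snd (bd z (e , i , o))))) h) (xor-same (at-vertex (λ z → right p z ∧ false) u0))
  ... | yes _ | yes _ | yes _ | no h = trans (wind-potential p W (at-vertex (λ z → right p z ∧ true)) λ e i →
   κ-below λ z o → dec-yes (let (q , u , v) = up-round (snd z) (snd (snd (bd z (e , i , o)))) in q , v , <ˡ-≤ʳ (snd p) u h)) (xor-same (at-vertex (λ z → right p z ∧ true) u0))

  wind-component : ∀ {z w} (W : W[ u , u ] n) → Face G z w → wind z W ≡ wind w W
  wind-component W = component-const (λ p → wind p W) λ p c → N-map (λ _ h _ → h) (wind-const W λ (e , _ , o) → let (x , eq) = onEdge⇒graph {e} o in c x eq)

  wind-closure : ∀ {z y} (W : W[ u , u ] n) → ¬ OnWalk' W y → Closure (Face G z) y → wind z W ≡ wind y W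
  wind-closure W off cl = let (w , f , eq) = closure-meets cl (wind-const W off) in trans (wind-component W f) eq

  wind-along : ∀ {a b} (W : W[ u , u ] n) e → a < b → (∀ t → In a b t → ¬ OnWalk' W (curve e t)) →
   ∀ s t → In a b s → In a b t → wind (curve e s) W ≡ wind (curve e t) W
  wind-along W e a<b off = locally-constant a<b (λ t → wind (curve e t) W) λ t i →
   Nb-map (λ s h _ → h) (curve-cont e t (wind-const W (off t i)))

  module _ (noacc : NoVertexAccumulation G) where

   -- Every point has a box in which it is the only possible position of a vertex, and finitely many
   -- such boxes cover the rectangle.
   vertices-in-box : ∀ a b c d → a < b → c < d → Σ[ vs ∈ List V ] (∀ v → let (x , y) = φ (vertex v) in In a b x → In c d y → v ∈ˡ vs)
   vertices-in-box = cousin² (λ a b c d → Σ[ vs ∈ List V ] (∀ v → let (x , y) = φ (vertex v) in In a b x → In c d y → v ∈ˡ vs))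
    (λ p m q r s _ _ _ (vs , f) (ws , g) → vs ++ ws , λ v i j → case em 0ℓ {fst (φ (vertex v)) ≤ᴿ m} of λ
     { (yes h) → ∈-++⁺ˡ (f v (fst i , h) j)
     ; (no h) → ∈-++⁺ʳ vs (g v ((λ k → h (<ʳ⇒≤ᴿ (fst (φ (vertex v))) k)) , snd i) j) })
    (λ p q r m s _ _ _ (vs , f) (ws , g) → vs ++ ws , λ v i j → case em 0ℓ {snd (φ (vertex v)) ≤ᴿ m} of λ
     { (yes h) → ∈-++⁺ˡ (f v i (fst j , h))
     ; (no h) → ∈-++⁺ʳ vs (g v i ((λ k → h (<ʳ⇒≤ᴿ (snd (φ (vertex v))) k)) , snd j)) })
    λ z → let nb p q r s (i , j) f = isolated z
              (p' , q' , p<p' , q'<q , i') = shrink (fst z) i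
              (r' , s' , r<r' , s'<s , j') = shrink (snd z) j
              (vs , g) = list z
     in p' , q' , r' , s' , (i' , j') , λ a b c d k _ l m _ o → vs , λ v iv jv →
      g v (f (φ (vertex v)) (In-Between (fst (φ (vertex v))) (In-mono (fst (φ (vertex v))) k l iv) p<p' q'<q ,
       In-Between (snd (φ (vertex v))) (In-mono (snd (φ (vertex v))) m o jv) r<r' s'<s) v (≈²-refl (φ (vertex v))))
    where
    isolated : ∀ z → N z (λ w → ∀ v → φ (vertex v) ≈² w → w ≈² z)
    isolated z = by-contra λ k → noacc z λ U o uz → by-contra λ none →
     k (N-map (λ w uw v eq → by-contra λ ne → none (w , (v , eq) , uw , ne)) (open-N o uz))
    list : ∀ z → Σ[ vs ∈ List V ] (∀ v → φ (vertex v) ≈² z → v ∈ˡ vs)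
    list z with em 0ℓ {Σ[ v ∈ V ] φ (vertex v) ≈² z}
    ... | yes (v , eq) = v ∷ [] , λ u eq' → here (vertex-injective (≈²-trans (φ (vertex u)) z (φ (vertex v)) eq' (≈²-sym (φ (vertex v)) z eq)))
    ... | no h = [] , λ u eq → ⊥-elim (h (u , eq))

   vertices-in-Box : ∀ a b c d → Σ[ vs ∈ List V ] (∀ v → φ (vertex v) ∈ Box a b c d → v ∈ˡ vs)
   vertices-in-Box a b c d with em 0ℓ {a < b} | em 0ℓ {c < d}
   ... | yes h | yes k = let (vs , f) = vertices-in-box a b c d h k in vs , λ v (i , j) → f v (Between-In (fst (φ (vertex v))) i) (Between-In (snd (φ (vertex v))) j)
   ... | no h | _ = [] , λ v ((i , j) , _) → ⊥-elim (h (lo<up (fst (φ (vertex v))) i j))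
   ... | yes _ | no k = [] , λ v (_ , (i , j)) → ⊥-elim (k (lo<up (snd (φ (vertex v))) i j))

   inside-finite : (W : W[ u , u ] n) → Σ[ vs ∈ List V ] (∀ v → wind (φ (vertex v)) W ≡ true → v ∈ˡ vs)
   inside-finite W = let (a , b , c , d , bd) = bounded (edges W); (vs , f) = vertices-in-Box a b c d in
    vs , λ v h → f v (by-contra λ out → true≢false (trans (sym h) (wind-outside {a = a} {b} {c} {d} W bd out)))

 open Winding

 -- Alexander duality in the lattice

 module LatticeDuality where
  open LatticePaths

  private variable
   i j a b c d : ℕ

  useH-All : ∀ {P Q : ℕ → ℕ → Set} (L : LPath i j a b) → AllE P Q L → ∀ x y → useH L x y ≡ true → P x y
  useV-All : ∀ {P Q : ℕ → ℕ → Set} (L : LPath i j a b) → AllE P Q L → ∀ x y → useV L x y ≡ true → Q x y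

  private
   at-≡ : ∀ x y i j → spot x y i j ≡ true → x ≡ i × y ≡ j
   at-≡ x y i j h = sym (≡ᵇ⇒≡ i x (to-T (∧-left h))) , sym (≡ᵇ⇒≡ j y (to-T (∧-right {i ≡ᵇ x} h)))
    where to-T : ∀ {b} → b ≡ true → T b
          to-T refl = tt
   split : ∀ s t → s xor t ≡ true → s ≡ true ⊎ t ≡ true
   split true t h = inl refl
   split false t h = inr h

  useH-All (east {i} {j} L) (p , h) x y e with split (spot x y i j) _ e
  ... | inl k = let (u , v) = at-≡ x y i j k in subst₂ _ (sym u) (sym v) p
  ... | inr k = useH-All L h x y k
  useH-All (west {i} {j} L) (p , h) x y e with split (spot x y i j) _ e
  ... | inl k = let (u , v) = at-≡ x y i j k in subst₂ _ (sym u) (sym v) p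
  ... | inr k = useH-All L h x y k
  useH-All (north L) (p , h) x y e = useH-All L h x y e
  useH-All (south L) (p , h) x y e = useH-All L h x y e
  useV-All (north {i} {j} L) (p , h) x y e with split (spot x y i j) _ e
  ... | inl k = let (u , v) = at-≡ x y i j k in subst₂ _ (sym u) (sym v) p
  ... | inr k = useV-All L h x y k
  useV-All (south {i} {j} L) (p , h) x y e with split (spot x y i j) _ e
  ... | inl k = let (u , v) = at-≡ x y i j k in subst₂ _ (sym u) (sym v) p
  ... | inr k = useV-All L h x y k
  useV-All (east L) (p , h) x y e = useV-All L h x y e
  useV-All (west L) (p , h) x y e = useV-All L h x y e

  -- Alexander duality in the lattice.  B is a set of cells and K a branch over B of the double cover
  -- branched at the two ends of L; then L can be deformed across B so as to avoid the edges
  -- between cells of B.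
  lattice-duality : ∀ M (B K χ : Grid) (L : LPath i j a b) → AllE (InRange (suc M)) (InRange (suc M)) L →
   (∀ x y → B x y ≡ true → x <ℕ M × y <ℕ M) →
   (∀ x y → B x y ≡ true → B x (suc y) ≡ true → K x y ≡ K x (suc y)) →
   (∀ x y → B x y ≡ true → B (suc x) y ≡ true → K x y xor K (suc x) y ≡ ray i j (suc x) y xor ray a b (suc x) y) →
   (∀ x y → B x y ∧ prevV B x y ≡ false → B x y ≡ true ⊎ prevV B x y ≡ true ⊎ useH L x y ≡ true → χ x y ≡ χ (suc x) y) →
   (∀ x y → B x y ∧ prevH B x y ≡ false → B x y ≡ true ⊎ prevH B x y ≡ true ⊎ useV L x y ≡ true → χ x y ≡ χ x (suc y)) →
   χ i j ≡ χ a b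
  lattice-duality {i} {j} {a} {b} M B K χ L range rng k1 k2 χH χV = xor-≡ (trans (trans (sym (xor-identityʳ _)) (cong ((χ i j xor χ a b) xor_) (sym (sumL-none L))))
   (trans (sym (sumL-cob f g none none χ (λ _ _ → ⊤) (λ _ _ → ⊤) (λ x y _ → sym (xor-identityʳ _)) (λ x y _ → sym (xor-identityʳ _)) L (AllE-⊤ L)))
    (sum-along M C f g outside L range hf hg (λ x y _ → taut 4 (λ p q r s → ((p xor q) xor (r xor s)) xor ((p xor r) xor (q xor s))) (λ _ _ _ _ → false) refl
     (χ x y) (χ (suc x) y) (χ x (suc y)) (χ (suc x) (suc y))))))
   where
   f g C : Grid
   f x y = χ x y xor χ (suc x) y
   g x y = χ x y xor χ x (suc y)
   -- `K` and `fill L` have the same jumps up to `L`, so on an edge between two cells of `B` the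
   -- boundary of this chain is `L`. On the remaining edges that matter the coboundary of `χ`
   -- vanishes.
   C x y = B x y ∧ (K x y xor fill L x y)
   outside : ∀ x y → M ≤ℕ x ⊎ M ≤ℕ y → C x y ≡ false
   outside x y h with B x y in e
   ... | false = refl
   ... | true with h
   ...   | inl l = ⊥-elim (<⇒≱ (fst (rng x y e)) l)
   ...   | inr l = ⊥-elim (<⇒≱ (snd (rng x y e)) l)
   clash : ∀ {A : Set} {x y} → x ≡ y → x xor y ≡ true → A
   clash {x = x} refl h = true≢false (trans (sym h) (xor-same x))
   hf : ∀ x y → f x y ≡ true → useH L x y ≡ C x y xor prevV C x y
   hf x zero h with B x zero in e
   ... | true = clash (χH x zero (trans (cong (_∧ false) e) refl) (inl e)) h
   ... | false with useH L x zero in u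
   ...   | true = clash (χH x zero (cong (_∧ false) e) (inr (inr u))) h
   ...   | false = refl
   hf x (suc y) h with B x (suc y) in e | B x y in e'
   ... | true | false = clash (χH x (suc y) (cong₂ _∧_ e e') (inl e)) h
   ... | false | true = clash (χH x (suc y) (cong₂ _∧_ e e') (inr (inl e'))) h
   ... | true | true = trans (sym (fill-V L x y)) (trans (taut 3 (λ k s t → s xor t) (λ k s t → (k xor t) xor (k xor s)) refl (K x y) (fill L x y) (fill L x (suc y)))
    (cong (λ k → (k xor fill L x (suc y)) xor (K x y xor fill L x y)) (k1 x y e' e)))
   ... | false | false with useH L x (suc y) in u
   ...   | true = clash (χH x (suc y) (cong₂ _∧_ e e') (inr (inr u))) h
   ...   | false = refl
   hg : ∀ x y → g x y ≡ true → useV L x y ≡ C x y xor prevH C x y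
   hg zero y h with B zero y in e
   ... | true = clash (χV zero y (cong (_∧ false) e) (inl e)) h
   ... | false with useV L zero y in u
   ...   | true = clash (χV zero y (cong (_∧ false) e) (inr (inr u))) h
   ...   | false = refl
   hg (suc x) y h with B (suc x) y in e | B x y in e'
   ... | true | false = clash (χV (suc x) y (cong₂ _∧_ e e') (inl e)) h
   ... | false | true = clash (χV (suc x) y (cong₂ _∧_ e e') (inr (inl e'))) h
   ... | true | true = sym (trans (taut 4 (λ k k' s t → (k' xor t) xor (k xor s)) (λ k k' s t → (k xor k') xor (s xor t)) refl (K x y) (K (suc x) y) (fill L x y) (fill L (suc x) y))
    (trans (cong₂ _xor_ (k2 x y e' e) (fill-H L x y)) (taut 3 (λ s t u → (s xor t) xor ((s xor t) xor u)) (λ s t u → u) refl (ray i j (suc x) y) (ray a b (suc x) y) (useV L (suc x) y))))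
   ... | false | false with useV L (suc x) y in u
   ...   | true = clash (χV (suc x) y (cong₂ _∧_ e e') (inr (inr u))) h
   ...   | false = refl

  ≤ᵇ-true : ∀ {m n} → m ≤ℕ n → (m ≤ᵇ n) ≡ true
  ≤ᵇ-true {m} {n} h with m ≤ᵇ n | ≤⇒≤ᵇ h
  ... | true | _ = refl

  ≤ᵇ-false : ∀ {m n} → n <ℕ m → (m ≤ᵇ n) ≡ false
  ≤ᵇ-false {m} {n} h with m ≤ᵇ n in e
  ... | false = refl
  ... | true = ⊥-elim (<⇒≱ h (≤ᵇ⇒≤ m n (subst T (sym e) tt)))

  ≡ᵇ-false : ∀ {m n} → m ≢ n → (m ≡ᵇ n) ≡ false
  ≡ᵇ-false {m} {n} h with m ≡ᵇ n in e
  ... | false = refl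
  ... | true = ⊥-elim (h (≡ᵇ⇒≡ m n (subst T (sym e) tt)))

  ≤ᵇ-suc : ∀ a i → (a ≤ᵇ i) xor (a ≤ᵇ suc i) ≡ (a ≡ᵇ suc i)
  ≤ᵇ-suc zero i = refl
  ≤ᵇ-suc (suc zero) zero = refl
  ≤ᵇ-suc (suc (suc a)) zero = refl
  ≤ᵇ-suc (suc zero) (suc i) = refl
  ≤ᵇ-suc (suc (suc a)) (suc i) = ≤ᵇ-suc (suc a) i

  module Cells (x0 y0 hx hy : ℚ) (0<hx : 0ℚ < hx) (0<hy : 0ℚ < hy) where
   X Y : ℕ → ℚ
   X = steps x0 hx
   Y = steps y0 hy

   pt : ℕ → ℕ → ℝ²
   pt a b = ι (X a) , ι (Y b)

   Block : ℕ → ℕ → ℕ → Pred ℝ² 0ℓ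
   Block k i j = Box (X i) (X (k +ℕ i)) (Y j) (Y (k +ℕ j))

   pt-in : ∀ k {i j a b} → i <ℕ a → a <ℕ k +ℕ i → j <ℕ b → b <ℕ k +ℕ j → pt a b ∈ Block k i j
   pt-in k h1 h2 h3 h4 = (steps-< 0<hx h1 , steps-< 0<hx h2) , (steps-< 0<hy h3 , steps-< 0<hy h4)

   data Far (i j a b : ℕ) : Set where
    left : a ≤ℕ i → Far i j a b
    right-of : 4 +ℕ i ≤ℕ a → Far i j a b
    low : b ≤ℕ j → Far i j a b
    high : 4 +ℕ j ≤ℕ b → Far i j a b

   far : ∀ {i j a b} → ¬ (pt a b ∈ Block 4 i j) → Far i j a b
   far {i} {j} {a} {b} h with ≤-<-connex a i | ≤-<-connex (4 +ℕ i) a | ≤-<-connex b j | ≤-<-connex (4 +ℕ j) b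
   ... | inl l | _ | _ | _ = left l
   ... | inr _ | inl l | _ | _ = right-of l
   ... | inr _ | inr _ | inl l | _ = low l
   ... | inr _ | inr _ | inr _ | inl l = high l
   ... | inr u | inr v | inr x | inr y = ⊥-elim (h (pt-in 4 u v x y))

   -- The crossings between a point and a cell.
   corner : ℕ → ℕ → ℝ² → Grid
   corner a b z i j = (right (pt a b) z xor (a ≤ᵇ i)) ∧ (j <ᵇ b)

   private
    R : ℕ → ℕ → ℝ² → Bool
    R a b = right (pt a b)

    rt : ∀ {i j a b z} → a ≤ℕ i → z ∈ Block 4 i j → right (pt a b) z ≡ true
    rt {a = a} {b} {z} h ((l , _) , _) = right-yes {pt a b} {z} {X a} (<ˡ⇒≤ʳ (fst z) (lower-down≤ (fst z) (steps-≤ 0<hx h) l)) (<-irrefl refl)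
    rf : ∀ {i j a b z} → 4 +ℕ i ≤ℕ a → z ∈ Block 4 i j → right (pt a b) z ≡ false
    rf {a = a} {b} {z} h ((_ , u) , _) = let (q , l , k) = up-round (fst z) u in right-no {pt a b} {z} (q , k , <-≤-trans l (steps-≤ 0<hx h))
    bf : ∀ {i j a b z} → b ≤ℕ j → z ∈ Block 4 i j → below (pt a b) z ≡ false
    bf {a = a} {b} {z} h (_ , (l , _)) = below-no {pt a b} {z} {Y b} (<ˡ⇒≤ʳ (snd z) (lower-down≤ (snd z) (steps-≤ 0<hy h) l)) (<-irrefl refl)
    bt : ∀ {i j a b z} → 4 +ℕ j ≤ℕ b → z ∈ Block 4 i j → below (pt a b) z ≡ true
    bt {a = a} {b} {z} h (_ , (_ , u)) = let (q , l , k) = up-round (snd z) u in dec-yes (q , k , <-≤-trans l (steps-≤ 0<hy h))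
    L1 : ∀ {i} → i ≤ℕ 1 +ℕ i
    L1 = n≤1+n _
    L2 : ∀ {i} → i ≤ℕ 2 +ℕ i
    L2 = m≤n+m _ 2

   -- From a cell to `z`, on to `w` and from there to the cell above, all crossings cancel because
   -- the block lies to one side of the branch point. For neighbours in a row, treated next, the
   -- edge between them can lie on the ray below the branch point, whence the extra term.
   across-horizontal : ∀ {i j a b z w} → z ∈ Block 4 i j → w ∈ Block 4 i j → ¬ (pt a b ∈ Block 4 i j) →
    (cut (pt a b) z w xor corner a b z (1 +ℕ i) (1 +ℕ j)) xor corner a b w (1 +ℕ i) (2 +ℕ j) ≡ false
   across-horizontal {i} {j} {a} {b} {z} {w} zi wi out with far {i} {j} {a} {b} out
   ... | left l rewrite rt {i} {j} {a} {b} {z} l zi | rt {i} {j} {a} {b} {w} l wi | ≤ᵇ-true (≤-trans l L1) = refl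
   ... | right-of l rewrite rf {i} {j} {a} {b} {z} l zi | rf {i} {j} {a} {b} {w} l wi | ≤ᵇ-false {a} {1 +ℕ i} (≤-trans (m≤n+m _ 2) l) = refl
   ... | low l rewrite bf {i} {j} {a} {b} {z} l zi | ≤ᵇ-false {2 +ℕ j} {b} (s≤s (≤-trans l L1)) | ≤ᵇ-false {3 +ℕ j} {b} (s≤s (≤-trans l L2)) =
    taut 3 (λ r s t → (((r xor s) ∧ false) xor ((r xor t) ∧ false)) xor ((s xor t) ∧ false)) (λ _ _ _ → false) refl (R a b z) (R a b w) (a ≤ᵇ 1 +ℕ i)
   ... | high l rewrite bt {i} {j} {a} {b} {z} l zi | ≤ᵇ-true {2 +ℕ j} {b} (≤-trans (m≤n+m _ 2) l) | ≤ᵇ-true {3 +ℕ j} {b} (≤-trans (m≤n+m _ 1) l) =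
    taut 3 (λ r s t → (((r xor s) ∧ true) xor ((r xor t) ∧ true)) xor ((s xor t) ∧ true)) (λ _ _ _ → false) refl (R a b z) (R a b w) (a ≤ᵇ 1 +ℕ i)

   across-vertical : ∀ {i j a b z w} → z ∈ Block 4 i j → w ∈ Block 4 i j → ¬ (pt a b ∈ Block 4 i j) →
    (cut (pt a b) z w xor corner a b z (1 +ℕ i) (1 +ℕ j)) xor corner a b w (2 +ℕ i) (1 +ℕ j) ≡ ray a b (2 +ℕ i) (1 +ℕ j)
   across-vertical {i} {j} {a} {b} {z} {w} zi wi out with far {i} {j} {a} {b} out
   ... | left l rewrite rt {i} {j} {a} {b} {z} l zi | rt {i} {j} {a} {b} {w} l wi | ≤ᵇ-true (≤-trans l L1) | ≤ᵇ-true (≤-trans l L2) | ≡ᵇ-false {a} {2 +ℕ i} (<⇒≢ (s≤s (≤-trans l L1))) = refl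
   ... | right-of l rewrite rf {i} {j} {a} {b} {z} l zi | rf {i} {j} {a} {b} {w} l wi | ≤ᵇ-false {a} {1 +ℕ i} (≤-trans (m≤n+m _ 2) l) | ≤ᵇ-false {a} {2 +ℕ i} (≤-trans (m≤n+m _ 1) l)
    | ≡ᵇ-false {a} {2 +ℕ i} (λ e → <⇒≢ (≤-trans (m≤n+m _ 1) l) (sym e)) = refl
   ... | low l rewrite bf {i} {j} {a} {b} {z} l zi | ≤ᵇ-false {2 +ℕ j} {b} (s≤s (≤-trans l L1)) =
    taut 5 (λ r s t u v → (((r xor s) ∧ false) xor ((r xor t) ∧ false)) xor ((s xor u) ∧ false)) (λ _ _ _ _ v → v ∧ false) refl (R a b z) (R a b w) (a ≤ᵇ 1 +ℕ i) (a ≤ᵇ 2 +ℕ i) (a ≡ᵇ 2 +ℕ i)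
   ... | high l rewrite bt {i} {j} {a} {b} {z} l zi | ≤ᵇ-true {2 +ℕ j} {b} (≤-trans (m≤n+m _ 2) l) | sym (≤ᵇ-suc a (1 +ℕ i)) =
    taut 4 (λ r s t u → (((r xor s) ∧ true) xor ((r xor t) ∧ true)) xor ((s xor u) ∧ true)) (λ r s t u → (t xor u) ∧ true) refl (R a b z) (R a b w) (a ≤ᵇ 1 +ℕ i) (a ≤ᵇ 2 +ℕ i)

 -- Lattices adapted to a closed set and two branch points

 module Lattices where
  open LatticePaths
  open LatticeDuality

  private variable
   ℓ : Level
   i j a b c d : ℕ

  cuts : ℝ² → ℝ² → ℝ² → ℝ² → Bool
  cuts p q z w = cut p z w xor cut q z w

  -- A branch over A of the double cover branched at p and q.
  Section : ℝ² → ℝ² → Pred ℝ² (lsuc 0ℓ) → (ℝ² → Bool) → Set₁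
  Section p q A σ = ∀ z → A z → N z (λ w → A w → σ w ≡ σ z xor cuts p q z w)

  Closed : Pred ℝ² (lsuc 0ℓ) → Set₁
  Closed A = ∀ z → ¬ A z → N z (λ w → ¬ A w)

  -- The form in which a condition enters the Lebesgue number.
  record Local {ℓ} (User : ℚ → ℚ → ℚ → ℚ → Set ℓ) : Set (lsuc 0ℓ ⊔ ℓ) where
   field
    mono : ∀ {p q r s p' q' r' s'} → p ≤ p' → q' ≤ q → r ≤ r' → s' ≤ s → User p q r s → User p' q' r' s'
    local : ∀ z → ∃[ p ] ∃[ q ] ∃[ r ] ∃[ s ] (z ∈ Box p q r s × User p q r s)

  N-local : ∀ {z} {P : ℝ² → Set ℓ} → N z P → ∃[ p ] ∃[ q ] ∃[ r ] ∃[ s ] (z ∈ Box p q r s × (∀ w → w ∈ Box p q r s → P w))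
  N-local (nb p q r s i f) = p , q , r , s , i , f

  local-× : ∀ {ℓ ℓ'} {P : ℚ → ℚ → ℚ → ℚ → Set ℓ} {Q : ℚ → ℚ → ℚ → ℚ → Set ℓ'} → Local P → Local Q → Local (λ p q r s → P p q r s × Q p q r s)
  local-× lp lq = record
   { mono = λ a b c d (x , y) → Local.mono lp a b c d x , Local.mono lq a b c d y
   ; local = λ z → let (p , q , r , s , i , x) = Local.local lp z; (p' , q' , r' , s' , j , y) = Local.local lq z in
    _ , _ , _ , _ , Box-∩ z {p} {q} {r} {s} {p'} {q'} {r'} {s'} i j ,
    Local.mono lp (p≤p⊔q p p') (p⊓q≤p q q') (p≤p⊔q r r') (p⊓q≤p s s') x ,
    Local.mono lq (p≤q⊔p p p') (p⊓q≤q q q') (p≤q⊔p r r') (p⊓q≤q s s') y }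

  Misses : Pred ℝ² (lsuc 0ℓ) → (p q r s : ℚ) → Set₁
  Misses A p q r s = ∀ z → A z → ¬ (z ∈ Box p q r s)

  local-avoid : ∀ {A} p → Closed A → ¬ A p → Local (λ a b c d → p ∈ Box a b c d → Misses A a b c d)
  local-avoid {A} p cl off = record
   { mono = λ {p1} {q1} {r1} {s1} {p2} {q2} {r2} {s2} a b c d f i z az j → f (Box-mono p {p1} {q1} {r1} {s1} {p2} {q2} {r2} {s2} a b c d i) z az (Box-mono z {p1} {q1} {r1} {s1} {p2} {q2} {r2} {s2} a b c d j)
   ; local = loc }
   where
   loc : ∀ z → ∃[ a ] ∃[ b ] ∃[ c ] ∃[ d ] (z ∈ Box a b c d × (p ∈ Box a b c d → Misses A a b c d))
   loc z with em _ {z ≈² p}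
   ... | yes eq = let (a , b , c , d , i , f) = N-local {z = z} (N-≈ {z = p} {w = z} (≈²-sym z p eq) (cl p off)) in a , b , c , d , i , λ _ w aw j → f w j aw
   ... | no ne = let (P , n , m) = separate p z (λ eq → ne (≈²-sym p z eq)); (a , b , c , d , i , f) = N-local {z = z} m in
    a , b , c , d , i , λ j → ⊥-elim (f p j (N-here n))

  Coherent-box : ℝ² → ℝ² → Pred ℝ² (lsuc 0ℓ) → (ℝ² → Bool) → (a b c d : ℚ) → Set₁
  Coherent-box p q A σ a b c d = ∀ z w → A z → A w → z ∈ Box a b c d → w ∈ Box a b c d → σ z xor σ w ≡ cuts p q z w

  -- Where `cut` is additive for both branch points, the crossings from the centre to two points add
  -- up to those between them, so coherence with the centre becomes coherence of any two points.
  local-coherent : ∀ {p q A σ} → Closed A → ¬ A p → ¬ A q → (∀ z w → z ≈² w → A z → A w) → Section p q A σ → Local (Coherent-box p q A σ)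
  local-coherent {p} {q} {A} {σ} cl offp offq resp sec = record
   { mono = λ {p1} {q1} {r1} {s1} {p2} {q2} {r2} {s2} a b c d f z w az aw i j →
    f z w az aw (Box-mono z {p1} {q1} {r1} {s1} {p2} {q2} {r2} {s2} a b c d i) (Box-mono w {p1} {q1} {r1} {s1} {p2} {q2} {r2} {s2} a b c d j)
   ; local = loc }
   where
   simpleN : ∀ p z → ¬ (z ≈² p) → Σ[ S ∈ Pred ℝ² 0ℓ ] (N z S × Simple p S)
   simpleN p z ne with loc-simple p z ne
   ... | inl (b , n) = _ , n , inl (b , λ w e → e)
   ... | inr (b , n) = _ , n , inr (b , λ w e → e)
   loc : ∀ z → ∃[ a ] ∃[ b ] ∃[ c ] ∃[ d ] (z ∈ Box a b c d × Coherent-box p q A σ a b c d)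
   loc z with em _ {A z}
   ... | no n = let (a , b , c , d , i , f) = N-local {z = z} (cl z n) in a , b , c , d , i , λ w _ aw _ j _ → ⊥-elim (f w j aw)
   ... | yes az = let (S , nS , sS) = simpleN p z (λ eq → offp (resp z p eq az)); (T , nT , sT) = simpleN q z (λ eq → offq (resp z q eq az))
                      n = N-∩ (sec z az) (N-∩ nS nT); (_ , sz , tz) = N-here n
                      (a , b , c , d , i , f) = N-local {z = z} n in
    a , b , c , d , i , λ u v au av iu iv → let (eu , su , tu) = f u iu; (ev , sv , tv) = f v iv in
     trans (cong₂ _xor_ (eu au) (ev av)) (trans (taut 5 (λ s p q p' q' → (s xor (p xor q)) xor (s xor (p' xor q'))) (λ s p q p' q' → (p xor p') xor (q xor q')) refl
      (σ z) (cut p z u) (cut q z u) (cut p z v) (cut q z v))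
      (cong₂ _xor_ (trans (cong (_xor cut p z v) (cut-sym {p = p} {S = S} sS {z} {u} sz su)) (cut-add {p = p} {S = S} sS {u} {z} {v} su sz sv))
       (trans (cong (_xor cut q z v) (cut-sym {p = q} {S = T} sT {z} {u} tz tu)) (cut-add {p = q} {S = T} sT {u} {z} {v} tu tz tv))))

  module Tiles (A : Pred ℝ² (lsuc 0ℓ)) (x0 y0 hx hy : ℚ) (0<hx : 0ℚ < hx) (0<hy : 0ℚ < hy) where
   open Cells x0 y0 hx hy 0<hx 0<hy public

   Occupied : ℕ → ℕ → Set₁
   Occupied i j = Σ[ z ∈ ℝ² ] (A z × z ∈ Block 3 i j)
   Empty : ℕ → ℕ → Set₁
   Empty i j = ¬ Occupied i j
   -- A cell is marked when `A` meets the three by three block around it, whose lower left corner is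
   -- one step down and left; hence the shift of indices. This margin makes the cells on both sides
   -- of an edge close to `A` marked.
   cells : Grid
   cells (suc i) (suc j) = dec (Occupied i j)
   cells zero _ = false
   cells (suc _) zero = false

   Bordered : ℕ → ℕ → Set
   Bordered i j = cells i j ∧ prevV cells i j ≡ true
   Flanked : ℕ → ℕ → Set
   Flanked i j = cells i j ∧ prevH cells i j ≡ true

   Inside : ℕ → ℕ → ℕ → ℕ → Set
   Inside i j a b = (i <ℕ a × a <ℕ 3 +ℕ i) × (j <ℕ b × b <ℕ 3 +ℕ j)

   inside-block : ∀ {i j a b} → Inside i j a b → pt a b ∈ Block 3 i j
   inside-block {i} {j} {a} {b} ((p , q) , (r , s)) = pt-in 3 {i} {j} {a} {b} p q r s

   Constant-near : Grid → Set₁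
   Constant-near χ = ∀ i j → Σ[ z ∈ ℝ² ] (A z × z ∈ Block 4 i j) → ∀ i' j' → i ≤ℕ i' → i' ≤ℕ 1 +ℕ i → j ≤ℕ j' → j' ≤ℕ 1 +ℕ j → Empty i' j' →
    ∀ a b c d → Inside i' j' a b → Inside i' j' c d → χ a b ≡ χ c d

   Free-H Free-V : Grid → ℕ → ℕ → Set
   Free-H χ i j = χ i j ≡ χ (suc i) j ⊎ Bordered i j
   Free-V χ i j = χ i j ≡ χ i (suc j) ⊎ Flanked i j

  record Frame : Set where
   constructor frame
   field
    px py qx qy la ra ba ta : ℚ

  -- `User` is a further local condition, supplied by the application and guaranteed on all blocks
  -- of side four that meet the rectangle of the frame.
  record Lattice {ℓ} (A : Pred ℝ² (lsuc 0ℓ)) (User : ℚ → ℚ → ℚ → ℚ → Set ℓ) (F : Frame) : Set (lsuc 0ℓ ⊔ ℓ) where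
   open Frame F
   field
    x0 y0 hx hy : ℚ
    0<hx : 0ℚ < hx
    0<hy : 0ℚ < hy
   open Tiles A x0 y0 hx hy 0<hx 0<hy public
   field
    size : ℕ
    lo-x : X 3 < la
    hi-x : ra < X size
    lo-y : Y 3 < ba
    hi-y : ta < Y size
    ip jp iq jq : ℕ
    at-px : X ip ≡ px
    at-py : Y jp ≡ py
    at-qx : X iq ≡ qx
    at-qy : Y jq ≡ qy
    good : ∀ i j → la < X (4 +ℕ i) → X i < ra → ba < Y (4 +ℕ j) → Y j < ta → User (X i) (X (4 +ℕ i)) (Y j) (Y (4 +ℕ j))

   field
    -- `L` may run between two marked cells, where nothing is known of `χ`; duality deforms it off
    -- the marked cells, around which `χ` is constant.
    duality : ∀ (χ : Grid) (L : LPath ip jp iq jq) → AllE (InRange (suc size)) (InRange (suc size)) L →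
     Constant-near χ → AllE (Free-H χ) (Free-V χ) L →
     χ ip jp ≡ χ iq jq

  BoundedIn : Frame → Pred ℝ² (lsuc 0ℓ) → Set₁
  BoundedIn F = BoundedBy la ra ba ta
   where open Frame F

  record Separable {ℓ} (A : Pred ℝ² (lsuc 0ℓ)) (User : ℚ → ℚ → ℚ → ℚ → Set ℓ) (F : Frame) : Set (lsuc 0ℓ ⊔ ℓ) where
   constructor separable
   open Frame F public
   field
    closed : Closed A
    resp : ∀ z w → z ≈² w → A z → A w
    la<ra : la < ra
    ba<ta : ba < ta
    bd : BoundedBy la ra ba ta A
    px≢qx : px ≢ qx
    py≢qy : py ≢ qy
    p∉A : ¬ A (ι px , ι py)
    q∉A : ¬ A (ι qx , ι qy)
    σ : ℝ² → Bool
    section-σ : Section (ι px , ι py) (ι qx , ι qy) A σ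
    user : Local User

  module _ {A : Pred ℝ² (lsuc 0ℓ)} {User : ℚ → ℚ → ℚ → ℚ → Set ℓ} {F : Frame} (separable : Separable A User F) where
   open Separable separable
   private
    p q : ℝ²
    p = ι px , ι py
    q = ι qx , ι qy
    Good : ℚ → ℚ → ℚ → ℚ → Set _
    Good a b c d = (User a b c d × Coherent-box p q A σ a b c d) × ((p ∈ Box a b c d → Misses A a b c d) × (q ∈ Box a b c d → Misses A a b c d))
    good-local : Local Good
    good-local = local-× (local-× user (local-coherent closed p∉A q∉A resp section-σ)) (local-× (local-avoid p closed p∉A) (local-avoid q closed q∉A))
    -- A block that meets the rectangle can start up to four steps before it, and four steps are
    -- kept below 1; whence the margin.
    Lebesgue : ℚ → Set _
    Lebesgue ε = ∀ p q r s → la - 1ℚ ≤ p → p ≤ ra → ba - 1ℚ ≤ r → r ≤ ta → q ≤ p + ε → s ≤ r + ε → Good p q r s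

   private module Build (ε0 : ℚ) (leb : Lebesgue ε0) (PX : Progression px qx la ra (ε0 ⊓ 1ℚ)) (PY : Progression py qy ba ta (ε0 ⊓ 1ℚ)) where
    ε : ℚ
    ε = ε0 ⊓ 1ℚ
    module PX = Progression PX
    module PY = Progression PY
    open Tiles A PX.base PY.base PX.step PY.step PX.0<step PY.0<step
    M : ℕ
    M = suc (PX.count ⊔ℕ PY.count)
    hiX : ra < X M
    hiX = <-≤-trans PX.covers-hi (steps-≤ {PX.base} PX.0<step {PX.count} {M} (m≤n⇒m≤1+n (m≤m⊔n PX.count PY.count)))
    hiY : ta < Y M
    hiY = <-≤-trans PY.covers-hi (steps-≤ {PY.base} PY.0<step {PY.count} {M} (m≤n⇒m≤1+n (m≤n⊔m PX.count PY.count)))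
    low' : ∀ {l x y} → l < y → y ≤ x + ε → l - 1ℚ ≤ x
    low' {l} {x} {y} h k = ℚP.<⇒≤ (subst (l - 1ℚ <_) (trans (ℚP.+-assoc x 1ℚ (- 1ℚ)) (ℚP.+-identityʳ x))
     (ℚP.+-monoˡ-< (- 1ℚ) (<-≤-trans h (ℚP.≤-trans k (ℚP.+-monoʳ-≤ x (p⊓q≤q ε0 1ℚ))))))
    good : ∀ i j → la < X (4 +ℕ i) → X i < ra → ba < Y (4 +ℕ j) → Y j < ta → Good (X i) (X (4 +ℕ i)) (Y j) (Y (4 +ℕ j))
    good i j h1 h2 h3 h4 = leb _ _ _ _ (low' h1 (PX.fine i)) (ℚP.<⇒≤ h2) (low' h3 (PY.fine j)) (ℚP.<⇒≤ h4)
     (ℚP.≤-trans (PX.fine i) (ℚP.+-monoʳ-≤ (X i) (p⊓q≤p ε0 1ℚ))) (ℚP.≤-trans (PY.fine j) (ℚP.+-monoʳ-≤ (Y j) (p⊓q≤p ε0 1ℚ)))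
    good-at : ∀ i j z → A z → z ∈ Block 4 i j → Good (X i) (X (4 +ℕ i)) (Y j) (Y (4 +ℕ j))
    good-at i j z az ((a , b) , (c , d)) = let ((a' , b') , (c' , d')) = bd z az in
     good i j (lo<up (fst z) a' b) (lo<up (fst z) a b') (lo<up (snd z) c' d) (lo<up (snd z) c d')

    lattice0 : Lattice A User F
    lattice0 = record
     { x0 = PX.base ; y0 = PY.base ; hx = PX.step ; hy = PY.step ; 0<hx = PX.0<step ; 0<hy = PY.0<step
     ; size = M ; lo-x = PX.covers-lo ; hi-x = hiX ; lo-y = PY.covers-lo ; hi-y = hiY
     ; ip = PX.ip ; jp = PY.ip ; iq = PX.iq ; jq = PY.iq ; at-px = PX.at-p ; at-py = PY.at-p ; at-qx = PX.at-q ; at-qy = PY.at-q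
     ; good = λ i j a b c d → fst (fst (good i j a b c d))
     ; duality = dual }
     where
     Occ = Occupied
     B = cells
     4⊇3 : ∀ {i j} z → z ∈ Block 3 i j → z ∈ Block 4 i j
     4⊇3 {i} {j} z = Box-mono z {X i} {X (4 +ℕ i)} {Y j} {Y (4 +ℕ j)} {X i} {X (3 +ℕ i)} {Y j} {Y (3 +ℕ j)} ℚP.≤-refl (ℚP.<⇒≤ (step-< PX.0<step)) ℚP.≤-refl (ℚP.<⇒≤ (step-< PY.0<step))
     4⊇3ˣ : ∀ {i j} z → z ∈ Block 3 (suc i) j → z ∈ Block 4 i j
     4⊇3ˣ {i} {j} z = Box-mono z {X i} {X (4 +ℕ i)} {Y j} {Y (4 +ℕ j)} {X (suc i)} {X (4 +ℕ i)} {Y j} {Y (3 +ℕ j)} (ℚP.<⇒≤ (step-< PX.0<step)) ℚP.≤-refl ℚP.≤-refl (ℚP.<⇒≤ (step-< PY.0<step))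
     4⊇3ʸ : ∀ {i j} z → z ∈ Block 3 i (suc j) → z ∈ Block 4 i j
     4⊇3ʸ {i} {j} z = Box-mono z {X i} {X (4 +ℕ i)} {Y j} {Y (4 +ℕ j)} {X i} {X (3 +ℕ i)} {Y (suc j)} {Y (4 +ℕ j)} ℚP.≤-refl (ℚP.<⇒≤ (step-< PX.0<step)) (ℚP.<⇒≤ (step-< PY.0<step)) ℚP.≤-refl
     P Q : ℝ²
     P = pt PX.ip PY.ip
     Q = pt PX.iq PY.iq
     P≡ : P ≡ p
     P≡ = cong₂ (λ x y → ι x , ι y) PX.at-p PY.at-p
     Q≡ : Q ≡ q
     Q≡ = cong₂ (λ x y → ι x , ι y) PX.at-q PY.at-q
     -- The branch `σ` at `z`, continued from `z` to the central cell of the block.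
     Kv : ℕ → ℕ → ℝ² → Bool
     Kv i j z = σ z xor (corner PX.ip PY.ip z (suc i) (suc j) xor corner PX.iq PY.iq z (suc i) (suc j))
     K : Grid
     K (suc i) (suc j) with em _ {Occ i j}
     ... | yes (z , _) = Kv i j z
     ... | no _ = false
     K _ _ = false
     K-spec : ∀ i j → B (suc i) (suc j) ≡ true → Σ[ z ∈ ℝ² ] (A z × z ∈ Block 3 i j × K (suc i) (suc j) ≡ Kv i j z)
     K-spec i j h with em _ {Occ i j}
     ... | yes (z , az , zi) = z , az , zi , refl
     K-spec i j () | no _
     coh : ∀ {i j z w} → A z → A w → z ∈ Block 4 i j → w ∈ Block 4 i j → σ z xor σ w ≡ cut P z w xor cut Q z w
     coh {i} {j} {z} {w} az aw zi wi = subst₂ (λ p q → σ z xor σ w ≡ cut p z w xor cut q z w) (sym P≡) (sym Q≡)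
      (snd (fst (good-at i j z az zi)) z w az aw zi wi)
     P∉ : ∀ {i j z} → A z → z ∈ Block 4 i j → ¬ (P ∈ Block 4 i j)
     P∉ {i} {j} {z} az zi k = fst (snd (good-at i j z az zi)) (subst (_∈ Block 4 i j) P≡ k) z az zi
     Q∉ : ∀ {i j z} → A z → z ∈ Block 4 i j → ¬ (Q ∈ Block 4 i j)
     Q∉ {i} {j} {z} az zi k = snd (snd (good-at i j z az zi)) (subst (_∈ Block 4 i j) Q≡ k) z az zi
     c1 c2 : ℝ² → Grid
     c1 = corner PX.ip PY.ip
     c2 = corner PX.iq PY.iq
     combine : ∀ i j i' j' z w {k k' ρ1 ρ2} → A z → A w → z ∈ Block 4 i j → w ∈ Block 4 i j → k ≡ Kv i j z → k' ≡ Kv i' j' w →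
      (cut P z w xor c1 z (suc i) (suc j)) xor c1 w (suc i') (suc j') ≡ ρ1 →
      (cut Q z w xor c2 z (suc i) (suc j)) xor c2 w (suc i') (suc j') ≡ ρ2 → k xor k' ≡ ρ1 xor ρ2
     combine i j i' j' z w az aw zi wi refl refl refl refl =
      rearrange (σ z) (σ w) (c1 z (suc i) (suc j)) (c2 z (suc i) (suc j)) (c1 w (suc i') (suc j')) (c2 w (suc i') (suc j')) (cut P z w) (cut Q z w) (coh {i} {j} {z} {w} az aw zi wi)
      where
      regroup : ∀ u v a b c d → (u xor v) xor ((a xor c) xor (b xor d)) ≡ ((u xor a) xor c) xor ((v xor b) xor d)
      regroup = taut 6 (λ u v a b c d → (u xor v) xor ((a xor c) xor (b xor d))) (λ u v a b c d → ((u xor a) xor c) xor ((v xor b) xor d)) refl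
      rearrange : ∀ s t a b c d u v → s xor t ≡ u xor v → (s xor (a xor b)) xor (t xor (c xor d)) ≡ ((u xor a) xor c) xor ((v xor b) xor d)
      rearrange s t a b c d u v e = trans (taut 6 (λ s t a b c d → (s xor (a xor b)) xor (t xor (c xor d))) (λ s t a b c d → (s xor t) xor ((a xor c) xor (b xor d))) refl s t a b c d)
       (trans (cong (_xor ((a xor c) xor (b xor d))) e) (regroup u v a b c d))
     k1 : ∀ x y → B x y ≡ true → B x (suc y) ≡ true → K x y ≡ K x (suc y)
     k1 (suc i) (suc j) h h' = let (z , az , zi , ez) = K-spec i j h; (w , aw , wi , ew) = K-spec i (suc j) h'
                                   zi' = 4⊇3 {i} {j} z zi; wi' = 4⊇3ʸ {i} {j} w wi in
      xor-≡ (combine i j i (suc j) z w az aw zi' wi' ez ew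
       (across-horizontal {i} {j} {PX.ip} {PY.ip} {z} {w} zi' wi' (P∉ {i} {j} {z} az zi')) (across-horizontal {i} {j} {PX.iq} {PY.iq} {z} {w} zi' wi' (Q∉ {i} {j} {z} az zi')))
     k2 : ∀ x y → B x y ≡ true → B (suc x) y ≡ true → K x y xor K (suc x) y ≡ ray PX.ip PY.ip (suc x) y xor ray PX.iq PY.iq (suc x) y
     k2 (suc i) (suc j) h h' = let (z , az , zi , ez) = K-spec i j h; (w , aw , wi , ew) = K-spec (suc i) j h'
                                   zi' = 4⊇3 {i} {j} z zi; wi' = 4⊇3ˣ {i} {j} w wi in
      combine i j (suc i) j z w az aw zi' wi' ez ew
       (across-vertical {i} {j} {PX.ip} {PY.ip} {z} {w} zi' wi' (P∉ {i} {j} {z} az zi')) (across-vertical {i} {j} {PX.iq} {PY.iq} {z} {w} zi' wi' (Q∉ {i} {j} {z} az zi'))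
     range : ∀ x y → B x y ≡ true → x <ℕ M × y <ℕ M
     range (suc i) (suc j) h = let (z , az , ((a , _) , (c , _))) = dec-true h; ((_ , b) , (_ , d)) = bd z az in
      s≤s (ℕP.<-≤-trans (steps-<⁻ {PX.base} PX.0<step {i} {PX.count} (<-trans (lo<up (fst z) a b) PX.covers-hi)) (m≤m⊔n PX.count PY.count)) ,
      s≤s (ℕP.<-≤-trans (steps-<⁻ {PY.base} PY.0<step {j} {PY.count} (<-trans (lo<up (snd z) c d) PY.covers-hi)) (m≤n⊔m PX.count PY.count))
     low-x : ∀ {j} → ¬ Occ 0 j
     low-x (z , az , ((_ , b) , _)) = <-asym (lo<up (fst z) (fst (fst (bd z az))) b) PX.covers-lo
     low-y : ∀ {i} → ¬ Occ i 0
     low-y (z , az , (_ , (_ , b))) = <-asym (lo<up (snd z) (fst (snd (bd z az))) b) PY.covers-lo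
     dual : ∀ (χ : Grid) (L : LPath PX.ip PY.ip PX.iq PY.iq) → AllE (InRange (suc M)) (InRange (suc M)) L → Constant-near χ → AllE (Free-H χ) (Free-V χ) L → χ PX.ip PY.ip ≡ χ PX.iq PY.iq
     dual χ L rng EA EL = lattice-duality M B K χ L rng
      range k1 k2 hχ vχ
      where
      hχ : ∀ x y → B x y ∧ prevV B x y ≡ false → B x y ≡ true ⊎ prevV B x y ≡ true ⊎ useH L x y ≡ true → χ x y ≡ χ (suc x) y
      hχ x y n (inr (inr u)) with useH-All {P = Free-H χ} {Free-V χ} L EL x y u
      ... | inl e = e
      ... | inr k = true≢false (trans (sym k) n)
      hχ (suc i) (suc zero) n (inl h) = ⊥-elim (low-y {i} (dec-true h))
      hχ (suc i) (suc (suc j)) n (inl h) = let (z , az , zi) = dec-true h in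
       EA i j (z , az , 4⊇3ʸ {i} {j} z zi) i j ≤-refl (n≤1+n i) ≤-refl (n≤1+n j) (dec-false (trans (sym (cong (_∧ dec (Occ i j)) h)) n))
        _ _ _ _ ((≤-refl , (s≤s (s≤s (n≤1+n _)))) , ((n≤1+n _) , ≤-refl)) (((n≤1+n _) , ≤-refl) , ((n≤1+n _) , ≤-refl))
      hχ (suc i) (suc (suc j)) n (inr (inl h)) = let (z , az , zi) = dec-true h in
       EA i j (z , az , 4⊇3 {i} {j} z zi) i (suc j) ≤-refl (n≤1+n i) (n≤1+n j) ≤-refl (dec-false (trans (sym (trans (cong (B (suc i) (suc (suc j)) ∧_) h) (∧-t _))) n))
        _ _ _ _ ((≤-refl , (s≤s (s≤s (n≤1+n _)))) , (≤-refl , (s≤s (s≤s (s≤s (n≤1+n _)))))) (((n≤1+n _) , ≤-refl) , (≤-refl , (s≤s (s≤s (s≤s (n≤1+n _))))))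
       where ∧-t : ∀ b → b ∧ true ≡ b
             ∧-t true = refl
             ∧-t false = refl
      vχ : ∀ x y → B x y ∧ prevH B x y ≡ false → B x y ≡ true ⊎ prevH B x y ≡ true ⊎ useV L x y ≡ true → χ x y ≡ χ x (suc y)
      vχ x y n (inr (inr u)) with useV-All {P = Free-H χ} {Free-V χ} L EL x y u
      ... | inl e = e
      ... | inr k = true≢false (trans (sym k) n)
      vχ (suc zero) (suc j) n (inl h) = ⊥-elim (low-x {j} (dec-true h))
      vχ (suc (suc i)) (suc j) n (inl h) = let (z , az , zi) = dec-true h in
       EA i j (z , az , 4⊇3ˣ {i} {j} z zi) i j ≤-refl (n≤1+n i) ≤-refl (n≤1+n j) (dec-false (trans (sym (cong (_∧ dec (Occ i j)) h)) n))
        _ _ _ _ (((n≤1+n _) , ≤-refl) , (≤-refl , (s≤s (s≤s (n≤1+n _))))) (((n≤1+n _) , ≤-refl) , ((n≤1+n _) , ≤-refl))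
      vχ (suc (suc i)) (suc j) n (inr (inl h)) = let (z , az , zi) = dec-true h in
       EA i j (z , az , 4⊇3 {i} {j} z zi) (suc i) j (n≤1+n i) ≤-refl ≤-refl (n≤1+n j) (dec-false (trans (sym (trans (cong (B (suc (suc i)) (suc j) ∧_) h) (∧-t _))) n))
        _ _ _ _ ((≤-refl , (s≤s (s≤s (s≤s (n≤1+n _))))) , (≤-refl , (s≤s (s≤s (n≤1+n _))))) ((≤-refl , (s≤s (s≤s (s≤s (n≤1+n _))))) , ((n≤1+n _) , ≤-refl))
       where ∧-t : ∀ b → b ∧ true ≡ b
             ∧-t true = refl
             ∧-t false = refl

   lattice : Lattice A User F
   lattice = let (ε0 , 0<ε0 , leb) = lebesgue Good (λ a b c d → Local.mono good-local a b c d) (Local.local good-local) (la - 1ℚ) ra (ba - 1ℚ) ta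
                  (<-trans (p-1<p la) la<ra) (<-trans (p-1<p ba) ba<ta)
                 0<ε = ⊓-pos 0<ε0 (positive⁻¹ 1ℚ)
    in Build.lattice0 ε0 leb (progression px qx la ra (ε0 ⊓ 1ℚ) px≢qx 0<ε) (progression py qy ba ta (ε0 ⊓ 1ℚ) py≢qy 0<ε)

 open Lattices

 -- Walks, connection within an edge set, and potentials

 module Walks where

  private variable
   ℓ ℓ' : Level
   u v x : V
   m n : ℕ

  infixr 5 _+ʷ_
  _+ʷ_ : W[ u , v ] m → W[ v , x ] n → W[ u , x ] (m +ℕ n)
  [] +ʷ W' = W'
  (a ∷ W) +ʷ W' = a ∷ (W +ʷ W')

  adj-sym : Adj graph u v → Adj graph v u
  adj-sym (e , inl j) = e , inr j
  adj-sym (e , inr j) = e , inl j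

  snoc : W[ u , v ] n → Adj graph v x → W[ u , x ] (suc n)
  snoc [] a = a ∷ []
  snoc (b ∷ W) a = b ∷ snoc W a

  rev : W[ u , v ] n → W[ v , u ] n
  rev [] = []
  rev (a ∷ W) = snoc (rev W) (adj-sym a)

  sumW-+ : ∀ f (W : W[ u , v ] m) (W' : W[ v , x ] n) → sumW f (W +ʷ W') ≡ sumW f W xor sumW f W'
  sumW-+ f [] W' = refl
  sumW-+ f ((e , _) ∷ W) W' = trans (cong (f e xor_) (sumW-+ f W W')) (sym (xor-assoc (f e) (sumW f W) (sumW f W')))

  sumW-snoc : ∀ f (W : W[ u , v ] m) (a : Adj graph v x) → sumW f (snoc W a) ≡ sumW f W xor f (fst a)
  sumW-snoc f [] (e , _) = xor-identityʳ (f e)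
  sumW-snoc f ((e , _) ∷ W) a = trans (cong (f e xor_) (sumW-snoc f W a)) (sym (xor-assoc (f e) (sumW f W) (f (fst a))))

  adj-sym-edge : (a : Adj graph u v) → fst (adj-sym a) ≡ fst a
  adj-sym-edge (e , inl _) = refl
  adj-sym-edge (e , inr _) = refl

  sumW-rev : ∀ f (W : W[ u , v ] m) → sumW f (rev W) ≡ sumW f W
  sumW-rev f [] = refl
  sumW-rev f (a@(e , _) ∷ W) = trans (sumW-snoc f (rev W) (adj-sym a)) (trans (cong₂ _xor_ (sumW-rev f W) (cong f (adj-sym-edge a))) (xor-comm (sumW f W) (f e)))

  sumW-⊕ : ∀ f g (W : W[ u , v ] m) → sumW (λ e → f e xor g e) W ≡ sumW f W xor sumW g W
  sumW-⊕ f g [] = refl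
  sumW-⊕ f g ((e , _) ∷ W) = trans (cong ((f e xor g e) xor_) (sumW-⊕ f g W)) (xor-swap (f e) (g e) (sumW f W) (sumW g W))

  sumW-potential : ∀ f (W : W[ u , v ] n) (g : V → Bool) →
   (∀ e → e ∈ˡ edges W → f e ≡ g (src e) xor g (tgt e)) → sumW f W ≡ g u xor g v
  sumW-potential {u} f [] g h = sym (xor-same (g u))
  sumW-potential {u} {v} f (_∷_ {v = w} (e , j) W) g h = trans (cong₂ _xor_ (trans (h e (here refl)) (joins-xor j g))
   (sumW-potential f W g (λ e i → h e (there i)))) (xor-cancel (g u) (g w) (g v))

  edges-+ : (W : W[ u , v ] m) (W' : W[ v , x ] n) → ∀ {e} → e ∈ˡ edges (W +ʷ W') → e ∈ˡ edges W ⊎ e ∈ˡ edges W'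
  edges-+ [] W' i = inr i
  edges-+ (a ∷ W) W' (here eq) = inl (here eq)
  edges-+ (a ∷ W) W' (there i) = [ (λ k → inl (there k)) , inr ]′ (edges-+ W W' i)

  edges-snoc : (W : W[ u , v ] m) (a : Adj graph v x) → ∀ {e} → e ∈ˡ edges (snoc W a) → e ∈ˡ edges W ⊎ e ≡ fst a
  edges-snoc [] a (here eq) = inr eq
  edges-snoc (b ∷ W) a (here eq) = inl (here eq)
  edges-snoc (b ∷ W) a (there i) = [ (λ k → inl (there k)) , inr ]′ (edges-snoc W a i)

  edges-rev : (W : W[ u , v ] m) → ∀ {e} → e ∈ˡ edges (rev W) → e ∈ˡ edges W
  edges-rev (a ∷ W) i = [ (λ k → there (edges-rev W k)) , (λ eq → here (trans eq (adj-sym-edge a))) ]′ (edges-snoc (rev W) (adj-sym a) i)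

  Within : List E → W[ u , v ] n → Set
  Within H W = ∀ e → e ∈ˡ edges W → e ∈ˡ H

  within-+ : ∀ {H} (W : W[ u , v ] m) (W' : W[ v , x ] n) → Within H W → Within H W' → Within H (W +ʷ W')
  within-+ W W' h k e i = [ h e , k e ]′ (edges-+ W W' i)

  Linked : List E → V → V → Set
  Linked H u v = Σ[ n ∈ ℕ ] Σ[ W ∈ W[ u , v ] n ] Within H W

  linked-refl : ∀ {H} → Linked H u u
  linked-refl = 0 , [] , λ _ ()

  linked-trans : ∀ {H} → Linked H u v → Linked H v x → Linked H u x
  linked-trans (m , W , h) (n , W' , k) = m +ℕ n , W +ʷ W' , within-+ W W' h k

  linked-sym : ∀ {H} → Linked H u v → Linked H v u
  linked-sym (n , W , h) = n , rev W , λ e i → h e (edges-rev W i)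

  linked-edge : ∀ {H e} → e ∈ˡ H → Linked H (src e) (tgt e)
  linked-edge {e = e} i = 1 , (e , inl (refl , refl)) ∷ [] , λ { _ (here refl) → i }

  -- Edges are added one at a time. An edge on which the potential fails either closes an odd cycle
  -- or joins two components, and then the potential is flipped on one of them.
  potential : ∀ (f : E → Bool) H →
   (Σ[ u ∈ V ] Σ[ n ∈ ℕ ] Σ[ W ∈ W[ u , u ] n ] (Within H W × sumW f W ≡ true)) ⊎
   (Σ[ g ∈ (V → Bool) ] (∀ e → e ∈ˡ H → f e ≡ g (src e) xor g (tgt e)))
  potential f [] = inr ((λ _ → false) , λ _ ())
  potential f (e ∷ H) with potential f H
  ... | inl (u , n , W , h , odd) = inl (u , n , W , (λ e i → there (h e i)) , odd)
  ... | inr (g , h) with Bool-cases (f e xor (g (src e) xor g (tgt e)))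
  ...   | inr eq = inr (g , λ { _ (here refl) → xor-≡ eq ; e' (there i) → h e' i })
  ...   | inl odd with em _ {Linked H (tgt e) (src e)}
  ...     | yes (n , W , k) = inl (src e , suc n , (e , inl (refl , refl)) ∷ W , (λ { _ (here refl) → here refl ; e' (there i) → there (k e' i) }) ,
   trans (cong (f e xor_) (trans (sumW-potential f W g (λ e i → h e (k e i))) (xor-comm (g (tgt e)) (g (src e))))) odd)
  ...     | no n = inr (g' , λ
   { _ (here refl) → trans (flip (f e) (g (src e)) (g (tgt e)) odd) (sym (cong₂ _xor_
    (trans (cong (g (src e) xor_) (dec-no n)) (xor-identityʳ (g (src e)))) (trans (cong (g (tgt e) xor_) (dec-yes linked-refl)) (xor-comm (g (tgt e)) true))))
   ; e' (there i) → trans (h e' i) (trans (same (g (src e')) (g (tgt e')) (dec (Linked H (tgt e) (src e')))) (cong (λ b → g' (src e') xor (g (tgt e') xor b))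
    (dec-⇔ (λ l → linked-trans l (linked-edge i)) (λ l → linked-trans l (linked-sym (linked-edge i)))))) })
   where
   g' : V → Bool
   g' v = g v xor dec (Linked H (tgt e) v)
   flip : ∀ f a b → f xor (a xor b) ≡ true → f ≡ a xor (not b)
   flip true true true h = refl
   flip true false false h = refl
   flip false true false h = refl
   flip false false true h = refl
   same : ∀ a b c → a xor b ≡ (a xor c) xor (b xor c)
   same = taut 3 (λ a b c → a xor b) (λ a b c → (a xor c) xor (b xor c)) refl

  Encircled : List E → ℝ² → Set
  Encircled H p = Σ[ u ∈ V ] Σ[ n ∈ ℕ ] Σ[ W ∈ W[ u , u ] n ] (Within H W × wind p W ≡ true)

  SameWinding : List E → ℝ² → ℝ² → Set
  SameWinding H p q = ∀ {u n} (W : W[ u , u ] n) → Within H W → wind p W ≡ wind q W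

 open Walks

 -- Branches over a subgraph with stubs

 module Sections where
  open LatticePaths
  open LatticeDuality

  private variable
   ℓ : Level

  ≺-≈ : ∀ x x' y → x ≈ x' → x ≺ y → x' ≺ y
  ≺-≈ x x' y e (q , u , v) = q , ≈-upper x x' e u , v

  right-≈ : ∀ p z w → z ≈² w → right p z ≡ right p w
  right-≈ (a , _) (x , _) (u , _) (e , _) = cong not (dec-⇔ (≺-≈ x u a e) (≺-≈ u x a (≈-sym x u e)))

  below-≈ : ∀ p z w → z ≈² w → below p z ≡ below p w
  below-≈ (_ , b) (_ , y) (_ , v) (_ , e) = dec-⇔ (≺-≈ y v b e) (≺-≈ v y b (≈-sym y v e))

  cut-≈ : ∀ p {z z' w w'} → z ≈² z' → w ≈² w' → cut p z w ≡ cut p z' w'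
  cut-≈ p {z} {z'} {w} {w'} e f = cong₂ _∧_ (cong₂ _xor_ (right-≈ p z z' e) (right-≈ p w w' f)) (below-≈ p z z' e)

  cuts-≈ : ∀ p q {z z' w w'} → z ≈² z' → w ≈² w' → cuts p q z w ≡ cuts p q z' w'
  cuts-≈ p q {z} {z'} {w} {w'} e f = cong₂ _xor_ (cut-≈ p {z} {z'} {w} {w'} e f) (cut-≈ q {z} {z'} {w} {w'} e f)

  cut-same : ∀ p z → cut p z z ≡ false
  cut-same p z = cong (_∧ below p z) (xor-same (right p z))

  cuts-same : ∀ p q z w → z ≈² w → cuts p q z w ≡ false
  cuts-same p q z w e = trans (cuts-≈ p q {z} {z} {w} {z} (≈²-refl z) (≈²-sym z w e)) (cong₂ _xor_ (cut-same p z) (cut-same q z))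

  In-≈ : ∀ {a b} s t → s ≈ t → In a b s → In a b t
  In-≈ s t e (h , k) = (λ x → h (≈-upper t s (≈-sym s t e) x)) , (λ x → k (snd e x))

  -- `out` is a stub at the source of the edge and `into` one at its target.
  data Kind (H : List E) (VH : V → Set) (lo hi : E → ℚ) (e : E) : ℚ → ℚ → Set where
   whole : e ∈ˡ H → Kind H VH lo hi e 0ℚ 1ℚ
   out : VH (src e) → ¬ (e ∈ˡ H) → Kind H VH lo hi e 0ℚ (lo e)
   into : VH (tgt e) → ¬ (e ∈ˡ H) → Kind H VH lo hi e (hi e) 1ℚ

  Coh : ℝ² → ℝ² → (ℝ → Set) → E → (ℝ → Bool) → Set₁
  Coh p q I e f = ∀ t → I t → Nb t (λ s → I s → f s ≡ f t xor cuts p q (curve e t) (curve e s))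

  -- A subgraph with edge set H together with stubs of further edges at its vertices:
  -- such an edge e is cut open over the interval [lo e , hi e].
  record Stubbed : Set₁ where
   field
    H : List E
    VH : V → Set
    ends : ∀ {e} → e ∈ˡ H → VH (src e) × VH (tgt e)
    lo hi : E → ℚ
    0<lo : ∀ e → 0ℚ < lo e
    lo<hi : ∀ e → lo e < hi e
    hi<1 : ∀ e → hi e < 1ℚ
    arcs : List (E × ℚ × ℚ)

   field
    kind : ∀ {e a b} → (e , a , b) ∈ˡ arcs → Kind H VH lo hi e a b

   lo<1 : ∀ e → lo e < 1ℚ
   lo<1 e = <-trans (lo<hi e) (hi<1 e)
   0<hi : ∀ e → 0ℚ < hi e
   0<hi e = <-trans (0<lo e) (lo<hi e)

   proper : ∀ {e a b} → (e , a , b) ∈ˡ arcs → a < b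
   proper {e} i with kind i
   ... | whole _ = 0<1
   ... | out _ _ = 0<lo e
   ... | into _ _ = hi<1 e

   A : Pred ℝ² (lsuc 0ℓ)
   A = OnArcs arcs

   A-closed : Closed A
   A-closed z = arcs-closed arcs z proper

   A-≈ : ∀ z w → z ≈² w → A z → A w
   A-≈ z w eq ((e , a , b) , i , o) = _ , i , arc-≈ {z = z} {w = w} eq o

   vertex-A : ∀ v z → A z → φ (vertex v) ≈² z → VH v
   vertex-A v z ((e , a , b) , i , arc t it eq) v≈z = go (position e t) (kind i)
    where
    same : ∀ {u} → γ e t ≡ vertex u → u ≡ v
    same {u} p = vertex-injective (≈²-trans (φ (vertex u)) z (φ (vertex v)) (subst (λ x → φ x ≈² z) p eq) (≈²-sym (φ (vertex v)) z v≈z))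
    go : Position e t → Kind H VH lo hi e a b → VH v
    go (at-inner j p) _ = ⊥-elim (vertex≢inner (≈²-trans (φ (vertex v)) z (φ (inner e t j)) v≈z (≈²-sym (φ (inner e t j)) z (subst (λ x → φ x ≈² z) p eq))))
    go (at-src _ p) (whole h) = subst VH (same p) (fst (ends h))
    go (at-src _ p) (out h _) = subst VH (same p) h
    go (at-src t≤0 p) (into h _) = ⊥-elim (fst it (≤ᴿ-<ʳ t t≤0 (0<hi e)))
    go (at-tgt _ p) (whole h) = subst VH (same p) (snd (ends h))
    go (at-tgt _ p) (into h _) = subst VH (same p) h
    go (at-tgt 1≤t p) (out h _) = ⊥-elim (snd it (<ˡ-≤ʳ t (lo<1 e) 1≤t))

   data Part (e : E) (t : ℝ) : Set where
    whole : e ∈ˡ H → Part e t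
    out : ¬ (e ∈ˡ H) → (e , 0ℚ , lo e) ∈ˡ arcs → t ≤ᴿ lo e → Part e t
    into : ¬ (e ∈ˡ H) → (e , hi e , 1ℚ) ∈ˡ arcs → hi e ≤ʳ t → Part e t

   inner-A : ∀ e t i z → A z → φ (inner e t i) ≈² z → Part e t
   inner-A e t i z ((e' , a , b) , m , arc s js eq) x≈z = go (position e' s) (kind m) m js
    where
    go : Position e' s → ∀ {a b} → Kind H VH lo hi e' a b → (e' , a , b) ∈ˡ arcs → In a b s → Part e t
    go (at-src _ p) _ _ _ = ⊥-elim (vertex≢inner (≈²-trans (φ (vertex (src e'))) z (φ (inner e t i)) (subst (λ x → φ x ≈² z) p eq) (≈²-sym (φ (inner e t i)) z x≈z)))
    go (at-tgt _ p) _ _ _ = ⊥-elim (vertex≢inner (≈²-trans (φ (vertex (tgt e'))) z (φ (inner e t i)) (subst (λ x → φ x ≈² z) p eq) (≈²-sym (φ (inner e t i)) z x≈z)))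
    go (at-inner j p) k m js with inner-injective (≈²-trans (φ (inner e t i)) z (φ (inner e' s j)) x≈z (≈²-sym (φ (inner e' s j)) z (subst (λ x → φ x ≈² z) p eq)))
    go (at-inner j p) (whole h) m js | refl , t≈s = whole h
    go (at-inner j p) (out _ n) m js | refl , t≈s = out n m (snd (In-≈ s t (≈-sym t s t≈s) js))
    go (at-inner j p) (into _ n) m js | refl , t≈s = into n m (fst (In-≈ s t (≈-sym t s t≈s) js))

   part-A : ∀ e t i → (e ∈ˡ H → (e , 0ℚ , 1ℚ) ∈ˡ arcs) → Part e t → A (φ (inner e t i))
   part-A e t i full (whole h) = _ , full h , inner-on e t i
   part-A e t i full (out _ m k) = _ , m , arc t (<ˡ⇒≤ʳ t (fst i) , k) (≈²-sym (φ (inner e t i)) (curve e t) (curve-inner e t i))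
   part-A e t i full (into _ m k) = _ , m , arc t (k , <ʳ⇒≤ᴿ t (snd i)) (≈²-sym (φ (inner e t i)) (curve e t) (curve-inner e t i))

   module _ (p q : ℝ²) (h : V → Bool) (f g1 g2 : E → ℝ → Bool)
    (cf : ∀ e → e ∈ˡ H → Coh p q (In 0ℚ 1ℚ) e (f e))
    (jump : ∀ e → e ∈ˡ H → f e (ι 0ℚ) xor f e (ι 1ℚ) ≡ h (src e) xor h (tgt e))
    (cg1 : ∀ e → (e , 0ℚ , lo e) ∈ˡ arcs → Coh p q (In 0ℚ (lo e)) e (g1 e))
    (cg2 : ∀ e → (e , hi e , 1ℚ) ∈ˡ arcs → Coh p q (In (hi e) 1ℚ) e (g2 e))
    where
    private
     value : Point graph → Bool
     value (vertex v) = h v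
     value (inner e t i) = if dec (e ∈ˡ H) then h (src e) xor (f e (ι 0ℚ) xor f e t)
      else (if dec (t ≤ᴿ lo e) then h (src e) xor (g1 e (ι 0ℚ) xor g1 e t) else h (tgt e) xor (g2 e (ι 1ℚ) xor g2 e t))
     on-whole : ∀ e t i → e ∈ˡ H → value (inner e t i) ≡ h (src e) xor (f e (ι 0ℚ) xor f e t)
     on-whole e t i m rewrite dec-yes m = refl
     on-out : ∀ e t i → ¬ (e ∈ˡ H) → t ≤ᴿ lo e → value (inner e t i) ≡ h (src e) xor (g1 e (ι 0ℚ) xor g1 e t)
     on-out e t i m k rewrite dec-no m | dec-yes k = refl
     on-into : ∀ e t i → ¬ (e ∈ˡ H) → hi e ≤ʳ t → value (inner e t i) ≡ h (tgt e) xor (g2 e (ι 1ℚ) xor g2 e t)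
     on-into e t i m k rewrite dec-no m | dec-no {A = t ≤ᴿ lo e} (λ l → k (≤ᴿ-<ʳ t l (lo<hi e))) = refl
     choose : ∀ z → A z → Σ[ x ∈ Point graph ] φ x ≈² z
     choose z (_ , _ , arc t _ eq) = γ _ t , eq
     pick : ∀ z → Dec (OnGraph z) → Bool
     pick z (yes (x , _)) = value x
     pick z (no _) = false

    -- Prescribed by `h` at the vertices and continued along each arc. On a whole edge `jump` makes
    -- the continuations from both ends agree; a stub has only one end to match. Off the graph the
    -- value is arbitrary.
    section : ℝ² → Bool
    section z = pick z (em _)

    private
     spec : ∀ z → A z → Σ[ x ∈ Point graph ] (φ x ≈² z × section z ≡ value x)
     spec z az with em _ {OnGraph z}
     ... | yes (x , eq) = x , eq , refl
     ... | no n = ⊥-elim (n (choose z az))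
     0∈ : ∀ {b} → 0ℚ < b → In 0ℚ b (ι 0ℚ)
     0∈ l = <-irrefl refl , <-asym l
     1∈ : ∀ {a} → a < 1ℚ → In a 1ℚ (ι 1ℚ)
     1∈ l = <-asym l , <-irrefl refl
     ends0 : ∀ e t i → cuts p q (curve e (ι 0ℚ)) (curve e t) ≡ cuts p q (φ (vertex (src e))) (φ (inner e t i))
     ends0 e t i = cuts-≈ p q {curve e (ι 0ℚ)} {φ (vertex (src e))} {curve e t} {φ (inner e t i)} (subst (λ z → curve e (ι 0ℚ) ≈² z) (curve-0 e) (≈²-refl (curve e (ι 0ℚ)))) (≈²-sym (φ (inner e t i)) (curve e t) (curve-inner e t i))
     ends1 : ∀ e t i → cuts p q (curve e (ι 1ℚ)) (curve e t) ≡ cuts p q (φ (vertex (tgt e))) (φ (inner e t i))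
     ends1 e t i = cuts-≈ p q {curve e (ι 1ℚ)} {φ (vertex (tgt e))} {curve e t} {φ (inner e t i)} (subst (λ z → curve e (ι 1ℚ) ≈² z) (curve-1 e) (≈²-refl (curve e (ι 1ℚ)))) (≈²-sym (φ (inner e t i)) (curve e t) (curve-inner e t i))
     absorb : ∀ h f c → h xor (f xor (f xor c)) ≡ h xor c
     absorb = taut 3 (λ h f c → h xor (f xor (f xor c))) (λ h f c → h xor c) refl
     Near0 Near1 : E → ℝ → Set
     Near0 e s = (e ∈ˡ H → f e s ≡ f e (ι 0ℚ) xor cuts p q (curve e (ι 0ℚ)) (curve e s)) ×
      ((e , 0ℚ , lo e) ∈ˡ arcs → g1 e s ≡ g1 e (ι 0ℚ) xor cuts p q (curve e (ι 0ℚ)) (curve e s)) × s <ʳ lo e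
     Near1 e s = (e ∈ˡ H → f e s ≡ f e (ι 1ℚ) xor cuts p q (curve e (ι 1ℚ)) (curve e s)) ×
      ((e , hi e , 1ℚ) ∈ˡ arcs → g2 e s ≡ g2 e (ι 1ℚ) xor cuts p q (curve e (ι 1ℚ)) (curve e s)) × hi e <ˡ s
     when : ∀ {X : Set} {t} {P : ℝ → Set} → (X → Nb t P) → Nb t (λ s → X → P s)
     when {X} k with em _ {X}
     ... | yes x = Nb-map (λ s y _ → y) (k x)
     ... | no n = Nb-all λ s x → ⊥-elim (n x)
     near0 : ∀ e → Nb (ι 0ℚ) (λ s → 0ℚ <ˡ s → s <ʳ 1ℚ → Near0 e s)
     near0 e = Nb-map (λ s (a , b , c) k l → (λ m → a m (<ˡ⇒≤ʳ s k , <ʳ⇒≤ᴿ s l)) , (λ m → b m (<ˡ⇒≤ʳ s k , <ʳ⇒≤ᴿ s c)) , c)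
      (Nb-∩ (when λ m → cf e m (ι 0ℚ) (0∈ 0<1)) (Nb-∩ (when λ m → cg1 e m (ι 0ℚ) (0∈ (0<lo e))) (Nb-<ʳ {ι 0ℚ} (0<lo e))))
     near1 : ∀ e → Nb (ι 1ℚ) (λ s → 0ℚ <ˡ s → s <ʳ 1ℚ → Near1 e s)
     near1 e = Nb-map (λ s (a , b , c) k l → (λ m → a m (<ˡ⇒≤ʳ s k , <ʳ⇒≤ᴿ s l)) , (λ m → b m (<ˡ⇒≤ʳ s c , <ʳ⇒≤ᴿ s l)) , c)
      (Nb-∩ (when λ m → cf e m (ι 1ℚ) (1∈ 0<1)) (Nb-∩ (when λ m → cg2 e m (ι 1ℚ) (1∈ (hi<1 e))) (Nb-<ˡ {ι 1ℚ} (hi<1 e))))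
     -- Up to this time every chosen branch is given by the crossings counted from the vertex. These
     -- bounds become the radii of a star, which may vary with the edge.
     bound0 : ∀ e → ∃[ b ] (0ℚ < b × (∀ s → 0ℚ <ˡ s → s <ʳ 1ℚ → s <ʳ b → Near0 e s))
     bound0 e = let nb a b (i , j) k = near0 e in b , j , λ s l m n → k s (lower-down s i l , n) l m
     bound1 : ∀ e → ∃[ a ] (a < 1ℚ × (∀ s → 0ℚ <ˡ s → s <ʳ 1ℚ → a <ˡ s → Near1 e s))
     bound1 e = let nb a b (i , j) k = near1 e in a , i , λ s l m n → k s (n , upper-up s j m) l m
     at-vertex-star : ∀ v y z → A z → φ y ≈² z → Star v (fst ∘ bound0) (fst ∘ bound1) y → value y ≡ h v xor cuts p q (φ (vertex v)) (φ y)
     at-vertex-star v _ z az eq (inl refl) = sym (trans (cong (h v xor_) (cuts-same p q (φ (vertex v)) (φ (vertex v)) (≈²-refl (φ (vertex v))))) (xor-identityʳ (h v)))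
     at-vertex-star v _ z az eq (inr (e , t , i , refl , inl (refl , k))) = go (inner-A e t i z az eq)
      where
      n = snd (snd (bound0 e)) t (fst i) (snd i) k
      go : Part e t → value (inner e t i) ≡ h (src e) xor cuts p q (φ (vertex (src e))) (φ (inner e t i))
      go (whole m) = trans (on-whole e t i m) (trans (cong (λ x → h (src e) xor (f e (ι 0ℚ) xor x)) (fst n m)) (trans (absorb (h (src e)) (f e (ι 0ℚ)) _) (cong (h (src e) xor_) (ends0 e t i))))
      go (out m m' l) = trans (on-out e t i m l) (trans (cong (λ x → h (src e) xor (g1 e (ι 0ℚ) xor x)) (fst (snd n) m')) (trans (absorb (h (src e)) (g1 e (ι 0ℚ)) _) (cong (h (src e) xor_) (ends0 e t i))))
      go (into m m' l) = ⊥-elim (l (upper-up t (lo<hi e) (snd (snd n))))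
     at-vertex-star v _ z az eq (inr (e , t , i , refl , inr (refl , k))) = go (inner-A e t i z az eq)
      where
      n = snd (snd (bound1 e)) t (fst i) (snd i) k
      other : e ∈ˡ H → h (src e) xor (f e (ι 0ℚ) xor f e t) ≡ h (tgt e) xor (f e (ι 1ℚ) xor f e t)
      other m = swap (h (src e)) (h (tgt e)) (f e (ι 0ℚ)) (f e (ι 1ℚ)) (f e t) (jump e m)
       where swap : ∀ a b c d x → c xor d ≡ a xor b → a xor (c xor x) ≡ b xor (d xor x)
             swap a b c d x eq = trans (taut 4 (λ a c d x → a xor (c xor x)) (λ a c d x → (a xor (c xor d)) xor (d xor x)) refl a c d x)
              (trans (cong (λ y → (a xor y) xor (d xor x)) eq) (taut 3 (λ a b y → (a xor (a xor b)) xor y) (λ a b y → b xor y) refl a b (d xor x)))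
      go : Part e t → value (inner e t i) ≡ h (tgt e) xor cuts p q (φ (vertex (tgt e))) (φ (inner e t i))
      go (whole m) = trans (on-whole e t i m) (trans (other m) (trans (cong (λ x → h (tgt e) xor (f e (ι 1ℚ) xor x)) (fst n m)) (trans (absorb (h (tgt e)) (f e (ι 1ℚ)) _) (cong (h (tgt e) xor_) (ends1 e t i)))))
      go (into m m' l) = trans (on-into e t i m l) (trans (cong (λ x → h (tgt e) xor (g2 e (ι 1ℚ) xor x)) (fst (snd n) m')) (trans (absorb (h (tgt e)) (g2 e (ι 1ℚ)) _) (cong (h (tgt e) xor_) (ends1 e t i))))
      go (out m m' l) = ⊥-elim (l (lower-down t (lo<hi e) (snd (snd n))))
     finish : ∀ x z → A z → φ x ≈² z → section z ≡ value x →
      N (φ x) (λ w → ∀ y → φ y ≈² w → A w → value y ≡ value x xor cuts p q (φ x) (φ y)) →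
      N z (λ w → A w → section w ≡ section z xor cuts p q z w)
     finish x z az x≈z sz n = N-≈ x≈z (N-map (λ w k aw → let (y , y≈w , sw) = spec w aw in
      trans sw (trans (k y y≈w aw) (cong₂ _xor_ (sym sz) (cuts-≈ p q {φ x} {z} {φ y} {w} x≈z y≈w)))) n)

     along : ∀ e t i (F : ℝ → Bool) (b : Bool) (I : ℝ → Set) → I t → Nb t (λ s → I s → F s ≡ F t xor cuts p q (curve e t) (curve e s)) →
      (∀ s j → I s → value (inner e s j) ≡ b xor F s) → Nb t (λ s → ∀ j → A (φ (inner e s j)) → I s) →
      N (φ (inner e t i)) (λ w → ∀ y → φ y ≈² w → A w → value y ≡ value (inner e t i) xor cuts p q (φ (inner e t i)) (φ y))
     along e t i F b I it coh val inI = let nb l r k g = Nb-∩ coh inI in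
      N-map (λ w st y y≈w aw → go l r g w aw y y≈w (st y y≈w)) (segment-N e t i l r k)
      where
      go : ∀ l r → (∀ s → Between l r s → (I s → F s ≡ F t xor cuts p q (curve e t) (curve e s)) × (∀ j → A (φ (inner e s j)) → I s)) →
       ∀ w → A w → ∀ y → φ y ≈² w → Σ[ s ∈ ℝ ] Σ[ j ∈ _ ] (y ≡ inner e s j × Between l r s) →
       value y ≡ value (inner e t i) xor cuts p q (φ (inner e t i)) (φ y)
      go l r g w aw _ y≈w (s , j , refl , m) = let is = snd (g s m) j (A-≈ w (φ (inner e s j)) (≈²-sym (φ (inner e s j)) w y≈w) aw) in
       trans (val s j is) (trans (cong (b xor_) (fst (g s m) is)) (trans (sym (xor-assoc b (F t) _))
        (cong₂ _xor_ (sym (val t i it)) (cuts-≈ p q {curve e t} {φ (inner e t i)} {curve e s} {φ (inner e s j)}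
         (≈²-sym (φ (inner e t i)) (curve e t) (curve-inner e t i)) (≈²-sym (φ (inner e s j)) (curve e s) (curve-inner e s j))))))

     at-inner-point : ∀ e t i z → A z → φ (inner e t i) ≈² z →
      N (φ (inner e t i)) (λ w → ∀ y → φ y ≈² w → A w → value y ≡ value (inner e t i) xor cuts p q (φ (inner e t i)) (φ y))
     at-inner-point e t i z az eq = go (inner-A e t i z az eq)
      where
      go : Part e t → _
      go (whole m) = along e t i (f e) (h (src e) xor f e (ι 0ℚ)) (In 0ℚ 1ℚ) (Between-In t i) (cf e m t (Between-In t i))
       (λ s j _ → trans (on-whole e s j m) (sym (xor-assoc (h (src e)) (f e (ι 0ℚ)) (f e s)))) (Nb-all λ s j _ → Between-In s j)
      go (out m m' l) = along e t i (g1 e) (h (src e) xor g1 e (ι 0ℚ)) (In 0ℚ (lo e)) it (cg1 e m' t it)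
       (λ s j is → trans (on-out e s j m (snd is)) (sym (xor-assoc (h (src e)) (g1 e (ι 0ℚ)) (g1 e s))))
       (Nb-map (λ s s<hi j as → inside s j s<hi (inner-A e s j _ as (≈²-refl (φ (inner e s j))))) (Nb-<ʳ {t} (≤ᴿ-<ʳ t l (lo<hi e))))
       where
       it : In 0ℚ (lo e) t
       it = <ˡ⇒≤ʳ t (fst i) , l
       inside : ∀ s → Between 0ℚ 1ℚ s → s <ʳ hi e → Part e s → In 0ℚ (lo e) s
       inside s j s<hi (whole k) = ⊥-elim (m k)
       inside s j s<hi (out _ _ k) = <ˡ⇒≤ʳ s (fst j) , k
       inside s j s<hi (into _ _ k) = ⊥-elim (k s<hi)
      go (into m m' l) = along e t i (g2 e) (h (tgt e) xor g2 e (ι 1ℚ)) (In (hi e) 1ℚ) it (cg2 e m' t it)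
       (λ s j is → trans (on-into e s j m (fst is)) (sym (xor-assoc (h (tgt e)) (g2 e (ι 1ℚ)) (g2 e s))))
       (Nb-map (λ s lo<s j as → inside s j lo<s (inner-A e s j _ as (≈²-refl (φ (inner e s j))))) (Nb-<ˡ {t} (<ˡ-≤ʳ t (lo<hi e) l)))
       where
       it : In (hi e) 1ℚ t
       it = l , <ʳ⇒≤ᴿ t (snd i)
       inside : ∀ s → Between 0ℚ 1ℚ s → lo e <ˡ s → Part e s → In (hi e) 1ℚ s
       inside s j lo<s (whole k) = ⊥-elim (m k)
       inside s j lo<s (out _ _ k) = ⊥-elim (k lo<s)
       inside s j lo<s (into _ _ k) = k , <ʳ⇒≤ᴿ s (snd j)

    section-coherent : Section p q A section
    section-coherent z az = let (x , x≈z , sz) = spec z az in go x x≈z sz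
     where
     go : ∀ x → φ x ≈² z → section z ≡ value x → N z (λ w → A w → section w ≡ section z xor cuts p q z w)
     go (vertex v) x≈z sz = finish (vertex v) z az x≈z sz (N-map (λ w st y y≈w aw → at-vertex-star v y w aw y≈w (st y y≈w))
      (star-N v (fst ∘ bound0) (fst ∘ bound1) (fst ∘ snd ∘ bound0) (fst ∘ snd ∘ bound1)))
     go (inner e t i) x≈z sz = finish (inner e t i) z az x≈z sz (at-inner-point e t i z az x≈z)

 -- Lattice paths that follow the graph, and escape from a subgraph

 module LatticeTracing where
  open LatticePaths
  open LatticeDuality
  open Sections

  private variable
   ℓ : Level
   u v : V
   n : ℕ

  third two-thirds : ℚ
  third = + 1 ℚ./ 3
   where open import Data.Integer.Base using (+_)
  two-thirds = + 2 ℚ./ 3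
   where open import Data.Integer.Base using (+_)

  coherent-⊕ : ∀ {I : ℝ → Set} {p q e f g} → Coherent-on I p e f → Coherent-on I q e g →
   ∀ t → I t → Nb t (λ s → I s → f s xor g s ≡ (f t xor g t) xor cuts p q (curve e t) (curve e s))
  coherent-⊕ {f = f} {g} cf cg t it = Nb-map (λ s (a , b) is → trans (cong₂ _xor_ (a is) (b is)) (xor-swap (f t) _ (g t) _)) (Nb-∩ (cf t it) (cg t it))

  module _ (S : Stubbed) (full : ∀ e → e ∈ˡ Stubbed.H S → (e , 0ℚ , 1ℚ) ∈ˡ Stubbed.arcs S) where
   open Stubbed S

   -- On `H` the sum of the two parities has a potential unless a closed walk separates `p` from
   -- `q`. A stub hangs on at one end and creates no closed walk.
   section-exists : ∀ p q → ¬ A p → ¬ A q →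
    (SameWinding H p q) → Σ[ σ ∈ (ℝ² → Bool) ] Section p q A σ
   section-exists p q p∉ q∉ same = go (potential (λ e → κ p e xor κ q e) H)
    where
    branch : ∀ e a b → (e , a , b) ∈ˡ arcs → Σ[ f ∈ (ℝ → Bool) ] Σ[ g ∈ (ℝ → Bool) ] (Coherent-on (In a b) p e f × Coherent-on (In a b) q e g)
    branch e a b i = let (f , cf) = coherent-exists p e (proper i) (λ o → p∉ (_ , i , o)); (g , cg) = coherent-exists q e (proper i) (λ o → q∉ (_ , i , o)) in f , g , cf , cg
    func : ∀ e a b → Dec ((e , a , b) ∈ˡ arcs) → ℝ → Bool
    func e a b (yes i) t = let (f , g , _) = branch e a b i in f t xor g t
    func e a b (no _) t = false
    func-coh : ∀ e a b d → (e , a , b) ∈ˡ arcs → ∀ t → In a b t → Nb t (λ s → In a b s → func e a b d s ≡ func e a b d t xor cuts p q (curve e t) (curve e s))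
    func-coh e a b (no n) i = ⊥-elim (n i)
    func-coh e a b (yes i) _ = let (f , g , cf , cg) = branch e a b i in coherent-⊕ {In a b} {p} {q} {e} {f} {g} cf cg
    func-jump : ∀ e d → (e , 0ℚ , 1ℚ) ∈ˡ arcs → func e 0ℚ 1ℚ d (ι 0ℚ) xor func e 0ℚ 1ℚ d (ι 1ℚ) ≡ κ p e xor κ q e
    func-jump e (no n) i = ⊥-elim (n i)
    func-jump e (yes i) _ = let (f , g , cf , cg) = branch e 0ℚ 1ℚ i in
     trans (xor-swap (f (ι 0ℚ)) (g (ι 0ℚ)) (f (ι 1ℚ)) (g (ι 1ℚ))) (sym (cong₂ _xor_ (κ-spec {p} {e} {f} cf) (κ-spec {q} {e} {g} cg)))
    go : _ → Σ[ σ ∈ (ℝ² → Bool) ] Section p q A σ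
    go (inl (u , n , W , wi , odd)) = true≢false (trans (sym odd) (trans (sumW-⊕ (κ p) (κ q) W) (trans (cong (_xor wind q W) (same W wi)) (xor-same (wind q W)))))
    go (inr (h , pot)) = section p q h (λ e → func e 0ℚ 1ℚ (em _)) (λ e → func e 0ℚ (lo e) (em _)) (λ e → func e (hi e) 1ℚ (em _))
     (λ e i → func-coh e 0ℚ 1ℚ (em _) (full e i)) (λ e i → trans (func-jump e (em _) (full e i)) (pot e i))
     (λ e i → func-coh e 0ℚ (lo e) (em _) i) (λ e i → func-coh e (hi e) 1ℚ (em _) i) ,
     section-coherent p q h (λ e → func e 0ℚ 1ℚ (em _)) (λ e → func e 0ℚ (lo e) (em _)) (λ e → func e (hi e) 1ℚ (em _))
      (λ e i → func-coh e 0ℚ 1ℚ (em _) (full e i)) (λ e i → trans (func-jump e (em _) (full e i)) (pot e i))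
      (λ e i → func-coh e 0ℚ (lo e) (em _) i) (λ e i → func-coh e (hi e) 1ℚ (em _) i)

  locate : ∀ (X : ℕ → ℚ) M (x : ℝ) → X 0 ≤ʳ x → x <ʳ X M → Σ[ i ∈ ℕ ] (i <ℕ M × X i ≤ʳ x × x <ʳ X (suc i))
  locate X zero x h k = ⊥-elim (h k)
  locate X (suc M) x h k with em 0ℓ {x <ʳ X M}
  ... | yes l = let (i , i<M , p) = locate X M x h l in i , m≤n⇒m≤1+n i<M , p
  ... | no n = M , ≤-refl , n , k

  -- The complement of `A` is traversed by boxes, along which every function that is locally
  -- constant on the complement keeps its value.
  data Chain (A : Pred ℝ² (lsuc 0ℓ)) (z : ℝ²) : ℝ² → Set₁ where
   start : Chain A z z
   extend : ∀ {w v} p q r s → Chain A z w → Misses A p q r s → w ∈ Box p q r s → v ∈ Box p q r s → Chain A z v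

  chain-wind : ∀ {A z w} (W : W[ u , u ] n) → (∀ z → OnWalk' W z → A z) → Chain A z w → wind z W ≡ wind w W
  chain-wind W sub start = refl
  chain-wind {u} W sub (extend {w} {v} p q r s c miss i j) = trans (chain-wind W sub c) (sym (trans (wind-move {a = p} {q} {r} {s} {w} {v} W i j (λ z k o → miss z (sub z o) k))
   (cong (_xor wind w W) (xor-same (at-vertex (shift w v) u)))))

  module LatticeTools {ℓ} {A : Pred ℝ² (lsuc 0ℓ)} {User : ℚ → ℚ → ℚ → ℚ → Set ℓ} {F : Frame} (Λ : Lattice A User F) where
   open Frame F
   open Lattice Λ

   -- Of the two cells beside the edge both are marked or one is not. In the second case both ends
   -- of the edge are interior lattice points of the empty block around the unmarked cell.
   h-edge : ∀ i j → Bordered (suc i) (suc (suc j)) ⊎ Σ[ i' ∈ ℕ ] Σ[ j' ∈ ℕ ] (Empty i' j' × Inside i' j' (1 +ℕ i) (2 +ℕ j) × Inside i' j' (2 +ℕ i) (2 +ℕ j))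
   h-edge i j with Bool-cases (cells (suc i) (suc (suc j))) | Bool-cases (cells (suc i) (suc j))
   ... | inl a | inl b = inl (∧-both a b)
   ... | inr a | _ = inr (i , suc j , dec-false a , ((≤-refl , s≤s (s≤s (n≤1+n _))) , (≤-refl , s≤s (s≤s (s≤s (n≤1+n _))))) , ((n≤1+n _ , ≤-refl) , (≤-refl , s≤s (s≤s (s≤s (n≤1+n _))))))
   ... | inl _ | inr b = inr (i , j , dec-false b , ((≤-refl , s≤s (s≤s (n≤1+n _))) , (n≤1+n _ , ≤-refl)) , ((n≤1+n _ , ≤-refl) , (n≤1+n _ , ≤-refl)))

   v-edge : ∀ i j → Flanked (suc (suc i)) (suc j) ⊎ Σ[ i' ∈ ℕ ] Σ[ j' ∈ ℕ ] (Empty i' j' × Inside i' j' (2 +ℕ i) (1 +ℕ j) × Inside i' j' (2 +ℕ i) (2 +ℕ j))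
   v-edge i j with Bool-cases (cells (suc (suc i)) (suc j)) | Bool-cases (cells (suc i) (suc j))
   ... | inl a | inl b = inl (∧-both a b)
   ... | inr a | _ = inr (suc i , j , dec-false a , ((≤-refl , s≤s (s≤s (s≤s (n≤1+n _)))) , (≤-refl , s≤s (s≤s (n≤1+n _)))) , ((≤-refl , s≤s (s≤s (s≤s (n≤1+n _)))) , (n≤1+n _ , ≤-refl)))
   ... | inl _ | inr b = inr (i , j , dec-false b , ((n≤1+n _ , ≤-refl) , (≤-refl , s≤s (s≤s (n≤1+n _)))) , ((n≤1+n _ , ≤-refl) , (n≤1+n _ , ≤-refl)))

   InnerX InnerY : ℚ → ℚ → ℕ → Set
   InnerX p q i = (2 <ℕ i × i ≤ℕ size) × (p < X i × X i < q)
   InnerY r s j = (2 <ℕ j × j ≤ℕ size) × (r < Y j × Y j < s)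

   private
    convex : ∀ {x h} → 0ℚ < h → ∀ p q → Convex (λ i → (2 <ℕ i × i ≤ℕ size) × (p < steps x h i × steps x h i < q))
    convex 0<h p q i j k i≤j j≤k ((a , b) , (c , d)) ((a' , b') , (c' , d')) =
     (≤-trans a i≤j , ≤-trans j≤k b') , (<-≤-trans c (steps-≤ 0<h i≤j) , ≤-<-trans (steps-≤ 0<h j≤k) d')

   box-path : ∀ p q r s {i j a b} → InnerX p q i → InnerY r s j → InnerX p q a → InnerY r s b →
    Σ[ L ∈ LPath i j a b ] AllE (λ i j → InnerX p q i × InnerX p q (suc i) × InnerY r s j) (λ i j → InnerX p q i × InnerY r s j × InnerY r s (suc j)) L
   box-path p q r s = rectangular {A = InnerX p q} {B = InnerY r s} (convex 0<hx p q) (convex 0<hy r s)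

   inner-range : ∀ p q r s {i j a b} (L : LPath i j a b) →
    AllE (λ i j → InnerX p q i × InnerX p q (suc i) × InnerY r s j) (λ i j → InnerX p q i × InnerY r s j × InnerY r s (suc j)) L → AllE (InRange (suc size)) (InRange (suc size)) L
   inner-range p q r s = AllE-map (λ i j (a , _ , b) → s≤s (snd (fst a)) , s≤s (snd (fst b))) (λ i j (a , b , _) → s≤s (snd (fst a)) , s≤s (snd (fst b)))

   box-free : ∀ p q r s (χ : Grid) →
    (∀ i j → Empty i j → ∀ a b c d → Inside i j a b → Inside i j c d → pt a b ∈ Box p q r s → pt c d ∈ Box p q r s → χ a b ≡ χ c d) →
    ∀ {i j a b} (L : LPath i j a b) →
    AllE (λ i j → InnerX p q i × InnerX p q (suc i) × InnerY r s j) (λ i j → InnerX p q i × InnerY r s j × InnerY r s (suc j)) L → AllE (Free-H χ) (Free-V χ) L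
   box-free p q r s χ k = AllE-map fh fv
    where
    fh : ∀ i j → InnerX p q i × InnerX p q (suc i) × InnerY r s j → Free-H χ i j
    fh (suc i) (suc (suc j)) (a , b , c) with h-edge i j
    ... | inl x = inr x
    ... | inr (i' , j' , e , x , y) = inl (k i' j' e _ _ _ _ x y (snd a , snd c) (snd b , snd c))
    fh zero j (((() , _) , _) , _)
    fh (suc i) zero (a , b , ((() , _) , _))
    fh (suc i) (suc zero) (a , b , ((s≤s () , _) , _))
    fv : ∀ i j → InnerX p q i × InnerY r s j × InnerY r s (suc j) → Free-V χ i j
    fv (suc (suc i)) (suc j) (a , b , c) with v-edge i j
    ... | inl x = inr x
    ... | inr (i' , j' , e , x , y) = inl (k i' j' e _ _ _ _ x y (snd a , snd b) (snd a , snd c))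
    fv zero j (((() , _) , _) , _)
    fv (suc zero) j (((s≤s () , _) , _) , _)
    fv (suc (suc i)) zero (a , ((() , _) , _) , _)

   indexX : ∀ {i x} → X i ≡ x → la < x → x < ra → 2 <ℕ i × i ≤ℕ size
   indexX refl l r = ℕP.<-trans ≤-refl (steps-<⁻ 0<hx {3} (<-trans lo-x l)) , <⇒≤ (steps-<⁻ 0<hx (<-trans r hi-x))

   indexY : ∀ {j y} → Y j ≡ y → ba < y → y < ta → 2 <ℕ j × j ≤ℕ size
   indexY refl l r = ℕP.<-trans ≤-refl (steps-<⁻ 0<hy {3} (<-trans lo-y l)) , <⇒≤ (steps-<⁻ 0<hy (<-trans r hi-y))

   -- The lattice point with these indices is the centre of an open block of two by two cells
   -- containing `w`. Being open, nearness persists along curves; several lattice points can be near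
   -- the same `w`.
   NearX NearY : ℝ² → ℕ → Set
   NearX w zero = ⊥
   NearX w (suc i) = Between (X i) (X (2 +ℕ i)) (fst w)
   NearY w zero = ⊥
   NearY w (suc j) = Between (Y j) (Y (2 +ℕ j)) (snd w)
   Near : ℝ² → ℕ → ℕ → Set
   Near w i j = NearX w i × NearY w j

   private
    near-convex : ∀ {x h} → 0ℚ < h → ∀ t i j k → i ≤ℕ j → j ≤ℕ k → Between (steps x h i) (steps x h (2 +ℕ i)) t →
     Between (steps x h k) (steps x h (2 +ℕ k)) t → Between (steps x h j) (steps x h (2 +ℕ j)) t
    near-convex 0<h t i j k i≤j j≤k (_ , b) (c , _) = lower-down≤ t (steps-≤ 0<h j≤k) c , upper-up≤ t (steps-≤ 0<h (s≤s (s≤s i≤j))) b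
    nearX-convex : ∀ w → Convex (NearX w)
    nearX-convex w (suc i) (suc j) (suc k) (s≤s a) (s≤s b) = near-convex 0<hx (fst w) i j k a b
    nearY-convex : ∀ w → Convex (NearY w)
    nearY-convex w (suc i) (suc j) (suc k) (s≤s a) (s≤s b) = near-convex 0<hy (snd w) i j k a b

   near-path : ∀ w {i j k l} → Near w i j → Near w k l →
    Σ[ L ∈ LPath i j k l ] AllE (λ i j → Near w i j × Near w (suc i) j) (λ i j → Near w i j × Near w i (suc j)) L
   near-path w (xi , yj) (xk , yl) = let (L , h) = rectangular {A = NearX w} {B = NearY w} (nearX-convex w) (nearY-convex w) xi yj xk yl in
    L , AllE-map (λ _ _ (a , b , c) → (a , c) , (b , c)) (λ _ _ (a , b , c) → (a , b) , (a , c)) L h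

   Hug-H Hug-V : ℕ → ℕ → Set
   Hug-H i j = InRange (suc size) i j × Bordered i j
   Hug-V i j = InRange (suc size) i j × Flanked i j

   module _ (bd : BoundedBy la ra ba ta A) where
    private
     ltX : ∀ w {i} → A w → X i <ˡ fst w → i <ℕ size
     ltX w a l = steps-<⁻ 0<hx (<-trans (lo<up (fst w) l (snd (fst (bd w a)))) hi-x)
     ltY : ∀ w {i} → A w → Y i <ˡ snd w → i <ℕ size
     ltY w a l = steps-<⁻ 0<hy (<-trans (lo<up (snd w) l (snd (snd (bd w a)))) hi-y)
     gtX : ∀ w {i} → A w → fst w <ʳ X i → 3 <ℕ i
     gtX w a l = steps-<⁻ 0<hx (<-trans lo-x (lo<up (fst w) (fst (fst (bd w a))) l))
     gtY : ∀ w {i} → A w → snd w <ʳ Y i → 3 <ℕ i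
     gtY w a l = steps-<⁻ 0<hy (<-trans lo-y (lo<up (snd w) (fst (snd (bd w a))) l))
     up1X : ∀ {i} → X i ≤ X (suc i)
     up1X = ℚP.<⇒≤ (step-< 0<hx)
     up1Y : ∀ {i} → Y i ≤ Y (suc i)
     up1Y = ℚP.<⇒≤ (step-< 0<hy)

    near-exists : ∀ w → A w → Σ[ i ∈ ℕ ] Σ[ j ∈ ℕ ] Near w i j
    near-exists w a = let (i , _ , li , ui) = locate X size (fst w) (<ˡ⇒≤ʳ (fst w) (lower-down (fst w) (≤-<-trans (steps-≤ 0<hx {0} {3} z≤n) lo-x) (fst (fst (bd w a)))))
                           (upper-up (fst w) hi-x (snd (fst (bd w a))))
                          (j , _ , lj , uj) = locate Y size (snd w) (<ˡ⇒≤ʳ (snd w) (lower-down (snd w) (≤-<-trans (steps-≤ 0<hy {0} {3} z≤n) lo-y) (fst (snd (bd w a)))))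
                           (upper-up (snd w) hi-y (snd (snd (bd w a))))
     in i , j , nx i li ui , ny j lj uj
     where
     nx : ∀ i → X i ≤ʳ fst w → fst w <ʳ X (suc i) → NearX w i
     nx zero l u with gtX w {1} a u
     ... | s≤s ()
     nx (suc i) l u = <ˡ-≤ʳ (fst w) (step-< 0<hx) l , u
     ny : ∀ i → Y i ≤ʳ snd w → snd w <ʳ Y (suc i) → NearY w i
     ny zero l u with gtY w {1} a u
     ... | s≤s ()
     ny (suc i) l u = <ˡ-≤ʳ (snd w) (step-< 0<hy) l , u

    near-inner : ∀ w {i j} → A w → Near w i j → (2 <ℕ i × i ≤ℕ size) × (2 <ℕ j × j ≤ℕ size)
    near-inner w {suc i} {suc j} a ((l , u) , (l' , u')) = (≤-pred (gtX w a u) , ltX w a l) , (≤-pred (gtY w a u') , ltY w a l')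

    -- For each cell beside these edges the block around it contains `w`, so the cell is marked.
    hug-near : ∀ w → A w → ∀ {i j k l} → Near w i j → Near w k l → Σ[ L ∈ LPath i j k l ] AllE Hug-H Hug-V L
    hug-near w a {i} {j} {k} {l} (xi , yj) (xk , yl) = let (L , h) = rectangular {A = NearX w} {B = NearY w} (nearX-convex w) (nearY-convex w) xi yj xk yl in
     L , AllE-map hh hv L h
     where
     hh : ∀ i j → NearX w i × NearX w (suc i) × NearY w j → Hug-H i j
     hh (suc i) (suc zero) (_ , _ , (_ , u)) with gtY w {2} a u
     ... | s≤s (s≤s ())
     hh (suc i) (suc (suc j)) ((a1 , b1) , (a2 , b2) , (c , d)) = (s≤s (<⇒≤ (ltX w a a2)) , s≤s (ltY w a c)) ,
      ∧-both (dec-yes (w , a , ((a1 , b2) , (c , upper-up≤ (snd w) (up1Y {3 +ℕ j}) d)))) (dec-yes (w , a , ((a1 , b2) , (lower-down≤ (snd w) (up1Y {j}) c , d))))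
     hv : ∀ i j → NearX w i × NearY w j × NearY w (suc j) → Hug-V i j
     hv (suc zero) j ((_ , u) , _) with gtX w {2} a u
     ... | s≤s (s≤s ())
     hv (suc (suc i)) (suc j) ((c , d) , (a1 , b1) , (a2 , b2)) = (s≤s (ltX w a c) , s≤s (<⇒≤ (ltY w a a2))) ,
      ∧-both (dec-yes (w , a , ((c , upper-up≤ (fst w) (up1X {3 +ℕ i}) d) , (a1 , b2)))) (dec-yes (w , a , ((lower-down≤ (fst w) (up1X {i}) c , d) , (a1 , b2))))

    near-open : ∀ w {i j} → Near w i j → N w (λ u → Near u i j)
    near-open w {suc i} {suc j} (x , y) = nb (X i) (X (2 +ℕ i)) (Y j) (Y (2 +ℕ j)) (x , y) λ u k → k

    near-≈ : ∀ z w {i j} → z ≈² w → Near z i j → Near w i j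
    near-≈ z w {suc i} {suc j} e n = Box-≈ z w {X i} {X (2 +ℕ i)} {Y j} {Y (2 +ℕ j)} e n

    Hugged : ℝ² → ℝ² → Set
    Hugged z w = ∀ i j k l → Near z i j → Near w k l → Σ[ L ∈ LPath i j k l ] AllE Hug-H Hug-V L

    hugged-trans : ∀ z w v → A w → Hugged z w → Hugged w v → Hugged z v
    hugged-trans z w v a h k i j i' j' n m = let (x , y , nw) = near-exists w a; (L , hL) = h i j x y n nw; (K , hK) = k x y i' j' nw m in L ⊙ K , AllE-⊙ L hL hK

    -- Induction along the curve: the existence of hugging paths is locally constant in `t`, since
    -- nearby points of the curve are near a common lattice point.
    hugged-curve : ∀ e {l r} → l < r → (∀ t → In l r t → A (curve e t)) → ∀ s t → In l r s → In l r t → Hugged (curve e s) (curve e t)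
    hugged-curve e {l} {r} l<r on s t is it = dec-true (trans (sym same) (dec-yes λ i j k l n m → hug-near (curve e s) (on s is) n m))
     where
     same : dec (Hugged (curve e s) (curve e s)) ≡ dec (Hugged (curve e s) (curve e t))
     same = locally-constant l<r (λ t → dec (Hugged (curve e s) (curve e t))) (λ t it →
      let (x , y , nt) = near-exists (curve e t) (on t it) in
      Nb-map (λ u nu iu → dec-⇔
       (λ h → hugged-trans (curve e s) (curve e u) (curve e t) (on u iu) h (link u t x y (on u iu) (on t it) nu nt))
       (λ h → hugged-trans (curve e s) (curve e t) (curve e u) (on t it) h (link t u x y (on t it) (on u iu) nt nu)))
      (curve-cont e t (near-open (curve e t) nt))) s t is it
      where
      link : ∀ u t x y → A (curve e u) → A (curve e t) → Near (curve e u) x y → Near (curve e t) x y → Hugged (curve e u) (curve e t)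
      link u t x y au at nu nt i j k l n m = let (L , hL) = hug-near (curve e u) au n nu; (K , hK) = hug-near (curve e t) at nt m in L ⊙ K , AllE-⊙ L hL hK

  whole-graph : List E → Stubbed
  whole-graph H = record
   { H = H ; VH = λ _ → ⊤ ; ends = λ _ → tt , tt ; lo = λ _ → third ; hi = λ _ → two-thirds
   ; 0<lo = λ _ → positive⁻¹ third ; lo<hi = λ _ → lemma ; hi<1 = λ _ → lemma'
   ; arcs = map (λ e → e , 0ℚ , 1ℚ) H ; kind = λ i → case ∈-map⁻ (λ e → e , 0ℚ , 1ℚ) i of λ { (e , j , refl) → whole j } }
   where
   open import Relation.Nullary.Decidable using (toWitness)
   lemma : third < two-thirds
   lemma = toWitness {a? = third ℚP.<? two-thirds} tt
   lemma' : two-thirds < 1ℚ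
   lemma' = toWitness {a? = two-thirds ℚP.<? 1ℚ} tt

  record Unencircled : Set₁ where
   constructor unencircled
   field
    H : List E
    px py : ℚ
    {la ra ba ta} : ℚ
    p∉ : ¬ On H (ι px , ι py)
    bd : BoundedBy la ra ba ta (On H)
    p∈ : (ι px , ι py) ∈ Box la ra ba ta
    astray : ¬ Encircled H (ι px , ι py)

  module Escape (lost : Unencircled) where
   open Unencircled lost

   p1 : la < px
   p1 = fst (fst p∈)
   p2 : px < ra
   p2 = snd (fst p∈)
   p3 : ba < py
   p3 = fst (snd p∈)
   p4 : py < ta
   p4 = snd (snd p∈)
   p q : ℝ²
   p = ι px , ι py
   -- Below the box, where no closed walk in `H` winds, and moved sideways because a lattice
   -- requires distinct abscissas.
   qx qy : ℚ
   qx = px + 1ℚ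
   qy = ba - 1ℚ
   q = ι qx , ι qy
   q-out : ¬ (q ∈ Box la ra ba ta)
   q-out (_ , (l , _)) = <-asym l (p-1<p ba)
   S : Stubbed
   S = whole-graph H
   open Stubbed S using (A; A-closed; A-≈; arcs)
   full : ∀ e → e ∈ˡ H → (e , 0ℚ , 1ℚ) ∈ˡ arcs
   full e i = ∈-map⁺ _ i
   A⇒On : ∀ {z} → A z → On H z
   A⇒On (_ , i , o) with ∈-map⁻ (λ e → e , 0ℚ , 1ℚ) i
   ... | e , j , refl = e , j , o
   bdA : BoundedBy la (ra + 1ℚ) (qy - 1ℚ) ta A
   bdA z a = Box-mono z {la} {ra + 1ℚ} {qy - 1ℚ} {ta} {la} {ra} {ba} {ta} ℚP.≤-refl (ℚP.<⇒≤ (p<p+1 ra)) (ℚP.<⇒≤ (<-trans (p-1<p qy) (p-1<p ba))) ℚP.≤-refl (bd z (A⇒On a))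
   q∉ : ¬ A q
   q∉ a = q-out (bd q (A⇒On a))
   same : SameWinding H p q
   same W wi = trans (≢true (λ odd → astray (_ , _ , W , wi , odd)))
    (sym (wind-outside {a = la} {ra} {ba} {ta} W (λ { z (e , i , o) → bd z (e , wi e i , o) }) q-out))
   sec = section-exists S full p q (λ a → p∉ (A⇒On a)) q∉ same
   module Use (Λ : Lattice A (λ _ _ _ _ → ⊤) (frame px py qx qy la (ra + 1ℚ) (qy - 1ℚ) ta)) where
    open Lattice Λ
    open LatticeTools Λ
    χ : Grid
    χ i j = dec (Chain (On H) p (pt i j))
    const : ∀ i j → Empty i j → ∀ a b c d → Inside i j a b → Inside i j c d → χ a b ≡ χ c d
    const i j e a b c d h k = dec-⇔ (λ x → extend _ _ _ _ x miss (inside-block {i} {j} {a} {b} h) (inside-block {i} {j} {c} {d} k)) (λ x → extend _ _ _ _ x miss (inside-block {i} {j} {c} {d} k) (inside-block {i} {j} {a} {b} h))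
     where
     miss : Misses (On H) (X i) (X (3 +ℕ i)) (Y j) (Y (3 +ℕ j))
     miss z (e' , m , o) zi = e (z , (_ , full e' m , o) , zi)
    ip∈ : InnerX la (ra + 1ℚ) ip
    ip∈ = indexX at-px p1 (<-trans p2 (p<p+1 ra)) , subst (λ x → la < x × x < ra + 1ℚ) (sym at-px) (p1 , <-trans p2 (p<p+1 ra))
    iq∈ : InnerX la (ra + 1ℚ) iq
    iq∈ = let h = <-trans p1 (p<p+1 px); k = ℚP.+-monoˡ-< 1ℚ p2 in indexX at-qx h k , subst (λ x → la < x × x < ra + 1ℚ) (sym at-qx) (h , k)
    jp∈ : InnerY (qy - 1ℚ) ta jp
    jp∈ = let h = <-trans (p-1<p qy) (<-trans (p-1<p ba) p3) in indexY at-py h p4 , subst (λ y → qy - 1ℚ < y × y < ta) (sym at-py) (h , p4)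
    jq∈ : InnerY (qy - 1ℚ) ta jq
    jq∈ = let h = p-1<p qy; k = <-trans (p-1<p ba) (<-trans p3 p4) in indexY at-qy h k , subst (λ y → qy - 1ℚ < y × y < ta) (sym at-qy) (h , k)
    path = box-path la (ra + 1ℚ) (qy - 1ℚ) ta ip∈ jp∈ iq∈ jq∈
    equal : χ ip jp ≡ χ iq jq
    equal = duality χ (fst path) (inner-range la (ra + 1ℚ) (qy - 1ℚ) ta (fst path) (snd path))
     (λ i j _ i' j' _ _ _ _ e → const i' j' e)
     (box-free la (ra + 1ℚ) (qy - 1ℚ) ta χ (λ i j e a b c d h k _ _ → const i j e a b c d h k) (fst path) (snd path))
    chain : Chain (On H) p q
    chain = subst (Chain (On H) p) (cong₂ (λ x y → ι x , ι y) at-qx at-qy)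
     (dec-true (trans (sym equal) (dec-yes (subst (Chain (On H) p) (sym (cong₂ (λ x y → ι x , ι y) at-px at-py)) start))))
   chain : Chain (On H) p q
   chain = Use.chain (lattice (separable A-closed A-≈ (<-trans (<-trans p1 p2) (p<p+1 ra)) (<-trans (p-1<p qy) (<-trans (p-1<p ba) (<-trans p3 p4))) bdA
    (λ e → <-irrefl e (p<p+1 px)) (λ e → <-irrefl (sym e) (<-trans (p-1<p ba) p3)) (λ a → p∉ (A⇒On a)) q∉ (fst sec) (snd sec)
    (record { mono = λ _ _ _ _ _ → tt ; local = λ z → let nb a b c d i _ = N-all {z = z} {P = λ _ → ⊤} (λ _ → tt) in a , b , c , d , i , tt })))

  -- If no closed walk in `H` winds around `p`, then none separates `p` from a point below the box,
  -- and the double cover branched at both is trivial over `H`. Duality, applied to reachability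
  -- from `p` by boxes missing `H`, carries reachability to that point.
  encircled-or-escapes : ∀ H px py {la ra ba ta} (let p = ι px , ι py) → ¬ On H p → BoundedBy la ra ba ta (On H) → p ∈ Box la ra ba ta →
   (Encircled H p) ⊎
   (Σ[ w ∈ ℝ² ] (¬ (w ∈ Box la ra ba ta) × Chain (On H) p w))
  encircled-or-escapes H px py p∉ bd p∈ = by (em _)
   where
   by : Dec (Encircled H (ι px , ι py)) → _
   by (yes x) = inl x
   by (no none) = inr (q , q-out , chain)
    where open Escape (unencircled H px py p∉ bd p∈ none) using (q; q-out; chain)

 open LatticeTracing

 -- Following the boundary of a face

 module FaceSeparation where
  open LatticePaths
  open LatticeDuality
  open Sections

  private variable
   ℓ : Level
   u v : V
   n : ℕ

  -- Recorded as rides along arcs, each of which is later replaced by a hugging lattice path.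
  data Route (arcs : List (E × ℚ × ℚ)) (z : ℝ²) : ℝ² → Set₁ where
   stay : ∀ {w} → z ≈² w → Route arcs z w
   ride : ∀ {w v e l r} → Route arcs z w → (e , l , r) ∈ˡ arcs → ∀ s t → In l r s → In l r t →
    curve e s ≈² w → curve e t ≈² v → Route arcs z v

  rational-in : ∀ {p q} (x : ℝ) → Between p q x → ∃[ m ] (p < m × m < q)
  rational-in x (a , b) = <-dense (lo<up x a b)

  rational-in-≢ : ∀ {p q} (x : ℝ) y → Between p q x → ∃[ m ] (y ≢ m × p < m × m < q)
  rational-in-≢ x y i with rational-in x i
  ... | m , a , b with y ℚP.≟ m
  ...   | no n = m , n , a , b
  ...   | yes refl = let (k , c , d) = <-dense a in k , (λ e → <-irrefl (sym e) d) , c , <-trans d b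

  meet : ∀ {p q r s p' q' r' s'} z → z ∈ Box p q r s → z ∈ Box p' q' r' s' → z ∈ Box (p ℚ.⊔ p') (q ⊓ q') (r ℚ.⊔ r') (s ⊓ s')
  meet {p} {q} {r} {s} {p'} {q'} {r'} {s'} z i j = Box-∩ z {p} {q} {r} {s} {p'} {q'} {r'} {s'} i j

  meet-l : ∀ {p q r s p' q' r' s'} z → z ∈ Box (p ℚ.⊔ p') (q ⊓ q') (r ℚ.⊔ r') (s ⊓ s') → z ∈ Box p q r s
  meet-l {p} {q} {r} {s} {p'} {q'} {r'} {s'} z = Box-mono z {p} {q} {r} {s} (p≤p⊔q p p') (p⊓q≤p q q') (p≤p⊔q r r') (p⊓q≤p s s')

  meet-r : ∀ {p q r s p' q' r' s'} z → z ∈ Box (p ℚ.⊔ p') (q ⊓ q') (r ℚ.⊔ r') (s ⊓ s') → z ∈ Box p' q' r' s'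
  meet-r {p} {q} {r} {s} {p'} {q'} {r'} {s'} z = Box-mono z {p'} {q'} {r'} {s'} (p≤q⊔p p p') (p⊓q≤q q q') (p≤q⊔p r r') (p⊓q≤q s s')

  -- The face of z cannot be lost sight of when following its boundary: if A is a connected part of the
  -- graph such that near A the face is bounded by A alone, then the face is seen from all of A,
  -- unless A separates it from some part of A.
  record Sight : Set₂ where
   constructor sight
   field
    S : Stubbed
   open Stubbed S public
   field
    full : ∀ e → e ∈ˡ H → (e , 0ℚ , 1ℚ) ∈ˡ arcs
    z0 : ℝ²
    z0∉ : Complement G z0
    local : ∀ w → A w → N w (λ u → OnGraph u → A u) ⊎ N w (λ u → ¬ Face G z0 u)
    a : ℝ²
    a∈A : A a
    a-seen : Closure (Face G z0) a
    b b' : ℝ²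
    b∈A : A b
    b'∉A : ¬ A b'
    b1 b2 b3 b4 : ℚ
    b∈B : b ∈ Box b1 b2 b3 b4
    b'∈B : b' ∈ Box b1 b2 b3 b4
    B-dark : ∀ u → u ∈ Box b1 b2 b3 b4 → ¬ Face G z0 u
    route : Route arcs a b
    same-wind : SameWinding H z0 b'

  module FaceLemma (seen : Sight) where
   open Sight seen
   private
    F : Pred ℝ² _
    F = Face G z0

    A⇒graph : ∀ {w} → A w → OnGraph w
    A⇒graph ((e , l , r) , _ , o) = onEdge⇒graph {e} {l} {r} o

    face-off : ∀ {w} → F w → ¬ OnGraph w
    face-off {w} f (x , eq) = component-⊆ f x eq

    same-face : ∀ {p q r s u v} → (∀ w → w ∈ Box p q r s → ¬ OnGraph w) → u ∈ Box p q r s → v ∈ Box p q r s → dec (F u) ≡ dec (F v)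
    same-face {p} {q} {r} {s} {u} {v} off i j = dec-⇔ (box-in-component {p = p} {q} {r} {s} (λ {w} k x eq → off w k (x , eq)) {w = u} {v} i j)
     (box-in-component {p = p} {q} {r} {s} (λ {w} k x eq → off w k (x , eq)) {w = v} {u} j i)

    -- A point of the face close to `a` with rational coordinates, which can therefore become a
    -- lattice point.
    record Viewpoint : Set₂ where
     field
      p1 p2 p3 p4 : ℚ
      a-in : a ∈ Box p1 p2 p3 p4
      clear : ∀ w → w ∈ Box p1 p2 p3 p4 → OnGraph w → A w
      qx qy : ℚ
      q-in : (ι qx , ι qy) ∈ Box p1 p2 p3 p4
      q-F : F (ι qx , ι qy)

    abstract
     viewpoint : Viewpoint
     viewpoint = go (local a a∈A)
      where
      go : N a (λ u → OnGraph u → A u) ⊎ N a (λ u → ¬ Face G z0 u) → Viewpoint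
      go (inr n) = let (w , f , k) = closure-meets a-seen n in ⊥-elim (k f)
      go (inl n@(nb p1 p2 p3 p4 i clear)) =
       let (w , f , k) = closure-meets a-seen (nb {P = λ w → w ∈ Box p1 p2 p3 p4} p1 p2 p3 p4 i λ _ j → j)
       in at w f (N-∩ (A-closed w (λ aw → face-off f (A⇒graph aw))) (nb {P = λ w → w ∈ Box p1 p2 p3 p4} p1 p2 p3 p4 k λ _ j → j))
       where
       at : ∀ w → F w → N w (λ u → ¬ A u × u ∈ Box p1 p2 p3 p4) → Viewpoint
       at w f (nb c1 c2 c3 c4 j off) = view (rational-in (fst w) (fst j)) (rational-in (snd w) (snd j))
        where
        view : ∃[ x ] (c1 < x × x < c2) → ∃[ y ] (c3 < y × y < c4) → Viewpoint
        view (x , x∈) (y , y∈) = record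
         { p1 = p1 ; p2 = p2 ; p3 = p3 ; p4 = p4 ; a-in = i ; clear = clear ; qx = x ; qy = y ; q-in = snd (off (ι x , ι y) (x∈ , y∈))
         ; q-F = box-in-component {p = c1} {c2} {c3} {c4} (λ {u} m v eq → fst (off u m) (clear u (snd (off u m)) (v , eq))) {w = w} {ι x , ι y} j (x∈ , y∈) f }
    open Viewpoint viewpoint

    -- A rational substitute for `b'` in the dark box; both of its coordinates avoid those of the
    -- viewpoint, as a lattice requires.
    record Hidden : Set₁ where
     field
      rx ry : ℚ
      qx≢rx : qx ≢ rx
      qy≢ry : qy ≢ ry
      r-in : (ι rx , ι ry) ∈ Box b1 b2 b3 b4
      r∉A : ¬ A (ι rx , ι ry)
      same-b' : SameWinding H b' (ι rx , ι ry)

    abstract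
     hidden : Hidden
     hidden = let nb c1 c2 c3 c4 j off = N-∩ (A-closed b' b'∉A) (nb {P = λ w → w ∈ Box b1 b2 b3 b4} b1 b2 b3 b4 b'∈B λ _ j → j)
                  (x , ne , x1 , x2) = rational-in-≢ (fst b') qx (fst j); (y , ne' , y1 , y2) = rational-in-≢ (snd b') qy (snd j)
                  r∈ = (x1 , x2) , (y1 , y2)
      in record { rx = x ; ry = y ; qx≢rx = ne ; qy≢ry = ne' ; r-in = snd (off (ι x , ι y) r∈) ; r∉A = fst (off (ι x , ι y) r∈)
       ; same-b' = λ {u} W h → sym (trans (wind-move {a = c1} {c2} {c3} {c4} {b'} {ι x , ι y} W j r∈ (λ { w k (e , i , o) → fst (off w k) (_ , full e (h e i) , o) }))
        (cong (_xor wind b' W) (xor-same (at-vertex (shift b' (ι x , ι y)) u)))) }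
    open Hidden hidden

    q r : ℝ²
    q = ι qx , ι qy
    r = ι rx , ι ry

    q∉A : ¬ A q
    q∉A aq = face-off q-F (A⇒graph aq)

    sec = section-exists S full q r q∉A r∉A (λ W h → trans (sym (wind-component W q-F)) (trans (same-wind W h) (same-b' W h)))

    User : ℚ → ℚ → ℚ → ℚ → Set₂
    User a1 a2 a3 a4 = ((∀ w → w ∈ Box a1 a2 a3 a4 → OnGraph w → A w) ⊎ (∀ w → w ∈ Box a1 a2 a3 a4 → ¬ F w) ⊎ (∀ w → w ∈ Box a1 a2 a3 a4 → ¬ A w)) ×
     ((a ∈ Box a1 a2 a3 a4 → (p1 ≤ a1 × a2 ≤ p2) × (p3 ≤ a3 × a4 ≤ p4)) × (b ∈ Box a1 a2 a3 a4 → (b1 ≤ a1 × a2 ≤ b2) × (b3 ≤ a3 × a4 ≤ b4)))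

    local-small : ∀ c {c1 c2 c3 c4} → c ∈ Box c1 c2 c3 c4 → Local (λ a1 a2 a3 a4 → c ∈ Box a1 a2 a3 a4 → (c1 ≤ a1 × a2 ≤ c2) × (c3 ≤ a3 × a4 ≤ c4))
    local-small c {c1} {c2} {c3} {c4} c∈ = record
     { mono = λ {p} {q} {r} {s} {p'} {q'} {r'} {s'} h1 h2 h3 h4 f k → let ((x , y) , (z , w)) = f (Box-mono c {p} {q} {r} {s} {p'} {q'} {r'} {s'} h1 h2 h3 h4 k) in
      (ℚP.≤-trans x h1 , ℚP.≤-trans h2 y) , (ℚP.≤-trans z h3 , ℚP.≤-trans h4 w)
     ; local = λ z → case em _ {z ≈² c} of λ
      { (yes eq) → c1 , c2 , c3 , c4 , Box-≈ c z {c1} {c2} {c3} {c4} (≈²-sym z c eq) c∈ , λ _ → (ℚP.≤-refl , ℚP.≤-refl) , (ℚP.≤-refl , ℚP.≤-refl)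
      ; (no ne) → let (P , n , m) = separate c z (λ eq → ne (≈²-sym c z eq)); (d1 , d2 , d3 , d4 , i , f) = N-local {z = z} m in
       d1 , d2 , d3 , d4 , i , λ k → ⊥-elim (f c k (N-here n)) } }

    local-user : Local User
    local-user = local-× (record
     { mono = λ {p} {q} {r} {s} {p'} {q'} {r'} {s'} h1 h2 h3 h4 → λ
      { (inl f) → inl λ w k → f w (Box-mono w {p} {q} {r} {s} {p'} {q'} {r'} {s'} h1 h2 h3 h4 k)
      ; (inr (inl f)) → inr (inl λ w k → f w (Box-mono w {p} {q} {r} {s} {p'} {q'} {r'} {s'} h1 h2 h3 h4 k))
      ; (inr (inr f)) → inr (inr λ w k → f w (Box-mono w {p} {q} {r} {s} {p'} {q'} {r'} {s'} h1 h2 h3 h4 k)) }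
     ; local = loc }) (local-× (local-small a a-in) (local-small b b∈B))
     where
     Goal : ℝ² → Set₂
     Goal z = ∃[ p ] ∃[ q ] ∃[ r ] ∃[ s ] (z ∈ Box p q r s ×
      ((∀ w → w ∈ Box p q r s → OnGraph w → A w) ⊎ (∀ w → w ∈ Box p q r s → ¬ F w) ⊎ (∀ w → w ∈ Box p q r s → ¬ A w)))
     loc : ∀ z → Goal z
     go : ∀ z → N z (λ u → OnGraph u → A u) ⊎ N z (λ u → ¬ Face G z0 u) → Goal z
     go z (inl n) = let (p , q , r , s , i , f) = N-local {z = z} n in p , q , r , s , i , inl f
     go z (inr n) = let (p , q , r , s , i , f) = N-local {z = z} n in p , q , r , s , i , inr (inl f)
     begin : ∀ z → Dec (A z) → Goal z
     begin z (no n) = let (p , q , r , s , i , f) = N-local {z = z} (A-closed z n) in p , q , r , s , i , inr (inr f)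
     begin z (yes az) = go z (local z az)
     loc z = begin z (em _)

    record Bounds : Set₁ where
     field
      la ra ba ta : ℚ
      bdA : BoundedBy la ra ba ta A
      q-bd : q ∈ Box la ra ba ta
      r-bd : r ∈ Box la ra ba ta

    abstract
     bounds : Bounds
     bounds = let (a1 , a2 , a3 , a4 , f) = bounded (map fst arcs)
                  nb q1 q2 q3 q4 qi _ = N-all {z = q} {P = λ _ → ⊤} (λ _ → tt)
                  nb r1 r2 r3 r4 ri _ = N-all {z = r} {P = λ _ → ⊤} (λ _ → tt)
      in record
      { bdA = λ z (_ , i , o) → widen {a1} {a2} {a3} {a4} z (inl (f z (_ , ∈-map⁺ fst i , whole-arc i o)))
      ; q-bd = widen {a1} {a2} {a3} {a4} q (inr (widen {q1} {q2} {q3} {q4} {r1} {r2} {r3} {r4} q (inl qi)))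
      ; r-bd = widen {a1} {a2} {a3} {a4} r (inr (widen {q1} {q2} {q3} {q4} {r1} {r2} {r3} {r4} r (inr ri))) }
      where
      whole-arc : ∀ {e l r z} → (e , l , r) ∈ˡ arcs → Arc e l r z → OnEdge e z
      whole-arc {e} i o with kind i
      ... | whole _ = o
      ... | out _ _ = arc-mono ℚP.≤-refl (ℚP.<⇒≤ (lo<1 e)) o
      ... | into _ _ = arc-mono (ℚP.<⇒≤ (0<hi e)) ℚP.≤-refl o
    open Bounds bounds

    module Use (Λ : Lattice A User (frame qx qy rx ry la ra ba ta)) where
     open Lattice Λ
     open LatticeTools Λ

     χ : Grid
     χ i j = dec (F (pt i j))

     good-at : ∀ w i j → A w → w ∈ Block 4 i j → User (X i) (X (4 +ℕ i)) (Y j) (Y (4 +ℕ j))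
     good-at w i j aw ((x1 , x2) , (y1 , y2)) = let ((a1 , a2) , (a3 , a4)) = bdA w aw in
      good i j (lo<up (fst w) a1 x2) (lo<up (fst w) x1 a2) (lo<up (snd w) a3 y2) (lo<up (snd w) y1 a4)

     near-const : Constant-near χ
     near-const i j (w , aw , wi) i' j' h1 h2 h3 h4 e a b c d k l = go (fst (good-at w i j aw wi))
      where
      bigger : ∀ u → u ∈ Block 3 i' j' → u ∈ Block 4 i j
      bigger u = Box-mono u {X i} {X (4 +ℕ i)} {Y j} {Y (4 +ℕ j)} {X i'} {X (3 +ℕ i')} {Y j'} {Y (3 +ℕ j')}
       (steps-≤ 0<hx h1) (steps-≤ 0<hx (s≤s (s≤s (s≤s h2)))) (steps-≤ 0<hy h3) (steps-≤ 0<hy (s≤s (s≤s (s≤s h4))))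
      ab : pt a b ∈ Block 3 i' j'
      ab = inside-block {i'} {j'} {a} {b} k
      cd : pt c d ∈ Block 3 i' j'
      cd = inside-block {i'} {j'} {c} {d} l
      go : _ → χ a b ≡ χ c d
      go (inl f) = same-face {X i'} {X (3 +ℕ i')} {Y j'} {Y (3 +ℕ j')} {pt a b} {pt c d} (λ u m g → e (u , f u (bigger u m) g , m)) ab cd
      go (inr (inl f)) = trans (dec-no (f (pt a b) (bigger (pt a b) ab))) (sym (dec-no (f (pt c d) (bigger (pt c d) cd))))
      go (inr (inr f)) = ⊥-elim (f w wi aw)

     view-const : ∀ i j → Empty i j → ∀ a b c d → Inside i j a b → Inside i j c d → pt a b ∈ Box p1 p2 p3 p4 → pt c d ∈ Box p1 p2 p3 p4 → χ a b ≡ χ c d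
     view-const i j e a b c d k l m n = same-face {X i ℚ.⊔ p1} {X (3 +ℕ i) ⊓ p2} {Y j ℚ.⊔ p3} {Y (3 +ℕ j) ⊓ p4} {pt a b} {pt c d}
      (λ u w g → e (u , clear u (meet-r {X i} {X (3 +ℕ i)} {Y j} {Y (3 +ℕ j)} {p1} {p2} {p3} {p4} u w) g , meet-l {X i} {X (3 +ℕ i)} {Y j} {Y (3 +ℕ j)} {p1} {p2} {p3} {p4} u w))
      (meet {X i} {X (3 +ℕ i)} {Y j} {Y (3 +ℕ j)} {p1} {p2} {p3} {p4} (pt a b) (inside-block {i} {j} {a} {b} k) m)
      (meet {X i} {X (3 +ℕ i)} {Y j} {Y (3 +ℕ j)} {p1} {p2} {p3} {p4} (pt c d) (inside-block {i} {j} {c} {d} l) n)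

     near-in : ∀ c {c1 c2 c3 c4} → A c → (∀ i j → c ∈ Block 4 i j → (c1 ≤ X i × X (4 +ℕ i) ≤ c2) × (c3 ≤ Y j × Y (4 +ℕ j) ≤ c4)) →
      ∀ {i j} → Near c i j → InnerX c1 c2 i × InnerY c3 c4 j
     near-in c ac small {suc i} {suc j} n@((x1 , x2) , (y1 , y2)) =
      let (ix , iy) = near-inner bdA c {suc i} {suc j} ac n
          up : ∀ {x h} → 0ℚ < h → ∀ i → steps x h (2 +ℕ i) ≤ steps x h (4 +ℕ i)
          up 0<h i = steps-≤ 0<h (m≤n+m (2 +ℕ i) 2)
          ((k1 , k2) , (k3 , k4)) = small i j ((x1 , upper-up≤ (fst c) (up 0<hx i) x2) , (y1 , upper-up≤ (snd c) (up 0<hy j) y2))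
      in (ix , (≤-<-trans k1 (step-< 0<hx) , <-≤-trans (steps-< 0<hx (s≤s (s≤s (m≤n+m i 2)))) k2)) ,
       (iy , (≤-<-trans k3 (step-< 0<hy) , <-≤-trans (steps-< 0<hy (s≤s (s≤s (m≤n+m j 2)))) k4))

     routed : ∀ {w} → Route arcs a w → Hugged bdA a w
     routed {w} (stay eq) i j k l n m = hug-near bdA w (A-≈ a w eq a∈A) (near-≈ bdA a w eq n) m
     routed {v} (ride {w} {v} {e} {l} {r} ρ i s t is it es et) = hugged-trans bdA a w v (w∈ es) (routed ρ)
      λ i' j' k' l' n m → hugged-curve bdA e (proper i) (λ t it → _ , i , arc t it (≈²-refl (curve e t))) s t is it i' j' k' l'
       (near-≈ bdA w (curve e s) (≈²-sym (curve e s) w es) n) (near-≈ bdA v (curve e t) (≈²-sym (curve e t) v et) m)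
      where
      w∈ : ∀ {w} → curve e s ≈² w → A w
      w∈ es = _ , i , arc s is es

     Clear-path : ℕ → ℕ → ℕ → ℕ → Set
     Clear-path i j k l = Σ[ L ∈ LPath i j k l ] (AllE (InRange (suc size)) (InRange (suc size)) L × AllE (Free-H χ) (Free-V χ) L)

     clear-⊙ : ∀ {i j k l m n} → Clear-path i j k l → Clear-path k l m n → Clear-path i j m n
     clear-⊙ (L , r , h) (K , s , k) = L ⊙ K , AllE-⊙ L r s , AllE-⊙ L h k

     q-inner : InnerX p1 p2 ip × InnerY p3 p4 jp
     q-inner = (indexX at-px (fst (fst q-bd)) (snd (fst q-bd)) , subst (λ x → p1 < x × x < p2) (sym at-px) (fst q-in)) ,
      (indexY at-py (fst (snd q-bd)) (snd (snd q-bd)) , subst (λ x → p3 < x × x < p4) (sym at-py) (snd q-in))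

     r-inner : InnerX b1 b2 iq × InnerY b3 b4 jq
     r-inner = (indexX at-qx (fst (fst r-bd)) (snd (fst r-bd)) , subst (λ x → b1 < x × x < b2) (sym at-qx) (fst r-in)) ,
      (indexY at-qy (fst (snd r-bd)) (snd (snd r-bd)) , subst (λ x → b3 < x × x < b4) (sym at-qy) (snd r-in))

     to-a : ∀ {i j} → InnerX p1 p2 i × InnerY p3 p4 j → Clear-path ip jp i j
     to-a (x , y) = finish (box-path p1 p2 p3 p4 (fst q-inner) (snd q-inner) x y)
      where
      finish : _ → Clear-path ip jp _ _
      finish (L , h) = L , inner-range p1 p2 p3 p4 L h , box-free p1 p2 p3 p4 χ view-const L h

     from-b : ∀ {i j} → InnerX b1 b2 i × InnerY b3 b4 j → Clear-path i j iq jq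
     from-b (x , y) = finish (box-path b1 b2 b3 b4 x y (fst r-inner) (snd r-inner))
      where
      finish : _ → Clear-path _ _ iq jq
      finish (L , h) = L , inner-range b1 b2 b3 b4 L h ,
       box-free b1 b2 b3 b4 χ (λ _ _ _ a b c d _ _ m n → trans (dec-no (B-dark (pt a b) m)) (sym (dec-no (B-dark (pt c d) n)))) L h

     along : ∀ {i j k l} → Near a i j → Near b k l → Clear-path i j k l
     along {i} {j} {k} {l} n m = finish (routed route i j k l n m)
      where
      finish : _ → Clear-path i j k l
      finish (L , h) = L , AllE-map (λ _ _ → fst) (λ _ _ → fst) L h , AllE-map (λ _ _ h → inr (snd h)) (λ _ _ h → inr (snd h)) L h

     a-inner : ∀ {i j} → Near a i j → InnerX p1 p2 i × InnerY p3 p4 j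
     a-inner = near-in a {p1} {p2} {p3} {p4} a∈A λ i j k → fst (snd (good-at a i j a∈A k)) k

     b-inner : ∀ {i j} → Near b i j → InnerX b1 b2 i × InnerY b3 b4 j
     b-inner = near-in b {b1} {b2} {b3} {b4} b∈A λ i j k → snd (snd (good-at b i j b∈A k)) k

     unchanged : Clear-path ip jp iq jq → χ ip jp ≡ χ iq jq
     unchanged (L , r , h) = duality χ L r near-const h

     seen-q : χ ip jp ≡ true
     seen-q = trans (cong₂ (λ x y → dec (F (ι x , ι y))) at-px at-py) (dec-yes q-F)

     unseen-r : χ iq jq ≡ false
     unseen-r = trans (cong₂ (λ x y → dec (F (ι x , ι y))) at-qx at-qy) (dec-no (B-dark r r-in))

     contradiction : ⊥
     contradiction = go (near-exists bdA a a∈A) (near-exists bdA b b∈A)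
      where
      go : Σ[ i ∈ ℕ ] Σ[ j ∈ ℕ ] Near a i j → Σ[ i ∈ ℕ ] Σ[ j ∈ ℕ ] Near b i j → ⊥
      go (i , j , n) (k , l , m) = true≢false (trans (sym seen-q)
       (trans (unchanged (clear-⊙ (to-a (a-inner n)) (clear-⊙ (along n m) (from-b (b-inner m))))) unseen-r))

   -- Let `χ` be membership in the face. The lattice path leads from `q` to `a` within the clear
   -- box, follows `A` from `a` to `b`, and ends at `r` within the dark box. As no closed walk in
   -- `H` separates `q` from `r`, duality makes `χ` agree there, although `q` is in the face and `r`
   -- is not.
   face-lemma : ⊥
   face-lemma = Use.contradiction (lattice (separable A-closed A-≈ (<-trans (fst (fst q-bd)) (snd (fst q-bd))) (<-trans (fst (snd q-bd)) (snd (snd q-bd))) bdA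
    qx≢rx qy≢ry q∉A r∉A (fst sec) (snd sec) local-user))

 open FaceSeparation

 -- Edges that leave the boundary of a face

 module FaceGaps where
  open LatticePaths
  open Sections

  private variable
   ℓ ℓ' : Level
   u v : V
   n : ℕ

  abstract
   select : ∀ {A : Set ℓ} (P : A → Set ℓ') (xs : List A) →
    Σ[ ys ∈ List A ] ((∀ {x} → x ∈ˡ ys → x ∈ˡ xs × P x) × (∀ {x} → x ∈ˡ xs → P x → x ∈ˡ ys))
   select P [] = [] , (λ ()) , λ ()
   select P (x ∷ xs) with select P xs | em _ {P x}
   ... | ys , f , g | yes p = x ∷ ys , (λ { (here refl) → here refl , p ; (there i) → let (j , q) = f i in there j , q }) ,
    (λ { (here refl) _ → here refl ; (there i) q → there (g i q) })
   ... | ys , f , g | no n = ys , (λ i → let (j , q) = f i in there j , q) , (λ { (here refl) q → ⊥-elim (n q) ; (there i) q → g i q })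

  Incident : E → V → Set
  Incident e v = IncidentTo graph v e

  Stars : (V → List E) → Set
  Stars star = ∀ {e v} → Incident e v → e ∈ˡ star v

  -- In both directions of the theorem this follows from an isoperimetric inequality whose bound
  -- vanishes for sets without boundary.
  NoFiniteComponent : Set
  NoFiniteComponent = ∀ (vs : List V) {v} → v ∈ˡ vs → Σ[ x ∈ V ] Σ[ y ∈ V ] (x ∈ˡ vs × ¬ (y ∈ˡ vs) × Adj graph x y)

  FaceLists : Set₂
  FaceLists = ∀ z → Complement G z → Σ[ H0 ∈ List E ] (∀ e → e ∈ˡ H0 ⇔ BoundaryEdge G z e)

  joins-incident : ∀ {e} → Joins e u v → Incident e u × Incident e v
  joins-incident (inl (p , q)) = inl p , inr q
  joins-incident (inr (p , q)) = inr q , inl p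

  walk-vertex : ∀ {H} → Linked H u v → u ≡ v ⊎ Σ[ e ∈ E ] (e ∈ˡ H × Incident e v)
  walk-vertex {H = H} (_ , W , h) = go W h
   where
   go : ∀ {u v n} (W : W[ u , v ] n) → Within H W → u ≡ v ⊎ Σ[ e ∈ E ] (e ∈ˡ H × Incident e v)
   go [] _ = inl refl
   go ((e , j) ∷ W) h with go W (λ e i → h e (there i))
   ... | inl refl = inr (e , h e (here refl) , snd (joins-incident j))
   ... | inr x = inr x

  reach-trans : ∀ {u v w} → Reachable graph u v → Reachable graph v w → Reachable graph u w
  reach-trans (_ , W) (_ , W') = _ , W +ʷ W'

  reach-sym : Reachable graph u v → Reachable graph v u
  reach-sym (_ , W) = _ , rev W

  linked-reach : ∀ {H} → Linked H u v → Reachable graph u v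
  linked-reach (n , W , _) = n , W

  on-edge-vertex : ∀ {e v} → Incident e v → OnEdge e (φ (vertex v))
  on-edge-vertex {e} (inl refl) = src-on e
  on-edge-vertex {e} (inr refl) = tgt-on e

  inner-off : ∀ H e t → ¬ (e ∈ˡ H) → Between 0ℚ 1ℚ t → ¬ On H (curve e t)
  inner-off H e t n i (e' , m , o) = let (j , eq) = γ-inner e t i in
   n (subst (_∈ˡ H) (sym (inner-on⁻ {e} {t} {j} {e'} (subst (λ x → OnEdge e' (φ x)) eq o))) m)

  curve-off : ∀ H e → ¬ (e ∈ˡ H) → ∀ t → (t ≤ᴿ 0ℚ → ¬ On H (φ (vertex (src e)))) → (1ℚ ≤ʳ t → ¬ On H (φ (vertex (tgt e)))) → ¬ On H (curve e t)
  curve-off H e n t s0 s1 o with position e t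
  ... | at-src h p = s0 h (subst (λ x → On H (φ x)) p o)
  ... | at-tgt h p = s1 h (subst (λ x → On H (φ x)) p o)
  ... | at-inner i p = inner-off H e t n i o

  0-in : In 0ℚ 1ℚ (ι 0ℚ)
  0-in = <-irrefl refl , <-asym 0<1
  1-in : In 0ℚ 1ℚ (ι 1ℚ)
  1-in = <-asym 0<1 , <-irrefl refl

  module _ (H : List E) (VH : V → Set) (ends : ∀ {e} → e ∈ˡ H → VH (src e) × VH (tgt e)) where

   vertex-off : ∀ v → ¬ VH v → ¬ On H (φ (vertex v))
   vertex-off v n (e , i , o) with vertex-on {v} {e} o
   ... | inl refl = n (fst (ends i))
   ... | inr refl = n (snd (ends i))

   wind-edge : ∀ {x y} (a : Adj graph x y) → ¬ VH x → ¬ VH y → (W : W[ u , u ] n) → Within H W → wind (φ (vertex x)) W ≡ wind (φ (vertex y)) W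
   wind-edge {u} {n} {x} {y} (e , j) nx ny W wi = go j
    where
    e∉ : ¬ (e ∈ˡ H)
    e∉ i = [ (λ (p , _) → nx (subst VH p (fst (ends i)))) , (λ (p , _) → ny (subst VH p (fst (ends i)))) ]′ j
    off : ¬ On H (φ (vertex (src e))) → ¬ On H (φ (vertex (tgt e))) → wind (φ (vertex (src e))) W ≡ wind (φ (vertex (tgt e))) W
    off s t = subst₂ (λ p q → wind p W ≡ wind q W) (curve-0 e) (curve-1 e)
     (wind-along W e 0<1 (λ { r _ (e' , i , o) → curve-off H e e∉ r (λ _ → s) (λ _ → t) (e' , wi e' i , o) }) (ι 0ℚ) (ι 1ℚ) 0-in 1-in)
    go : Joins e x y → wind (φ (vertex x)) W ≡ wind (φ (vertex y)) W
    go (inl (p , q)) = subst₂ (λ x y → ¬ VH x → ¬ VH y → wind (φ (vertex x)) W ≡ wind (φ (vertex y)) W) p q (λ nx ny → off (vertex-off _ nx) (vertex-off _ ny)) nx ny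
    go (inr (p , q)) = subst₂ (λ y x → ¬ VH x → ¬ VH y → wind (φ (vertex x)) W ≡ wind (φ (vertex y)) W) p q (λ nx ny → sym (off (vertex-off _ ny) (vertex-off _ nx))) nx ny

   record Entry (x : V) : Set₁ where
    field
     outer door : V
     step : Adj graph outer door
     outside : ¬ VH outer
     atdoor : VH door
     same : SameWinding H (φ (vertex x)) (φ (vertex outer))

   -- Before its first step into `VH` the walk avoids the vertices of `H`, so the winding about its
   -- vertices does not change.
   entry : ∀ {x y n} → W[ x , y ] n → ¬ VH x → VH y → Entry x
   entry [] nx vy = ⊥-elim (nx vy)
   entry {x} (_∷_ {v = w} a W) nx vy with em _ {VH w}
   ... | yes vw = record { outer = x ; door = w ; step = a ; outside = nx ; atdoor = vw ; same = λ _ _ → refl }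
   ... | no nw = prepend (entry W nw vy)
    where
    prepend : Entry w → Entry x
    prepend E = record { outer = outer ; door = door ; step = step ; outside = outside ; atdoor = atdoor ; same = λ W' h → trans (wind-edge a nx nw W' h) (same W' h) }
     where open Entry E

  record Gap (z : ℝ²) (e : E) : Set₂ where
   field
    g1 g2 : ℚ
    0<g1 : 0ℚ < g1
    g1<g2 : g1 < g2
    g2<1 : g2 < 1ℚ
    b1 b2 b3 b4 : ℚ
    inside : ∀ s → In g1 g2 s → curve e s ∈ Box b1 b2 b3 b4
    dark : ∀ w → w ∈ Box b1 b2 b3 b4 → ¬ Face G z w

  abstract
   gap-at : ∀ z e t (i : Between 0ℚ 1ℚ t) → ¬ Closure (Face G z) (φ (inner e t i)) → Gap z e
   gap-at z e t i n = let nb b1 b2 b3 b4 k dark = N-≈ {w = curve e t} (curve-inner e t i) (not-closure n)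
                          nb p q j f = curve-cont e t (nb {z = curve e t} {P = λ w → w ∈ Box b1 b2 b3 b4} b1 b2 b3 b4 k λ _ m → m)
                          (p' , q' , x , y , l) = shrink t (Between-∩ t j i)
    in record
    { g1 = p' ; g2 = q' ; 0<g1 = ≤-<-trans (p≤q⊔p p 0ℚ) x ; g1<g2 = lo<up t (fst l) (snd l) ; g2<1 = <-≤-trans y (p⊓q≤q q 1ℚ)
    ; b1 = b1 ; b2 = b2 ; b3 = b3 ; b4 = b4
    ; inside = λ s is → f s (In-Between s is (≤-<-trans (p≤p⊔q p 0ℚ) x) (<-≤-trans y (p⊓q≤p q 1ℚ))) ; dark = dark }

  -- Once the closure of the face contains the interior of an edge it contains the ends too. So an
  -- edge that is not in the boundary has an inner point away from the closure, hence a whole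
  -- interval.
  boundary-or-gap : ∀ z e → BoundaryEdge G z e ⊎ Gap z e
  boundary-or-gap z e with em _ {Σ[ t ∈ ℝ ] Σ[ i ∈ Between 0ℚ 1ℚ t ] ¬ Closure (Face G z) (φ (inner e t i))}
  ... | yes (t , i , n) = inr (gap-at z e t i n)
  ... | no none = inl (closure-src , closure-tgt , all)
   where
   all : ∀ t i → Closure (Face G z) (φ (inner e t i))
   all t i = by-contra λ n → none (t , i , n)
   closure-src : Closure (Face G z) (φ (vertex (src e)))
   closure-src = meets-closure λ A n → near (fst (vertex-N (src e) (λ w → N w A) (N-open n) e) refl)
    where
    near : ∀ {A} → ∃[ q ] (0ℚ < q × (∀ s j → s <ʳ q → N (φ (inner e s j)) A)) → Satisfiable (Face G z ∩ A)
    near (q , 0<q , f) = at (<-dense (⊓-<ʳ (ι 0ℚ) {q} {1ℚ} 0<q 0<1))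
     where
     at : ∃[ m ] (0ℚ < m × m < q ⊓ 1ℚ) → _
     at (m , 0<m , m<) = closure-meets (all (ι m) (0<m , <-≤-trans m< (p⊓q≤q q 1ℚ))) (f (ι m) _ (<-≤-trans m< (p⊓q≤p q 1ℚ)))
   closure-tgt : Closure (Face G z) (φ (vertex (tgt e)))
   closure-tgt = meets-closure λ A n → near (snd (vertex-N (tgt e) (λ w → N w A) (N-open n) e) refl)
    where
    near : ∀ {A} → ∃[ p ] (p < 1ℚ × (∀ s j → p <ˡ s → N (φ (inner e s j)) A)) → Satisfiable (Face G z ∩ A)
    near (p , p<1 , f) = at (<-dense (⊔-<ˡ (ι 1ℚ) {p} {0ℚ} p<1 0<1))
     where
     at : ∃[ m ] (p ℚ.⊔ 0ℚ < m × m < 1ℚ) → _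
     at (m , <m , m<1) = closure-meets (all (ι m) (≤-<-trans (p≤q⊔p p 0ℚ) <m , m<1)) (f (ι m) _ (≤-<-trans (p≤p⊔q p 0ℚ) <m))

  record Terrain : Set₂ where
   constructor terrain
   field
    noacc : NoVertexAccumulation G
    star : V → List E
    in-star : Stars star
    leaves : NoFiniteComponent

  record ListedFace : Set₂ where
   constructor listed-face
   field
    z : ℝ²
    z∉ : Complement G z
    H0 : List E
    H0-spec : ∀ e → e ∈ˡ H0 ⇔ BoundaryEdge G z e

  module Facial (ground : Terrain) where
   open Terrain ground

   module AtFace (face : ListedFace) where
    open ListedFace face

    F : Pred ℝ² _
    F = Face G z

    gap : ∀ e → ¬ (e ∈ˡ H0) → Gap z e
    gap e n = [ (λ b → ⊥-elim (n (from (H0-spec e) b))) , id ]′ (boundary-or-gap z e)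

    Interval : E → Set₂
    Interval e = ∃[ a ] ∃[ b ] (0ℚ < a × a < b × b < 1ℚ × (¬ (e ∈ˡ H0) → ∃[ b1 ] ∃[ b2 ] ∃[ b3 ] ∃[ b4 ]
     ((∀ s → In a b s → curve e s ∈ Box b1 b2 b3 b4) × (∀ w → w ∈ Box b1 b2 b3 b4 → ¬ F w))))

    gap-interval : ∀ {e} → Gap z e → Interval e
    gap-interval g = g1 , g2 , 0<g1 , g1<g2 , g2<1 , λ _ → b1 , b2 , b3 , b4 , inside , dark
     where open Gap g

    abstract
     interval : ∀ e → Interval e
     interval e = by (em _)
      where
      by : Dec (e ∈ˡ H0) → Interval e
      -- A boundary edge has no gap; any interval completes the functions `lo` and `hi`.
      by (yes i) = let (m , x , y) = <-dense 0<1; (k , p , q) = <-dense x in k , m , p , q , y , λ n → ⊥-elim (n i)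
      by (no n) = gap-interval (gap e n)

    lo hi : E → ℚ
    lo e = fst (interval e)
    hi e = fst (snd (interval e))

    dark-box : ∀ e → ¬ (e ∈ˡ H0) → ∃[ b1 ] ∃[ b2 ] ∃[ b3 ] ∃[ b4 ]
     ((∀ s → In (lo e) (hi e) s → curve e s ∈ Box b1 b2 b3 b4) × (∀ w → w ∈ Box b1 b2 b3 b4 → ¬ F w))
    dark-box e = snd (snd (snd (snd (snd (interval e)))))

    -- The component of H0 at v0, with stubs of all other edges at its vertices.
    module Component (v0 : V) where
     VH : V → Set
     VH = Linked H0 v0
     H : List E
     H = fst (select (λ e → VH (src e)) H0)
     H-in : ∀ {e} → e ∈ˡ H → e ∈ˡ H0 × VH (src e)
     H-in = fst (snd (select (λ e → VH (src e)) H0))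
     in-H : ∀ {e} → e ∈ˡ H0 → VH (src e) → e ∈ˡ H
     in-H = snd (snd (select (λ e → VH (src e)) H0))
     ends : ∀ {e} → e ∈ˡ H → VH (src e) × VH (tgt e)
     ends i = let (j , l) = H-in i in l , linked-trans l (linked-edge j)
     in-H' : ∀ {e v} → e ∈ˡ H0 → Incident e v → VH v → e ∈ˡ H
     in-H' i (inl refl) l = in-H i l
     in-H' i (inr refl) l = in-H i (linked-trans l (linked-sym (linked-edge i)))
     not-H0 : ∀ {e v} → Incident e v → VH v → ¬ (e ∈ˡ H) → ¬ (e ∈ˡ H0)
     not-H0 inc l n i = n (in-H' i inc l)

     vertices : List V
     vertices = v0 ∷ (map src H0 ++ map tgt H0)
     VH-in : ∀ {v} → VH v → v ∈ˡ vertices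
     VH-in l with walk-vertex l
     ... | inl refl = here refl
     ... | inr (e , i , inl refl) = there (∈-++⁺ˡ (∈-map⁺ src i))
     ... | inr (e , i , inr refl) = there (∈-++⁺ʳ (map src H0) (∈-map⁺ tgt i))
     near-edges : List E
     near-edges = concatMap star vertices
     in-near : ∀ {e v} → Incident e v → VH v → e ∈ˡ near-edges
     in-near inc l = ∈-concatMap⁺ star (Any.map (λ { refl → in-star inc }) (VH-in l))
     K : E × ℚ × ℚ → Set
     K (e , a , b) = Kind H VH lo hi e a b
     candidates : List (E × ℚ × ℚ)
     candidates = concatMap (λ e → (e , 0ℚ , 1ℚ) ∷ (e , 0ℚ , lo e) ∷ (e , hi e , 1ℚ) ∷ []) near-edges
     S : Stubbed
     S = record
      { H = H ; VH = VH ; ends = ends ; lo = lo ; hi = hi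
      ; 0<lo = λ e → fst (snd (snd (interval e))) ; lo<hi = λ e → fst (snd (snd (snd (interval e)))) ; hi<1 = λ e → fst (snd (snd (snd (snd (interval e)))))
      ; arcs = fst (select K candidates) ; kind = λ i → snd (fst (snd (select K candidates)) i) }
     open Stubbed S using (arcs; A; A-closed; A-≈; inner-A; part-A; whole; out; into; 0<lo; lo<hi; hi<1; Part; kind) public

     private
      candidate : ∀ {e x} → e ∈ˡ near-edges → x ∈ˡ ((e , 0ℚ , 1ℚ) ∷ (e , 0ℚ , lo e) ∷ (e , hi e , 1ℚ) ∷ []) → K x → x ∈ˡ arcs
      candidate {e} i j k = snd (snd (select K candidates)) (∈-concatMap⁺ (λ e → (e , 0ℚ , 1ℚ) ∷ (e , 0ℚ , lo e) ∷ (e , hi e , 1ℚ) ∷ []) (Any.map (λ { refl → j }) i)) k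

     full : ∀ e → e ∈ˡ H → (e , 0ℚ , 1ℚ) ∈ˡ arcs
     full e i = candidate (in-near (inl refl) (fst (ends i))) (here refl) (whole i)
     out-arc : ∀ e → VH (src e) → ¬ (e ∈ˡ H) → (e , 0ℚ , lo e) ∈ˡ arcs
     out-arc e l n = candidate (in-near (inl refl) l) (there (here refl)) (out l n)
     into-arc : ∀ e → VH (tgt e) → ¬ (e ∈ˡ H) → (e , hi e , 1ℚ) ∈ˡ arcs
     into-arc e l n = candidate (in-near (inr refl) l) (there (there (here refl))) (into l n)

     open Stubbed S using (vertex-A)

     vertex-in-A : ∀ v → VH v → A (φ (vertex v))
     vertex-in-A v l = go (leaves (v ∷ []) (here refl))
      where
      go : _ → A (φ (vertex v))
      go (_ , y , here refl , _ , (e , j)) with em _ {e ∈ˡ H}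
      ... | yes i = _ , full e i , on-edge-vertex (fst (joins-incident j))
      ... | no n with fst (joins-incident j)
      ...   | inl refl = _ , out-arc e l n , arc (ι 0ℚ) (<-irrefl refl , <-asym (0<lo e)) (subst (λ z → curve e (ι 0ℚ) ≈² z) (curve-0 e) (≈²-refl (curve e (ι 0ℚ))))
      ...   | inr refl = _ , into-arc e l n , arc (ι 1ℚ) (<-asym (hi<1 e) , <-irrefl refl) (subst (λ z → curve e (ι 1ℚ) ≈² z) (curve-1 e) (≈²-refl (curve e (ι 1ℚ))))

     -- At the tip of a stub the graph continues beyond `A`, but there the gap hides the face. At
     -- all other points stars and segments show that the nearby graph belongs to `A`.
     local : ∀ w → A w → N w (λ u → OnGraph u → A u) ⊎ N w (λ u → ¬ F u)
     local w aw@((e , l , r) , i , arc t it eq) = go (γ e t) eq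
      where
      grow : ∀ {x} → φ x ≈² w → N (φ x) (λ u → ∀ y → φ y ≈² u → A u) → N w (λ u → OnGraph u → A u)
      grow eq n = N-≈ eq (N-map (λ u f (y , y≈u) → f y y≈u) n)
      part : ∀ e t i u → φ (inner e t i) ≈² u → Part e t → A u
      part e t i u eq p = A-≈ (φ (inner e t i)) u eq (part-A e t i (full e) p)
      vertex-case : ∀ v u y → VH v → φ y ≈² u → Star v lo hi y → A u
      vertex-case v u _ l eq (inl refl) = A-≈ (φ (vertex v)) u eq (vertex-in-A v l)
      vertex-case v u _ l eq (inr (e , s , j , refl , inl (refl , k))) = part e s j u eq (by (em _))
       where
       by : Dec (e ∈ˡ H) → Part e s
       by (yes i) = whole i
       by (no n) = out n (out-arc e l n) (<ʳ⇒≤ᴿ s k)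
      vertex-case v u _ l eq (inr (e , s , j , refl , inr (refl , k))) = part e s j u eq (by (em _))
       where
       by : Dec (e ∈ˡ H) → Part e s
       by (yes i) = whole i
       by (no n) = into n (into-arc e l n) (<ˡ⇒≤ʳ s k)
      tip : ∀ e t i → φ (inner e t i) ≈² w → ¬ (e ∈ˡ H0) → In (lo e) (hi e) t → N w (λ u → ¬ F u)
      tip e t i eq n it = let (b1 , b2 , b3 , b4 , ins , dark) = dark-box e n in
       N-≈ {z = curve e t} {w = w} (≈²-trans (curve e t) (φ (inner e t i)) w (≈²-sym (φ (inner e t i)) (curve e t) (curve-inner e t i)) eq) (nb b1 b2 b3 b4 (ins t it) dark)
      kind-H : ∀ {e a b} → Kind H VH lo hi e a b → e ∈ˡ H0 → e ∈ˡ H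
      kind-H (whole i) _ = i
      kind-H (out l _) h = in-H' h (inl refl) l
      kind-H (into l _) h = in-H' h (inr refl) l
      inner-case : ∀ e t i → φ (inner e t i) ≈² w → Part e t → N w (λ u → OnGraph u → A u) ⊎ N w (λ u → ¬ F u)
      inner-case e t i eq (whole m) = inl (grow eq (N-map (λ { u f y y≈u → case f y y≈u of λ { (s , j , refl , _) → part e s j u y≈u (whole m) } }) (segment-N e t i 0ℚ 1ℚ i)))
      inner-case e t i eq (out n m t≤lo) with em _ {t <ʳ lo e}
      ... | yes t<lo = inl (grow eq (N-map (λ { u f y y≈u → case f y y≈u of λ { (s , j , refl , k) → part e s j u y≈u (out n m (<ʳ⇒≤ᴿ s (snd k))) } }) (segment-N e t i 0ℚ (lo e) (fst i , t<lo))))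
      ... | no t≮lo = inr (tip e t i eq (λ h → n (kind-H (kind m) h)) (t≮lo , λ k → t≤lo (lower-down t (lo<hi e) k)))
      inner-case e t i eq (into n m hi≤t) with em _ {hi e <ˡ t}
      ... | yes hi<t = inl (grow eq (N-map (λ { u f y y≈u → case f y y≈u of λ { (s , j , refl , k) → part e s j u y≈u (into n m (<ˡ⇒≤ʳ s (fst k))) } }) (segment-N e t i (hi e) 1ℚ (hi<t , snd i))))
      ... | no hi≮t = inr (tip e t i eq (λ h → n (kind-H (kind m) h)) ((λ k → hi≤t (upper-up t (lo<hi e) k)) , hi≮t))
      go : ∀ x → φ x ≈² w → N w (λ u → OnGraph u → A u) ⊎ N w (λ u → ¬ F u)
      go (vertex v) eq = inl (grow eq (N-map (λ u f y y≈u → vertex-case v u y (vertex-A v w aw eq) y≈u (f y y≈u)) (star-N v lo hi 0<lo hi<1)))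
      go (inner e t i) eq = inner-case e t i eq (inner-A e t i w aw eq)

     mid : E → ℚ
     mid e = fst (<-dense (lo<hi e))
     lo<mid : ∀ e → lo e < mid e
     lo<mid e = fst (snd (<-dense (lo<hi e)))
     mid<hi : ∀ e → mid e < hi e
     mid<hi e = snd (snd (<-dense (lo<hi e)))
     mid-between : ∀ e → Between 0ℚ 1ℚ (ι (mid e))
     mid-between e = <-trans (0<lo e) (lo<mid e) , <-trans (mid<hi e) (hi<1 e)
     mid∉A : ∀ e → ¬ (e ∈ˡ H) → ¬ A (curve e (ι (mid e)))
     mid∉A e n aw = go (inner-A e (ι (mid e)) (mid-between e) _ aw (curve-inner e (ι (mid e)) (mid-between e)))
      where
      go : ¬ Part e (ι (mid e))
      go (whole i) = n i
      go (out _ _ k) = k (lo<mid e)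
      go (into _ _ k) = k (mid<hi e)

     -- The edge `e` leaves the component and is cut open in a gap that the face does not enter.
     -- Following the component from the seen point `a` to this stub contradicts `face-lemma`,
     -- unless a closed walk in the component separates the face from the gap.
     blind : ∀ a → A a → Closure F a → ∀ e v → Incident e v → VH v → ¬ (e ∈ˡ H) →
      Route arcs a (φ (vertex v)) →
      (∀ {u n} (W : W[ u , u ] n) → Within H W → wind z W ≡ wind (curve e (ι (mid e))) W) → ⊥
     blind a aa cl e v inc l n route same = go inc
      where
      D = dark-box e (not-H0 inc l n)
      b1 = fst D
      b2 = fst (snd D)
      b3 = fst (snd (snd D))
      b4 = fst (snd (snd (snd D)))
      ins : ∀ s → In (lo e) (hi e) s → curve e s ∈ Box b1 b2 b3 b4
      ins = fst (snd (snd (snd (snd D))))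
      dark : ∀ w → w ∈ Box b1 b2 b3 b4 → ¬ F w
      dark = snd (snd (snd (snd (snd D))))
      at-mid : curve e (ι (mid e)) ∈ Box b1 b2 b3 b4
      at-mid = ins (ι (mid e)) (<-asym (lo<mid e) , <-asym (mid<hi e))
      use : ∀ b → b ∈ Box b1 b2 b3 b4 → A b → Route arcs a b → ⊥
      use b b∈ ab ρ = FaceLemma.face-lemma (sight S full z z∉ local a aa cl b (curve e (ι (mid e))) ab (mid∉A e n) b1 b2 b3 b4 b∈ at-mid dark ρ same)
      go : Incident e v → ⊥
      go (inl refl) = let b = curve e (ι (lo e)); m = out-arc e l n; it = <-asym (0<lo e) , <-irrefl refl in
       use b (ins (ι (lo e)) (<-irrefl refl , <-asym (lo<hi e))) (_ , m , arc (ι (lo e)) it (≈²-refl b))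
        (ride route m (ι 0ℚ) (ι (lo e)) (<-irrefl refl , <-asym (0<lo e)) it (subst (λ z → curve e (ι 0ℚ) ≈² z) (curve-0 e) (≈²-refl (curve e (ι 0ℚ)))) (≈²-refl b))
      go (inr refl) = let b = curve e (ι (hi e)); m = into-arc e l n; it = <-irrefl refl , <-asym (hi<1 e) in
       use b (ins (ι (hi e)) (<-asym (lo<hi e) , <-irrefl refl)) (_ , m , arc (ι (hi e)) it (≈²-refl b))
        (ride route m (ι 1ℚ) (ι (hi e)) (<-asym (hi<1 e) , <-irrefl refl) it (subst (λ z → curve e (ι 1ℚ) ≈² z) (curve-1 e) (≈²-refl (curve e (ι 1ℚ)))) (≈²-refl b))

 open FaceGaps

 -- The boundary of a face is connected and encircles it

 module FacialBoundaries where
  open LatticePaths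
  open Sections

  private variable
   ℓ ℓ' : Level
   u v : V
   n : ℕ

  curve-src : ∀ e {v} → src e ≡ v → curve e (ι 0ℚ) ≈² φ (vertex v)
  curve-src e refl = subst (λ z → curve e (ι 0ℚ) ≈² z) (curve-0 e) (≈²-refl (curve e (ι 0ℚ)))
  curve-tgt : ∀ e {v} → tgt e ≡ v → curve e (ι 1ℚ) ≈² φ (vertex v)
  curve-tgt e refl = subst (λ z → curve e (ι 1ℚ) ≈² z) (curve-1 e) (≈²-refl (curve e (ι 1ℚ)))

  wind-interior : ∀ H e → ¬ (e ∈ˡ H) → (W : W[ u , u ] n) → Within H W → ∀ s t → Between 0ℚ 1ℚ s → Between 0ℚ 1ℚ t →
   wind (curve e s) W ≡ wind (curve e t) W
  wind-interior H e n W h = interval-const (λ t → wind (curve e t) W) λ t i →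
   Nb-map (λ s eq _ → eq) (curve-cont e t (wind-const W λ { (e' , k , o) → inner-off H e t n i (e' , h e' k , o) }))

  ≈²-wind : ∀ {z w} (W : W[ u , u ] n) → ¬ OnWalk' W z → z ≈² w → wind w W ≡ wind z W
  ≈²-wind W off eq = N-here (N-≈ eq (wind-const W off))

  module FacialStructure (ground : Terrain) where
   open Terrain ground
   open Facial ground

   -- Otherwise the vertices with `P` would form a finite set that no edge leaves.
   spread : (P : V → Set₁) (vs : List V) → (∀ {x y} → P x → Adj graph x y → P y) → ∀ {v} → P v → Σ[ y ∈ V ] (P y × ¬ (y ∈ˡ vs))
   spread P vs step {v} pv = by-contra λ none →
    let all = λ {x} (px : P x) → by-contra λ n → none (x , px , n)
        (ys , f , g) = select P vs
        (x , y , x∈ , y∉ , a) = leaves ys (g (all pv) pv)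
        py = step (snd (f x∈)) a
    in y∉ (g (all py) py)

   inner-inside : (W : W[ u , u ] n) → ∀ e t i → ¬ OnWalk' W (φ (inner e t i)) → wind (φ (inner e t i)) W ≡ true →
    On (edges W) (φ (vertex (src e))) ⊎ wind (φ (vertex (src e))) W ≡ true
   inner-inside W e t i off wt with em _ {On (edges W) (φ (vertex (src e)))}
   ... | yes o = inl o
   ... | no n = let (q , q<1 , t<q) = up-round t (snd i) in
    inr (trans (subst (λ p → wind p W ≡ wind (curve e t) W) (curve-0 e)
     (wind-along W e (lo<up t (fst i) t<q) (λ s is → curve-off (edges W) e (λ k → off (e , k , inner-on e t i)) s (λ _ → n) (λ k _ → snd is (<ˡ-≤ʳ s q<1 k)))
      (ι 0ℚ) t (<-irrefl refl , <-asym (lo<up t (fst i) t<q)) (<ˡ⇒≤ʳ t (fst i) , <ʳ⇒≤ᴿ t t<q)))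
     (trans (≈²-wind W off (curve-inner e t i)) wt))

   -- Only finitely many edges meet the region encircled by a closed walk.
   inside-open : (W : W[ u , u ] n) → ∀ {y} → Complement G y → wind y W ≡ true → N y (λ w → Complement G w)
   inside-open W {y} cy wy = N-map clear (N-∩ (N-∩ (on-closed region y (y-off _)) (on-closed (edges W) y (y-off _))) (wind-const W (y-off _)))
    where
    inner-vs = inside-finite noacc W
    core : List V
    core = fst inner-vs ++ (map src (edges W) ++ map tgt (edges W))
    region : List E
    region = concatMap star core
    in-core : ∀ v → On (edges W) (φ (vertex v)) ⊎ wind (φ (vertex v)) W ≡ true → v ∈ˡ core
    in-core v (inr h) = ∈-++⁺ˡ (snd inner-vs v h)
    in-core v (inl (e , i , o)) with vertex-on {v} {e} o
    ... | inl refl = ∈-++⁺ʳ (fst inner-vs) (∈-++⁺ˡ (∈-map⁺ src i))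
    ... | inr refl = ∈-++⁺ʳ (fst inner-vs) (∈-++⁺ʳ (map src (edges W)) (∈-map⁺ tgt i))
    in-region : ∀ {e v} → Incident e v → v ∈ˡ core → e ∈ˡ region
    in-region inc i = ∈-concatMap⁺ star (Any.map (λ { refl → in-star inc }) i)
    contains : ∀ x → ¬ OnWalk' W (φ x) → wind (φ x) W ≡ true → On region (φ x)
    contains (vertex v) off wt with leaves (v ∷ []) (here refl)
    ... | (_ , y , here refl , _ , (e , j)) = let inc = fst (joins-incident j) in e , in-region inc (in-core v (inr wt)) , on-edge-vertex inc
    contains (inner e t i) off wt = e , in-region (inl refl) (in-core (src e) (inner-inside W e t i off wt)) , inner-on e t i
    y-off : ∀ L → ¬ On L y
    y-off L (e , _ , o) = let (x , eq) = onEdge⇒graph {e} o in cy x eq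
    clear : ∀ w → (¬ On region w × ¬ On (edges W) w) × wind w W ≡ wind y W → Complement G w
    clear w ((r , o) , e) x eq =
     let off = λ { (d , i , k) → o (d , i , arc-≈ {z = φ x} {w} eq k) }
         (d , i , k) = contains x off (trans (≈²-wind W off' (≈²-sym (φ x) w eq)) (trans e wy))
     in r (d , i , arc-≈ {z = φ x} {w} eq k)
     where off' : ¬ OnWalk' W w
           off' = o

   module _ (face : ListedFace) where
    open ListedFace face
    open AtFace face

    closure-edge : ∀ {e v} → e ∈ˡ H0 → Incident e v → Closure F (φ (vertex v))
    closure-edge i (inl refl) = fst (to (H0-spec _) i)
    closure-edge i (inr refl) = fst (snd (to (H0-spec _) i))

    module _ (v0 : V) where
     open Component v0

     route : ∀ {a v} → Route arcs a (φ (vertex v0)) → VH v → Route arcs a (φ (vertex v))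
     route ρ (_ , W , h) = go W h linked-refl ρ
      where
      go : ∀ {a x y n} (W : W[ x , y ] n) → Within H0 W → VH x → Route arcs a (φ (vertex x)) → Route arcs a (φ (vertex y))
      go [] _ _ ρ = ρ
      go ((e , j) ∷ W) h l ρ = go W (λ e i → h e (there i)) (linked-trans l (1 , (e , j) ∷ [] , λ { _ (here refl) → h e (here refl) })) (crossing j)
       where
       e∈ = full e (in-H' (h e (here refl)) (fst (joins-incident j)) l)
       crossing : Joins e _ _ → Route arcs _ (φ (vertex _))
       crossing (inl (p , q)) = ride ρ e∈ (ι 0ℚ) (ι 1ℚ) 0-in 1-in (curve-src e p) (curve-tgt e q)
       crossing (inr (p , q)) = ride ρ e∈ (ι 1ℚ) (ι 0ℚ) 1-in 0-in (curve-tgt e q) (curve-src e p)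

     wind-mid : ∀ e {x y} → Joins e x y → ¬ VH x → ¬ (e ∈ˡ H) → (W : W[ u , u ] n) → Within H W →
      wind (φ (vertex x)) W ≡ wind (curve e (ι (mid e))) W
     wind-mid e (inl (refl , _)) nx n W h = subst (λ p → wind p W ≡ wind (curve e (ι (mid e))) W) (curve-0 e)
      (wind-along W e (fst (mid-between e)) (λ { t it (e' , i , o) → curve-off H e n t (λ _ → vertex-off H VH ends (src e) nx)
       (λ k → ⊥-elim (snd it (<ˡ-≤ʳ t (snd (mid-between e)) k))) (e' , h e' i , o) })
       (ι 0ℚ) (ι (mid e)) (<-irrefl refl , <-asym (fst (mid-between e))) (<-asym (fst (mid-between e)) , <-irrefl refl))
     wind-mid e (inr (_ , refl)) nx n W h = subst (λ p → wind p W ≡ wind (curve e (ι (mid e))) W) (curve-1 e)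
      (wind-along W e (snd (mid-between e)) (λ { t it (e' , i , o) → curve-off H e n t (λ k → ⊥-elim (fst it (≤ᴿ-<ʳ t k (fst (mid-between e)))))
       (λ _ → vertex-off H VH ends (tgt e) nx) (e' , h e' i , o) })
       (ι 1ℚ) (ι (mid e)) (<-asym (snd (mid-between e)) , <-irrefl refl) (<-irrefl refl , <-asym (snd (mid-between e))))

     -- A walk from `x` enters the component through an edge outside `H`, whose gap has the same
     -- windings as `x`; then `blind` forces a separating closed walk.
     separated : Closure F (φ (vertex v0)) → ∀ {x} → ¬ VH x → Reachable graph x v0 →
      Σ[ u ∈ V ] Σ[ n ∈ ℕ ] Σ[ W ∈ W[ u , u ] n ] (Within H W × wind z W ≢ wind (φ (vertex x)) W)
     separated cl {x} nx (k , P) = by-contra λ none →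
      let open Entry (entry H VH ends P nx linked-refl)
          e = fst step; j = snd step
          e∉ : ¬ (e ∈ˡ H)
          e∉ i = [ (λ (p , _) → outside (subst VH p (fst (ends i)))) , (λ (_ , p) → outside (subst VH p (snd (ends i)))) ]′ j
      in blind (φ (vertex v0)) (vertex-in-A v0 linked-refl) cl e door (snd (joins-incident j)) atdoor e∉
       (route (stay (≈²-refl (φ (vertex v0)))) atdoor)
       (λ W h → trans (by-contra λ ne → none (_ , _ , W , h , ne)) (trans (same W h) (wind-mid e j outside e∉ W h)))

    closure-≈ : ∀ {x y} → x ≈² y → Closure F x → Closure F y
    closure-≈ {x} {y} eq cl = meets-closure λ B n → closure-meets cl (N-≈ (≈²-sym x y eq) n)

    H-⊆ : ∀ v0 e → ¬ (e ∈ˡ H0) → ¬ (e ∈ˡ Component.H v0)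
    H-⊆ v0 e n i = n (fst (Component.H-in v0 i))

    -- The seen inner point lies in the gap, which is impossible, or on a stub of `e`. In the second
    -- case no closed walk in `H` meets the interior of `e`, so none separates the face from the
    -- gap, against `blind`.
    closure-inner : ∀ e t i → Closure F (φ (inner e t i)) → e ∈ˡ H0
    closure-inner e t i cl0 = by-contra absurd
     where
     cl : Closure F (curve e t)
     cl = closure-≈ (curve-inner e t i) cl0
     same : ∀ v0 → ¬ (e ∈ˡ H0) → ∀ {u n} (W : W[ u , u ] n) → Within (Component.H v0) W → wind z W ≡ wind (curve e (ι (Component.mid v0 e))) W
     same v0 n W h = trans (wind-closure W (λ { (e' , k , o) → inner-off (Component.H v0) e t (H-⊆ v0 e n) i (e' , h e' k , o) }) cl)
      (wind-interior (Component.H v0) e (H-⊆ v0 e n) W h t (ι (Component.mid v0 e)) i (Component.mid-between v0 e))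
     absurd : ¬ (e ∈ˡ H0) → ⊥
     absurd n with em 0ℓ {t <ʳ lo e} | em 0ℓ {hi e <ˡ t}
     ... | yes t<lo | _ = let open Component (src e); n' = H-⊆ (src e) e n; m = out-arc e linked-refl n'; it = <ˡ⇒≤ʳ t (fst i) , <ʳ⇒≤ᴿ t t<lo in
      blind (curve e t) (_ , m , arc t it (≈²-refl (curve e t))) cl e (src e) (inl refl) linked-refl n'
       (ride {w = curve e t} (stay (≈²-refl (curve e t))) m t (ι 0ℚ) it (<-irrefl refl , <-asym (0<lo e)) (≈²-refl (curve e t)) (curve-src e refl)) (same (src e) n)
     ... | no _ | yes hi<t = let open Component (tgt e); n' = H-⊆ (tgt e) e n; m = into-arc e linked-refl n'; it = <ˡ⇒≤ʳ t hi<t , <ʳ⇒≤ᴿ t (snd i) in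
      blind (curve e t) (_ , m , arc t it (≈²-refl (curve e t))) cl e (tgt e) (inr refl) linked-refl n'
       (ride {w = curve e t} (stay (≈²-refl (curve e t))) m t (ι 1ℚ) it (<-asym (hi<1 e) , <-irrefl refl) (≈²-refl (curve e t)) (curve-tgt e refl)) (same (tgt e) n)
     ... | no t≮lo | no t≯hi = let (b1 , b2 , b3 , b4 , ins , dark) = dark-box e n
                                   (w , f , b∈) = closure-meets cl (nb {P = λ w → w ∈ Box b1 b2 b3 b4} b1 b2 b3 b4 (ins t (t≮lo , t≯hi)) λ _ k → k)
      in dark w b∈ f

    -- Otherwise the component of `v` has no edges, so its only closed walks are empty and nothing
    -- separates the face from the gap of an edge at `v`, against `blind`.
    closure-vertex : ∀ v → Closure F (φ (vertex v)) → Σ[ e ∈ E ] (e ∈ˡ H0 × Incident e v)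
    closure-vertex v cl = by-contra λ none → absurd none (leaves (v ∷ []) (here refl))
     where
     absurd : ¬ (Σ[ e ∈ E ] (e ∈ˡ H0 × Incident e v)) → (Σ[ x ∈ V ] Σ[ y ∈ V ] (x ∈ˡ (v ∷ []) × ¬ (y ∈ˡ (v ∷ [])) × Adj graph x y)) → ⊥
     absurd none (_ , y , here refl , _ , (e , j)) =
      blind (φ (vertex v)) (vertex-in-A v linked-refl) cl e v inc linked-refl (λ i → none (e , fst (H-in i) , inc)) (stay (≈²-refl (φ (vertex v)))) same
      where
      open Component v
      inc = fst (joins-incident j)
      alone : ∀ {e} → ¬ (e ∈ˡ H)
      alone i with walk-vertex (linked-sym (fst (ends i)))
      ... | inl refl = none (_ , fst (H-in i) , inl refl)
      ... | inr x = none x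
      same : ∀ {u n} (W : W[ u , u ] n) → Within H W → wind z W ≡ wind (curve e (ι (mid e))) W
      same [] h = refl
      same ((e , _) ∷ _) h = ⊥-elim (alone (h e (here refl)))

    -- The graph component is infinite and so leaves any box. The closed walk that separates the
    -- face from a reachable vertex far outside does not wind around that vertex, hence winds around
    -- the face.
    encircled : ∀ {e0} → e0 ∈ˡ H0 → Encircled (Component.H (src e0)) z
    encircled {e0} e0∈ =
     let (a , b , c , d , bd) = bounded H
         (vs , f) = vertices-in-Box noacc a b c d
         (y , r , y∉) = spread (λ v → Lift _ (Reachable graph v (src e0))) (src e0 ∷ vs) (λ { (lift r) α → lift (reach-trans (_ , adj-sym α ∷ []) r) }) {src e0} (lift (0 , []))
         out : ¬ (φ (vertex y) ∈ Box a b c d)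
         out i = y∉ (there (f y i))
         y-off : ¬ VH y
         y-off l = case walk-vertex l of λ
          { (inl eq) → y∉ (here (sym eq))
          ; (inr (e , i , inc)) → out (bd _ (e , in-H' i inc l , on-edge-vertex inc)) }
         (u , n , W , h , ne) = separated (src e0) (closure-edge e0∈ (inl refl)) y-off (Lift.lower r)
     in u , n , W , h , by-contra λ nt → ne (trans (≢true nt) (sym (wind-outside {a = a} {b} {c} {d} W (λ { z (e , i , o) → bd z (e , h e i , o) }) out)))
     where open Component (src e0)

    -- A second component is seen from the face, so closed walks in the first one cannot separate
    -- the two. If the components are joined in the graph, this contradicts `separated`. If not, the
    -- graph component of the second stays inside a closed walk around the face, where only finitely
    -- many vertices fit.
    boundary-connected : ∀ {e e'} → e ∈ˡ H0 → e' ∈ˡ H0 → Linked H0 (src e) (src e')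
    boundary-connected {e} {e'} i i' = by-contra λ nl →
     let (u , n , W , h , wt) = encircled i
         seen : ∀ {u n} (W : W[ u , u ] n) → Within H W → wind z W ≡ wind (φ (vertex (src e'))) W
         seen W h = wind-closure W (λ { (e , k , o) → vertex-off H VH ends (src e') nl (e , h e k , o) }) (closure-edge i' (inl refl))
     in case em _ {Reachable graph (src e') (src e)} of λ
      { (yes r) → let (_ , _ , W' , h' , ne) = separated (src e) (closure-edge i (inl refl)) nl r in ne (seen W' h')
      ; (no nr) → let (vs , f) = inside-finite noacc W
                      (y , (lift r , wy) , y∉) = spread (λ v → Lift (lsuc 0ℓ) (Reachable graph (src e') v) × wind (φ (vertex v)) W ≡ true) vs
                       (λ { {x} {y} (lift r , wx) α → lift (reach-trans r (_ , α ∷ [])) ,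
                        trans (sym (wind-edge H VH ends α (λ l → nr (reach-trans r (reach-sym (linked-reach l))))
                         (λ l → nr (reach-trans r (reach-trans (_ , α ∷ []) (reach-sym (linked-reach l))))) W h)) wx })
                       {src e'} (lift (0 , []) , trans (sym (seen W h)) wt)
       in y∉ (f y wy) }
     where open Component (src e)

    -- Not automatic: that vertices do not accumulate does not by itself keep edges from
    -- accumulating. Inside the encircling walk, however, only finitely many edges occur.
    open-face : ∀ {e0} → e0 ∈ˡ H0 → ∀ {y} → F y → N y F
    open-face {e0} e0∈ {y} f =
     let (u , n , W , h , wt) = encircled e0∈
         nb a b c d i g = inside-open W (component-⊆ f) (trans (sym (wind-component W f)) wt)
     in nb a b c d i λ w k → box-in-component {p = a} {b} {c} {d} (λ {w} m → g w m) {w = y} {w} i k f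

    -- In such a box the closure of the face contains no point of the graph, so the face is both
    -- open and closed there.
    saturated : ∀ {e0} → e0 ∈ˡ H0 → ∀ {p q r s} → Misses (On H0) p q r s → ∀ {y w} → y ∈ Box p q r s → w ∈ Box p q r s → F y → F w
    saturated e0∈ {p} {q} {r} {s} miss {y} {w} i j f = dec-true (trans (sym (box-const {p} {q} {r} {s} (λ w → dec (F w)) loc y w i j)) (dec-yes f))
     where
     loc : Locally-constant-on (Box p q r s) (λ w → dec (F w))
     loc y i with em _ {F y}
     ... | yes f = N-map (λ w g _ → dec-yes g) (open-face e0∈ f)
     ... | no nf = N-map (λ w g _ → dec-no g) (not-closure λ cl → nf (closure-component z∉ (λ w w≈y x x≈w → seen x (≈²-trans (φ x) w y x≈w w≈y) cl) cl))
      where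
      seen : ∀ x → φ x ≈² y → Closure F y → ⊥
      seen (vertex v) eq cl = let (e , k , inc) = closure-vertex v (closure-≈ (≈²-sym (φ (vertex v)) y eq) cl) in
       miss y (e , k , arc-≈ {z = φ (vertex v)} {y} eq (on-edge-vertex inc)) i
      seen (inner e t k) eq cl = let m = closure-inner e t k (closure-≈ (≈²-sym (φ (inner e t k)) y eq) cl) in
       miss y (e , m , arc-≈ {z = φ (inner e t k)} {y} eq (inner-on e t k)) i

 open FacialBoundaries

 -- Counting and graph distance

 module Distances where

  private variable
   ℓ ℓ' ℓ″ : Level
   X : Set ℓ
   u v x y : V
   m n : ℕ

  unique-⊆ : {xs ys : List X} → Unique xs → (∀ {x} → x ∈ˡ xs → x ∈ˡ ys) → length xs ≤ℕ length ys
  unique-⊆ {xs = []} _ _ = z≤n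
  unique-⊆ {xs = x ∷ xs} {ys} (x∉ ∷ un) sub with ∈-∃++ (sub (here refl))
  ... | as , bs , refl = subst (suc (length xs) ≤ℕ_) (sym (trans (length-++ as) (+-suc (length as) (length bs))))
   (s≤s (subst (length xs ≤ℕ_) (length-++ as) (unique-⊆ un λ i → drop (sub (there i)) (λ eq → All.lookup x∉ i (sym eq)))))
   where
   drop : ∀ {z} → z ∈ˡ (as ++ x ∷ bs) → z ≢ x → z ∈ˡ (as ++ bs)
   drop i ne with ∈-++⁻ as i
   ... | inl j = ∈-++⁺ˡ j
   ... | inr (here eq) = ⊥-elim (ne eq)
   ... | inr (there j) = ∈-++⁺ʳ as j

  dedupe : (xs : List X) → Σ[ ys ∈ List X ] (Unique ys × (∀ {x} → x ∈ˡ ys → x ∈ˡ xs) × (∀ {x} → x ∈ˡ xs → x ∈ˡ ys))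
  dedupe [] = [] , [] , id , id
  dedupe (x ∷ xs) with dedupe xs | em _ {x ∈ˡ xs}
  ... | ys , un , f , g | yes i = ys , un , (λ j → there (f j)) , λ { (here refl) → g i ; (there j) → g j }
  ... | ys , un , f , g | no n = x ∷ ys , All.tabulate (λ j eq → n (f (subst (_∈ˡ ys) (sym eq) j))) ∷ un ,
   (λ { (here refl) → here refl ; (there j) → there (f j) }) , λ { (here refl) → here refl ; (there j) → there (g j) }

  -- A cardinality bound stated without a listing of `P`; it passes to subsets and adds up over
  -- unions directly.
  AtMost : {X : Set ℓ} → (X → Set ℓ') → ℕ → Set _
  AtMost P n = ∀ xs → Unique xs → (∀ {x} → x ∈ˡ xs → P x) → length xs ≤ℕ n

  atMost-list : {P : X → Set ℓ'} (ys : List X) → (∀ {x} → P x → x ∈ˡ ys) → AtMost P (length ys)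
  atMost-list ys f xs un h = unique-⊆ un λ i → f (h i)

  atMost-⊆ : {P : X → Set ℓ'} {Q : X → Set ℓ″} → (∀ {x} → P x → Q x) → AtMost Q n → AtMost P n
  atMost-⊆ sub h xs un k = h xs un λ i → sub (k i)

  atMost-≤ : {P : X → Set ℓ'} → m ≤ℕ n → AtMost P m → AtMost P n
  atMost-≤ le h xs un k = ≤-trans (h xs un k) le

  select-unique : (P : X → Set ℓ') (xs : List X) → Unique xs → Σ[ ys ∈ List X ] Σ[ zs ∈ List X ]
   (Unique ys × Unique zs × (∀ {x} → x ∈ˡ ys → x ∈ˡ xs × P x) × (∀ {x} → x ∈ˡ zs → x ∈ˡ xs × ¬ P x) × length xs ≡ length ys +ℕ length zs)
  select-unique P [] _ = [] , [] , [] , [] , (λ ()) , (λ ()) , refl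
  select-unique P (x ∷ xs) (x∉ ∷ un) with select-unique P xs un | em _ {P x}
  ... | ys , zs , uy , uz , f , g , eq | yes p = x ∷ ys , zs , All.tabulate (λ i → All.lookup x∉ (fst (f i))) ∷ uy , uz ,
   (λ { (here refl) → here refl , p ; (there i) → there (fst (f i)) , snd (f i) }) , (λ i → there (fst (g i)) , snd (g i)) , cong suc eq
  ... | ys , zs , uy , uz , f , g , eq | no n = ys , x ∷ zs , uy , All.tabulate (λ i → All.lookup x∉ (fst (g i))) ∷ uz ,
   (λ i → there (fst (f i)) , snd (f i)) , (λ { (here refl) → here refl , n ; (there i) → there (fst (g i)) , snd (g i) }) ,
   trans (cong suc eq) (sym (+-suc (length ys) (length zs)))

  atMost-∪ : {P : X → Set ℓ} {Q : X → Set ℓ'} {R : X → Set ℓ″} → (∀ {x} → P x → Q x ⊎ R x) → AtMost Q m → AtMost R n → AtMost P (m +ℕ n)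
  atMost-∪ {Q = Q} sub hq hr xs un h with select-unique Q xs un
  ... | ys , zs , uy , uz , f , g , eq = subst (_≤ℕ _) (sym eq) (+-mono-≤ (hq ys uy λ i → snd (f i))
   (hr zs uz λ i → [ (λ q → ⊥-elim (snd (g i) q)) , id ]′ (sub (h (fst (g i))))))

  size-atMost : {P : X → Set ℓ'} → HasSize P n → AtMost P n
  size-atMost {n = n} (ys , un , f , refl) = atMost-list ys λ {x} p → from (f x) p

  has-size : {P : X → Set ℓ'} (xs : List X) → (∀ {x} → P x → x ∈ˡ xs) → Σ[ n ∈ ℕ ] HasSize P n
  has-size {P = P} xs sub = let (ys , f , g) = select P xs; (zs , un , h , k) = dedupe ys in
   length zs , zs , un , (λ x → mk⇔ (λ i → snd (f (h i))) (λ p → k (g (sub p) p))) , refl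

  size-≤ : {P : X → Set ℓ'} → HasSize P m → AtMost P n → m ≤ℕ n
  size-≤ (xs , un , f , refl) h = h xs un λ {x} i → to (f x) i

  least : (P : ℕ → Set ℓ) → ∀ n → P n → Σ[ m ∈ ℕ ] (P m × (∀ k → P k → m ≤ℕ k))
  least P n pn = <-rec (λ n → P n → Σ[ m ∈ ℕ ] (P m × (∀ k → P k → m ≤ℕ k))) go n pn
   where
   go : ∀ n → (∀ {i} → i <ℕ n → P i → Σ[ m ∈ ℕ ] (P m × (∀ k → P k → m ≤ℕ k))) → P n → Σ[ m ∈ ℕ ] (P m × (∀ k → P k → m ≤ℕ k))
   go n rec pn with em _ {Σ[ i ∈ ℕ ] (i <ℕ n × P i)}
   ... | yes (i , l , p) = rec l p
   ... | no none = n , pn , λ k pk → ℕP.≮⇒≥ λ l → none (k , l , pk)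

  dist : V → V → ℕ
  dist u v with em 0ℓ {Reachable graph u v}
  ... | yes (n , W) = fst (least (Walk graph u v) n W)
  ... | no _ = 0

  dist-walk : Reachable graph u v → W[ u , v ] (dist u v)
  dist-walk {u} {v} r with em 0ℓ {Reachable graph u v}
  ... | yes (n , W) = fst (snd (least (Walk graph u v) n W))
  ... | no none = ⊥-elim (none r)

  dist-≤ : W[ u , v ] n → dist u v ≤ℕ n
  dist-≤ {u} {v} {n} W with em 0ℓ {Reachable graph u v}
  ... | yes (m , W') = snd (snd (least (Walk graph u v) m W')) n W
  ... | no none = z≤n

  dist-sym : Reachable graph u v → dist u v ≡ dist v u
  dist-sym r = ≤-antisym (dist-≤ (rev (dist-walk (reach-sym r)))) (dist-≤ (rev (dist-walk r)))

  is-distance : Reachable graph u v → IsDistance graph u v (dist u v)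
  is-distance r = dist-walk r , λ m W → dist-≤ W

  geodesic : Reachable graph u v → Geodesic graph u v
  geodesic r = record { walk = dist-walk r ; shortest = λ m W → dist-≤ W }

  at : W[ u , v ] n → ℕ → V
  at {u} [] _ = u
  at {u} (a ∷ W) zero = u
  at (a ∷ W) (suc i) = at W i

  at-0 : (W : W[ u , v ] n) → at W 0 ≡ u
  at-0 [] = refl
  at-0 (a ∷ W) = refl

  at-end : (W : W[ u , v ] n) → at W n ≡ v
  at-end [] = refl
  at-end (a ∷ W) = at-end W

  data Split {u v} : ∀ {n} → W[ u , v ] n → ℕ → Set where
   split : ∀ {x m k} (A : W[ u , x ] m) (B : W[ x , v ] k) → Split (A +ʷ B) m

  split-at : (W : W[ u , v ] n) → ∀ i → i ≤ℕ n → Split W i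
  split-at W zero _ = split [] W
  split-at (a ∷ W) (suc i) (s≤s l) with split-at W i l
  ... | split A B = split (a ∷ A) B

  at-+ : (A : W[ u , x ] m) (B : W[ x , v ] n) → at (A +ʷ B) m ≡ x
  at-+ [] B = at-0 B
  at-+ (a ∷ A) B = at-+ A B

  at-on : (W : W[ u , v ] n) → ∀ i → OnWalk graph (at W i) W
  at-on [] i = start
  at-on (a ∷ W) zero = start
  at-on (a ∷ W) (suc i) = later (at-on W i)

  on-at : {W : W[ u , v ] n} → OnWalk graph x W → Σ[ i ∈ ℕ ] (i ≤ℕ n × at W i ≡ x)
  on-at {W = W} start = 0 , z≤n , at-0 W
  on-at (later o) = let (i , l , e) = on-at o in suc i , s≤s l , e

  on-split : {W : W[ u , v ] n} → OnWalk graph x W → Σ[ i ∈ ℕ ] Σ[ j ∈ ℕ ] (W[ u , x ] i × W[ x , v ] j × i +ℕ j ≡ n)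
  on-split {W = W} start = 0 , _ , [] , W , refl
  on-split {W = a ∷ _} (later o) = let (i , j , A , B , e) = on-split o in suc i , j , a ∷ A , B , cong suc e

  on-+ˡ : {A : W[ u , x ] m} (B : W[ x , v ] n) → OnWalk graph y A → OnWalk graph y (A +ʷ B)
  on-+ˡ B start = start
  on-+ˡ B (later o) = later (on-+ˡ B o)

  on-+ʳ : (A : W[ u , x ] m) {B : W[ x , v ] n} → OnWalk graph y B → OnWalk graph y (A +ʷ B)
  on-+ʳ [] o = o
  on-+ʳ (a ∷ A) o = later (on-+ʳ A o)

  on-+⁻ : (A : W[ u , x ] m) {B : W[ x , v ] n} → OnWalk graph y (A +ʷ B) → OnWalk graph y A ⊎ OnWalk graph y B
  on-+⁻ [] o = inr o
  on-+⁻ (a ∷ A) start = inl start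
  on-+⁻ (a ∷ A) (later o) = [ (λ k → inl (later k)) , inr ]′ (on-+⁻ A o)

  on-end : (W : W[ u , v ] n) → OnWalk graph v W
  on-end [] = start
  on-end (a ∷ W) = later (on-end W)

  on-snoc : (W : W[ u , v ] n) (a : Adj graph v x) → OnWalk graph y (snoc W a) → OnWalk graph y W ⊎ y ≡ x
  on-snoc [] a start = inl start
  on-snoc [] a (later start) = inr refl
  on-snoc (b ∷ W) a start = inl start
  on-snoc (b ∷ W) a (later o) = [ (λ k → inl (later k)) , inr ]′ (on-snoc W a o)

  on-rev : (W : W[ u , v ] n) → OnWalk graph y (rev W) → OnWalk graph y W
  on-rev [] o = o
  on-rev (a ∷ W) o = [ (λ k → later (on-rev W k)) , (λ { refl → start }) ]′ (on-snoc (rev W) (adj-sym a) o)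

  vertices : W[ u , v ] n → List V
  vertices {u} [] = u ∷ []
  vertices {u} (a ∷ W) = u ∷ vertices W

  vertices-length : (W : W[ u , v ] n) → length (vertices W) ≡ suc n
  vertices-length [] = refl
  vertices-length (a ∷ W) = cong suc (vertices-length W)

  on-vertices : {W : W[ u , v ] n} → OnWalk graph x W → x ∈ˡ vertices W
  on-vertices {W = []} start = here refl
  on-vertices {W = a ∷ W} start = here refl
  on-vertices (later o) = there (on-vertices o)

  edge-on-walk : (W : W[ u , v ] n) → ∀ {e} → e ∈ˡ edges W → OnWalk graph (src e) W × OnWalk graph (tgt e) W
  edge-on-walk ((e , inl (refl , refl)) ∷ W) (here refl) = start , later start
  edge-on-walk ((e , inr (refl , refl)) ∷ W) (here refl) = later start , start
  edge-on-walk (a ∷ W) (there i) = let (p , q) = edge-on-walk W i in later p , later q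

  maximum : ∀ n (f : ℕ → ℕ) → Σ[ i ∈ ℕ ] (i ≤ℕ n × (∀ j → j ≤ℕ n → f j ≤ℕ f i))
  maximum zero f = 0 , z≤n , λ { zero _ → ≤-refl }
  maximum (suc n) f with maximum n f
  ... | i , l , h with ≤-total (f i) (f (suc n))
  ...   | inl le = suc n , ≤-refl , λ j k → case m≤n⇒m<n∨m≡n k of λ { (inl (s≤s p)) → ≤-trans (h j p) le ; (inr refl) → ≤-refl }
  ...   | inr ge = i , m≤n⇒m≤1+n l , λ j k → case m≤n⇒m<n∨m≡n k of λ { (inl (s≤s p)) → h j p ; (inr refl) → ge }

 open Distances

 -- Isoperimetry of closed walks in hyperbolic graphs

 module IsoperimetricInequality where

  private variable
   ℓ ℓ' : Level
   u v : V
   m n : ℕ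

  record Piece (W : W[ u , v ] n) (i m : ℕ) : Set where
   field
    {x y} : V
    {rest} : ℕ
    A : W[ u , x ] i
    B : W[ x , y ] m
    C : W[ y , v ] rest
    at-x : at W i ≡ x
    at-y : at W (i +ℕ m) ≡ y
    total : i +ℕ (m +ℕ rest) ≡ n
    sums : ∀ f → sumW f W ≡ sumW f A xor (sumW f B xor sumW f C)
    ons : ∀ {z} → OnWalk graph z W → OnWalk graph z A ⊎ OnWalk graph z B ⊎ OnWalk graph z C
    places : ∀ j → j ≤ℕ m → at W (i +ℕ j) ≡ at B j

  at-+ʳ : ∀ {x} (A : W[ u , x ] m) (B : W[ x , v ] n) → ∀ j → at (A +ʷ B) (m +ℕ j) ≡ at B j
  at-+ʳ [] B j = refl
  at-+ʳ (a ∷ A) B j = at-+ʳ A B j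

  at-+ˡ : ∀ {x} (A : W[ u , x ] m) (B : W[ x , v ] n) → ∀ j → j ≤ℕ m → at (A +ʷ B) j ≡ at A j
  at-+ˡ [] B zero _ = at-0 B
  at-+ˡ (a ∷ A) B zero _ = refl
  at-+ˡ (a ∷ A) B (suc j) (s≤s l) = at-+ˡ A B j l

  piece : (W : W[ u , v ] n) → ∀ i m → i +ℕ m ≤ℕ n → Piece W i m
  piece W i m h with split-at W i (≤-trans (m≤m+n i m) h)
  ... | split {k = k} A R with split-at R m (+-cancelˡ-≤ i m k h)
  ...   | split B C = record
   { A = A ; B = B ; C = C ; at-x = at-+ A (B +ʷ C) ; at-y = trans (at-+ʳ A (B +ʷ C) m) (at-+ B C) ; total = refl
   ; sums = λ f → trans (sumW-+ f A (B +ʷ C)) (cong (sumW f A xor_) (sumW-+ f B C))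
   ; ons = λ o → [ inl , (λ p → inr (on-+⁻ B p)) ]′ (on-+⁻ A o)
   ; places = λ j j≤m → trans (at-+ʳ A (B +ʷ C) j) (at-+ˡ B C j j≤m) }

  -- Only the first side, with a natural constant and a walk in place of a distance; rotating the
  -- triangle gives the other sides.
  Thin' : ℕ → Set
  Thin' D = ∀ {u v w} (α : Geodesic graph u v) (β : Geodesic graph v w) (γ : Geodesic graph w u) →
   ∀ x → OnWalk graph x (Geodesic.walk α) →
   Σ[ y ∈ V ] ((OnWalk graph y (Geodesic.walk β) ⊎ OnWalk graph y (Geodesic.walk γ)) × Σ[ n ∈ ℕ ] (n ≤ℕ D × W[ x , y ] n))

  record Shorter (K : ℕ) (W : W[ u , u ] n) : Set where
   field
    {n' l} : ℕ
    {o} : V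
    W' : W[ u , u ] n'
    loop : W[ o , o ] l
    shorter : n' <ℕ n
    short : l ≤ℕ K
    sums : ∀ f → sumW f W ≡ sumW f W' xor sumW f loop
    ons : ∀ {z} → OnWalk graph z W → OnWalk graph z W' ⊎ OnWalk graph z loop

  -- Dehn's algorithm: a nontrivial closed walk cannot be a local geodesic,
  -- since a point of it farthest from the base point could be cut off.
  module Dehn (D : ℕ) (thin : Thin' D) where
   -- `a` exceeds twice the thinness constant, which makes the middle of a geodesic of length `k`
   -- too far from its ends for the triangle argument below. `K` bounds a detour of length at most
   -- `k` together with its shortcut.
   a k K : ℕ
   a = suc (D +ℕ D)
   k = a +ℕ a
   K = k +ℕ k

   shortcut : (W : W[ u , u ] n) → ∀ i m → i +ℕ m ≤ℕ n → m ≤ℕ k → dist (at W i) (at W (i +ℕ m)) <ℕ m → Shorter K W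
   shortcut {u = u} {n = n} W i m h m≤k d<m = record
    { W' = A +ʷ (g +ʷ C) ; loop = B +ʷ rev g
    ; shorter = subst (i +ℕ (d +ℕ rest) <ℕ_) total (+-monoʳ-< i (+-monoˡ-< rest d<m'))
    ; short = +-mono-≤ m≤k (≤-trans (<⇒≤ d<m') m≤k)
    ; sums = λ f → trans (sums f) (trans (rearrange (sumW f A) (sumW f B) (sumW f C) (sumW f g))
     (sym (cong₂ _xor_ (trans (sumW-+ f A (g +ʷ C)) (cong (sumW f A xor_) (sumW-+ f g C))) (trans (sumW-+ f B (rev g)) (cong (sumW f B xor_) (sumW-rev f g))))))
    ; ons = λ o → case ons o of λ
     { (inl p) → inl (on-+ˡ (g +ʷ C) p)
     ; (inr (inl p)) → inr (on-+ˡ (rev g) p)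
     ; (inr (inr p)) → inl (on-+ʳ A (on-+ʳ g p)) } }
    where
    open Piece (piece W i m h)
    d = dist x y
    g = dist-walk {x} {y} (_ , B)
    d<m' : d <ℕ m
    d<m' = subst₂ (λ p q → dist p q <ℕ m) at-x at-y d<m
    rearrange : ∀ a b c g → a xor (b xor c) ≡ (a xor (g xor c)) xor (b xor g)
    rearrange = taut 4 (λ a b c g → a xor (b xor c)) (λ a b c g → (a xor (g xor c)) xor (b xor g)) refl

   reduce : (W : W[ u , u ] n) → 1 ≤ℕ n → Shorter K W
   reduce {u} {n} W 1≤n = by-contra absurd
    where
    module _ (none : ¬ Shorter K W) where
     geo : ∀ i m → i +ℕ m ≤ℕ n → m ≤ℕ k → m ≤ℕ dist (at W i) (at W (i +ℕ m))
     geo i m h m≤k = ℕP.≮⇒≥ λ l → none (shortcut W i m h m≤k l)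
     same-ends : at W 0 ≡ at W n
     same-ends = trans (at-0 W) (sym (at-end W))
     f : ℕ → ℕ
     f i = dist (at W i) u
     M : Σ[ i ∈ ℕ ] (i ≤ℕ n × (∀ j → j ≤ℕ n → f j ≤ℕ f i))
     M = maximum n f
     i0 = fst M
     i0≤n = fst (snd M)
     k<n : k <ℕ n
     k<n = ≰⇒> λ n≤k → <⇒≱ 1≤n (≤-trans (geo 0 n ≤-refl n≤k) (subst (λ z → dist (at W 0) z ≤ℕ 0) same-ends (dist-≤ [])))
     to-u : ∀ i → i ≤ℕ n → W[ u , at W i ] i × Σ[ j ∈ ℕ ] (i +ℕ j ≡ n × W[ at W i , u ] j)
     to-u i l = let open Piece (piece W i 0 (subst (_≤ℕ n) (sym (+-identityʳ i)) l)) in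
      subst (λ z → W[ u , z ] i) (sym at-x) A , _ , total , subst (λ z → W[ z , u ] rest) (sym at-x) (B +ʷ C)
     k≤f : k ≤ℕ f i0
     k≤f = ≤-trans (≤-trans (geo 0 k (<⇒≤ k<n) ≤-refl)
      (≤-reflexive (trans (dist-sym (_ , subst (λ z → W[ z , at W k ] k) (sym (at-0 W)) (fst (to-u k (<⇒≤ k<n))))) (cong (dist (at W k)) (at-0 W)))))
      (snd (snd M) k (<⇒≤ k<n))
     k≤i0 : k ≤ℕ i0
     k≤i0 = ≤-trans k≤f (dist-≤ (rev (fst (to-u i0 i0≤n))))
     r : ℕ
     r = fst (snd (to-u i0 i0≤n))
     i0+r : i0 +ℕ r ≡ n
     i0+r = fst (snd (snd (to-u i0 i0≤n)))
     k≤r : k ≤ℕ r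
     k≤r = ≤-trans k≤f (dist-≤ (snd (snd (snd (to-u i0 i0≤n)))))
     p : ℕ
     -- The piece of length `k` is centred at a vertex of the walk farthest from `u`. It fits
     -- because that vertex is at distance at least `k` from `u` along both parts of the walk.
     p = i0 ∸ a
     p+a : p +ℕ a ≡ i0
     p+a = m∸n+n≡m (≤-trans (m≤m+n a a) k≤i0)
     bound : i0 +ℕ a ≤ℕ n
     bound = subst (i0 +ℕ a ≤ℕ_) i0+r (+-monoʳ-≤ i0 (≤-trans (m≤m+n a a) k≤r))
     p+k : p +ℕ k ≡ i0 +ℕ a
     p+k = trans (sym (+-assoc p a a)) (cong (_+ℕ a) p+a)
     P : Piece W p k
     P = piece W p k (subst (_≤ℕ n) (sym p+k) bound)
     open Piece P
     c : V
     c = at W i0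
     α : Geodesic graph x y
     α = record { walk = B ; shortest = λ m V' → ≤-trans (geo p k (subst (_≤ℕ n) (sym p+k) bound) ≤-refl) (subst₂ (λ x y → dist x y ≤ℕ m) (sym at-x) (sym at-y) (dist-≤ V')) }
     on-c : OnWalk graph c B
     on-c = subst (λ z → OnWalk graph z B) (trans (sym (places a (m≤m+n a a))) (cong (at W) p+a)) (at-on B a)
     x-u : Reachable graph x u
     x-u = _ , B +ʷ C
     y-u : Reachable graph y u
     y-u = _ , C
     fx : dist x u ≤ℕ f i0
     fx = subst (λ z → dist z u ≤ℕ f i0) at-x (snd (snd M) p (≤-trans (m∸n≤m i0 a) i0≤n))
     fy : dist y u ≤ℕ f i0
     fy = subst (λ z → dist z u ≤ℕ f i0) at-y (snd (snd M) (p +ℕ k) (subst (_≤ℕ n) (sym p+k) bound))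
     a≤cx : a ≤ℕ dist c x
     a≤cx = ≤-trans (geo p a (subst (_≤ℕ n) (sym p+a) i0≤n) (m≤m+n a a))
      (≤-reflexive (trans (cong₂ (λ z i → dist z (at W i)) at-x p+a) (dist-sym (_ , fst (snd (snd (on-split on-c)))))))
     a≤cy : a ≤ℕ dist c y
     a≤cy = subst (λ z → a ≤ℕ dist c z) (trans (cong (at W) (sym p+k)) at-y) (geo i0 a bound (m≤m+n a a))
     -- The triangle inequality through a point t near c on a geodesic from z to u.
     close : ∀ z t i j d → W[ z , t ] i → W[ t , u ] j → i +ℕ j ≡ dist z u → dist z u ≤ℕ f i0 → a ≤ℕ dist c z → d ≤ℕ D → W[ c , t ] d → ⊥
     close z t i j d Z T eq zu cz d≤D Q = ℕP.<-irrefl refl (≤-trans total-bound (≤-reflexive (+-comm (D +ℕ D) (f i0))))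
      where
      e1 : a ≤ℕ D +ℕ i
      e1 = ≤-trans cz (≤-trans (dist-≤ (Q +ʷ rev Z)) (+-monoˡ-≤ i d≤D))
      e2 : f i0 ≤ℕ D +ℕ j
      e2 = ≤-trans (dist-≤ (Q +ʷ T)) (+-monoˡ-≤ j d≤D)
      shuffle : (D +ℕ i) +ℕ (D +ℕ j) ≡ (D +ℕ D) +ℕ (i +ℕ j)
      shuffle = trans (+-assoc D i (D +ℕ j)) (trans (cong (D +ℕ_) (trans (sym (+-assoc i D j)) (trans (cong (_+ℕ j) (+-comm i D)) (+-assoc D i j)))) (sym (+-assoc D D (i +ℕ j))))
      total-bound : suc (f i0 +ℕ (D +ℕ D)) ≤ℕ (D +ℕ D) +ℕ f i0
      total-bound = ≤-trans (≤-reflexive (cong suc (+-comm (f i0) (D +ℕ D))))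
       (≤-trans (+-mono-≤ e1 e2) (≤-trans (≤-reflexive shuffle) (+-monoʳ-≤ (D +ℕ D) (≤-trans (≤-reflexive eq) zu))))
     near-side : Σ[ t ∈ V ] ((OnWalk graph t (dist-walk y-u) ⊎ OnWalk graph t (dist-walk (reach-sym x-u))) × Σ[ d ∈ ℕ ] (d ≤ℕ D × W[ c , t ] d)) → ⊥
     near-side (t , inl o , d , d≤D , Q) = let (i , j , Z , T , eq) = on-split o in close y t i j d Z T eq fy a≤cy d≤D Q
     near-side (t , inr o , d , d≤D , Q) = let (i , j , Z , T , eq) = on-split o in
      close x t j i d (rev T) (rev Z) (trans (+-comm j i) (trans eq (dist-sym (reach-sym x-u)))) fx a≤cx d≤D Q
     absurd : ⊥
     absurd = near-side (thin α (geodesic y-u) (geodesic (reach-sym x-u)) c on-c)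

   -- Each reduction splits off a short loop; a cochain that is even on all of these would be even
   -- on the walk, since it vanishes on the empty walk left at the end.
   short-odd : ∀ f (W : W[ u , u ] n) → sumW f W ≡ true → Σ[ o ∈ V ] Σ[ l ∈ ℕ ] Σ[ L ∈ W[ o , o ] l ] (l ≤ℕ K × sumW f L ≡ true)
   short-odd {u} {n} f = <-rec (λ n → (W : W[ u , u ] n) → sumW f W ≡ true → Σ[ o ∈ V ] Σ[ l ∈ ℕ ] Σ[ L ∈ W[ o , o ] l ] (l ≤ℕ K × sumW f L ≡ true)) go n
    where
    go : ∀ n → (∀ {i} → i <ℕ n → (W : W[ u , u ] i) → sumW f W ≡ true → Σ[ o ∈ V ] Σ[ l ∈ ℕ ] Σ[ L ∈ W[ o , o ] l ] (l ≤ℕ K × sumW f L ≡ true)) →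
     (W : W[ u , u ] n) → sumW f W ≡ true → Σ[ o ∈ V ] Σ[ l ∈ ℕ ] Σ[ L ∈ W[ o , o ] l ] (l ≤ℕ K × sumW f L ≡ true)
    go zero rec [] ()
    go (suc n) rec W odd = use (reduce W (s≤s z≤n))
     where
     use : Shorter K W → Σ[ o ∈ V ] Σ[ l ∈ ℕ ] Σ[ L ∈ W[ o , o ] l ] (l ≤ℕ K × sumW f L ≡ true)
     use R with Bool-cases (sumW f (Shorter.loop R))
     ... | inl e = _ , _ , Shorter.loop R , Shorter.short R , e
     ... | inr e = rec (Shorter.shorter R) (Shorter.W' R) (trans (sym (trans (Shorter.sums R f) (trans (cong (sumW f (Shorter.W' R) xor_) e) (xor-identityʳ (sumW f (Shorter.W' R)))))) odd)

  -- Vertices of the walk are listed separately, since the winding parity has no meaning at points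
  -- on it.
  Enclosed : W[ u , u ] n → V → Set
  Enclosed W v = OnWalk graph v W ⊎ wind (φ (vertex v)) W ≡ true

  Isoperimetry : (ℕ → ℕ) → Set₁
  Isoperimetry F = ∀ (S : Pred V 0ℓ) m n → HasSize S (suc m) → HasSize (∂ graph S) n → suc m ≤ℕ F n

  module Isoperimetric (noacc : NoVertexAccumulation G)
   (F : ℕ → ℕ) (F-mono : Monotonic₁ _≤ℕ_ _≤ℕ_ F)
   (iso : Isoperimetry F)
   where

   Strictly-inside : W[ u , u ] n → Pred V 0ℓ
   Strictly-inside W v = ¬ OnWalk graph v W × wind (φ (vertex v)) W ≡ true

   -- Between vertices off the walk an edge preserves the winding parity, so a neighbour off the
   -- walk would itself be strictly inside.
   boundary-on : (W : W[ u , u ] n) → ∀ {v} → ∂ graph (Strictly-inside W) v → OnWalk graph v W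
   boundary-on W {v} (out , w , (w-off , ww) , a) = by-contra λ v-off → out (v-off ,
    trans (wind-edge (edges W) (λ v → OnWalk graph v W) (edge-on-walk W) a v-off w-off W (λ _ i → i)) ww)

   inside-bound : (W : W[ u , u ] n) → AtMost (Strictly-inside W) (F (suc n))
   inside-bound {n = n} W with has-size (fst (inside-finite noacc W)) (λ {v} (_ , h) → snd (inside-finite noacc W) v h)
   ... | zero , sz = atMost-≤ z≤n (size-atMost sz)
   ... | suc m , sz = let (k , sz∂) = has-size (vertices W) (λ d → on-vertices (boundary-on W d)) in
    atMost-≤ (≤-trans (iso _ m k sz sz∂) (F-mono (≤-trans (size-≤ sz∂ (atMost-list (vertices W) λ d → on-vertices (boundary-on W d))) (≤-reflexive (vertices-length W))))) (size-atMost sz)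

   enclosed-bound : (W : W[ u , u ] n) → AtMost (Enclosed W) (suc n +ℕ F (suc n))
   enclosed-bound {n = n} W = atMost-∪ {Q = λ v → OnWalk graph v W} {R = Strictly-inside W}
    (λ {v} → [ inl , (λ h → case em 0ℓ {OnWalk graph v W} of λ { (yes o) → inl o ; (no k) → inr (k , h) }) ]′)
    (subst (AtMost (λ v → OnWalk graph v W)) (vertices-length W) (atMost-list (vertices W) on-vertices)) (inside-bound W)

   module _ (D : ℕ) (thin : Thin' D) where
    open Dehn D thin

    Q : ℕ
    Q = suc K +ℕ F (suc K)

    short-bound : ∀ {l} (L : W[ u , u ] l) → l ≤ℕ K → AtMost (Enclosed L) Q
    short-bound L l≤K = atMost-≤ (+-mono-≤ (s≤s l≤K) (F-mono (s≤s l≤K))) (enclosed-bound L)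

    -- Each reduction shortens the walk by at least one edge and splits off a loop that encloses at
    -- most `Q` vertices.
    linear-bound : (W : W[ u , u ] n) → AtMost (Enclosed W) (suc n *ℕ Q)
    linear-bound {u} {n} = <-rec (λ n → (W : W[ u , u ] n) → AtMost (Enclosed W) (suc n *ℕ Q)) go n
     where
     go : ∀ n → (∀ {i} → i <ℕ n → (W : W[ u , u ] i) → AtMost (Enclosed W) (suc i *ℕ Q)) → (W : W[ u , u ] n) → AtMost (Enclosed W) (suc n *ℕ Q)
     go zero rec W = atMost-≤ (m≤m+n Q 0) (short-bound W z≤n)
     go (suc n) rec W = use (reduce W (s≤s z≤n))
      where
      use : Shorter K W → AtMost (Enclosed W) (suc (suc n) *ℕ Q)
      use R = atMost-∪ {Q = Enclosed loop} {R = Enclosed W'} cover (short-bound loop short) (atMost-≤ (*-monoˡ-≤ Q shorter) (rec shorter W'))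
       where
       open Shorter R
       cover : ∀ {v} → Enclosed W v → Enclosed loop v ⊎ Enclosed W' v
       cover (inl o) = [ (λ p → inr (inl p)) , (λ p → inl (inl p)) ]′ (ons o)
       cover {v} (inr h) with Bool-cases (wind (φ (vertex v)) loop)
       ... | inl e = inl (inr e)
       ... | inr e = inr (inr (trans (sym (trans (sums (κ (φ (vertex v)))) (trans (cong (wind (φ (vertex v)) W' xor_) e) (xor-identityʳ (wind (φ (vertex v)) W'))))) h))

 open IsoperimetricInequality

 -- Mod 2 cycles and their combinations

 module Chains where

  private variable
   ℓ ℓ' : Level
   u v : V
   m n : ℕ

  sumE : (E → Bool) → List E → Bool
  sumE f [] = false
  sumE f (e ∷ c) = f e xor sumE f c

  sumE-++ : ∀ f c d → sumE f (c ++ d) ≡ sumE f c xor sumE f d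
  sumE-++ f [] d = refl
  sumE-++ f (e ∷ c) d = trans (cong (f e xor_) (sumE-++ f c d)) (sym (xor-assoc (f e) (sumE f c) (sumE f d)))

  sumE-edges : ∀ f (W : W[ u , v ] n) → sumE f (edges W) ≡ sumW f W
  sumE-edges f [] = refl
  sumE-edges f ((e , _) ∷ W) = cong (f e xor_) (sumE-edges f W)

  δ : (V → Bool) → E → Bool
  δ g e = g (src e) xor g (tgt e)

  -- Mod 2 cycles, detected by the vanishing of all coboundaries on them.
  Even : List E → Set
  Even c = ∀ g → sumE (δ g) c ≡ false

  even-closed : (W : W[ u , u ] n) → Even (edges W)
  even-closed {u} W g = trans (sumE-edges (δ g) W) (trans (sumW-potential (δ g) W g (λ _ _ → refl)) (xor-same (g u)))

  even-++ : ∀ {c d} → Even c → Even d → Even (c ++ d)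
  even-++ {c} {d} ec ed g = trans (sumE-++ (δ g) c d) (cong₂ _xor_ (ec g) (ed g))

  cnt : {X : Set ℓ} → (X → Bool) → List X → ℕ
  cnt p [] = 0
  cnt p (x ∷ xs) = (if p x then 1 else 0) +ℕ cnt p xs

  module _ {X : Set ℓ} where
   cnt-split : ∀ (p q : X → Bool) xs → cnt p xs ≡ cnt (λ x → p x ∧ q x) xs +ℕ cnt (λ x → p x ∧ not (q x)) xs
   cnt-split p q [] = refl
   cnt-split p q (x ∷ xs) with p x | q x
   ... | true | true = cong suc (cnt-split p q xs)
   ... | true | false = trans (cong suc (cnt-split p q xs)) (sym (+-suc (cnt (λ x → p x ∧ q x) xs) _))
   ... | false | _ = cnt-split p q xs

   cnt-mono : ∀ (p q : X → Bool) xs → (∀ x → p x ≡ true → q x ≡ true) → cnt p xs ≤ℕ cnt q xs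
   cnt-mono p q [] h = z≤n
   cnt-mono p q (x ∷ xs) h with p x in e | q x in e'
   ... | true | true = s≤s (cnt-mono p q xs h)
   ... | true | false = true≢false (trans (sym (h x e)) e')
   ... | false | true = m≤n⇒m≤1+n (cnt-mono p q xs h)
   ... | false | false = cnt-mono p q xs h

   cnt-all : ∀ (xs : List X) → cnt (λ _ → true) xs ≡ length xs
   cnt-all [] = refl
   cnt-all (x ∷ xs) = cong suc (cnt-all xs)

   cnt-none : ∀ (p : X → Bool) xs → (∀ x → p x ≡ false) → cnt p xs ≡ 0
   cnt-none p [] h = refl
   cnt-none p (x ∷ xs) h rewrite h x = cnt-none p xs h

   cnt-atMost : ∀ (p : X → Bool) xs → Unique xs → AtMost (λ x → p x ≡ true) n → cnt p xs ≤ℕ n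
   cnt-atMost p xs un h = let (ys , l , uy , f) = go xs un in subst (_≤ℕ _) l (h ys uy λ i → snd (f i))
    where
    go : ∀ xs → Unique xs → Σ[ ys ∈ List X ] (length ys ≡ cnt p xs × Unique ys × (∀ {x} → x ∈ˡ ys → x ∈ˡ xs × p x ≡ true))
    go [] _ = [] , refl , [] , λ ()
    go (x ∷ xs) (x∉ ∷ un) with go xs un | p x in e
    ... | ys , l , uy , f | true = x ∷ ys , cong suc l , All.tabulate (λ i → All.lookup x∉ (fst (f i))) ∷ uy ,
     λ { (here refl) → here refl , e ; (there i) → there (fst (f i)) , snd (f i) }
    ... | ys , l , uy , f | false = ys , l , uy , λ i → there (fst (f i)) , snd (f i)

  -- If every x is odd for one of the chains Cs, then some combination of them is odd for half of the xs:
  -- choose greedily whether to add a chain, according to the x for which it is the last odd one.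
  module _ {X : Set} (val : X → E → Bool) (xs : List X) (H : List E) where
   odd : X → List E → Bool
   odd x c = sumE (val x) c

   record Combination (Cs : List (List E)) (c0 : List E) (q : X → Bool) : Set where
    field
     c : List E
     even : Even c0 → Even c
     within : (∀ {e} → e ∈ˡ c0 → e ∈ˡ H) → ∀ {e} → e ∈ˡ c → e ∈ˡ H
     unchanged : ∀ x → (∀ {d} → d ∈ˡ Cs → odd x d ≡ false) → odd x c ≡ odd x c0
     half : cnt q xs ≤ℕ 2 *ℕ cnt (λ x → q x ∧ odd x c) xs

   combine : ∀ Cs → (∀ {d} → d ∈ˡ Cs → Even d) → (∀ {d e} → d ∈ˡ Cs → e ∈ˡ d → e ∈ˡ H) → ∀ c0 q →
    (∀ x → q x ≡ true → Σ[ d ∈ List E ] (d ∈ˡ Cs × odd x d ≡ true)) → Combination Cs c0 q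
   combine [] ev wi c0 q h = record { c = c0 ; even = id ; within = id ; unchanged = λ _ _ → refl
    ; half = ≤-trans (≤-reflexive (cnt-none q xs λ x → ≢true λ e → case h x e of λ { (_ , () , _) })) z≤n }
   combine (d ∷ Cs) ev wi c0 q h = finish (≤-total (cnt (λ x → q″ x ∧ not (odd x c0)) xs) (cnt (λ x → q″ x ∧ odd x c0) xs))
    where
    later? : X → Bool
    later? x = dec (Σ[ d ∈ List E ] (d ∈ˡ Cs × odd x d ≡ true))
    q' q″ : X → Bool
    q' x = q x ∧ later? x
    q″ x = q x ∧ not (later? x)
    not-later : ∀ x → q″ x ≡ true → ∀ {d} → d ∈ˡ Cs → odd x d ≡ false
    not-later x e i = ≢true λ o → true≢false (trans (sym (∧-right {q x} e)) (cong not (dec-yes (_ , i , o))))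
    first : ∀ x → q″ x ≡ true → odd x d ≡ true
    first x e with h x (∧-left e)
    ... | _ , here refl , o = o
    ... | _ , there i , o = true≢false (trans (sym o) (not-later x e i))
    extend' : ∀ c1 → (Even c0 → Even c1) → ((∀ {e} → e ∈ˡ c0 → e ∈ˡ H) → ∀ {e} → e ∈ˡ c1 → e ∈ˡ H) →
     (∀ x → odd x d ≡ false → odd x c1 ≡ odd x c0) → cnt q″ xs ≤ℕ 2 *ℕ cnt (λ x → q″ x ∧ odd x c1) xs → Combination (d ∷ Cs) c0 q
    extend' c1 ec wc un hf = record
     { c = c ; even = λ k → even (ec k) ; within = λ k → within (wc k)
     ; unchanged = λ x k → trans (unchanged x (λ i → k (there i))) (un x (k (here refl)))
     ; half = subst₂ _≤ℕ_ (sym (cnt-split q later? xs)) (trans (sym (*-distribˡ-+ 2 (cnt (λ x → q' x ∧ odd x c) xs) _)) (cong (2 *ℕ_) (sym (trans (cnt-split (λ x → q x ∧ odd x c) later? xs)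
      (cong₂ _+ℕ_ (same (λ x → taut 3 (λ a b c → (a ∧ b) ∧ c) (λ a b c → (a ∧ c) ∧ b) refl (q x) (odd x c) (later? x)))
       (same (λ x → taut 3 (λ a b c → (a ∧ b) ∧ not c) (λ a b c → (a ∧ not c) ∧ b) refl (q x) (odd x c) (later? x))))))))
      (+-mono-≤ half (≤-trans hf (*-monoʳ-≤ 2 (cnt-mono (λ x → q″ x ∧ odd x c1) (λ x → q″ x ∧ odd x c) xs
       λ x e → ∧-both (∧-left e) (trans (unchanged x (not-later x (∧-left e))) (∧-right {q″ x} e)))))) }
     where
     open Combination (combine Cs (λ i → ev (there i)) (λ i → wi (there i)) c1 q' (λ x e → dec-true (∧-right {q x} e)))
     same : ∀ {p p' : X → Bool} → (∀ x → p x ≡ p' x) → cnt p xs ≡ cnt p' xs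
     same {p} {p'} k = ≤-antisym (cnt-mono p p' xs λ x e → trans (sym (k x)) e) (cnt-mono p' p xs λ x e → trans (k x) e)
    double : ∀ {a b} → a ≤ℕ b → b +ℕ a ≤ℕ 2 *ℕ b
    double {a} {b} l = +-monoʳ-≤ b (≤-trans l (m≤m+n b 0))
    finish : cnt (λ x → q″ x ∧ not (odd x c0)) xs ≤ℕ cnt (λ x → q″ x ∧ odd x c0) xs ⊎ cnt (λ x → q″ x ∧ odd x c0) xs ≤ℕ cnt (λ x → q″ x ∧ not (odd x c0)) xs →
     Combination (d ∷ Cs) c0 q
    finish (inl l) = extend' c0 id id (λ _ _ → refl) (≤-trans (≤-reflexive (cnt-split q″ (λ x → odd x c0) xs)) (double l))
    finish (inr l) = extend' (d ++ c0) (λ k → even-++ {d} {c0} (ev (here refl)) k) (λ k i → [ wi (here refl) , k ]′ (∈-++⁻ d i))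
     (λ x k → trans (sumE-++ (val x) d c0) (cong (_xor odd x c0) k))
     (≤-trans (≤-trans (≤-reflexive (trans (cnt-split q″ (λ x → odd x c0) xs) (+-comm (cnt (λ x → q″ x ∧ odd x c0) xs) _))) (double l))
      (*-monoʳ-≤ 2 (cnt-mono (λ x → q″ x ∧ not (odd x c0)) (λ x → q″ x ∧ odd x (d ++ c0)) xs λ x e →
       ∧-both (∧-left e) (trans (sumE-++ (val x) d c0) (trans (cong (_xor odd x c0) (first x (∧-left e))) (∧-right {q″ x} e))))))

  sumE-false : ∀ (f : E → Bool) c → (∀ {e} → e ∈ˡ c → f e ≡ false) → sumE f c ≡ false
  sumE-false f [] h = refl
  sumE-false f (e ∷ c) h rewrite h (here refl) = sumE-false f c (λ i → h (there i))

  module _ (H : List E) where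
   private
    Hu = dedupe H
    hs : List E
    hs = fst Hu
    unique-hs : Unique hs
    unique-hs = fst (snd Hu)

   parity : List E → E → Bool
   parity c e = sumE (λ e' → dec (e ≡ e')) c

   private
    thin-out : (E → Bool) → List E → List E
    thin-out p [] = []
    thin-out p (e ∷ c) = if p e then e ∷ thin-out p c else thin-out p c

    thin-sum : ∀ f p c → sumE f (thin-out p c) ≡ sumE (λ e → p e ∧ f e) c
    thin-sum f p [] = refl
    thin-sum f p (e ∷ c) with p e
    ... | true = cong (f e xor_) (thin-sum f p c)
    ... | false = thin-sum f p c

    thin-length : ∀ p c → length (thin-out p c) ≤ℕ length c
    thin-length p [] = z≤n
    thin-length p (e ∷ c) with p e
    ... | true = s≤s (thin-length p c)
    ... | false = m≤n⇒m≤1+n (thin-length p c)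

    sumE-⊕ : ∀ (f g : E → Bool) c → sumE (λ e → f e xor g e) c ≡ sumE f c xor sumE g c
    sumE-⊕ f g [] = refl
    sumE-⊕ f g (e ∷ c) = trans (cong ((f e xor g e) xor_) (sumE-⊕ f g c)) (xor-swap (f e) (g e) (sumE f c) (sumE g c))

    sumE-cong : ∀ (f g : E → Bool) c → (∀ e → f e ≡ g e) → sumE f c ≡ sumE g c
    sumE-cong f g [] h = refl
    sumE-cong f g (e ∷ c) h = cong₂ _xor_ (h e) (sumE-cong f g c h)

    single : ∀ (f : E → Bool) e c → Unique c → e ∈ˡ c → sumE (λ x → dec (x ≡ e) ∧ f x) c ≡ f e
    single f e (_ ∷ c) (e∉ ∷ un) (here refl) = trans (cong₂ _xor_ (cong (_∧ f e) (dec-yes {A = e ≡ e} refl))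
     (sumE-false (λ x → dec (x ≡ e) ∧ f x) c λ {x} i → cong (_∧ f x) (dec-no λ eq → All.lookup e∉ i (sym eq)))) (xor-identityʳ (f e))
    single f e (x ∷ c) (x∉ ∷ un) (there i) = trans (cong (λ b → (b ∧ f x) xor sumE (λ x → dec (x ≡ e) ∧ f x) c) (dec-no λ eq → All.lookup x∉ i eq)) (single f e c un i)

    collect : ∀ (f : E → Bool) c → (∀ {e} → e ∈ˡ c → e ∈ˡ H) → sumE f c ≡ sumE (λ e → parity c e ∧ f e) hs
    collect f [] h = sym (sumE-false (λ e → parity [] e ∧ f e) hs λ _ → refl)
    collect f (e ∷ c) h = trans (cong₂ _xor_ (sym (single f e hs unique-hs (snd (snd (snd Hu)) (h (here refl))))) (collect f c (λ i → h (there i))))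
     (trans (sym (sumE-⊕ (λ x → dec (x ≡ e) ∧ f x) (λ x → parity c x ∧ f x) hs))
      (sumE-cong (λ x → (dec (x ≡ e) ∧ f x) xor (parity c x ∧ f x)) (λ x → parity (e ∷ c) x ∧ f x) hs λ x → taut 3 (λ a b c → (a ∧ c) xor (b ∧ c)) (λ a b c → (a xor b) ∧ c) refl (dec (x ≡ e)) (parity c x) (f x)))

   -- Mod 2 only the parity of each edge counts. A combination of many walks may be long, but its
   -- length is cut down to the number of available edges.
   shrink-chain : ∀ c → (∀ {e} → e ∈ˡ c → e ∈ˡ H) → Σ[ d ∈ List E ] (length d ≤ℕ length H × (∀ f → sumE f d ≡ sumE f c))
   shrink-chain c h = thin-out (parity c) hs ,
    ≤-trans (thin-length (parity c) hs) (unique-⊆ unique-hs (fst (snd (snd Hu)))) ,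
    λ f → trans (thin-sum f (parity c) hs) (sym (collect f c h))

  -- Every mod 2 cycle is a sum of closed walks: extend a trail until it closes up.
  record Peeled (c : List E) : Set where
   field
    {base} : V
    {k} : ℕ
    loop : W[ base , base ] (suc k)
    rest : List E
    rest-even : Even rest
    total : suc k +ℕ length rest ≡ length c
    sums : ∀ f → sumE f c ≡ sumW f loop xor sumE f rest

  peel : ∀ c → Even c → 1 ≤ℕ length c → Peeled c
  peel (e ∷ c) even _ = go (length c) c refl ((e , inl (refl , refl)) ∷ []) (λ g → sym (xor-≡ (even g))) refl
   (λ f → cong (_xor sumE f c) (sym (xor-identityʳ (f e))))
   where
   u0 = src e
   find : ∀ (f : E → Bool) r → sumE f r ≡ true → Σ[ e ∈ E ] (e ∈ˡ r × f e ≡ true)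
   find f (e ∷ r) h with f e in eq
   ... | true = e , here refl , eq
   ... | false = let (e' , i , k) = find f r h in e' , there i , k
   go : ∀ n r → length r ≡ n → ∀ {x k} (T : W[ u0 , x ] (suc k)) → (∀ g → sumE (δ g) r ≡ g u0 xor g x) →
    suc k +ℕ length r ≡ suc (length c) → (∀ f → sumE f (e ∷ c) ≡ sumW f T xor sumE f r) → Peeled (e ∷ c)
   go n r l {x} {k} T bd total sums with em _ {u0 ≡ x}
   ... | yes refl = record { loop = T ; rest = r ; rest-even = λ g → trans (bd g) (xor-same (g u0)) ; total = total ; sums = sums }
   -- As long as the trail is open, the coboundary of the indicator of `x` is odd on the remaining
   -- edges, so one of them has exactly one end at `x` and continues the trail.
   ... | no ne = step (find (δ at-x) r (trans (bd at-x) (cong₂ _xor_ (dec-no {A = u0 ≡ x} ne) (dec-yes {A = x ≡ x} refl))))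
    where
    at-x : V → Bool
    at-x v = dec (v ≡ x)
    other : ∀ e' → δ at-x e' ≡ true → Σ[ y ∈ V ] Joins e' x y
    other e' h with em _ {src e' ≡ x} | em _ {tgt e' ≡ x}
    ... | yes p | _ = tgt e' , inl (p , refl)
    ... | no _ | yes q = src e' , inr (refl , q)
    other e' () | no _ | no _
    step : Σ[ e' ∈ E ] (e' ∈ˡ r × δ at-x e' ≡ true) → Peeled (e ∷ c)
    step (e' , i , h) with ∈-∃++ i | other e' h
    ... | r1 , r2 , refl | y , j = continue n l
     where
     remove : ∀ f → sumE f (r1 ++ e' ∷ r2) ≡ f e' xor sumE f (r1 ++ r2)
     remove f = trans (sumE-++ f r1 (e' ∷ r2)) (trans (taut 3 (λ a b c → a xor (b xor c)) (λ a b c → b xor (a xor c)) refl (sumE f r1) (f e') (sumE f r2))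
      (cong (f e' xor_) (sym (sumE-++ f r1 r2))))
     len : length (r1 ++ e' ∷ r2) ≡ suc (length (r1 ++ r2))
     len = trans (length-++ r1) (trans (+-suc (length r1) (length r2)) (cong suc (sym (length-++ r1))))
     continue : ∀ n → length (r1 ++ e' ∷ r2) ≡ n → Peeled (e ∷ c)
     continue zero l = ⊥-elim (1+n≢0 (trans (sym len) l))
     continue (suc n) l = go n (r1 ++ r2) (suc-injective (trans (sym len) l)) (snoc T (e' , j))
      (λ g → trans (taut 2 (λ a b → b) (λ a b → a xor (a xor b)) refl (δ g e') (sumE (δ g) (r1 ++ r2)))
       (trans (cong (δ g e' xor_) (trans (sym (remove (δ g))) (bd g))) (trans (cong (_xor (g u0 xor g x)) (joins-xor j g))
        (taut 3 (λ x y u → (x xor y) xor (u xor x)) (λ x y u → u xor y) refl (g x) (g y) (g u0)))))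
      (trans (sym (+-suc (suc k) (length (r1 ++ r2)))) (trans (cong (suc k +ℕ_) (sym len)) total))
      (λ f → trans (sums f) (trans (cong (sumW f T xor_) (remove f)) (trans (sym (xor-assoc (sumW f T) (f e') _)) (cong (_xor sumE f (r1 ++ r2)) (sym (sumW-snoc f T (e' , j)))))))

  -- The loops split off by `peel` have length n at least 1, so n + 1 is at most 2 n; with the
  -- factor 2 the bound is additive over loops.
  even-bound : {X : Set} (val : X → E → Bool) (Q : ℕ) →
   (∀ {u n} (W : W[ u , u ] n) → AtMost (λ x → sumW (val x) W ≡ true) (suc n *ℕ Q)) →
   ∀ c → Even c → AtMost (λ x → sumE (val x) c ≡ true) (2 *ℕ length c *ℕ Q)
  even-bound {X} val Q bound c even = <-rec (λ n → ∀ c → length c ≡ n → Even c → AtMost (λ x → sumE (val x) c ≡ true) (2 *ℕ n *ℕ Q)) go (length c) c refl even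
   where
   Goal : ℕ → Set
   Goal n = ∀ c → length c ≡ n → Even c → AtMost (λ x → sumE (val x) c ≡ true) (2 *ℕ n *ℕ Q)
   go : ∀ n → (∀ {i} → i <ℕ n → Goal i) → Goal n
   go n rec [] l even xs un h = empty xs h
    where empty : ∀ xs → (∀ {x} → x ∈ˡ xs → false ≡ true) → length xs ≤ℕ 2 *ℕ n *ℕ Q
          empty [] _ = z≤n
          empty (x ∷ xs) h = true≢false (sym (h (here refl)))
   go n rec c@(_ ∷ _) refl even = use (peel c even (s≤s z≤n))
    where
    use : Peeled c → AtMost (λ x → sumE (val x) c ≡ true) (2 *ℕ length c *ℕ Q)
    use P = atMost-≤ (≤-reflexive arith) (atMost-∪ {Q = λ x → sumW (val x) loop ≡ true} {R = λ x → sumE (val x) rest ≡ true} cover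
     (atMost-≤ (*-monoˡ-≤ Q {suc (suc k)} {2 *ℕ suc k} (s≤s (≤-trans (≤-reflexive (cong suc (sym (+-identityʳ k)))) (m≤n+m (suc (k +ℕ 0)) k)))) (bound loop))
     (rec (subst (length rest <ℕ_) total (s≤s (m≤n+m (length rest) k))) rest refl rest-even))
     where
     open Peeled P
     cover : ∀ {x} → sumE (val x) c ≡ true → sumW (val x) loop ≡ true ⊎ sumE (val x) rest ≡ true
     cover {x} h with Bool-cases (sumW (val x) loop)
     ... | inl e = inl e
     ... | inr e = inr (trans (sym (trans (sums (val x)) (cong (_xor sumE (val x) rest) e))) h)
     arith : 2 *ℕ suc k *ℕ Q +ℕ 2 *ℕ length rest *ℕ Q ≡ 2 *ℕ length c *ℕ Q
     arith = trans (sym (*-distribʳ-+ Q (2 *ℕ suc k) (2 *ℕ length rest))) (cong (_*ℕ Q) (trans (sym (*-distribˡ-+ 2 (suc k) (length rest))) (cong (2 *ℕ_) total)))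

 open Chains

 -- The region of the plane spanned by a finite vertex set

 module Regions where

  private variable
   ℓ : Level
   u v : V
   n : ℕ

  -- If the closure of the face of `w` met no graph point in the box, the face would be open and
  -- closed in the box and so contain `y`.
  first-hit : ∀ H {p q r s} → (∀ w → w ∈ Box p q r s → OnGraph w → On H w) → ∀ {y w} → y ∈ Box p q r s → OnGraph y →
   w ∈ Box p q r s → Complement G w → Σ[ u ∈ ℝ² ] (u ∈ Box p q r s × OnGraph u × Closure (Face G w) u)
  first-hit H {p} {q} {r} {s} sub {y} {w} i (x , eq) j cw = by-contra λ none →
   let f : ℝ² → Bool
       f v = dec (Face G w v)
       loc : Locally-constant-on (Box p q r s) f
       loc v k = case em _ {OnGraph v} of λ
        { (yes g) → let ncl = not-closure λ cl → none (v , k , g , cl) in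
         N-map (λ v' nf _ → trans (dec-no nf) (sym (dec-no (N-here ncl)))) ncl
        ; (no ng) → off v k ng }
   in component-⊆ (dec-true (trans (box-const {p} {q} {r} {s} f loc y w i j) (dec-yes (component-self cw)))) x eq
   where
   off : ∀ v → v ∈ Box p q r s → ¬ OnGraph v → N v (λ v' → v' ∈ Box p q r s → dec (Face G w v') ≡ dec (Face G w v))
   off v k ng with N-∩ (on-closed H v λ (e , _ , o) → ng (onEdge⇒graph {e} o)) (nb {P = λ z → z ∈ Box p q r s} p q r s k λ _ i → i)
   ... | nb a b c d l g = nb a b c d l λ v' l' _ →
    let clear : Box a b c d ⊆ Complement G
        clear {z} m x eq = fst (g z m) (sub z (snd (g z m)) (x , eq))
    in dec-⇔ (box-in-component {p = a} {b} {c} {d} (λ {z} → clear {z}) {w = v'} {v} l' l) (box-in-component {p = a} {b} {c} {d} (λ {z} → clear {z}) {w = v} {v'} l l')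

  chain-const : ∀ {A z w} (f : ℝ² → Bool) → (∀ y → ¬ A y → N y (λ w → ¬ A w → f w ≡ f y)) → Chain A z w → f z ≡ f w
  chain-const f loc start = refl
  chain-const f loc (extend {w} {v} p q r s c miss i j) = trans (chain-const f loc c)
   (box-const {p} {q} {r} {s} f (λ y k → N-map (λ z g m → g λ az → miss z az m) (loc y λ ay → miss y ay k)) w v i j)

  face-edge : ∀ {z w} → Face G z w → ∀ {e} → BoundaryEdge G z e → BoundaryEdge G w e
  face-edge {z} {w} f (a , b , c) = move a , move b , λ t i → move (c t i)
   where
   move : ∀ {y} → Closure (Face G z) y → Closure (Face G w) y
   move cl = meets-closure λ A n → let (v , g , k) = closure-meets cl n in v , component-trans (component-sym f) g , k

  linked-crossing : ∀ {H} (S : V → Set) → Linked H u v → S u → ¬ S v →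
   Σ[ x ∈ V ] Σ[ y ∈ V ] Σ[ e ∈ E ] (Joins e x y × e ∈ˡ H × S x × ¬ S y)
  linked-crossing S (_ , W , h) = go W h
   where
   go : ∀ {u v n H} (W : W[ u , v ] n) → Within H W → S u → ¬ S v → Σ[ x ∈ V ] Σ[ y ∈ V ] Σ[ e ∈ E ] (Joins e x y × e ∈ˡ H × S x × ¬ S y)
   go [] _ s ns = ⊥-elim (ns s)
   go (_∷_ {v = w} (e , j) W) h s ns with em _ {S w}
   ... | yes sw = go W (λ e i → h e (there i)) sw ns
   ... | no nw = _ , _ , e , j , h e (here refl) , s , nw

  joins-sym : ∀ {e} → Joins e u v → Joins e v u
  joins-sym (inl j) = inr j
  joins-sym (inr j) = inl j

  -- `H` is the barrier around `S`: leaving the region of `S` along an edge or across a face means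
  -- passing an edge of `H`. `M` serves to bound that region.
  record Marking : Set₂ where
   constructor marking
   field
    ground : Terrain
    faces : FaceLists
    S : V → Set
    H M : List E
    frontier : ∀ {e v} → ∂ graph S v → Incident e v → e ∈ˡ H
    frontier-face : ∀ z c {e e' v} → ∂ graph S v → Incident e v → e ∈ˡ fst (faces z c) → e' ∈ˡ fst (faces z c) → e' ∈ˡ H
    all : ∀ {e v} → S v → Incident e v → e ∈ˡ M
    all-face : ∀ z c {e e' v} → S v → Incident e v → e ∈ˡ fst (faces z c) → e' ∈ˡ fst (faces z c) → e' ∈ˡ M

  module Region (marked : Marking) where
   open Marking marked
   open Terrain ground
   open FacialStructure ground

   Touches : E → Set
   Touches e = S (src e) ⊎ S (tgt e)

   touch : ∀ {e v} → S v → Incident e v → Touches e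
   touch s (inl refl) = inl s
   touch s (inr refl) = inr s

   touch⁻ : ∀ {e} → Touches e → Σ[ v ∈ V ] (S v × Incident e v)
   touch⁻ (inl s) = _ , s , inl refl
   touch⁻ (inr s) = _ , s , inr refl

   both-ends : ∀ {e v} → Touches e → ¬ (e ∈ˡ H) → Incident e v → S v
   both-ends {e} {v} (inl s) e∉ i = by-contra λ nv → e∉ (frontier (nv , src e , s , e , [ (λ { refl → ⊥-elim (nv s) }) , (λ { refl → inr (refl , refl) }) ]′ i) i)
   both-ends {e} {v} (inr s) e∉ i = by-contra λ nv → e∉ (frontier (nv , tgt e , s , e , [ (λ { refl → inl (refl , refl) }) , (λ { refl → ⊥-elim (nv s) }) ]′ i) i)

   Sₚ : Point graph → Set
   Sₚ (vertex v) = S v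
   Sₚ (inner e _ _) = Touches e

   -- The region of `S`. A face all of whose touching boundary edges lie in `H` is left out, so that
   -- membership can change only on `H`.
   D : ℝ² → Set (lsuc (lsuc 0ℓ))
   D y = (Σ[ x ∈ Point graph ] (φ x ≈² y × Sₚ x)) ⊎ (Complement G y × Σ[ e ∈ E ] (BoundaryEdge G y e × Touches e × ¬ (e ∈ˡ H)))

   D-graph : ∀ x {w} → φ x ≈² w → D w → Sₚ x
   D-graph x {w} eq (inr (c , _)) = ⊥-elim (c x eq)
   D-graph x {w} eq (inl (x' , eq' , s)) = go (injective x' x (≈²-trans (φ x') w (φ x) eq' (≈²-sym (φ x) w eq))) s
    where
    go : ∀ {x x'} → _≈ᵖ_ graph x' x → Sₚ x' → Sₚ x
    go vertex s = s
    go (inner _) s = s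

   D-complement : ∀ {w} → Complement G w → D w → Σ[ e ∈ E ] (BoundaryEdge G w e × Touches e × ¬ (e ∈ˡ H))
   D-complement c (inl (x , eq , _)) = ⊥-elim (c x eq)
   D-complement c (inr (_ , d)) = d

   module AtFace (w : ℝ²) (c : Complement G w) where
    H0 = fst (faces w c)
    spec = snd (faces w c)

    linked-ends : ∀ {e v} → e ∈ˡ H0 → Incident e v → Linked H0 (src e) v
    linked-ends m (inl refl) = linked-refl
    linked-ends m (inr refl) = linked-edge m

    -- Otherwise the connected boundary of the face has an edge from `S` to `∂ graph S`, and then
    -- `frontier-face` puts all of its edges into `H`, including `e'`.
    cross : ∀ {e e' v} → e' ∈ˡ H0 → Touches e' → ¬ (e' ∈ˡ H) → e ∈ˡ H0 → Incident e v → S v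
    cross {e} {e'} {v} m t e'∉ m' inc = by-contra λ nv →
     let (x , y , d , j , dm , sx , ny) = linked-crossing S (linked-trans (boundary-connected (listed-face w c H0 spec) m m') (linked-ends m' inc)) (both-ends t e'∉ (inl refl)) nv
     in e'∉ (frontier-face w c (ny , x , sx , d , joins-sym j) (snd (joins-incident j)) dm m)

    spread-M : ∀ {e e'} → e ∈ˡ H0 → Touches e → e' ∈ˡ H0 → e' ∈ˡ M
    spread-M m t m' = let (v , s , i) = touch⁻ t in all-face w c s i m m'

   graph-in-M : ∀ x {w} → φ x ≈² w → Sₚ x → On M w
   graph-in-M (vertex v) {w} eq s with leaves (v ∷ []) (here refl)
   ... | (_ , y , here refl , _ , (e , j)) = let inc = fst (joins-incident j) in e , all s inc , arc-≈ {z = φ (vertex v)} {w} eq (on-edge-vertex inc)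
   graph-in-M (inner e t i) {w} eq s = let (v , sv , inc) = touch⁻ s in e , all sv inc , arc-≈ {z = φ (inner e t i)} {w} eq (inner-on e t i)

   -- A face in the region is encircled by a closed walk in its own boundary, whose edges all lie in
   -- `M`.
   D-bounded : ∀ {a b c d} → BoundedBy a b c d (On M) → ∀ w → D w → w ∈ Box a b c d
   D-bounded bd w (inl (x , eq , s)) = bd w (graph-in-M x eq s)
   D-bounded {a} {b} {c} {d} bd w (inr (cw , e , be , t , _)) =
    let open AtFace w cw
        e∈ = from (spec e) be
        (_ , _ , W , h , wt) = encircled (listed-face w cw H0 spec) e∈
    in by-contra λ out → true≢false (trans (sym wt) (wind-outside {a = a} {b} {c} {d} W
     (λ { z (e' , i , o) → bd z (e' , spread-M e∈ t (fst (Facial.AtFace.Component.H-in ground (listed-face w cw H0 spec) (src e) (h e' i))) , o) }) out))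

   OpenD : ℝ² → Set₁
   OpenD y = N y (λ w → ¬ On H w → dec (D w) ≡ dec (D y))

   -- Common part of the two kinds of graph points. `s` is the value on the graph near `y`; by
   -- `first-hit` every face near `y` meets the graph there, which transfers the value to the face.
   D-open-near : ∀ y (K : List E) → OnGraph y → N y (λ w → OnGraph w → On K w) → ∀ {A : ℝ² → Set₁} → N y A → ∀ s →
    (∀ x w → φ x ≈² w → A w → ¬ On H w → (Sₚ x → s ≡ true) × (s ≡ true → Sₚ x)) →
    (∀ x w u → φ x ≈² u → A u → Complement G w → Closure (Face G w) (φ x) → (D w → s ≡ true) × (s ≡ true → D w)) →
    ¬ On H y → OpenD y
   D-open-near y K (xy , eqy) cov {A} nA s onG off y∉ with N-∩ cov nA
   ... | nb a b c d i g = nb a b c d i λ w k w∉ → trans (val w k w∉) (sym (val y i y∉))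
    where
    val : ∀ w → w ∈ Box a b c d → ¬ On H w → dec (D w) ≡ s
    val w k w∉ with em _ {OnGraph w}
    ... | yes (x , eq) = let (f , f') = onG x w eq (snd (g w k)) w∉ in
     same-truth (λ e → f (D-graph x eq (dec-true e))) (λ e → dec-yes (inl (x , eq , f' e)))
    ... | no ng = let cw : Complement G w
                      cw x eq = ng (x , eq)
                      (u , l , (x , eq) , cl) = first-hit K {a} {b} {c} {d} (λ w k → fst (g w k)) {y} {w} i (xy , eqy) k cw
                      (f , f') = off x w u eq (snd (g u l)) cw (closure-≈ (listed-face w cw (AtFace.H0 w cw) (AtFace.spec w cw)) (≈²-sym (φ x) u eq) cl)
     in same-truth (λ e → f (dec-true e)) (λ e → dec-yes (f' e))

   ½ : ℚ
   ½ = fst (<-dense 0<1)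

   D-near-vertex : ∀ v → ¬ On H (φ (vertex v)) → OpenD (φ (vertex v))
   D-near-vertex v v∉ = D-open-near (φ (vertex v)) (star v) (vertex v , ≈²-refl (φ (vertex v)))
    (N-map (λ w st (x , eq) → cov x w eq (st x eq)) st-N) st-N (dec (S v))
    (λ x w eq st w∉ → (λ s → dec-yes (outer x s (st x eq))) , λ e → inn x (dec-true e) (st x eq))
    (λ x w u eq st cw cl →
     let open AtFace w cw
         (e , m , inc) = hit w cw x (st x eq) cl
     in (λ d → let (e' , b , t , e'∉) = D-complement cw d in dec-yes (cross (from (spec e') b) t e'∉ m inc)) ,
      λ k → inr (cw , e , to (spec e) m , touch (dec-true k) inc , e∉ inc))
    v∉
    where
    St = Star v (λ _ → ½) (λ _ → ½)
    st-N : N (φ (vertex v)) (λ w → ∀ x → φ x ≈² w → St x)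
    st-N = star-N v (λ _ → ½) (λ _ → ½) (λ _ → fst (snd (<-dense 0<1))) (λ _ → snd (snd (<-dense 0<1)))
    e∉ : ∀ {e} → Incident e v → ¬ (e ∈ˡ H)
    e∉ inc m = v∉ (_ , m , on-edge-vertex inc)
    ends : ∀ {e t} → (src e ≡ v × t <ʳ ½) ⊎ (tgt e ≡ v × ½ <ˡ t) → Incident e v
    ends (inl (p , _)) = inl p
    ends (inr (p , _)) = inr p
    cov : ∀ x w → φ x ≈² w → St x → On (star v) w
    cov _ w eq (inl refl) with leaves (v ∷ []) (here refl)
    ... | (_ , y , here refl , _ , (e , j)) = let inc = fst (joins-incident j) in e , in-star inc , arc-≈ {z = φ (vertex v)} {w} eq (on-edge-vertex inc)
    cov _ w eq (inr (e , t , i , refl , k)) = e , in-star (ends {e} {t} k) , arc-≈ {z = φ (inner e t i)} {w} eq (inner-on e t i)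
    outer : ∀ x → Sₚ x → St x → S v
    outer _ s (inl refl) = s
    outer _ s (inr (e , t , i , refl , k)) = let inc = ends {e} {t} k in both-ends s (e∉ inc) inc
    inn : ∀ x → S v → St x → Sₚ x
    inn _ s (inl refl) = s
    inn _ s (inr (e , t , i , refl , k)) = touch s (ends {e} {t} k)
    hit : ∀ w cw x → St x → Closure (Face G w) (φ x) → Σ[ e ∈ E ] (e ∈ˡ AtFace.H0 w cw × Incident e v)
    hit w cw _ (inl refl) cl = closure-vertex (listed-face w cw (AtFace.H0 w cw) (AtFace.spec w cw)) v cl
    hit w cw _ (inr (e , t , i , refl , k)) cl = e , closure-inner (listed-face w cw (AtFace.H0 w cw) (AtFace.spec w cw)) e t i cl , ends {e} {t} k

   D-near-inner : ∀ e t i → ¬ On H (φ (inner e t i)) → OpenD (φ (inner e t i))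
   D-near-inner e t i x∉ = D-open-near (φ (inner e t i)) (e ∷ []) (inner e t i , ≈²-refl (φ (inner e t i)))
    (N-map (λ w sg (x , eq) → cov x w eq (sg x eq)) sg-N) sg-N (dec (Touches e))
    (λ x w eq sg w∉ → (λ s → dec-yes (subst Sₚ (snd (lies x (sg x eq))) s)) , λ k → subst Sₚ (sym (snd (lies x (sg x eq)))) (dec-true k))
    (λ x w u eq sg cw cl →
     let open AtFace w cw
         (s , j , x≡ , _) = sg x eq
         m = closure-inner (listed-face w cw H0 spec) e s j (subst (λ x → Closure (Face G w) (φ x)) x≡ cl)
     in (λ d → let (e' , b , t , e'∉) = D-complement cw d in dec-yes (inl (cross (from (spec e') b) t e'∉ m (inl refl)))) ,
      λ k → inr (cw , e , to (spec e) m , dec-true k , e∉))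
    x∉
    where
    sg-N : N (φ (inner e t i)) (λ w → ∀ x → φ x ≈² w → Σ[ s ∈ ℝ ] Σ[ j ∈ _ ] (x ≡ inner e s j × Between 0ℚ 1ℚ s))
    sg-N = segment-N e t i 0ℚ 1ℚ i
    e∉ : ¬ (e ∈ˡ H)
    e∉ m = x∉ (e , m , inner-on e t i)
    lies : ∀ x → Σ[ s ∈ ℝ ] Σ[ j ∈ _ ] (x ≡ inner e s j × Between 0ℚ 1ℚ s) → Σ[ sj ∈ Σ[ s ∈ ℝ ] Between 0ℚ 1ℚ s ] x ≡ inner e (fst sj) (snd sj)
    lies x (s , j , eq , _) = (s , j) , eq
    cov : ∀ x w → φ x ≈² w → Σ[ s ∈ ℝ ] Σ[ j ∈ _ ] (x ≡ inner e s j × Between 0ℚ 1ℚ s) → On (e ∷ []) w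
    cov _ w eq (s , j , refl , _) = e , here refl , arc-≈ {z = φ (inner e s j)} {w} eq (inner-on e s j)

   -- A face with a boundary edge is open. A face without one is not in the region, and a face of
   -- the region that comes close to `y` would contain `y` by `saturated`.
   D-near-complement : ∀ y → Complement G y → OpenD y
   D-near-complement y cy with em _ {Σ[ e ∈ E ] e ∈ˡ AtFace.H0 y cy}
   ... | yes (e0 , m) = N-map (λ w f _ → dec-⇔
    (λ d → let (e , b , r) = D-complement (component-⊆ f) d in inr (cy , e , face-edge (component-sym f) b , r))
    (λ d → let (e , b , r) = D-complement cy d in inr (component-⊆ f , e , face-edge f b , r)))
    (open-face (listed-face y cy H0 spec) m (component-self cy))
    where open AtFace y cy
   ... | no none = near (on-closed M y λ (e , _ , o) → let (x , eq) = onEdge⇒graph {e} o in cy x eq)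
    where
    open AtFace y cy
    empty : ∀ {e} → ¬ BoundaryEdge G y e
    empty {e} b = none (e , from (spec e) b)
    near : N y (λ w → ¬ On M w) → OpenD y
    near (nb a b c d i g) = nb a b c d i λ w k _ → trans (dec-no (not-D w k)) (sym (dec-no λ dy → let (_ , b , _) = D-complement cy dy in empty b))
     where
     not-D : ∀ w → w ∈ Box a b c d → ¬ D w
     not-D w k (inl (x , eq , s)) = g w k (graph-in-M x eq s)
     not-D w k (inr (cw , e , be , t , _)) =
      let module B = AtFace w cw
          m = from (B.spec e) be
      in empty (face-edge (saturated (listed-face w cw B.H0 B.spec) m {a} {b} {c} {d} (λ { z (e' , i' , o) l → g z l (e' , B.spread-M m t i' , o) }) {w} {y} k i (component-self cw)) be)

   D-open : ∀ y → ¬ On H y → OpenD y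
   D-open y y∉ with em _ {OnGraph y}
   ... | no ng = D-near-complement y (λ x eq → ng (x , eq))
   ... | yes (x , eq) = move (go x λ (e , m , o) → y∉ (e , m , arc-≈ {z = φ x} {y} eq o))
    where
    go : ∀ x → ¬ On H (φ x) → OpenD (φ x)
    go (vertex v) = D-near-vertex v
    go (inner e t i) = D-near-inner e t i
    move : OpenD (φ x) → OpenD y
    move n = N-map (λ w g w∉ → trans (g w∉) (sym (N-here (N-≈ eq n) y∉))) (N-≈ eq n)

   -- The region contains the vertex, is bounded, and membership cannot change along boxes that miss
   -- `H`. So a rational point near the vertex cannot escape, and some closed walk in `H` encircles
   -- it.
   encloses : ∀ v → S v → ¬ On H (φ (vertex v)) → Encircled H (φ (vertex v))
   encloses v sv v∉ = near (N-∩ (D-open (φ (vertex v)) v∉) (on-closed H (φ (vertex v)) v∉)) (bounded (M ++ H))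
    where
    y = φ (vertex v)
    near : N y (λ w → (¬ On H w → dec (D w) ≡ dec (D y)) × ¬ On H w) → ∃[ a ] ∃[ b ] ∃[ c ] ∃[ d ] BoundedBy a b c d (On (M ++ H)) → Encircled H y
    near (nb a b c d i g) (l , r , bo , t , bd) =
     let (px , p1 , p2) = rational-in (fst y) (fst i)
         (py , p3 , p4) = rational-in (snd y) (snd i)
         p = ι px , ι py
         j : p ∈ Box a b c d
         j = (p1 , p2) , (p3 , p4)
         p∉ = snd (g p j)
         Dp : dec (D p) ≡ true
         Dp = trans (fst (g p j) p∉) (dec-yes (inl (vertex v , ≈²-refl y , sv)))
         bdM : BoundedBy l r bo t (On M)
         bdM z (e , m , o) = bd z (e , ∈-++⁺ˡ m , o)
     in case encircled-or-escapes H px py {l} {r} {bo} {t} p∉ (λ { z (e , m , o) → bd z (e , ∈-++⁺ʳ M m , o) }) (D-bounded {l} {r} {bo} {t} bdM p (dec-true Dp)) of λ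
      { (inl (u , n , W , h , wt)) → u , n , W , h , trans (box-const {a} {b} {c} {d} (λ z → wind z W)
       (λ z k → N-map (λ z' e _ → e) (wind-const W λ { (e , m , o) → snd (g z k) (e , h e m , o) })) y p i j) wt
      ; (inr (w , out , ch)) → ⊥-elim (out (D-bounded {l} {r} {bo} {t} bdM w (dec-true (trans (sym (chain-const (λ w → dec (D w)) D-open ch)) Dp)))) }

 -- Bounded codegree and non-amenability from hyperbolicity

 module Codegree where
  open Regions

  private variable
   ℓ : Level
   u v : V
   m n : ℕ

  length-concatMap : ∀ {X Y : Set} (f : X → List Y) {c} → (∀ x → length (f x) ≤ℕ c) → ∀ xs → length (concatMap f xs) ≤ℕ length xs *ℕ c
  length-concatMap f h [] = z≤n
  length-concatMap f {c} h (x ∷ xs) = subst (_≤ℕ c +ℕ length xs *ℕ c) (sym (length-++ (f x))) (+-mono-≤ (h x) (length-concatMap f h xs))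

  frac-≤ : ∀ p q → p ℚᵘ.≤ q → fromℚᵘ p ≤ fromℚᵘ q
  frac-≤ p q h = ℚP.toℚᵘ-cancel-≤ (ℚᵘP.≤-trans (ℚᵘP.≤-reflexive (ℚP.toℚᵘ-fromℚᵘ p)) (ℚᵘP.≤-trans h (ℚᵘP.≤-reflexive (ℚᵘP.≃-sym (ℚP.toℚᵘ-fromℚᵘ q)))))

  frac-≤⁻ : ∀ p q → fromℚᵘ p ≤ fromℚᵘ q → p ℚᵘ.≤ q
  frac-≤⁻ p q h = ℚᵘP.≤-trans (ℚᵘP.≤-reflexive (ℚᵘP.≃-sym (ℚP.toℚᵘ-fromℚᵘ p))) (ℚᵘP.≤-trans (ℚP.toℚᵘ-mono-≤ h) (ℚᵘP.≤-reflexive (ℚP.toℚᵘ-fromℚᵘ q)))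

  frac-mono : ∀ m n c d → m *ℕ suc d ≤ℕ n *ℕ suc c → pos m / suc c ≤ pos n / suc d
  frac-mono m n c d h = frac-≤ (mkℚᵘ (pos m) c) (mkℚᵘ (pos n) d) (*≤* (subst₂ ℤ._≤_ (ℤP.pos-* m (suc d)) (ℤP.pos-* n (suc c)) (ℤ.+≤+ h)))

  frac-mono⁻ : ∀ m n c d → pos m / suc c ≤ pos n / suc d → m *ℕ suc d ≤ℕ n *ℕ suc c
  frac-mono⁻ m n c d h with frac-≤⁻ (mkℚᵘ (pos m) c) (mkℚᵘ (pos n) d) h
  ... | *≤* k = ℤP.drop‿+≤+ (subst₂ ℤ._≤_ (sym (ℤP.pos-* m (suc d))) (sym (ℤP.pos-* n (suc c))) k)

  fromℕ-/ : ∀ n → fromℕ n ≡ pos n / 1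
  fromℕ-/ n = ℚP.toℚᵘ-injective (ℚᵘP.≃-trans (fromℕ-ᵘ n) (ℚᵘP.≃-sym (ℚP.toℚᵘ-fromℚᵘ (mkℚᵘ (pos n) 0))))

  nonamenable : ∀ C → Isoperimetry (C *ℕ_) → NonAmenable graph
  nonamenable C h = pos 1 / suc C , <-≤-trans (positive⁻¹ (pos 1 / suc C) {{ℚP.normalize-pos 1 (suc C)}}) ℚP.≤-refl ,
   λ { _ (S , m , n , sz , sz∂ , refl) → frac-mono 1 n C m (≤-trans (≤-reflexive (+-identityʳ (suc m)))
    (≤-trans (h S m n sz sz∂) (≤-trans (≤-reflexive (*-comm C n)) (*-monoʳ-≤ n (n≤1+n C))))) }

  thin-natural : Hyperbolic graph → Σ[ D ∈ ℕ ] Thin' D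
  thin-natural (δ , _ , hyp) = let (q , δ<q) = ℝ.upper-inhab δ; (D , q<D) = archimedean1 q in D , λ {u} {v} {w} α β γ x o →
   let (y , y∈ , n , (W , _) , n≤δ) = fst (hyp u (0 , []) (_ , Geodesic.walk α) (reach-sym (_ , Geodesic.walk γ)) α β γ) o
   in y , y∈ , n , ℕP.≮⇒≥ (λ D<n → n≤δ (upper-up≤ δ (ℚP.≤-trans (ℚP.<⇒≤ q<D) (subst (_≤ pos n / 1) (sym (fromℕ-/ D))
    (frac-mono D n 0 0 (*-monoˡ-≤ 1 (<⇒≤ D<n))))) δ<q)) , W

  -- Whatever a walk does between its first and last passage of `e` can be skipped.
  linked-once : ∀ {H e} → Linked (e ∷ H) u v → Linked H u v ⊎ Σ[ p ∈ V ] Σ[ q ∈ V ] (Joins e p q × Linked H u p × Linked H q v)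
  linked-once {H = H} {e} (_ , W , h) = go W h
   where
   go : ∀ {u v n} (W : W[ u , v ] n) → Within (e ∷ H) W → Linked H u v ⊎ Σ[ p ∈ V ] Σ[ q ∈ V ] (Joins e p q × Linked H u p × Linked H q v)
   go [] h = inl linked-refl
   go ((d , j) ∷ W) h with go W (λ e i → h e (there i)) | h d (here refl)
   ... | inl L | there m = inl (linked-trans (1 , (d , j) ∷ [] , λ { _ (here refl) → m }) L)
   ... | inr (p , q , k , L , L') | there m = inr (p , q , k , linked-trans (1 , (d , j) ∷ [] , λ { _ (here refl) → m }) L , L')
   ... | inl L | here refl = inr (_ , _ , j , linked-refl , L)
   ... | inr (p , q , k , L , L') | here refl with joins-ends j k
    where
    joins-ends : ∀ {a b p q} → Joins d a b → Joins d p q → q ≡ a ⊎ q ≡ b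
    joins-ends (inl (refl , refl)) (inl (_ , y)) = inr (sym y)
    joins-ends (inl (refl , refl)) (inr (x , _)) = inl (sym x)
    joins-ends (inr (refl , refl)) (inl (_ , y)) = inl (sym y)
    joins-ends (inr (refl , refl)) (inr (x , _)) = inr (sym x)
   ...   | inl refl = inl L'
   ...   | inr refl = inr (_ , _ , j , linked-refl , L')

  -- The crude bound 2^n - 1 that results from adding edges one at a time; it depends only on their
  -- number.
  diameter : ℕ → ℕ
  diameter zero = 0
  diameter (suc n) = suc (diameter n +ℕ diameter n)

  diameter-mono : m ≤ℕ n → diameter m ≤ℕ diameter n
  diameter-mono z≤n = z≤n
  diameter-mono (s≤s h) = s≤s (+-mono-≤ (diameter-mono h) (diameter-mono h))

  linked-short : ∀ H → Linked H u v → Σ[ n ∈ ℕ ] (n ≤ℕ diameter (length H) × W[ u , v ] n)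
  linked-short [] (_ , [] , _) = 0 , z≤n , []
  linked-short [] (_ , (e , _) ∷ _ , h) = case h e (here refl) of λ ()
  linked-short (e ∷ H) l with linked-once l
  ... | inl L = let (n , b , W) = linked-short H L in n , m≤n⇒m≤1+n (≤-trans b (m≤m+n _ _)) , W
  ... | inr (p , q , j , L , L') = let (n , b , W) = linked-short H L; (n' , b' , W') = linked-short H L' in
   n +ℕ suc n' , ≤-trans (≤-reflexive (+-suc n n')) (s≤s (+-mono-≤ b b')) , W +ʷ ((e , j) ∷ W')

  module Balls (star : V → List E) (in-star : Stars star) (Δ : ℕ) (star-length : ∀ v → length (star v) ≤ℕ Δ) where
   grow : List V → List V
   grow vs = vs ++ (map src (concatMap star vs) ++ map tgt (concatMap star vs))

   stars : List V → List E
   stars = concatMap star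

   in-stars : ∀ {e v vs} → Incident e v → v ∈ˡ vs → e ∈ˡ stars vs
   in-stars inc i = ∈-concatMap⁺ star (Any.map (λ { refl → in-star inc }) i)

   in-grow : ∀ {vs} → u ∈ˡ vs → Adj graph u v → v ∈ˡ grow vs
   in-grow {vs = vs} i (e , inl (refl , refl)) = ∈-++⁺ʳ vs (∈-++⁺ʳ (map src (stars vs)) (∈-map⁺ tgt (in-stars (inl refl) i)))
   in-grow {vs = vs} i (e , inr (refl , refl)) = ∈-++⁺ʳ vs (∈-++⁺ˡ (∈-map⁺ src (in-stars (inr refl) i)))

   ball : ℕ → List V → List V
   ball zero vs = vs
   ball (suc n) vs = ball n (grow vs)

   in-ball : ∀ {vs} n → u ∈ˡ vs → W[ u , v ] m → m ≤ℕ n → v ∈ˡ ball n vs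
   in-ball zero i [] _ = i
   in-ball (suc n) i [] _ = in-ball n (∈-++⁺ˡ i) [] z≤n
   in-ball (suc n) i (a ∷ W) (s≤s h) = in-ball n (in-grow i a) W h

   growth : ℕ
   growth = suc (Δ +ℕ Δ)

   ball-length : ∀ n vs → length (ball n vs) ≤ℕ length vs *ℕ growth ^ n
   ball-length zero vs = ≤-reflexive (sym (*-identityʳ (length vs)))
   ball-length (suc n) vs = ≤-trans (ball-length n (grow vs)) (≤-trans (*-monoˡ-≤ (growth ^ n) grow-length)
    (≤-reflexive (*-assoc (length vs) growth (growth ^ n))))
    where
    k = length vs *ℕ Δ
    edge-count : ∀ (f : E → V) → length (map f (stars vs)) ≤ℕ k
    edge-count f = ≤-trans (≤-reflexive (length-map f (stars vs))) (length-concatMap star star-length vs)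
    grow-length : length (grow vs) ≤ℕ length vs *ℕ growth
    grow-length = ≤-trans (≤-reflexive (trans (length-++ vs) (cong (length vs +ℕ_) (length-++ (map src (stars vs))))))
     (≤-trans (+-monoʳ-≤ (length vs) (+-mono-≤ (edge-count src) (edge-count tgt)))
      (≤-reflexive (sym (trans (*-suc (length vs) (Δ +ℕ Δ)) (cong (length vs +ℕ_) (*-distribˡ-+ (length vs) Δ Δ))))))

  module Leaves (star : V → List E) (in-star : Stars star) (Δ : ℕ) (star-length : ∀ v → length (star v) ≤ℕ Δ)
   (F : ℕ → ℕ) (F-0 : F 0 ≡ 0) (iso : Isoperimetry F) where
   open Balls star in-star Δ star-length

   boundary-size : ∀ (S : Pred V 0ℓ) vs → (∀ {v} → S v → v ∈ˡ vs) → Σ[ n ∈ ℕ ] HasSize (∂ graph S) n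
   boundary-size S vs sub = has-size (grow vs) λ (_ , w , s , a) → in-grow (sub s) (adj-sym a)

   -- Here `F 0 ≡ 0` enters: a nonempty finite set cannot have empty boundary.
   leaves : NoFiniteComponent
   leaves vs {v} i = go (has-size {P = λ x → x ∈ˡ vs} vs id) (boundary-size (λ x → x ∈ˡ vs) vs id)
    where
    go : Σ[ n ∈ ℕ ] HasSize (λ x → x ∈ˡ vs) n → Σ[ n ∈ ℕ ] HasSize (∂ graph (λ x → x ∈ˡ vs)) n →
     Σ[ x ∈ V ] Σ[ y ∈ V ] (x ∈ˡ vs × ¬ (y ∈ˡ vs) × Adj graph x y)
    go (zero , [] , _ , f , _) _ = case from (f v) i of λ ()
    go (suc m , sz) (zero , sz∂) = case subst (suc m ≤ℕ_) F-0 (iso _ m 0 sz sz∂) of λ ()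
    go (suc m , sz) (suc n , y ∷ ys , _ , f , _) = let (y∉ , w , w∈ , a) = to (f y) (here refl) in w , y , w∈ , y∉ , adj-sym a

  collect : ∀ h b c q → h ≤ℕ b *ℕ c → 2 *ℕ (2 *ℕ h *ℕ q) +ℕ (h +ℕ h) ≤ℕ (2 *ℕ (2 *ℕ q) +ℕ 2) *ℕ c *ℕ b
  collect h b c q le = ≤-trans (≤-reflexive (solve 2 (λ h q → con 2 :* (con 2 :* h :* q) :+ (h :+ h) := (con 2 :* (con 2 :* q) :+ con 2) :* h) refl h q))
   (≤-trans (*-monoʳ-≤ (2 *ℕ (2 *ℕ q) +ℕ 2) le) (≤-reflexive (solve 3 (λ q b c → (con 2 :* (con 2 :* q) :+ con 2) :* (b :* c) := (con 2 :* (con 2 :* q) :+ con 2) :* c :* b) refl q b c)))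
   where open +-*-Solver

  record Premises : Set₂ where
   constructor premises
   field
    noacc : NoVertexAccumulation G
    star : V → List E
    in-star : Stars star
    Δ : ℕ
    star-length : ∀ v → length (star v) ≤ℕ Δ
    nuf : NoUnboundedFace G
    F : ℕ → ℕ
    F-0 : F 0 ≡ 0
    F-mono : Monotonic₁ _≤ℕ_ _≤ℕ_ F
    iso : Isoperimetry F
    K q : ℕ
    short-odd : ∀ {u n} f (W : W[ u , u ] n) → sumW f W ≡ true → Σ[ o ∈ V ] Σ[ l ∈ ℕ ] Σ[ L ∈ W[ o , o ] l ] (l ≤ℕ K × sumW f L ≡ true)
    short-bound : ∀ {u l} (L : W[ u , u ] l) → l ≤ℕ K → AtMost (Enclosed L) q
    linear-bound : ∀ {u n} (W : W[ u , u ] n) → AtMost (Enclosed W) (suc n *ℕ q)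

  module Forward (given : Premises) where
   open Premises given
   open Balls star in-star Δ star-length

   open Leaves star in-star Δ star-length F F-0 iso using (leaves)

   ground : Terrain
   ground = terrain noacc star in-star leaves

   open FacialStructure ground

   off-walk : (L : W[ u , u ] n) → ¬ OnWalk graph v L → ¬ OnWalk' L (φ (vertex v))
   off-walk L n (e , i , o) with vertex-on o | edge-on-walk L i
   ... | inl refl | (p , _) = n p
   ... | inr refl | (_ , p) = n p

   module _ {z es} (un : Unique es) (f : ∀ e → e ∈ˡ es ⇔ BoundaryEdge G z e) where
    -- The source of a boundary edge is in the closure of the face, hence on or inside `L`. So there
    -- are at most `q` sources, each with at most `Δ` edges.
    face-size : ∀ {o l} (L : W[ o , o ] l) → l ≤ℕ K → wind z L ≡ true → length es ≤ℕ q *ℕ Δ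
    face-size L l≤K Lt = count (dedupe (map src es))
     where
     enclosed : ∀ {d} → d ∈ˡ es → Enclosed L (src d)
     enclosed {d} i with em 0ℓ {OnWalk graph (src d) L}
     ... | yes on = inl on
     ... | no off = inr (trans (sym (wind-closure L (off-walk L off) (fst (to (f d) i)))) Lt)
     count : Σ[ vs ∈ List V ] (Unique vs × (∀ {x} → x ∈ˡ vs → x ∈ˡ map src es) × (∀ {x} → x ∈ˡ map src es → x ∈ˡ vs)) → length es ≤ℕ q *ℕ Δ
     count (vs , uv , sub , sup) = ≤-trans (unique-⊆ {ys = stars vs} un λ i → in-stars (inl refl) (sup (∈-map⁺ src i)))
      (≤-trans (length-concatMap star star-length vs) (*-monoˡ-≤ Δ
       (short-bound L l≤K vs uv λ i → let (d , j , eq) = ∈-map⁻ src (sub i) in subst (Enclosed L) (sym eq) (enclosed j))))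

    encircled-size : Σ[ u ∈ V ] Σ[ n ∈ ℕ ] Σ[ W ∈ W[ u , u ] n ] wind z W ≡ true → length es ≤ℕ q *ℕ Δ
    encircled-size (_ , _ , W , wt) with short-odd (κ z) W wt
    ... | _ , _ , L , l≤K , Lt = face-size L l≤K Lt

    nonempty-size : ∀ {e} → Complement G z → e ∈ˡ es → length es ≤ℕ q *ℕ Δ
    nonempty-size c i = let (u , n , W , _ , wt) = encircled (listed-face z c es f) i in encircled-size (u , n , W , wt)

   codegree : ∀ z n → Complement G z → FaceLength G z n → n ≤ℕ q *ℕ Δ
   codegree z _ c ([] , _ , _ , refl) = z≤n
   codegree z _ c (e ∷ es , un , f , refl) = nonempty-size un f c (here refl)

   faces : FaceLists
   faces z c = let (_ , es , _ , f , _) = nuf z c in es , f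

   face-length : ∀ z c → length (fst (faces z c)) ≤ℕ q *ℕ Δ
   face-length z c = let (n , es , un , f , eq) = nuf z c in codegree z _ c (es , un , f , refl)

   -- The boundary of a face is connected and has at most `q *ℕ Δ` edges, so all of it starts within
   -- this distance of any of its vertices.
   R : ℕ
   R = diameter (q *ℕ Δ)

   near-face : ∀ vs z c {e e' v} → v ∈ˡ vs → Incident e v → e ∈ˡ fst (faces z c) → e' ∈ˡ fst (faces z c) → e' ∈ˡ stars (ball R vs)
   near-face vs z c {e} {e'} {v} i inc m m' =
    let (n , b , W) = linked-short H0 (linked-trans (linked-sym (ends inc)) (boundary-connected (listed-face z c H0 spec) m m'))
    in in-stars (inl refl) (in-ball R i W (≤-trans b (diameter-mono (face-length z c))))
    where
    H0 = fst (faces z c)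
    spec = snd (faces z c)
    ends : ∀ {v} → Incident e v → Linked H0 (src e) v
    ends (inl refl) = linked-refl
    ends (inr refl) = linked-edge m

   near-star : ∀ vs {e v} → v ∈ˡ vs → Incident e v → e ∈ˡ stars (ball R vs)
   near-star vs i inc = in-stars inc (in-ball R i [] z≤n)

   module Count (S : Pred V 0ℓ) (Ss : List V) (uniq : Unique Ss) (inS : ∀ x → x ∈ˡ Ss ⇔ x ∈ S)
    (Bs : List V) (inB : ∀ x → x ∈ˡ Bs ⇔ x ∈ ∂ graph S) where
    H = stars (ball R Bs)
    M = stars (ball R Ss)
    open Region (marking ground faces S H M (λ b inc → near-star Bs (from (inB _) b) inc)
     (λ z c b inc → near-face Bs z c (from (inB _) b) inc) (λ s inc → near-star Ss (from (inS _) s) inc) (λ z c s inc → near-face Ss z c (from (inS _) s) inc))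
     using (encloses)
    val : V → E → Bool
    val v = κ (φ (vertex v))
    off : V → Set₁
    off v = v ∈ˡ Ss × ¬ On H (φ (vertex v))

    Cycles : List V → Set₁
    Cycles xs = Σ[ Cs ∈ List (List E) ] ((∀ {d} → d ∈ˡ Cs → Even d) × (∀ {d e} → d ∈ˡ Cs → e ∈ˡ d → e ∈ˡ H) ×
     (∀ {x} → x ∈ˡ xs → ¬ On H (φ (vertex x)) → Σ[ d ∈ List E ] (d ∈ˡ Cs × sumE (val x) d ≡ true)))

    cycles : ∀ xs → (∀ {x} → x ∈ˡ xs → S x) → Cycles xs
    cycles [] _ = [] , (λ ()) , (λ ()) , λ ()
    cycles (x ∷ xs) s = add (em _) (cycles xs (λ i → s (there i)))
     where
     insert : ¬ On H (φ (vertex x)) → Cycles xs → Encircled H (φ (vertex x)) → Cycles (x ∷ xs)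
     insert n (Cs , ev , wi , f) (u , k , W , h , wt) = edges W ∷ Cs , (λ { (here refl) → even-closed W ; (there i) → ev i }) , (λ { (here refl) j → h _ j ; (there i) j → wi i j }) ,
      λ { (here refl) _ → _ , here refl , trans (sumE-edges (val x) W) wt ; (there i) m → let (d , j , o) = f i m in d , there j , o }
     add : Dec (On H (φ (vertex x))) → Cycles xs → Cycles (x ∷ xs)
     add (yes on) (Cs , ev , wi , f) = Cs , ev , wi , λ { (here refl) n → ⊥-elim (n on) ; (there i) n → f i n }
     add (no n) C = insert n C (encloses x (s (here refl)) n)

    -- The outer factor 2 comes from a cycle that encircles half of the vertices off `H`, the inner
    -- one from `even-bound`; the last summand bounds the number of vertices on `H`.
    count : length Ss ≤ℕ 2 *ℕ (2 *ℕ length H *ℕ q) +ℕ (length H +ℕ length H)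
    count = use (cycles Ss (λ i → to (inS _) i))
     where
     p : V → Bool
     p v = dec (off v)
     use : Cycles Ss → length Ss ≤ℕ 2 *ℕ (2 *ℕ length H *ℕ q) +ℕ (length H +ℕ length H)
     use (Cs , ev , wi , f) = ≤-trans (≤-reflexive (trans (sym (cnt-all Ss)) (cnt-split (λ _ → true) p Ss))) (+-mono-≤ off-bound on-bound)
      where
      odd-at : ∀ x → p x ≡ true → Σ[ d ∈ List E ] (d ∈ˡ Cs × sumE (val x) d ≡ true)
      odd-at x e = let (i , n) = dec-true e in f i n
      open Combination (combine val Ss H Cs ev wi [] p odd-at)
      shrunk = shrink-chain H c (within (λ ()))
      d = fst shrunk
      same-sums = snd (snd shrunk)
      odd-bound : AtMost (λ v → sumE (val v) c ≡ true) (2 *ℕ length H *ℕ q)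
      odd-bound = atMost-⊆ (λ {v} e → trans (same-sums (val v)) e) (atMost-≤ (*-monoˡ-≤ q (*-monoʳ-≤ 2 (fst (snd shrunk))))
       (even-bound val q (λ W → atMost-⊆ inr (linear-bound W)) d (λ g → trans (same-sums (δ g)) (even (λ _ → refl) g))))
      off-bound : cnt p Ss ≤ℕ 2 *ℕ (2 *ℕ length H *ℕ q)
      off-bound = ≤-trans half (*-monoʳ-≤ 2 (cnt-atMost (λ x → p x ∧ sumE (val x) c) Ss uniq (atMost-⊆ (λ {x} e → ∧-right {p x} e) odd-bound)))
      on-bound : cnt (λ x → not (p x)) Ss ≤ℕ length H +ℕ length H
      on-bound = ≤-trans (counted Ss uniq id)
       (≤-reflexive (trans (length-++ (map src H)) (cong₂ _+ℕ_ (length-map src H) (length-map tgt H))))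
       where
       ends : List V
       ends = map src H ++ map tgt H
       end : ∀ {x d} → d ∈ˡ H → OnEdge d (φ (vertex x)) → x ∈ˡ ends
       end i o with vertex-on o
       ... | inl refl = ∈-++⁺ˡ (∈-map⁺ src i)
       ... | inr refl = ∈-++⁺ʳ (map src H) (∈-map⁺ tgt i)
       -- Outside Ss the predicate p fails for another reason, hence the restriction to a sublist.
       counted : ∀ xs → Unique xs → (∀ {x} → x ∈ˡ xs → x ∈ˡ Ss) → cnt (λ x → not (p x)) xs ≤ℕ length ends
       counted xs un sub = ≤-trans (cnt-in xs sub) (cnt-atMost (λ x → dec (x ∈ˡ ends)) xs un (atMost-list ends dec-true))
        where
        cnt-in : ∀ xs → (∀ {x} → x ∈ˡ xs → x ∈ˡ Ss) → cnt (λ x → not (p x)) xs ≤ℕ cnt (λ x → dec (x ∈ˡ ends)) xs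
        cnt-in [] _ = z≤n
        cnt-in (x ∷ xs) sub = +-mono-≤ (one (Bool-cases (p x))) (cnt-in xs λ i → sub (there i))
         where
         one : p x ≡ true ⊎ p x ≡ false → (if not (p x) then 1 else 0) ≤ℕ (if dec (x ∈ˡ ends) then 1 else 0)
         one (inl e) rewrite e = z≤n
         one (inr e) rewrite e | dec-yes {A = x ∈ˡ ends} (by-contra λ n → dec-false e (sub (here refl) , λ (d , i , o) → n (end i o))) = ≤-refl

   cH C : ℕ
   cH = growth ^ R *ℕ Δ
   C = (2 *ℕ (2 *ℕ q) +ℕ 2) *ℕ cH

   linear : Isoperimetry (C *ℕ_)
   linear S m n (Ss , uS , fS , eS) (Bs , uB , fB , eB) = subst₂ (λ a b → a ≤ℕ C *ℕ b) eS eB (≤-trans count (collect (length H) (length Bs) cH q H-length))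
    where
    open Count S Ss uS fS Bs fB using (H; count)
    H-length : length H ≤ℕ length Bs *ℕ cH
    H-length = ≤-trans (length-concatMap star star-length (ball R Bs)) (≤-trans (*-monoˡ-≤ Δ (ball-length R Bs)) (≤-reflexive (*-assoc (length Bs) (growth ^ R) Δ)))

  forward : NoVertexAccumulation G → BoundedDegree graph → NoUnboundedFace G → Hyperbolic graph → WeaklyNonAmenable graph → NonAmenable graph × BoundedCodegree G
  forward noacc (Δ , deg) nuf hyp (F , F0 , Fm , _ , iso) = let (D , thin) = thin-natural hyp in
   go D thin
   where
   go : ∀ D → Thin' D → NonAmenable graph × BoundedCodegree G
   go D thin = nonamenable C linear , Q D thin *ℕ Δ , codegree
    where
    open Isoperimetric noacc F Fm iso
    open Forward (premises noacc (λ v → fst (fst (snd (deg v)))) (λ {e} {v} i → from (fst (snd (snd (fst (snd (deg v))))) e) i) Δ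
     (λ v → ≤-trans (≤-reflexive (snd (snd (snd (fst (snd (deg v))))))) (snd (snd (deg v)))) nuf F F0 Fm iso (Dehn.K D thin) (Q D thin) (Dehn.short-odd D thin) (short-bound D thin) (linear-bound D thin))

 open Codegree

 -- Lattice approximations of edge cochains

 module LatticeSystems where
  open LatticePaths
  open LatticeDuality

  private variable
   ℓ : Level
   i j a b : ℕ
   u v x y : V
   n : ℕ

  sumL-exact : ∀ (f g χ : Grid) (P Q : ℕ → ℕ → Set) → (∀ i j → P i j → f i j ≡ χ i j xor χ (suc i) j) → (∀ i j → Q i j → g i j ≡ χ i j xor χ i (suc j)) →
   (L : LPath i j a b) → AllE P Q L → sumL f g L ≡ χ i j xor χ a b
  sumL-exact {i} {j} {a} {b} f g χ P Q p q L h = trans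
   (sumL-cob f g none none χ P Q (λ i j k → trans (p i j k) (sym (xor-identityʳ (χ i j xor χ (suc i) j)))) (λ i j k → trans (q i j k) (sym (xor-identityʳ (χ i j xor χ i (suc j))))) L h)
   (trans (cong ((χ i j xor χ a b) xor_) (sumL-none L)) (xor-identityʳ (χ i j xor χ a b)))

  Nb-list : ∀ {X : Set ℓ} {t} (P : X → ℝ → Set) (xs : List X) → (∀ {x} → x ∈ˡ xs → Nb t (P x)) → Nb t (λ s → ∀ {x} → x ∈ˡ xs → P x s)
  Nb-list P [] h = Nb-all λ { _ () }
  Nb-list P (x ∷ xs) h = Nb-map (λ { s (p , f) (here refl) → p ; s (p , f) (there i) → f i }) (Nb-∩ (h (here refl)) (Nb-list P xs λ i → h (there i)))

  module Trace {ℓ} {H : List E} {User : ℚ → ℚ → ℚ → ℚ → Set ℓ} {F : Frame}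
   (Λ : Lattice (On H) User F) (bd : BoundedIn F (On H)) where
   open Frame F
   open Lattice Λ
   open LatticeTools Λ

   Ranged : ℕ → ℕ → Set
   Ranged i j = (2 <ℕ i × i ≤ℕ size) × (2 <ℕ j × j ≤ℕ size)

   -- A lattice cochain (f , g), exact near every point of the graph, and the cochain val on edges approximated by it.
   record System : Set₁ where
    field
     f g : Grid
     pot : V → Grid
     val : E → Bool
     h : E → ℝ → Grid
     horizontal : ∀ {e} → e ∈ˡ H → ∀ t → In 0ℚ 1ℚ t → ∀ i j → Near (curve e t) i j → Near (curve e t) (suc i) j → f i j ≡ h e t i j xor h e t (suc i) j
     vertical : ∀ {e} → e ∈ˡ H → ∀ t → In 0ℚ 1ℚ t → ∀ i j → Near (curve e t) i j → Near (curve e t) i (suc j) → g i j ≡ h e t i j xor h e t i (suc j)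
     steady : ∀ {e} → e ∈ˡ H → ∀ t → In 0ℚ 1ℚ t → Nb t (λ s → In 0ℚ 1ℚ s → ∀ i j → Near (curve e t) i j → Near (curve e s) i j → h e s i j ≡ h e t i j)
     at-ends : ∀ {e} → e ∈ˡ H → Σ[ b ∈ Bool ] ((∀ i j → Near (φ (vertex (src e))) i j → h e (ι 0ℚ) i j ≡ pot (src e) i j xor b) ×
      (∀ i j → Near (φ (vertex (tgt e))) i j → h e (ι 1ℚ) i j ≡ pot (tgt e) i j xor (b xor val e)))

   module _ (Ss : List System) where
    -- One path serves all systems at once, so that the same filling can be tested by the
    -- transported cochain and by the crossing parities of single cells.
    Traced : ℕ → ℕ → ℕ → ℕ → (System → Bool) → Set₁
    Traced i j k l α = Σ[ L ∈ LPath i j k l ] (AllE Ranged Ranged L × (∀ {S} → S ∈ˡ Ss → sumL (System.f S) (System.g S) L ≡ α S))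

    traced-+ : ∀ {i j k l a b α β γ} → Traced i j k l α → Traced k l a b β → (∀ {S} → S ∈ˡ Ss → α S xor β S ≡ γ S) → Traced i j a b γ
    traced-+ (L , r , p) (K , s , q) e = L ⊙ K , AllE-⊙ L r s , λ {S} m → trans (sumL-⊙ (System.f S) (System.g S) L K) (trans (cong₂ _xor_ (p m) (q m)) (e m))

    module _ {e} (e∈ : e ∈ˡ H) where
     c : ℝ → ℝ²
     c = curve e

     on : ∀ {t} → In 0ℚ 1ℚ t → On H (c t)
     on {t} it = e , e∈ , curve-on e t it

     trace-near : ∀ t → In 0ℚ 1ℚ t → ∀ {i j k l} → Near (c t) i j → Near (c t) k l → Traced i j k l (λ S → System.h S e t i j xor System.h S e t k l)
     trace-near t it n m = let (L , r) = near-path (c t) n m in L ,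
      AllE-map (λ i j (a , _) → near-inner bd (c t) {i} {j} (on it) a) (λ i j (a , _) → near-inner bd (c t) {i} {j} (on it) a) L r ,
      λ {S} _ → sumL-exact (System.f S) (System.g S) (System.h S e t) (λ i j → Near (c t) i j × Near (c t) (suc i) j) (λ i j → Near (c t) i j × Near (c t) i (suc j))
       (λ i j (a , b) → System.horizontal S e∈ t it i j a b) (λ i j (a , b) → System.vertical S e∈ t it i j a b) L r

     Reach : ℝ → ℝ → Set₁
     Reach s t = ∀ i j k l → Near (c s) i j → Near (c t) k l → Traced i j k l (λ S → System.h S e s i j xor System.h S e t k l)

     reach-step : ∀ s u t → In 0ℚ 1ℚ t → ∀ x y → Near (c u) x y → Near (c t) x y →
      (∀ {S} → S ∈ˡ Ss → System.h S e u x y ≡ System.h S e t x y) → Reach s u → Reach s t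
     reach-step s u t it x y nu nt eq ρ i j k l n m = traced-+ (ρ i j x y n nu) (trace-near t it nt m)
      λ {S} S∈ → trans (cong (λ z → (System.h S e s i j xor z) xor (System.h S e t x y xor System.h S e t k l)) (eq S∈))
       (xor-cancel (System.h S e s i j) (System.h S e t x y) (System.h S e t k l))

     -- Induction along the curve as for hugging paths; `steady` keeps the potentials of the
     -- finitely many systems constant near each time.
     trace-curve : ∀ s t → In 0ℚ 1ℚ s → In 0ℚ 1ℚ t → Reach s t
     trace-curve s t is it = dec-true (trans (sym (locally-constant 0<1 (λ t → dec (Reach s t)) loc s t is it)) (dec-yes λ i j k l n m → trace-near s is n m))
      where
      loc : ∀ t → In 0ℚ 1ℚ t → Nb t (λ u → In 0ℚ 1ℚ u → dec (Reach s u) ≡ dec (Reach s t))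
      loc t it = let (x , y , nt) = near-exists bd (c t) (on it) in
       Nb-map (λ u (nu , st) iu → dec-⇔
        (λ ρ → reach-step s u t it x y nu nt (λ S∈ → st S∈ iu x y nt nu) ρ)
        (λ ρ → reach-step s t u iu x y nt nu (λ S∈ → sym (st S∈ iu x y nt nu)) ρ))
        (Nb-∩ (curve-cont e t (near-open bd (c t) nt))
         (Nb-list (λ S s → In 0ℚ 1ℚ s → ∀ i j → Near (c t) i j → Near (c s) i j → System.h S e s i j ≡ System.h S e t i j) Ss λ {S} _ → System.steady S e∈ t it))

     trace-edge : Joins e x y → ∀ {i j k l} → Near (φ (vertex x)) i j → Near (φ (vertex y)) k l →
      Traced i j k l (λ S → (System.pot S x i j xor System.val S e) xor System.pot S y k l)
     trace-edge (inl (refl , refl)) {i} {j} {k} {l} n m =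
      let (L , r , p) = trace-curve (ι 0ℚ) (ι 1ℚ) (<-irrefl refl , <-asym 0<1) (<-asym 0<1 , <-irrefl refl) i j k l
           (subst (λ z → Near z i j) (sym (curve-0 e)) n) (subst (λ z → Near z k l) (sym (curve-1 e)) m)
      in L , r , λ {S} S∈ → let (b , p0 , p1) = System.at-ends S e∈ in trans (p S∈) (trans (cong₂ _xor_ (p0 i j n) (p1 k l m))
       (taut 4 (λ x y b v → (x xor b) xor (y xor (b xor v))) (λ x y b v → (x xor v) xor y) refl (System.pot S (src e) i j) (System.pot S (tgt e) k l) b (System.val S e)))
     trace-edge (inr (refl , refl)) {i} {j} {k} {l} n m =
      let (L , r , p) = trace-curve (ι 1ℚ) (ι 0ℚ) (<-asym 0<1 , <-irrefl refl) (<-irrefl refl , <-asym 0<1) i j k l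
           (subst (λ z → Near z i j) (sym (curve-1 e)) n) (subst (λ z → Near z k l) (sym (curve-0 e)) m)
      in L , r , λ {S} S∈ → let (b , p0 , p1) = System.at-ends S e∈ in trans (p S∈) (trans (cong₂ _xor_ (p1 i j n) (p0 k l m))
       (taut 4 (λ x y b v → (x xor (b xor v)) xor (y xor b)) (λ x y b v → (x xor v) xor y) refl (System.pot S (tgt e) i j) (System.pot S (src e) k l) b (System.val S e)))

    trace-walk : (W : W[ x , y ] (suc n)) → Within H W → ∀ {i j k l} → Near (φ (vertex x)) i j → Near (φ (vertex y)) k l →
     Traced i j k l (λ S → (System.pot S x i j xor sumW (System.val S) W) xor System.pot S y k l)
    trace-walk {x} {y} ((e , J) ∷ []) w {i} {j} {k} {l} n m = let (L , r , p) = trace-edge (w e (here refl)) J n m in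
     L , r , λ {S} S∈ → trans (p S∈) (cong (λ b → (System.pot S x i j xor b) xor System.pot S y k l) (sym (xor-identityʳ (System.val S e))))
    trace-walk {x} {y} (_∷_ {v = z} (e , J) W@(b ∷ _)) w {i} {j} {k} {l} n m =
     let (i' , j' , nz) = near-exists bd (φ (vertex z)) (fst b , w (fst b) (there (here refl)) , joins-on (snd b))
     in traced-+ (trace-edge (w e (here refl)) J n nz) (trace-walk W (λ e i → w e (there i)) nz m)
      λ {S} _ → taut 5 (λ x v z w y → ((x xor v) xor z) xor ((z xor w) xor y)) (λ x v z w y → (x xor (v xor w)) xor y) refl
       (System.pot S x i j) (System.val S e) (System.pot S z i' j') (sumW (System.val S) W) (System.pot S y k l)
     where
     joins-on : ∀ {e x y} → Joins e x y → OnEdge e (φ (vertex x))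
     joins-on {e} (inl (refl , _)) = src-on e
     joins-on {e} (inr (_ , refl)) = tgt-on e

 -- Vertices attached to points of the plane

 module Attachments where
  open Regions

  private variable
   u v x y : V
   m n : ℕ

  Close : ℕ → V → V → Set
  Close m x y = Σ[ n ∈ ℕ ] (n ≤ℕ m × W[ x , y ] n)

  close-mono : m ≤ℕ n → Close m x y → Close n x y
  close-mono l (k , h , W) = k , ≤-trans h l , W

  close-+ : Close m x y → Close n y v → Close (m +ℕ n) x v
  close-+ (k , h , W) (l , h' , W') = k +ℕ l , +-mono-≤ h h' , W +ʷ W'

  close-sym : Close m x y → Close m y x
  close-sym (k , h , W) = k , h , rev W

  close-edge : ∀ {e} → Incident e x → Incident e y → Close 1 x y
  close-edge (inl refl) (inl refl) = 0 , z≤n , []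
  close-edge (inr refl) (inr refl) = 0 , z≤n , []
  close-edge {e = e} (inl refl) (inr refl) = 1 , ≤-refl , (e , inl (refl , refl)) ∷ []
  close-edge {e = e} (inr refl) (inl refl) = 1 , ≤-refl , (e , inr (refl , refl)) ∷ []

  -- The vertices that represent a point of the plane in the graph. Bounded codegree makes
  -- representatives of points in a common small box close to each other.
  Attached : ℝ² → V → Set₂
  Attached u x = (Σ[ e ∈ E ] (OnEdge e u × Incident e x)) ⊎ (Complement G u) × Σ[ e ∈ E ] (BoundaryEdge G u e × Incident e x)

  Starlike : V → (p q r s : ℚ) → Set₁
  Starlike v p q r s = ∀ w → w ∈ Box p q r s → OnGraph w → Σ[ e ∈ E ] (Incident e v × OnEdge e w)

  record Tiled : Set₂ where
   constructor tiled
   field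
    ground : Terrain
    faces : FaceLists
    Δ* : ℕ
    face-length : ∀ z c → length (fst (faces z c)) ≤ℕ Δ*

  module Attachment (P : Tiled) (Z : W[ u , u ] (suc n)) where
   open Tiled P
   open Terrain ground
   open FacialStructure ground

   d : ℕ
   d = diameter Δ*

   closure-bounds : ∀ w c x → Closure (Face G w) (φ x) → Σ[ e ∈ E ] (BoundaryEdge G w e × OnEdge e (φ x))
   closure-bounds w c (vertex v) cl = let (H0 , spec) = faces w c; (e , m , inc) = closure-vertex (listed-face w c H0 spec) v cl in e , to (spec e) m , on-edge-vertex inc
   closure-bounds w c (inner e t i) cl = let (H0 , spec) = faces w c in e , to (spec e) (closure-inner (listed-face w c H0 spec) e t i cl) , inner-on e t i

   face-bounds : ∀ w c u → OnGraph u → Closure (Face G w) u → Σ[ e ∈ E ] (BoundaryEdge G w e × OnEdge e u)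
   face-bounds w c u (x , eq) cl = let (H0 , spec) = faces w c; (e , b , o) = closure-bounds w c x (closure-≈ (listed-face w c H0 spec) (≈²-sym (φ x) u eq) cl) in e , b , arc-≈ {z = φ x} {u} eq o

   -- The face of an encircled point is not the whole plane, hence has a boundary.
   face-touches : ∀ {w} → Complement G w → wind w Z ≡ true → Σ[ e ∈ E ] BoundaryEdge G w e
   face-touches {w} c wt with N-all {z = w} {P = λ _ → ⊤} (λ _ → tt) | N-all {z = φ (vertex u)} {P = λ _ → ⊤} (λ _ → tt)
   ... | nb p q r s i _ | nb p' q' r' s' j _ = by-contra λ none →
    let f : ℝ² → Bool
        f y = dec (Face G w y)
        loc : Locally-constant-on (Box (p ⊓ p') (q ℚ.⊔ q') (r ⊓ r') (s ℚ.⊔ s')) f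
        loc y _ = case em _ {Face G w y} of λ
         { (yes g) → within y g (inside-open Z (component-⊆ g) (trans (sym (wind-component Z g)) wt))
         ; (no ng) → N-map (λ y' h _ → trans (dec-no h) (sym (dec-no ng))) (not-closure λ cl → ng (closure-component c
          (λ y' y'≈y x x≈y' → none (let (e , b , _) = face-bounds w c y (x , ≈²-trans (φ x) y' y x≈y' y'≈y) cl in e , b)) cl)) }
    in component-⊆ (dec-true (trans (sym (box-const {p ⊓ p'} {q ℚ.⊔ q'} {r ⊓ r'} {s ℚ.⊔ s'} f loc w (φ (vertex u))
     (widen {p} {q} {r} {s} {p'} {q'} {r'} {s'} w (inl i)) (widen {p} {q} {r} {s} {p'} {q'} {r'} {s'} (φ (vertex u)) (inr j)))) (dec-yes (component-self c)))) (vertex u) (≈²-refl (φ (vertex u)))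
    where
    within : ∀ y → Face G w y → N y (Complement G) → N y (λ y' → y' ∈ Box (p ⊓ p') (q ℚ.⊔ q') (r ⊓ r') (s ℚ.⊔ s') → dec (Face G w y') ≡ dec (Face G w y))
    within y g (nb p q r s i k) = nb p q r s i λ y' j _ → trans (dec-yes (box-in-component {p = p} {q} {r} {s} (λ {z} m → k z m) {w = y} {y'} i j g)) (sym (dec-yes g))

   Covered : ℝ² → Set₁
   Covered z = OnWalk' Z z ⊎ wind z Z ≡ true

   on-walk : ∀ {x} → On (edges Z) (φ (vertex x)) → OnWalk graph x Z
   on-walk (e , i , o) with vertex-on o
   ... | inl refl = fst (edge-on-walk Z i)
   ... | inr refl = snd (edge-on-walk Z i)

   enclosed : ∀ {x} → On (edges Z) (φ (vertex x)) ⊎ wind (φ (vertex x)) Z ≡ true → Enclosed Z x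
   enclosed (inl o) = inl (on-walk o)
   enclosed (inr h) = inr h

   -- This provides the short closed walks with base points in the region of the walk `Z`.
   attached-inside : ∀ {z} → Covered z → Σ[ x ∈ V ] (Attached z x × Enclosed Z x)
   attached-inside (inl (e , i , o)) = src e , inl (e , o , inl refl) , inl (fst (edge-on-walk Z i))
   attached-inside {z} (inr wt) with em _ {OnGraph z} | em _ {OnWalk' Z z}
   ... | _ | yes (e , i , o) = src e , inl (e , o , inl refl) , inl (fst (edge-on-walk Z i))
   ... | no ng | no _ = let cz : Complement G z
                            cz x eq = ng (x , eq)
                            (e , b) = face-touches cz wt
    in src e , inr (cz , e , b , inl refl) , (case em _ {On (edges Z) (φ (vertex (src e)))} of λ
     { (yes o) → inl (on-walk o)
     ; (no off) → inr (trans (sym (wind-closure Z off (fst b))) wt) })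
   ... | yes (x , eq) | no off = go x eq
    where
    moved : ∀ x → φ x ≈² z → ¬ OnWalk' Z (φ x)
    moved x eq (e , i , o) = off (e , i , arc-≈ {z = φ x} {z} eq o)
    go : ∀ x → φ x ≈² z → Σ[ x ∈ V ] (Attached z x × Enclosed Z x)
    go (inner e t i) eq = src e , inl (e , arc-≈ {z = φ (inner e t i)} {z} eq (inner-on e t i) , inl refl) ,
     enclosed (inner-inside Z e t i (moved (inner e t i) eq) (trans (≈²-wind Z off (≈²-sym (φ (inner e t i)) z eq)) wt))
    go (vertex v) eq with leaves (v ∷ []) (here refl)
    ... | (_ , y , here refl , _ , (e , j)) = v , inl (e , arc-≈ {z = φ (vertex v)} {z} eq (on-edge-vertex (fst (joins-incident j))) , fst (joins-incident j)) ,
     inr (trans (≈²-wind Z off (≈²-sym (φ (vertex v)) z eq)) wt)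

   meet-close : ∀ {e e' x y u} → OnEdge e u → OnEdge e' u → OnGraph u → Incident e x → Incident e' y → Close 2 x y
   meet-close {e} {e'} {u = u} o o' (z , eq) i j = go z (arc-≈ {z = u} {φ z} (≈²-sym (φ z) u eq) o) (arc-≈ {z = u} {φ z} (≈²-sym (φ z) u eq) o')
    where
    go : ∀ z → OnEdge e (φ z) → OnEdge e' (φ z) → Close 2 _ _
    go (vertex v) o o' = close-+ (close-edge i (vertex-on o)) (close-edge (vertex-on o') j)
    go (inner d t k) o o' with inner-on⁻ o | inner-on⁻ o'
    ... | refl | refl = close-mono (s≤s z≤n) (close-edge i j)

   same-face : ∀ {w e e' x y} → Complement G w → BoundaryEdge G w e → BoundaryEdge G w e' → Incident e x → Incident e' y → Close (2 +ℕ d) x y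
   same-face {w} {e} {e'} c b b' i j = let (H0 , spec) = faces w c
                                           (n , l , W) = linked-short H0 (boundary-connected (listed-face w c H0 spec) (from (spec e) b) (from (spec e') b')) in
    close-mono (≤-reflexive (cong suc (+-comm d 1))) (close-+ (close-edge i (inl refl)) (close-+ (n , ≤-trans l (diameter-mono (face-length w c)) , W) (close-edge (inl refl) j)))

   module _ {v p q r s} (starlike : Starlike v p q r s) where
    private
     in-list : ∀ w → w ∈ Box p q r s → OnGraph w → On (star v) w
     in-list w i g = let (e , inc , o) = starlike w i g in e , in-star inc , o

    complement-hit : ∀ {y u} → y ∈ Box p q r s → OnGraph y → u ∈ Box p q r s → Complement G u →
     Σ[ e ∈ E ] Σ[ e' ∈ E ] Σ[ w ∈ ℝ² ] (BoundaryEdge G u e × OnEdge e w × OnGraph w × Incident e' v × OnEdge e' w)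
    complement-hit {y} {u} i g j c = let (w , k , gw , cl) = first-hit (star v) {p} {q} {r} {s} in-list {y} {u} i g j c
                                         (e , b , o) = face-bounds u c w gw cl
                                         (e' , inc , o') = starlike w k gw
     in e , e' , w , b , o , gw , inc , o'

    clear : ¬ (Σ[ y ∈ ℝ² ] (y ∈ Box p q r s × OnGraph y)) → Box p q r s ⊆ Complement G
    clear none {w} k x eq = none (w , k , (x , eq))

    attached-exists : ∀ {z u} → z ∈ Box p q r s → Covered z → u ∈ Box p q r s → Σ[ x ∈ V ] Attached u x
    attached-exists {z} {u} i cov j with em _ {OnGraph u} | em _ {Σ[ y ∈ ℝ² ] (y ∈ Box p q r s × OnGraph y)}
    ... | yes g | _ = let (e , _ , o) = starlike u j g in src e , inl (e , o , inl refl)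
    ... | no ng | yes (y , k , g) = let cu = λ x eq → ng (x , eq); (e , _ , _ , b , _) = complement-hit {y} k g j cu in src e , inr (cu , e , b , inl refl)
    ... | no ng | no none = let cu = λ x eq → ng (x , eq)
                                wt = [ (λ (e , _ , o) → ⊥-elim (none (z , i , onEdge⇒graph {e} o))) , id ]′ cov
                                (e , b) = face-touches (λ x eq → none (z , i , (x , eq))) wt
     in src e , inr (cu , e , face-edge (box-in-component {p = p} {q} {r} {s} (λ {w} → clear none {w}) {w = z} {u} i j (component-self (λ x eq → none (z , i , (x , eq))))) b , inl refl)

    -- Two steps lead from `v` past a point of its star on the boundary of the face of `u`, and
    -- `2 +ℕ d` more lead around that face.
    attached-center : ∀ {y u x} → y ∈ Box p q r s → OnGraph y → u ∈ Box p q r s → Attached u x → Close (4 +ℕ d) v x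
    attached-center {y} {u} k g j (inl (e , o , inc)) = let gu = onEdge⇒graph {e} o; (e' , inc' , o') = starlike u j gu in
     close-mono (m≤m+n 2 (2 +ℕ d)) (meet-close o' o gu inc' inc)
    attached-center {y} {u} k g j (inr (cu , e , b , inc)) = let (e' , e″ , w , b' , o' , gw , inc″ , o″) = complement-hit {y} k g j cu in
     close-+ {2} {n = 2 +ℕ d} (meet-close o″ o' gw inc″ (inl refl)) (same-face cu b' b (inl refl) inc)

    attached-close : ∀ {u u' x x'} → u ∈ Box p q r s → u' ∈ Box p q r s → Attached u x → Attached u' x' → Close ((4 +ℕ d) +ℕ (4 +ℕ d)) x x'
    attached-close {u} {u'} i j a a' with em _ {Σ[ y ∈ ℝ² ] (y ∈ Box p q r s × OnGraph y)}
    ... | yes (y , k , g) = close-+ (close-sym (attached-center {y} k g i a)) (attached-center {y} k g j a')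
    ... | no none = both a a'
     where
     both : Attached u _ → Attached u' _ → Close ((4 +ℕ d) +ℕ (4 +ℕ d)) _ _
     both (inl (e , o , _)) _ = ⊥-elim (none (u , i , onEdge⇒graph {e} o))
     both _ (inl (e , o , _)) = ⊥-elim (none (u' , j , onEdge⇒graph {e} o))
     both (inr (c , e , b , inc)) (inr (c' , e' , b' , inc')) = close-mono (≤-trans (+-monoˡ-≤ d {2} {4} (s≤s (s≤s z≤n))) (m≤m+n (4 +ℕ d) (4 +ℕ d)))
      (same-face c b (face-edge (component-sym (box-in-component {p = p} {q} {r} {s} (λ {w} → clear none {w}) {w = u} {u'} i j (component-self c))) b') inc inc')

 open Attachments

 -- Filling closed walks by short ones

 module Fillings where
  open LatticePaths
  open LatticeDuality
  open LatticeSystems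

  private variable
   u v x y : V
   m n : ℕ

  module Transport (f : E → Bool) (c : ℕ) (Base : V → Set)
   (short : ∀ {o n} → Base o → (L : W[ o , o ] n) → n ≤ℕ c +ℕ (c +ℕ c) +ℕ c → sumW f L ≡ false) where

   abstract
    τ : V → V → Bool
    τ x y with em 0ℓ {Reachable graph x y}
    ... | yes r = sumW f (dist-walk r)
    ... | no _ = false

    τ-walk : ∀ {o} → Base o → (k : Close c o x) → τ o x ≡ sumW f (snd (snd k))
    τ-walk {x} {o} b (n , l , A) with em 0ℓ {Reachable graph o x}
    ... | no nr = ⊥-elim (nr (n , A))
    ... | yes r = xor-≡ (trans (trans (cong (sumW f (dist-walk r) xor_) (sym (sumW-rev f A))) (sym (sumW-+ f (dist-walk r) (rev A))))
     (short b (dist-walk r +ʷ rev A) (+-mono-≤ (≤-trans (dist-≤ A) (≤-trans l (m≤m+n c (c +ℕ c)))) l)))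

    -- From `o` to `x`, on to `y` by a shortest walk of length at most `c +ℕ c`, and back to `o`:
    -- this closed walk has length at most four times `c`, so `f` vanishes on it.
    τ-close : ∀ {o} → Base o → Close c o x → Close c o y → τ x y ≡ τ o x xor τ o y
    τ-close {x} {y} {o} b k@(m , l , A) k'@(n , l' , B) with em 0ℓ {Reachable graph x y}
    ... | no nr = ⊥-elim (nr (_ , rev A +ʷ B))
    ... | yes r = trans (solved (sumW f A) (sumW f (dist-walk r)) (sumW f B) (trans (cong (sumW f A xor_) (sym
     (trans (sumW-+ f (dist-walk r) (rev B)) (cong (sumW f (dist-walk r) xor_) (sumW-rev f B))))) (trans (sym (sumW-+ f A (dist-walk r +ʷ rev B)))
     (short b (A +ʷ (dist-walk r +ʷ rev B)) (≤-trans (+-mono-≤ l (+-mono-≤ (≤-trans (dist-≤ (rev A +ʷ B)) (+-mono-≤ l l')) l')) (≤-reflexive (sym (+-assoc c (c +ℕ c) c))))))))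
     (sym (cong₂ _xor_ (τ-walk b k) (τ-walk b k')))
     where
     solved : ∀ a d b → a xor (d xor b) ≡ false → d ≡ a xor b
     solved a d b h = trans (taut 3 (λ a d b → d) (λ a d b → (a xor (d xor b)) xor (a xor b)) refl a d b) (cong (_xor (a xor b)) h)

  private
   square : ∀ a b c d {p q r s} → p ≡ a xor b → q ≡ c xor d → r ≡ a xor c → s ≡ b xor d → (p xor q) xor (r xor s) ≡ false
   square a b c d refl refl refl refl = taut 4 (λ a b c d → ((a xor b) xor (c xor d)) xor ((a xor c) xor (b xor d))) (λ _ _ _ _ → false) refl a b c d

   same-side : ∀ q s R B r r' → q ≡ false → r ≡ r' → q ≡ (s xor (((R xor r) ∧ B) xor r)) xor (s xor (((R xor r') ∧ B) xor r'))
   same-side _ s R B r _ refl refl = sym (xor-same (s xor (((R xor r) ∧ B) xor r)))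

   other-side : ∀ q s R B r r' → r ≡ false → r' ≡ true → q ≡ not B → q ≡ (s xor (((R xor r) ∧ B) xor r)) xor (s xor (((R xor r') ∧ B) xor r'))
   other-side q s R B _ _ refl refl e = trans e (taut 3 (λ s R B → not B) (λ s R B → (s xor (((R xor false) ∧ B) xor false)) xor (s xor (((R xor true) ∧ B) xor true))) refl s R B)

   same-right : ∀ s R R' B B' r → R ≡ r → R' ≡ r → (s xor ((R xor R') ∧ B)) xor (((R' xor r) ∧ B') xor r) ≡ s xor (((R xor r) ∧ B) xor r)
   same-right s _ _ B B' r refl refl = taut 4 (λ s r B B' → (s xor ((r xor r) ∧ B)) xor (((r xor r) ∧ B') xor r)) (λ s r B B' → s xor (((r xor r) ∧ B) xor r)) refl s r B B'

   same-below : ∀ s R R' B B' r → B ≡ B' → (s xor ((R xor R') ∧ B)) xor (((R' xor r) ∧ B') xor r) ≡ s xor (((R xor r) ∧ B) xor r)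
   same-below s R R' B _ r refl = taut 5 (λ s R R' r B → (s xor ((R xor R') ∧ B)) xor (((R' xor r) ∧ B) xor r)) (λ s R R' r B → s xor (((R xor r) ∧ B) xor r)) refl s R R' r B

  abstract
   all-cells : ℕ → List (ℕ × ℕ)
   all-cells m = cartesianProduct (upTo m) (upTo m)

   in-cells : ∀ {m i j} → i <ℕ m → j <ℕ m → (i , j) ∈ˡ all-cells m
   in-cells h k = ∈-cartesianProduct⁺ (∈-upTo⁺ h) (∈-upTo⁺ k)

  module Filling (P : Tiled) (Z : W[ u , u ] (suc n)) where
   open Tiled P
   open Terrain ground
   open Attachment P Z
   open FacialStructure ground using (inside-open)

   c : ℕ
   c = (4 +ℕ d) +ℕ (4 +ℕ d)

   H : List E
   H = edges Z

   -- Blocks that meet the region of `Z` see at most the star of one vertex.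
   Good : ℚ → ℚ → ℚ → ℚ → Set₁
   Good p q r s = (Σ[ v ∈ V ] Starlike v p q r s) ⊎ (∀ w → w ∈ Box p q r s → ¬ On H w × wind w Z ≡ false)

   good-local : Local Good
   good-local = record
    { mono = λ {p} {q} {r} {s} {p'} {q'} {r'} {s'} h1 h2 h3 h4 → λ
     { (inl (v , g)) → inl (v , λ w k → g w (Box-mono w {p} {q} {r} {s} {p'} {q'} {r'} {s'} h1 h2 h3 h4 k))
     ; (inr g) → inr λ w k → g w (Box-mono w {p} {q} {r} {s} {p'} {q'} {r'} {s'} h1 h2 h3 h4 k) }
    ; local = λ z → around z (em _) }
    where
    Goal : ℝ² → Set₁
    Goal z = ∃[ p ] ∃[ q ] ∃[ r ] ∃[ s ] (z ∈ Box p q r s × Good p q r s)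
    starry : ∀ v z → N z (λ w → OnGraph w → Σ[ e ∈ E ] (Incident e v × OnEdge e w)) → Goal z
    starry v z n = let (p , q , r , s , i , g) = N-local {z = z} n in p , q , r , s , i , inl (v , g)
    off-graph : ∀ z → Complement G z → wind z Z ≡ true ⊎ wind z Z ≡ false → Goal z
    -- Near an encircled point off the graph there is no graph at all, so being starlike is vacuous
    -- and `u` stands for any vertex.
    off-graph z cz (inl wt) = starry u z (N-map (λ w cw (x , eq) → ⊥-elim (cw x eq)) (inside-open Z cz wt))
    off-graph z cz (inr wf) = let (p , q , r , s , i , g) = N-local {z = z} (N-map (λ w (a , b) → a , trans b wf) (N-∩ (on-closed H z off) (wind-const Z off))) in
     p , q , r , s , i , inr g
     where
     off : ¬ On H z
     off (e , _ , o) = cz (fst (onEdge⇒graph {e} o)) (snd (onEdge⇒graph {e} o))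
    mid : ℚ
    mid = fst (<-dense 0<1)
    on-star : ∀ v x w → φ x ≈² w → Star v (λ _ → mid) (λ _ → mid) x → Σ[ e ∈ E ] (Incident e v × OnEdge e w)
    on-star v _ w eq (inl refl) with leaves (v ∷ []) (here refl)
    ... | (_ , y , here refl , _ , (e , j)) = let inc = fst (joins-incident j) in e , inc , arc-≈ {z = φ (vertex v)} {w} eq (on-edge-vertex inc)
    on-star v _ w eq (inr (e , t , i , refl , inl (p , _))) = e , inl p , arc-≈ {z = φ (inner e t i)} {w} eq (inner-on e t i)
    on-star v _ w eq (inr (e , t , i , refl , inr (p , _))) = e , inr p , arc-≈ {z = φ (inner e t i)} {w} eq (inner-on e t i)
    on-graph : ∀ z x → φ x ≈² z → Goal z
    on-graph z (vertex v) eq = starry v z (N-≈ eq (N-map (λ w st (x , eq) → on-star v x w eq (st x eq))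
     (star-N v (λ _ → mid) (λ _ → mid) (λ _ → fst (snd (<-dense 0<1))) (λ _ → snd (snd (<-dense 0<1))))))
    on-graph z (inner e t i) eq = starry (src e) z (N-≈ eq (N-map (λ w sg (x , eq) → seg x w eq (sg x eq)) (segment-N e t i 0ℚ 1ℚ i)))
     where
     seg : ∀ x w → φ x ≈² w → Σ[ s ∈ ℝ ] Σ[ j ∈ _ ] (x ≡ inner e s j × Between 0ℚ 1ℚ s) → Σ[ d ∈ E ] (Incident d (src e) × OnEdge d w)
     seg _ w eq (s , j , refl , _) = e , inl refl , arc-≈ {z = φ (inner e s j)} {w} eq (inner-on e s j)
    around : ∀ z → Dec (OnGraph z) → Goal z
    around z (yes (x , eq)) = on-graph z x eq
    around z (no ng) = off-graph z (λ x eq → ng (x , eq)) (Bool-cases (wind z Z))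

   module Fill (f : E → Bool) (short : ∀ {o n} → Enclosed Z o → (L : W[ o , o ] n) → n ≤ℕ c +ℕ (c +ℕ c) +ℕ c → sumW f L ≡ false)
    {F : Frame} (Λ : Lattice (On H) Good F) (bd : BoundedIn F (On H)) where
    open Frame F
    open Lattice Λ
    open LatticeTools Λ
    open Trace Λ bd hiding (c)
    open Transport f c (Enclosed Z) short

    -- The default is taken only where no vertex is attached; starlike blocks that meet the region
    -- of `Z` contain no such lattice point.
    anchor-by : ∀ i j → Dec (Σ[ x ∈ V ] Attached (pt i j) x) → V
    anchor-by _ _ (yes (x , _)) = x
    anchor-by _ _ (no _) = u

    abstract
     anchor : ℕ → ℕ → V
     anchor i j = anchor-by i j (em _)

     anchored : ∀ i j → Σ[ x ∈ V ] Attached (pt i j) x → Attached (pt i j) (anchor i j)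
     anchored i j h = by (em _)
      where
      by : ∀ d → Attached (pt i j) (anchor-by i j d)
      by (yes (_ , a)) = a
      by (no n) = ⊥-elim (n h)

    covered-in : ∀ {z} → Covered z → z ∈ Box la ra ba ta
    covered-in {z} (inl o) = bd z o
    covered-in (inr wt) = by-contra λ out → true≢false (trans (sym wt) (wind-outside {a = la} {ra} {ba} {ta} Z bd out))

    block-star : ∀ {z} i j → Covered z → z ∈ Block 4 i j → Σ[ v ∈ V ] Starlike v (X i) (X (4 +ℕ i)) (Y j) (Y (4 +ℕ j))
    block-star {z} i j cov k@((x1 , x2) , (y1 , y2)) = let ((a1 , a2) , (a3 , a4)) = covered-in {z} cov in
     go (good i j (lo<up (fst z) a1 x2) (lo<up (fst z) x1 a2) (lo<up (snd z) a3 y2) (lo<up (snd z) y1 a4))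
     where
     go : Good (X i) (X (4 +ℕ i)) (Y j) (Y (4 +ℕ j)) → Σ[ v ∈ V ] Starlike v (X i) (X (4 +ℕ i)) (Y j) (Y (4 +ℕ j))
     go (inl s) = s
     go (inr g) = [ (λ o → ⊥-elim (fst (g z k) o)) , (λ wt → true≢false (trans (sym wt) (snd (g z k)))) ]′ cov

    block-close : ∀ {z o} i j → Covered z → z ∈ Block 4 i j → Attached z o → ∀ {a b} → pt a b ∈ Block 4 i j → Close c o (anchor a b)
    block-close {z} {o} i j cov k att {a} {b} l = go (block-star {z} i j cov k)
     where
     go : Σ[ v ∈ V ] Starlike v (X i) (X (4 +ℕ i)) (Y j) (Y (4 +ℕ j)) → Close c o (anchor a b)
     go (v , s) = attached-close {v} {X i} {X (4 +ℕ i)} {Y j} {Y (4 +ℕ j)} s {z} {pt a b} k l att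
      (anchored a b (attached-exists {v} {X i} {X (4 +ℕ i)} {Y j} {Y (4 +ℕ j)} s {z} {pt a b} k cov l))

    near-close : ∀ {z o} → Covered z → Attached z o → ∀ {i j} → Near z i j → Close c o (anchor i j)
    near-close {z} cov att {suc i} {suc j} ((x1 , x2) , (y1 , y2)) = block-close {z} i j cov
     ((x1 , upper-up≤ (fst z) (steps-≤ 0<hx (m≤n+m (2 +ℕ i) 2)) x2) , (y1 , upper-up≤ (snd z) (steps-≤ 0<hy (m≤n+m (2 +ℕ j) 2)) y2)) att
     {suc i} {suc j} (pt-in 4 {i} {j} {suc i} {suc j} (n<1+n i) (s≤s (s≤s (m≤n+m i 2))) (n<1+n j) (s≤s (s≤s (m≤n+m j 2))))

    on-enclosed : ∀ {e} → e ∈ˡ H → Enclosed Z (src e)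
    on-enclosed i = inl (fst (edge-on-walk Z i))

    curve-close : ∀ {e} → e ∈ˡ H → ∀ {t} → In 0ℚ 1ℚ t → ∀ {i j} → Near (curve e t) i j → Close c (src e) (anchor i j)
    curve-close {e} e∈ {t} it = near-close {curve e t} (inl (e , e∈ , curve-on e t it)) (inl (e , curve-on e t it , inl refl))

    across up : Grid
    across i j = τ (anchor i j) (anchor (suc i) j)
    up i j = τ (anchor i j) (anchor i (suc j))

    -- The cochain `f` carried over to the lattice: an edge receives the sum of `f` along a shortest
    -- walk between the anchors of its ends.
    transport : System
    transport = record
     { f = across ; g = up
     ; pot = λ v i j → τ v (anchor i j) ; val = f ; h = λ e _ i j → τ (src e) (anchor i j)
     ; horizontal = λ e∈ t it i j n m → τ-close (on-enclosed e∈) (curve-close e∈ it n) (curve-close e∈ it m)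
     ; vertical = λ e∈ t it i j n m → τ-close (on-enclosed e∈) (curve-close e∈ it n) (curve-close e∈ it m)
     ; steady = λ _ _ _ → Nb-all λ _ _ _ _ _ _ → refl
     ; at-ends = λ {e} e∈ → false , (λ i j _ → sym (xor-identityʳ (τ (src e) (anchor i j)))) , λ i j n →
      let edge = close-mono {1} {c} (s≤s z≤n) (close-edge {e = e} (inl refl) (inr refl))
      in trans (taut 2 (λ a b → b) (λ a b → (a xor b) xor a) refl (f e) (τ (src e) (anchor i j)))
       (cong (_xor f e) (sym (trans (τ-close (on-enclosed e∈) edge (near-close {φ (vertex (tgt e))} (inl (e , e∈ , tgt-on e)) (inl (e , tgt-on e , inl refl)) n))
        (cong (_xor τ (src e) (anchor i j)) (trans (τ-walk (on-enclosed e∈) edge) (xor-identityʳ (f e))))))) }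

    -- In other words, no corner of the cell is near a point of the walk.
    Clear : ℕ → ℕ → Set₁
    Clear x y = ∀ w i j → On H w → Near w i j → (i <ℕ x ⊎ suc x <ℕ i) ⊎ (j <ℕ y ⊎ suc y <ℕ j)

    module Cell (x y : ℕ) where
     private
      abstract
       pX : ∃[ p ] (X x < p × p < X (suc x))
       pX = <-dense (step-< 0<hx)
       pY : ∃[ p ] (Y y < p × p < Y (suc y))
       pY = <-dense (step-< 0<hy)
     p : ℝ²
     p = ι (fst pX) , ι (fst pY)

     X<p : X x < fst pX
     X<p = fst (snd pX)
     p<X : fst pX < X (suc x)
     p<X = snd (snd pX)
     Y<p : Y y < fst pY
     Y<p = fst (snd pY)
     p<Y : fst pY < Y (suc y)
     p<Y = snd (snd pY)

     p-in : ∀ {i j} → i ≤ℕ x → suc x ≤ℕ 4 +ℕ i → j ≤ℕ y → suc y ≤ℕ 4 +ℕ j → p ∈ Block 4 i j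
     p-in a b c d = (≤-<-trans (steps-≤ 0<hx a) X<p , <-≤-trans p<X (steps-≤ 0<hx b)) , (≤-<-trans (steps-≤ 0<hy c) Y<p , <-≤-trans p<Y (steps-≤ 0<hy d))

     west-of : ∀ w {i j} → Near w i j → i <ℕ x → right p w ≡ false
     west-of w {suc i} {suc j} ((_ , l) , _) h = right-no {p} {w} (X x , upper-up≤ (fst w) (steps-≤ 0<hx h) l , X<p)
     east-of : ∀ w {i j} → Near w i j → suc x <ℕ i → right p w ≡ true
     east-of w {suc i} {suc j} ((l , _) , _) (s≤s h) = right-yes {p} {w} {X (suc x)} (<ˡ⇒≤ʳ (fst w) (lower-down≤ (fst w) (steps-≤ 0<hx h) l)) (<-asym p<X)
     south-of : ∀ w {i j} → Near w i j → j <ℕ y → below p w ≡ true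
     south-of w {suc i} {suc j} (_ , (_ , l)) h = dec-yes (Y y , upper-up≤ (snd w) (steps-≤ 0<hy h) l , Y<p)
     north-of : ∀ w {i j} → Near w i j → suc y <ℕ j → below p w ≡ false
     north-of w {suc i} {suc j} (_ , (l , _)) (s≤s h) = below-no {p} {w} {Y (suc y)} (<ˡ⇒≤ʳ (snd w) (lower-down≤ (snd w) (steps-≤ 0<hy h) l)) (<-asym p<Y)

     pt-left : ∀ i j → i ≤ℕ x → right p (pt i j) ≡ false
     pt-left i j h = let (q , l , k) = <-dense X<p in right-no {p} {pt i j} (q , ≤-<-trans (steps-≤ 0<hx h) l , k)
     pt-right : ∀ i j → x <ℕ i → right p (pt i j) ≡ true
     pt-right i j h = right-yes {p} {pt i j} {X (suc x)} (λ l → <-irrefl refl (<-≤-trans l (steps-≤ 0<hx h))) (<-asym p<X)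

     module Crossing (clear : Clear x y) where
      off : ¬ On H p
      off o = hit (near-exists bd p o)
       where
       hit : ¬ (Σ[ i ∈ ℕ ] Σ[ j ∈ ℕ ] Near p i j)
       hit (suc i , suc j , nr@((a , b) , (a' , b'))) = side (clear p (suc i) (suc j) o nr)
        where
        side : ¬ ((suc i <ℕ x ⊎ suc x <ℕ suc i) ⊎ (suc j <ℕ y ⊎ suc y <ℕ suc j))
        side (inl (inl h)) = <-asym b (≤-<-trans (steps-≤ 0<hx h) X<p)
        side (inl (inr (s≤s h))) = <-asym a (<-≤-trans p<X (steps-≤ 0<hx h))
        side (inr (inl h)) = <-asym b' (≤-<-trans (steps-≤ 0<hy h) Y<p)
        side (inr (inr (s≤s h))) = <-asym a' (<-≤-trans p<Y (steps-≤ 0<hy h))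

      abstract
       sections : ∀ e → Σ[ f ∈ (ℝ → Bool) ] (e ∈ˡ H → Coherent p e f)
       sections e = by (em _)
        where
        by : Dec (Σ[ f ∈ (ℝ → Bool) ] Coherent p e f) → Σ[ f ∈ (ℝ → Bool) ] (e ∈ˡ H → Coherent p e f)
        by (yes (f , co)) = f , λ _ → co
        by (no n) = (λ _ → false) , λ e∈ → ⊥-elim (n (coherent-exists p e 0<1 (λ o → off (e , e∈ , o))))

      σ : E → ℝ → Bool
      σ e = fst (sections e)

      σ-coherent : ∀ {e} → e ∈ˡ H → Coherent p e (σ e)
      σ-coherent {e} = snd (sections e)

      -- `fill` counts horizontal steps above the cell, whereas `cut` uses the ray below `p`. Adding
      -- `right`, whose coboundary lives on the whole vertical line through `p`, exchanges the two
      -- rays.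
      φ' : ℕ → ℕ → ℝ² → Bool
      φ' i j w = cut p w (pt i j) xor right p (pt i j)

      step-right : ∀ i j w (s : Bool) → On H w → Near w i j → (i ≡ᵇ x) ∧ (y <ᵇ j) ≡ (s xor φ' i j w) xor (s xor φ' (suc i) j w)
      step-right i j w s o n = go (ℕP.<-cmp i x)
       where
       r r' : Bool
       r = right p (pt i j)
       r' = right p (pt (suc i) j)
       ≡ᵇ-refl : ∀ i → (i ≡ᵇ i) ≡ true
       ≡ᵇ-refl zero = refl
       ≡ᵇ-refl (suc i) = ≡ᵇ-refl i
       side : i ≡ x → (i <ℕ x ⊎ suc x <ℕ i) ⊎ (j <ℕ y ⊎ suc y <ℕ j) → (y <ᵇ j) ≡ not (below p w)
       side refl (inl (inl h)) = ⊥-elim (ℕP.<-irrefl refl h)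
       side refl (inl (inr h)) = ⊥-elim (ℕP.<-asym h (n<1+n i))
       side refl (inr (inl h)) = trans (≤ᵇ-false {suc y} {j} (m≤n⇒m≤1+n h)) (cong not (sym (south-of w n h)))
       side refl (inr (inr h)) = trans (≤ᵇ-true {suc y} {j} (<⇒≤ h)) (cong not (sym (north-of w n h)))
       go : Tri (i <ℕ x) (i ≡ x) (x <ℕ i) → (i ≡ᵇ x) ∧ (y <ᵇ j) ≡ (s xor φ' i j w) xor (s xor φ' (suc i) j w)
       go (tri< l ne _) = same-side ((i ≡ᵇ x) ∧ (y <ᵇ j)) s (right p w) (below p w) r r' (cong (_∧ (y <ᵇ j)) (≡ᵇ-false ne)) (trans (pt-left i j (<⇒≤ l)) (sym (pt-left (suc i) j l)))
       go (tri> _ ne l) = same-side ((i ≡ᵇ x) ∧ (y <ᵇ j)) s (right p w) (below p w) r r' (cong (_∧ (y <ᵇ j)) (≡ᵇ-false ne)) (trans (pt-right i j l) (sym (pt-right (suc i) j (ℕP.<-trans l (n<1+n i)))))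
       go (tri≈ _ e _) = other-side ((i ≡ᵇ x) ∧ (y <ᵇ j)) s (right p w) (below p w) r r' (pt-left i j (≤-reflexive e)) (pt-right (suc i) j (s≤s (≤-reflexive (sym e))))
        (trans (cong (_∧ (y <ᵇ j)) (trans (cong (i ≡ᵇ_) (sym e)) (≡ᵇ-refl i))) (side e (clear w i j o n)))

      step-steady : ∀ i j w w' (s : Bool) → On H w → Near w i j → Near w' i j → (s xor cut p w w') xor φ' i j w' ≡ s xor φ' i j w
      step-steady i j w w' s o n n' = go (clear w i j o n)
       where
       r : Bool
       r = right p (pt i j)
       level : right p w ≡ r → right p w' ≡ r → (s xor cut p w w') xor φ' i j w' ≡ s xor φ' i j w
       level = same-right s (right p w) (right p w') (below p w) (below p w') r
       go : (i <ℕ x ⊎ suc x <ℕ i) ⊎ (j <ℕ y ⊎ suc y <ℕ j) → (s xor cut p w w') xor φ' i j w' ≡ s xor φ' i j w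
       go (inl (inl h)) = let l = pt-left i j (<⇒≤ h) in level (trans (west-of w n h) (sym l)) (trans (west-of w' n' h) (sym l))
       go (inl (inr h)) = let l = pt-right i j (ℕP.<-trans (n<1+n x) h) in level (trans (east-of w n h) (sym l)) (trans (east-of w' n' h) (sym l))
       go (inr (inl h)) = same-below s (right p w) (right p w') (below p w) (below p w') r (trans (south-of w n h) (sym (south-of w' n' h)))
       go (inr (inr h)) = same-below s (right p w) (right p w') (below p w) (below p w') r (trans (north-of w n h) (sym (north-of w' n' h)))

      system : System
      system = record
       { f = λ i j → (i ≡ᵇ x) ∧ (y <ᵇ j) ; g = none
       ; pot = λ v i j → φ' i j (φ (vertex v)) ; val = κ p ; h = λ e t i j → σ e t xor φ' i j (curve e t)
       ; horizontal = λ {e} e∈ t it i j n _ → step-right i j (curve e t) (σ e t) (e , e∈ , curve-on e t it) n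
       ; vertical = λ {e} _ t _ i j _ _ → sym (xor-same (σ e t xor φ' i j (curve e t)))
       ; steady = λ {e} e∈ t it → Nb-map (λ s co is i j n n' → trans (cong (_xor φ' i j (curve e s)) (co is))
        (step-steady i j (curve e t) (curve e s) (σ e t) (e , e∈ , curve-on e t it) n n')) (σ-coherent e∈ t it)
       ; at-ends = λ {e} e∈ → σ e (ι 0ℚ) ,
        (λ i j _ → trans (xor-comm (σ e (ι 0ℚ)) (φ' i j (curve e (ι 0ℚ)))) (cong (λ z → φ' i j z xor σ e (ι 0ℚ)) (curve-0 e))) ,
        λ i j _ → trans (xor-comm (σ e (ι 1ℚ)) (φ' i j (curve e (ι 1ℚ)))) (cong₂ (λ z b → φ' i j z xor b) (curve-1 e)
         (trans (taut 2 (λ a b → b) (λ a b → a xor (a xor b)) refl (σ e (ι 0ℚ)) (σ e (ι 1ℚ))) (cong (σ e (ι 0ℚ) xor_) (sym (κ-spec (σ-coherent e∈)))))) }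

    cons-system : ∀ {x y} → Dec (Clear x y) → List System → List System
    cons-system {x} {y} (yes cl) Ss = Cell.Crossing.system x y cl ∷ Ss
    cons-system (no _) Ss = Ss

    cell-systems : List (ℕ × ℕ) → List System
    cell-systems [] = []
    cell-systems ((x , y) ∷ cs) = cons-system {x} {y} (em _) (cell-systems cs)

    -- The filling of a lattice path that follows Z agrees with the winding of Z at the cells away from Z.
    record Cellular (x y : ℕ) (Ss : List System) : Set₁ where
     field
      S : System
      S∈ : S ∈ˡ Ss
      f-is : System.f S ≡ λ i j → (i ≡ᵇ x) ∧ (y <ᵇ j)
      g-is : System.g S ≡ none
      val-is : System.val S ≡ κ (Cell.p x y)

    cell-system : ∀ cs {x y} → (x , y) ∈ˡ cs → Clear x y → Cellular x y (cell-systems cs)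
    cell-system ((x , y) ∷ cs) (here refl) cl = by (em _)
     where
     by : (d : Dec (Clear x y)) → Cellular x y (cons-system d (cell-systems cs))
     by (yes cl') = record { S = Cell.Crossing.system x y cl' ; S∈ = here refl ; f-is = refl ; g-is = refl ; val-is = refl }
     by (no n) = ⊥-elim (n cl)
    cell-system (_ ∷ cs) {x} {y} (there i) cl = by (em _) (cell-system cs i cl)
     where
     by : ∀ {a b Ss} (d : Dec (Clear a b)) → Cellular x y Ss → Cellular x y (cons-system d Ss)
     by (yes _) C = record { Cellular C ; S∈ = there (Cellular.S∈ C) }
     by (no _) C = C

    systems : List System
    systems = transport ∷ cell-systems (all-cells (2 +ℕ size))

    module Loop {i j} (L : LPath i j i j) (range : AllE Ranged Ranged L) (b : System → Bool)
     (sums : ∀ {S} → S ∈ˡ systems → sumL (System.f S) (System.g S) L ≡ (b S xor sumW (System.val S) Z) xor b S) where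
     C : Grid
     C = fill L

     sum-val : ∀ {S} → S ∈ˡ systems → sumL (System.f S) (System.g S) L ≡ sumW (System.val S) Z
     sum-val {S} i = trans (sums i) (taut 2 (λ a b → (a xor b) xor a) (λ a b → b) refl (b S) (sumW (System.val S) Z))

     vanish : ∀ (f : Grid) → (∀ i j → Ranged i j → f i j ≡ false) → sumL f none L ≡ false
     vanish f h = sumL-exact f none none Ranged Ranged h (λ _ _ _ → refl) L range

     vanish' : ∀ (g : Grid) → (∀ i j → Ranged i j → g i j ≡ false) → sumL none g L ≡ false
     vanish' g h = sumL-exact none g none Ranged Ranged (λ _ _ _ → refl) h L range

     absent : ∀ a b (c : Bool) → a ≢ b → (a ≡ᵇ b) ∧ c ≡ false
     absent a b c ne rewrite ≡ᵇ-false ne = refl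

     outside : ∀ x y → suc size ≤ℕ x ⊎ suc size ≤ℕ y → C x y ≡ false
     outside x y (inl h) = vanish (λ i j → (i ≡ᵇ x) ∧ (y <ᵇ j)) λ i j ((_ , l) , _) → absent i x (y <ᵇ j) (<⇒≢ (≤-trans (s≤s l) h))
     outside x y (inr h) = vanish (λ i j → (i ≡ᵇ x) ∧ (y <ᵇ j)) λ i j (_ , (_ , l)) →
      trans (cong ((i ≡ᵇ x) ∧_) (≤ᵇ-false {suc y} {j} (s≤s (≤-trans l (≤-trans (n≤1+n size) h))))) (taut 1 (λ a → a ∧ false) (λ _ → false) refl (i ≡ᵇ x))

     first-column : ∀ y → C 0 y ≡ false
     first-column y = vanish (λ i j → (i ≡ᵇ 0) ∧ (y <ᵇ j)) λ i j ((l , _) , _) → absent i 0 (y <ᵇ j) λ { refl → case l of λ () }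

     h-sides : ∀ x y → C x y xor C (suc x) y ≡ useV L (suc x) y
     h-sides x y = trans (fill-H L x y) (taut 2 (λ r u → (r xor r) xor u) (λ r u → u) refl (ray i j (suc x) y) (useV L (suc x) y))

     unused-row : ∀ x → useV L x 0 ≡ false
     unused-row x = vanish' (spot x 0) λ i j (_ , (l , _)) → trans (cong ((i ≡ᵇ x) ∧_) (≡ᵇ-false {j} {0} λ { refl → case l of λ () })) (taut 1 (λ a → a ∧ false) (λ _ → false) refl (i ≡ᵇ x))

     first-row : ∀ x → C x 0 ≡ false
     first-row zero = first-column 0
     first-row (suc x) = trans (sym (xor-≡ (trans (h-sides x 0) (unused-row (suc x))))) (first-row x)

     hf : ∀ x y → useH L x y ≡ C x y xor prevV C x y
     hf x zero = trans (vanish (spot x 0) λ i j (_ , (l , _)) → trans (cong ((i ≡ᵇ x) ∧_) (≡ᵇ-false {j} {0} λ { refl → case l of λ () })) (taut 1 (λ a → a ∧ false) (λ _ → false) refl (i ≡ᵇ x)))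
      (sym (cong (_xor false) (first-row x)))
     hf x (suc y) = trans (sym (fill-V L x y)) (xor-comm (C x y) (C x (suc y)))

     hg : ∀ x y → useV L x y ≡ C x y xor prevH C x y
     hg zero y = trans (vanish' (spot 0 y) λ i j ((l , _) , _) → absent i 0 (j ≡ᵇ y) λ { refl → case l of λ () }) (sym (cong (_xor false) (first-column y)))
     hg (suc x) y = trans (sym (h-sides x y)) (xor-comm (C x y) (C (suc x) y))

     -- A cell in the filling is either close to `Z` or clear, and then its cell system identifies
     -- the filling with the winding parity of `Z`.
     covered-cell : ∀ x y → C (suc x) (suc y) ≡ true → Σ[ z ∈ ℝ² ] (Covered z × z ∈ Block 4 x y)
     covered-cell x y Ct = go (em _)
      where
      clear-cell : Clear (suc x) (suc y) → wind (Cell.p (suc x) (suc y)) Z ≡ true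
      clear-cell cl = winding (cell-system (all-cells (2 +ℕ size)) (in-cells (in-range (outside (suc x) (suc y) ∘ inl)) (in-range (outside (suc x) (suc y) ∘ inr))) cl)
       where
       in-range : ∀ {k} → (suc size ≤ℕ k → C (suc x) (suc y) ≡ false) → k <ℕ 2 +ℕ size
       in-range h = m≤n⇒m≤1+n (≰⇒> λ l → true≢false (trans (sym Ct) (h l)))
       winding : Cellular (suc x) (suc y) (cell-systems (all-cells (2 +ℕ size))) → wind (Cell.p (suc x) (suc y)) Z ≡ true
       winding D = trans (sym (trans (sym (cong₂ (λ f g → sumL f g L) f-is g-is)) (trans (sum-val (there S∈)) (cong (λ v → sumW v Z) val-is)))) Ct
        where open Cellular D
      inside : ∀ w i j → Near w i j → ¬ ((i <ℕ suc x ⊎ suc (suc x) <ℕ i) ⊎ (j <ℕ suc y ⊎ suc (suc y) <ℕ j)) → w ∈ Block 4 x y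
      inside w (suc i) (suc j) ((a , b) , (a' , b')) h =
       (lower-down≤ (fst w) (steps-≤ 0<hx {x} {i} x≤i) a , upper-up≤ (fst w) (steps-≤ 0<hx {2 +ℕ i} {4 +ℕ x} (s≤s (s≤s (m≤n⇒m≤1+n i≤x)))) b) ,
       (lower-down≤ (snd w) (steps-≤ 0<hy {y} {j} y≤j) a' , upper-up≤ (snd w) (steps-≤ 0<hy {2 +ℕ j} {4 +ℕ y} (s≤s (s≤s (m≤n⇒m≤1+n j≤y)))) b')
       where
       x≤i : x ≤ℕ i
       x≤i = ≤-pred (ℕP.≮⇒≥ (λ k → h (inl (inl k))))
       i≤x : i ≤ℕ suc x
       i≤x = ≤-pred (ℕP.≮⇒≥ (λ k → h (inl (inr k))))
       y≤j : y ≤ℕ j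
       y≤j = ≤-pred (ℕP.≮⇒≥ (λ k → h (inr (inl k))))
       j≤y : j ≤ℕ suc y
       j≤y = ≤-pred (ℕP.≮⇒≥ (λ k → h (inr (inr k))))
      go : Dec (Clear (suc x) (suc y)) → Σ[ z ∈ ℝ² ] (Covered z × z ∈ Block 4 x y)
      go (yes cl) = Cell.p (suc x) (suc y) , inr (clear-cell cl) , Cell.p-in (suc x) (suc y) {x} {y} (n≤1+n x) (s≤s (s≤s (m≤n+m x 2))) (n≤1+n y) (s≤s (s≤s (m≤n+m y 2)))
      go (no ncl) = by-contra λ none → ncl λ w i j o n → by-contra λ near → none (w , inl o , inside w i j n near)

     -- The anchors of the four corners are all close to one enclosed vertex, and from there `τ` is
     -- a coboundary.
     closed : ∀ x y → C x y ≡ true → (across x y xor across x (suc y)) xor (up x y xor up (suc x) y) ≡ false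
     closed zero y Ct = true≢false (trans (sym Ct) (first-column y))
     closed (suc x) zero Ct = true≢false (trans (sym Ct) (first-row (suc x)))
     closed (suc x) (suc y) Ct = use (covered-cell x y Ct)
      where
      Goal = (across (suc x) (suc y) xor across (suc x) (2 +ℕ y)) xor (up (suc x) (suc y) xor up (2 +ℕ x) (suc y)) ≡ false
      close : ∀ {z} → z ∈ Block 4 x y → Covered z → Σ[ o ∈ V ] (Attached z o × Enclosed Z o) → Goal
      close {z} k cov (o , att , enc) = square (pot (1 +ℕ x) (1 +ℕ y)) (pot (2 +ℕ x) (1 +ℕ y)) (pot (1 +ℕ x) (2 +ℕ y)) (pot (2 +ℕ x) (2 +ℕ y))
       (side e11 e21) (side e12 e22) (side e11 e12) (side e21 e22)
       where
       side : ∀ {a b} → Close c o a → Close c o b → τ a b ≡ τ o a xor τ o b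
       side = τ-close enc
       pot : Grid
       pot i j = τ o (anchor i j)
       one : ∀ x → 1 +ℕ x <ℕ 4 +ℕ x
       one x = s≤s (s≤s (m≤n+m x 2))
       two : ∀ x → 2 +ℕ x <ℕ 4 +ℕ x
       two x = s≤s (s≤s (s≤s (n≤1+n x)))
       corner-close : ∀ a b → x <ℕ a → a <ℕ 4 +ℕ x → y <ℕ b → b <ℕ 4 +ℕ y → Close c o (anchor a b)
       corner-close a b h1 h2 h3 h4 = block-close {z} x y cov k att {a} {b} (pt-in 4 {x} {y} {a} {b} h1 h2 h3 h4)
       e11 : Close c o (anchor (1 +ℕ x) (1 +ℕ y))
       e11 = corner-close (1 +ℕ x) (1 +ℕ y) (n<1+n x) (one x) (n<1+n y) (one y)
       e21 : Close c o (anchor (2 +ℕ x) (1 +ℕ y))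
       e21 = corner-close (2 +ℕ x) (1 +ℕ y) (m≤n+m (suc x) 1) (two x) (n<1+n y) (one y)
       e12 : Close c o (anchor (1 +ℕ x) (2 +ℕ y))
       e12 = corner-close (1 +ℕ x) (2 +ℕ y) (n<1+n x) (one x) (m≤n+m (suc y) 1) (two y)
       e22 : Close c o (anchor (2 +ℕ x) (2 +ℕ y))
       e22 = corner-close (2 +ℕ x) (2 +ℕ y) (m≤n+m (suc x) 1) (two x) (m≤n+m (suc y) 1) (two y)
      use : Σ[ z ∈ ℝ² ] (Covered z × z ∈ Block 4 x y) → Goal
      use (z , cov , k) = close k cov (attached-inside {z} cov)

     -- `L` is the boundary of `C`, and the transported cochain is closed on the cells of `C`.
     trivial : sumW f Z ≡ false
     trivial = trans (sym (sum-val (here refl))) (sum-along (suc size) C across up outside L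
      (AllE-map (λ _ _ r → in-range r) (λ _ _ r → in-range r) L range) (λ x y _ → hf x y) (λ x y _ → hg x y) closed)
      where
      in-range : ∀ {i j} → Ranged i j → InRange (2 +ℕ size) i j
      in-range ((_ , a) , (_ , b)) = s≤s (m≤n⇒m≤1+n a) , s≤s (m≤n⇒m≤1+n b)

    conclusion : sumW f Z ≡ false
    conclusion = go (near-exists bd (φ (vertex u)) start-on)
     where
     start-on : On H (φ (vertex u))
     start-on = first Z
      where
      first : ∀ {x y n} (W : W[ x , y ] (suc n)) → On (edges W) (φ (vertex x))
      first ((e , j) ∷ W) = e , here refl , on-edge-vertex (fst (joins-incident j))
     go : Σ[ i ∈ ℕ ] Σ[ j ∈ ℕ ] Near (φ (vertex u)) i j → sumW f Z ≡ false
     go (i , j , nr) = use (trace-walk systems Z (λ _ m → m) nr nr)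
      where
      use : Traced systems i j i j (λ S → (System.pot S u i j xor sumW (System.val S) Z) xor System.pot S u i j) → sumW f Z ≡ false
      use (L , range , sums) = Loop.trivial L range (λ S → System.pot S u i j) sums

   -- A closed walk is a sum of short closed walks that meet the region it encircles.
   fillable : (f : E → Bool) → (∀ {o n} → Enclosed Z o → (L : W[ o , o ] n) → n ≤ℕ c +ℕ (c +ℕ c) +ℕ c → sumW f L ≡ false) → sumW f Z ≡ false
   fillable f short with bounded H
   ... | la , ra , ba , ta , bd = Fill.conclusion f short (lattice {F = frame px py (px + 1ℚ) (py + 1ℚ) la ra ba ta} (separable (on-closed H) (λ z w eq (e , i , o) → e , i , arc-≈ {z = z} {w} eq o)
    la<ra ba<ta bd (λ e → <-irrefl e (p<p+1 px)) (λ e → <-irrefl e (p<p+1 py))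
    (λ o → <-asym (snd (fst (bd (ι px , ι py) o))) (p<p+1 ra))
    (λ o → <-asym (snd (fst (bd (ι (px + 1ℚ) , ι (py + 1ℚ)) o))) (<-trans (p<p+1 ra) (p<p+1 px)))
    (λ _ → false) (λ z zo → N-all λ w wo → sym (cong₂ _xor_ (no-cut (p<p+1 ra) zo wo) (no-cut (<-trans (p<p+1 ra) (p<p+1 px)) zo wo))) good-local)) bd
    where
    -- Both branch points lie to the right of the bounding box, where their rays miss the walk, so
    -- the constant function is a branch over it.
    px = ra + 1ℚ
    py = ta + 1ℚ
    somewhere : Σ[ z ∈ ℝ² ] On H z
    somewhere = first Z
     where
     first : ∀ {x y n} (W : W[ x , y ] (suc n)) → Σ[ z ∈ ℝ² ] On (edges W) z
     first ((e , j) ∷ W) = φ (vertex (src e)) , e , here refl , src-on e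
    la<ra : la < ra
    la<ra = let (z , o) = somewhere in lo<up (fst z) (fst (fst (bd z o))) (snd (fst (bd z o)))
    ba<ta : ba < ta
    ba<ta = let (z , o) = somewhere in lo<up (snd z) (fst (snd (bd z o))) (snd (snd (bd z o)))
    no-cut : ∀ {x y z w} → ra < x → On H z → On H w → cut (ι x , ι y) z w ≡ false
    no-cut {x} {y} {z} {w} l zo wo = cong₂ (λ a b → (a xor b) ∧ below (ι x , ι y) z) (beyond z zo) (beyond w wo)
     where
     beyond : ∀ z → On H z → right (ι x , ι y) z ≡ false
     beyond z o = right-no {ι x , ι y} {z} (ra , snd (fst (bd z o)) , l)

 -- Edges at a given distance from a geodesic side

 module Windows where
  open Regions

  private variable
   ℓ : Level
   u v x y : V
   m n : ℕ

  close-on : {W : W[ u , v ] n} → OnWalk graph x W → Close n u x × Close n x v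
  close-on {n = n} o = let (i , j , A , B , e) = on-split o in
   (i , ≤-trans (m≤m+n i j) (≤-reflexive e) , A) , (j , ≤-trans (m≤n+m j i) (≤-reflexive e) , B)

  -- A connected set of edges contains one edge between any two consecutive distances from a.
  linked-length : ∀ {H} → Linked H u v → (∀ n → W[ u , v ] n → m ≤ℕ n) → m ≤ℕ length H
  linked-length {u} {v} {m} {H} L short = let (es , un , l , f) = crossings m ≤-refl in subst (_≤ℕ length H) l (unique-⊆ un λ i → fst (f i))
   where
   crossings : ∀ j → j ≤ℕ m → Σ[ es ∈ List E ] (Unique es × length es ≡ j × (∀ {e} → e ∈ˡ es → e ∈ˡ H × Close j u (src e) × Close j u (tgt e)))
   crossings zero _ = [] , [] , refl , λ ()
   crossings (suc j) j<m with crossings j (<⇒≤ j<m) | linked-crossing (Close j u) L (0 , z≤n , []) (λ (n , l , W) → <⇒≱ j<m (≤-trans (short n W) l))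
   ... | es , un , l , f | x , y , e , J , e∈ , cx , ny = e ∷ es , All.tabulate (λ i eq → ny (end J (f (subst (_∈ˡ es) (sym eq) i)))) ∷ un , cong suc l , λ
    { (here refl) → e∈ , ends J ; (there i) → let (h , p , q) = f i in h , up p , up q }
    where
    up : ∀ {x} → Close j u x → Close (suc j) u x
    up = close-mono (n≤1+n j)
    end : ∀ {e} → Joins e x y → e ∈ˡ H × Close j u (src e) × Close j u (tgt e) → Close j u y
    end (inl (_ , refl)) (_ , _ , q) = q
    end (inr (refl , _)) (_ , p , _) = p
    cy : Close (suc j) u y
    cy = close-mono (≤-reflexive (+-comm j 1)) (close-+ cx (1 , ≤-refl , (e , J) ∷ []))
    ends : Joins e x y → Close (suc j) u (src e) × Close (suc j) u (tgt e)
    ends (inl (refl , refl)) = up cx , cy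
    ends (inr (refl , refl)) = cy , up cx

  picks : {X : Set ℓ} (p : X → Bool) (xs : List X) →
   Σ[ ys ∈ List X ] (length ys ≡ cnt p xs × (∀ {x} → x ∈ˡ xs → p x ≡ true → x ∈ˡ ys))
  picks p [] = [] , refl , λ ()
  picks p (x ∷ xs) with picks p xs | p x in e
  ... | ys , l , f | true = x ∷ ys , cong suc l , λ { (here refl) _ → here refl ; (there i) k → there (f i k) }
  ... | ys , l , f | false = ys , l , λ { (here refl) k → true≢false (trans (sym k) e) ; (there i) k → f i k }

  cnt-disjoint : {X : Set ℓ} (p q s : X → Bool) (xs : List X) → (∀ x → p x ≡ true → s x ≡ true) → (∀ x → q x ≡ true → s x ≡ true) →
   (∀ x → p x ≡ true → q x ≡ true → ⊥) → cnt p xs +ℕ cnt q xs ≤ℕ cnt s xs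
  cnt-disjoint p q s xs ps qs dis = ≤-trans (+-mono-≤
   (cnt-mono p (λ x → s x ∧ p x) xs λ x e → ∧-both (ps x e) e)
   (cnt-mono q (λ x → s x ∧ not (p x)) xs λ x e → ∧-both (qs x e) (cong not (≢true λ e' → dis x e' e))))
   (≤-reflexive (sym (cnt-split s p xs)))

  -- A geodesic side S of a closed walk made up of S, the connectors Rc and the distant edges Rf.
  record GeodeticSide : Set₁ where
   constructor geodetic-side
   field
    K0 : ℕ
    Base : V → Set
    ne : List E
    near : ∀ {o e} → Base o → Close K0 o (src e) → e ∈ˡ ne
    {a b} : V
    {len} : ℕ
    S : W[ a , b ] len
    shortest : ∀ n → W[ a , b ] n → len ≤ℕ n
    Rc Rf : List E
    r0 : ℕ
    far : ∀ {e p} → e ∈ˡ Rf → OnWalk graph p S → ¬ Close r0 p (src e) × ¬ Close r0 p (tgt e)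
    fil : ∀ f → (∀ {o n} → Base o → (L : W[ o , o ] n) → n ≤ℕ K0 → sumW f L ≡ false) → sumW f S xor (sumE f Rc xor sumE f Rf) ≡ false

  module Window (side : GeodeticSide) where
   open GeodeticSide side

   -- A closed walk of length at most `K0` that has a vertex at level `k` stays within level
   -- `K +ℕ k`.
   K : ℕ
   K = K0 +ℕ K0

   Lvl : ℕ → V → Set
   Lvl k v = Σ[ p ∈ V ] (OnWalk graph p S × Close k p v)

   window below' : ℕ → E → Bool
   window k e = dec ((¬ Lvl k (src e) × ¬ Lvl k (tgt e)) × (Lvl (K +ℕ k) (src e) × Lvl (K +ℕ k) (tgt e)))
   below' k e = dec (Lvl k (src e) × Lvl k (tgt e))

   module _ (k : ℕ) (k≤r0 : k ≤ℕ r0) where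
    private
     ys = picks (window k) ne
     Ek : List E
     Ek = Rc ++ fst ys

    -- Otherwise the coboundary of the component of a in Ek, restricted to low levels, would be odd on the closed walk.
    window-linked : Linked Ek a b
    window-linked = by-contra λ nl → true≢false (trans (sym (total-odd nl)) (fil f λ {o} {n} base L l → loops base L l (em _)))
     where
     t : V → Bool
     t v = dec (Linked Ek a v)
     f : E → Bool
     f e = dec (Lvl k (src e) ⊎ Lvl k (tgt e)) ∧ δ t e
     linked-flat : ∀ {e} → e ∈ˡ Ek → δ t e ≡ false
     linked-flat {e} i = trans (cong (_xor t (tgt e)) (dec-⇔ {A = Linked Ek a (src e)} (λ l → linked-trans l (linked-edge i)) (λ l → linked-trans l (linked-sym (linked-edge i))))) (xor-same (t (tgt e)))
     f-low : ∀ e → Lvl k (src e) ⊎ Lvl k (tgt e) → f e ≡ δ t e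
     f-low e h = cong (_∧ δ t e) (dec-yes h)
     f-high : ∀ e → ¬ (Lvl k (src e) ⊎ Lvl k (tgt e)) → f e ≡ false
     f-high e h = cong (_∧ δ t e) (dec-no h)
     loops : ∀ {o n} → Base o → (L : W[ o , o ] n) → n ≤ℕ K0 → Dec (Σ[ p ∈ V ] (OnWalk graph p L × Lvl k p)) → sumW f L ≡ false
     loops base L l (no none) = sumW-potential f L (λ _ → false) λ e i → let (p , q) = edge-on-walk L i in
      f-high e [ (λ h → none (_ , p , h)) , (λ h → none (_ , q , h)) ]′
     -- A short loop that meets the low levels stays within the window above them. Its edges either
     -- touch the low levels, where `f` is the coboundary of `t`, or lie in the window, where `t` is
     -- constant. So `f` is a coboundary on the loop.
     loops {o} base L l (yes (p , p-on , s , s-on , ps)) = trans (sumW-potential f L t eq) (xor-same (t o))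
      where
      reach : ∀ {x} → OnWalk graph x L → Lvl (K +ℕ k) x
      reach x-on = s , s-on , close-mono (≤-trans (+-monoʳ-≤ k (+-mono-≤ l l)) (≤-reflexive (+-comm k K))) (close-+ ps (close-+ (snd (close-on p-on)) (fst (close-on x-on))))
      eq : ∀ e → e ∈ˡ edges L → f e ≡ δ t e
      eq e i with em _ {Lvl k (src e) ⊎ Lvl k (tgt e)}
      ... | yes h = refl
      ... | no h = let (p , q) = edge-on-walk L i in sym (linked-flat (∈-++⁺ʳ Rc (snd (snd ys) (near base (close-mono l (fst (close-on p))))
       (dec-yes (((λ x → h (inl x)) , (λ x → h (inr x))) , (reach p , reach q))))))
     total-odd : ¬ Linked Ek a b → sumW f S xor (sumE f Rc xor sumE f Rf) ≡ true
     total-odd nl = cong₂ _xor_ (trans (sumW-potential f S t λ e i → f-low e (inl (src e , fst (edge-on-walk S i) , 0 , z≤n , [])))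
      (cong₂ _xor_ (dec-yes {A = Linked Ek a a} linked-refl) (dec-no nl)))
      (cong₂ _xor_ (sumE-false f Rc λ {e} i → trans (cong (dec (Lvl k (src e) ⊎ Lvl k (tgt e)) ∧_) (linked-flat (∈-++⁺ˡ i))) (taut 1 (λ a → a ∧ false) (λ _ → false) refl (dec (Lvl k (src e) ⊎ Lvl k (tgt e)))))
       (sumE-false f Rf λ {e} i → f-high e [ (λ (p , o , c) → fst (far i o) (close-mono k≤r0 c)) , (λ (p , o , c) → snd (far i o) (close-mono k≤r0 c)) ]′))

    window-size : len ≤ℕ length Rc +ℕ cnt (window k) ne
    window-size = ≤-trans (linked-length window-linked shortest) (≤-reflexive (trans (length-++ Rc) (cong (length Rc +ℕ_) (fst (snd ys)))))

   -- Windows at successive multiples of `K` are disjoint and together lie within level `q *ℕ K`.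
   windows : ∀ q → q *ℕ K ≤ℕ r0 → q *ℕ len ≤ℕ q *ℕ length Rc +ℕ cnt (below' (q *ℕ K)) ne
   windows zero _ = z≤n
   windows (suc q) h = ≤-trans (+-mono-≤ (window-size (q *ℕ K) q≤) (windows q q≤)) (≤-trans (≤-reflexive shuffle)
    (+-monoʳ-≤ (suc q *ℕ length Rc) (cnt-disjoint (window (q *ℕ K)) (below' (q *ℕ K)) (below' (suc q *ℕ K)) ne
     (λ e w → dec-yes (snd (dec-true w))) (λ e w → let ((p , o , c) , (p' , o' , c')) = dec-true w in dec-yes ((p , o , close-mono (m≤n+m _ K) c) , (p' , o' , close-mono (m≤n+m _ K) c')))
     λ e w w' → fst (fst (dec-true w)) (fst (dec-true w')))))
    where
    q≤ : q *ℕ K ≤ℕ r0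
    q≤ = ≤-trans (m≤n+m (q *ℕ K) K) h
    shuffle : (length Rc +ℕ cnt (window (q *ℕ K)) ne) +ℕ (q *ℕ length Rc +ℕ cnt (below' (q *ℕ K)) ne) ≡
     suc q *ℕ length Rc +ℕ (cnt (window (q *ℕ K)) ne +ℕ cnt (below' (q *ℕ K)) ne)
    shuffle = trans (+-assoc (length Rc) (cnt (window (q *ℕ K)) ne) _) (trans (cong (length Rc +ℕ_) (trans (sym (+-assoc (cnt (window (q *ℕ K)) ne) (q *ℕ length Rc) _))
     (trans (cong (_+ℕ cnt (below' (q *ℕ K)) ne) (+-comm (cnt (window (q *ℕ K)) ne) (q *ℕ length Rc))) (+-assoc (q *ℕ length Rc) (cnt (window (q *ℕ K)) ne) _))))
     (sym (+-assoc (length Rc) (q *ℕ length Rc) _)))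

 -- Geodesic triangles are thin

 module ThinTriangles where
  open Regions
  open Windows

  private variable
   u v w x y : V
   k l m n : ℕ

  edges-length : (W : W[ u , v ] n) → length (edges W) ≡ n
  edges-length [] = refl
  edges-length (a ∷ W) = cong suc (edges-length W)

  edges-positive : (W : W[ u , v ] n) → ∀ {e} → e ∈ˡ edges W → 0 <ℕ n
  edges-positive (a ∷ W) _ = s≤s z≤n

  Geodetic : W[ u , v ] n → Set
  Geodetic {u} {v} {n} _ = ∀ k → W[ u , v ] k → n ≤ℕ k

  geodetic-prefix : (A : W[ u , x ] m) (B : W[ x , v ] n) → Geodetic (A +ʷ B) → Geodetic A
  geodetic-prefix {m = m} {n = n} A B g k W = +-cancelʳ-≤ n m k (g (k +ℕ n) (W +ʷ B))

  geodetic-suffix : (A : W[ u , x ] m) (B : W[ x , v ] n) → Geodetic (A +ʷ B) → Geodetic B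
  geodetic-suffix {m = m} {n = n} A B g k W = +-cancelˡ-≤ m n k (g (m +ℕ k) (A +ʷ W))

  at-close : (W : W[ u , v ] n) → ∀ i m → i +ℕ m ≤ℕ n → Close m (at W i) (at W (i +ℕ m))
  at-close W i m h = subst₂ (Close m) (sym at-x) (sym at-y) (m , ≤-refl , B)
   where open Piece (piece W i m h)

  at-next : (W : W[ u , v ] n) → ∀ i → suc i ≤ℕ n → Close 1 (at W i) (at W (suc i))
  at-next {n = n} W i h = subst (λ j → Close 1 (at W i) (at W j)) (+-comm i 1) (at-close W i 1 (subst (_≤ℕ n) (sym (+-comm i 1)) h))

  module _ where
   open +-*-Solver

   double : ∀ B a b c → B *ℕ ((a +ℕ b +ℕ c) +ℕ (a +ℕ b +ℕ c)) ≡ (B +ℕ B) *ℕ a +ℕ ((B +ℕ B) *ℕ b +ℕ (B +ℕ B) *ℕ c)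
   double = solve 4 (λ B a b c → B :* ((a :+ b :+ c) :+ (a :+ b :+ c)) := (B :+ B) :* a :+ ((B :+ B) :* b :+ (B :+ B) :* c)) refl

   regroup : ∀ q x y z → (q +ℕ x) +ℕ ((q +ℕ y) +ℕ (q +ℕ z)) ≡ (q +ℕ q +ℕ q) +ℕ (x +ℕ (y +ℕ z))
   regroup = solve 4 (λ q x y z → (q :+ x) :+ ((q :+ y) :+ (q :+ z)) := (q :+ q :+ q) :+ (x :+ (y :+ z))) refl

   factor : ∀ B t s → ((B +ℕ B) *ℕ t +ℕ (B +ℕ B) *ℕ t +ℕ (B +ℕ B) *ℕ t) +ℕ B *ℕ (1 +ℕ (s +ℕ t)) ≡ B *ℕ (s +ℕ (7 *ℕ t +ℕ 1))
   factor = solve 3 (λ B t s → ((B :+ B) :* t :+ (B :+ B) :* t :+ (B :+ B) :* t) :+ B :* (con 1 :+ (s :+ t)) := B :* (s :+ (con 7 :* t :+ con 1))) refl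

   excess : ∀ r → suc (12 *ℕ r) +ℕ suc (12 *ℕ r) ≡ ((7 *ℕ (3 *ℕ r) +ℕ 1) +ℕ (r +ℕ r)) +ℕ suc r
   excess = solve 1 (λ r → (con 1 :+ con 12 :* r) :+ (con 1 :+ con 12 :* r) := ((con 7 :* (con 3 :* r) :+ con 1) :+ (r :+ r)) :+ (con 1 :+ r)) refl

  -- Both `k1` and `k2` exceed 11 r, whereas their sum is at most 21 r + 1; this is the origin of
  -- the factor 12.
  too-long : ∀ r k1 k2 → 12 *ℕ r <ℕ k1 +ℕ r → 12 *ℕ r <ℕ k2 +ℕ r → k1 +ℕ k2 ≤ℕ 7 *ℕ (3 *ℕ r) +ℕ 1 → ⊥
  too-long r k1 k2 h1 h2 h = m+1+n≰m ((7 *ℕ (3 *ℕ r) +ℕ 1) +ℕ (r +ℕ r)) (≤-trans (≤-reflexive (sym (excess r)))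
   (≤-trans (+-mono-≤ h1 h2) (≤-trans (≤-reflexive (swap k1 r k2)) (+-monoˡ-≤ (r +ℕ r) h))))
   where
   open +-*-Solver
   swap : ∀ a r b → (a +ℕ r) +ℕ (b +ℕ r) ≡ (a +ℕ b) +ℕ (r +ℕ r)
   swap = solve 3 (λ a r b → (a :+ r) :+ (b :+ r) := (a :+ b) :+ (r :+ r)) refl

  -- With s for the sum of `a`, `b` and `c`, the hypotheses add up to 2 (B + 1) s ≤ 6 (B + 1) t + (B
  -- + 1) (1 + s + t). One summand (B + 1) s is cancelled and the rest divided by B + 1.
  arithmetic : ∀ B Q t R a b c x y z → Q ≡ suc B +ℕ suc B → R ≤ℕ t → Q *ℕ a ≤ℕ Q *ℕ R +ℕ x → Q *ℕ b ≤ℕ Q *ℕ R +ℕ y → Q *ℕ c ≤ℕ Q *ℕ R +ℕ z →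
   x +ℕ (y +ℕ z) ≤ℕ B *ℕ (1 +ℕ (a +ℕ b +ℕ c +ℕ t)) → a +ℕ b +ℕ c ≤ℕ 7 *ℕ t +ℕ 1
  arithmetic B Q t R a b c x y z refl hR h1 h2 h3 hU = +-cancelˡ-≤ s s (7 *ℕ t +ℕ 1) (*-cancelˡ-≤ (suc B)
   (≤-trans (≤-reflexive (double (suc B) a b c)) (≤-trans (+-mono-≤ h1 (+-mono-≤ h2 h3)) (≤-trans (≤-reflexive (regroup (Q *ℕ R) x y z))
    (≤-trans (+-mono-≤ (+-mono-≤ (+-mono-≤ qR qR) qR) (≤-trans hU (*-monoˡ-≤ (1 +ℕ (s +ℕ t)) (n≤1+n B)))) (≤-reflexive (factor (suc B) t s)))))))
   where
   s = a +ℕ b +ℕ c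
   qR : Q *ℕ R ≤ℕ Q *ℕ t
   qR = *-monoʳ-≤ Q hR

  -- What the encircled region of a closed walk provides: few edges ne near it, in which the walk can be filled.
  record Area (B K0 : ℕ) (Z : W[ u , u ] (suc n)) : Set₁ where
   field
    Base : V → Set
    ne : List E
    few : length ne ≤ℕ B *ℕ (1 +ℕ suc n)
    near : ∀ {o e} → Base o → Close K0 o (src e) → e ∈ˡ ne
    fill : ∀ f → (∀ {o n} → Base o → (L : W[ o , o ] n) → n ≤ℕ K0 → sumW f L ≡ false) → sumW f Z ≡ false

  -- Around each side `Q` windows of width `K0 +ℕ K0` are placed; `Q` exceeds twice `B`, so that for
  -- long sides they outgrow the area. By the choice of `r0`, windows of sides farther than `r0`
  -- apart are disjoint. `M` bounds the total length of the three sides of a hexagon whose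
  -- connectors have length at most `suc r0`, and a vertex farther than `D` from the other sides
  -- would lie on a longer one.
  record Scale : Set₁ where
   constructor scale
   field
    B K0 : ℕ
    area : ∀ {u n} (Z : W[ u , u ] (suc n)) → Area B K0 Z
    Q r0 M D : ℕ
    Q-is : Q ≡ suc B +ℕ suc B
    r0-is : r0 ≡ Q *ℕ (K0 +ℕ K0) +ℕ Q *ℕ (K0 +ℕ K0)
    M-is : M ≡ 7 *ℕ (3 *ℕ suc r0) +ℕ 1
    D-is : D ≡ 12 *ℕ suc r0

  module Thinness (scales : Scale) where
   open Scale scales

   r : ℕ
   r = suc r0

   Apart : W[ u , v ] m → W[ x , y ] n → Set
   Apart S T = ∀ p q → OnWalk graph p S → OnWalk graph q T → ¬ Close r0 p q

   apart-edge : (S : W[ u , v ] m) (T : W[ x , y ] n) → Apart S T → ∀ {e p} → e ∈ˡ edges T → OnWalk graph p S → ¬ Close r0 p (src e) × ¬ Close r0 p (tgt e)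
   apart-edge S T ap i o = let (a , b) = edge-on-walk T i in ap _ _ o a , ap _ _ o b

   -- When `S3` is empty the hexagon degenerates and `S2` may end close to the single vertex of
   -- `S3`; therefore `ap23` is conditional.
   record Sides : Set where
    constructor sides
    field
     {a1 a2 b1 b2 s t} : V
     {m1 m2 m3 k1 k2 k3} : ℕ
     S1 : W[ a1 , a2 ] (suc m1)
     κ2 : W[ a2 , b2 ] k2
     S2 : W[ b2 , t ] m2
     κ3 : W[ t , s ] k3
     S3 : W[ s , b1 ] m3
     κ1 : W[ b1 , a1 ] k1
     g1 : Geodetic S1
     g2 : Geodetic S2
     g3 : Geodetic S3
     l1 : k1 ≤ℕ r
     l2 : k2 ≤ℕ r
     l3 : k3 ≤ℕ r
     ap12 : Apart S1 S2
     ap13 : Apart S1 S3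
     ap23 : 0 <ℕ m3 → Apart S2 S3

   module Hexagon (hexagon : Sides) where
    open Sides hexagon

    Z : W[ a1 , a1 ] (suc (m1 +ℕ (k2 +ℕ (m2 +ℕ (k3 +ℕ (m3 +ℕ k1))))))
    Z = S1 +ʷ κ2 +ʷ S2 +ʷ κ3 +ʷ S3 +ʷ κ1

    open Area (area Z)

    Rc : List E
    Rc = edges κ1 ++ edges κ2 ++ edges κ3

    sum-Z : ∀ f → sumW f Z ≡ sumW f S1 xor (sumW f κ2 xor (sumW f S2 xor (sumW f κ3 xor (sumW f S3 xor sumW f κ1))))
    sum-Z f = trans (sumW-+ f S1 _) (cong (sumW f S1 xor_) (trans (sumW-+ f κ2 _) (cong (sumW f κ2 xor_) (trans (sumW-+ f S2 _) (cong (sumW f S2 xor_)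
     (trans (sumW-+ f κ3 _) (cong (sumW f κ3 xor_) (sumW-+ f S3 κ1))))))))

    sum-two : ∀ f (A : W[ u , v ] m) (C : W[ x , y ] n) → sumE f (edges A ++ edges C) ≡ sumW f A xor sumW f C
    sum-two f A C = trans (sumE-++ f (edges A) (edges C)) (cong₂ _xor_ (sumE-edges f A) (sumE-edges f C))

    sum-Rc : ∀ f → sumE f Rc ≡ sumW f κ1 xor (sumW f κ2 xor sumW f κ3)
    sum-Rc f = trans (sumE-++ f (edges κ1) _) (cong₂ _xor_ (sumE-edges f κ1) (sum-two f κ2 κ3))

    Filled : ∀ {u v m} → W[ u , v ] m → List E → Set
    Filled S Rf = ∀ f → (∀ {o n} → Base o → (L : W[ o , o ] n) → n ≤ℕ K0 → sumW f L ≡ false) → sumW f S xor (sumE f Rc xor sumE f Rf) ≡ false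

    filled : ∀ {p q p' q' i j} (S : W[ x , y ] m) (A : W[ p , q ] i) (C : W[ p' , q' ] j) →
     (∀ f → sumW f Z ≡ sumW f S xor ((sumW f κ1 xor (sumW f κ2 xor sumW f κ3)) xor (sumW f A xor sumW f C))) → Filled S (edges A ++ edges C)
    filled S A C eq f h = trans (cong (sumW f S xor_) (cong₂ _xor_ (sum-Rc f) (sum-two f A C))) (trans (sym (eq f)) (fill f h))

    fill1 : Filled S1 (edges S2 ++ edges S3)
    fill1 = filled S1 S2 S3 λ f → trans (sum-Z f) (taut 6 (λ a b c d e g → a xor (b xor (c xor (d xor (e xor g))))) (λ a b c d e g → a xor ((g xor (b xor d)) xor (c xor e))) refl
     (sumW f S1) (sumW f κ2) (sumW f S2) (sumW f κ3) (sumW f S3) (sumW f κ1))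
    fill2 : Filled S2 (edges S1 ++ edges S3)
    fill2 = filled S2 S1 S3 λ f → trans (sum-Z f) (taut 6 (λ a b c d e g → a xor (b xor (c xor (d xor (e xor g))))) (λ a b c d e g → c xor ((g xor (b xor d)) xor (a xor e))) refl
     (sumW f S1) (sumW f κ2) (sumW f S2) (sumW f κ3) (sumW f S3) (sumW f κ1))
    fill3 : Filled S3 (edges S1 ++ edges S2)
    fill3 = filled S3 S1 S2 λ f → trans (sum-Z f) (taut 6 (λ a b c d e g → a xor (b xor (c xor (d xor (e xor g))))) (λ a b c d e g → e xor ((g xor (b xor d)) xor (a xor c))) refl
     (sumW f S1) (sumW f κ2) (sumW f S2) (sumW f κ3) (sumW f S3) (sumW f κ1))

    apart-sym : ∀ {i j p q p' q'} {S : W[ p , q ] i} {T : W[ p' , q' ] j} → Apart S T → Apart T S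
    apart-sym ap p q o o' c = ap q p o' o (close-sym c)

    far-two : ∀ {p q p' q' p″ q″ i j k} (S : W[ p , q ] i) (A : W[ p' , q' ] j) (C : W[ p″ , q″ ] k) → Apart S A → (∀ {e} → e ∈ˡ edges C → Apart S C) →
     ∀ {e x} → e ∈ˡ edges A ++ edges C → OnWalk graph x S → ¬ Close r0 x (src e) × ¬ Close r0 x (tgt e)
    far-two S A C ap ap' i o = [ (λ k → apart-edge S A ap k o) , (λ k → apart-edge S C (ap' k) k o) ]′ (∈-++⁻ (edges A) i)

    h : Q *ℕ (K0 +ℕ K0) ≤ℕ r0
    h = ≤-trans (m≤m+n (Q *ℕ (K0 +ℕ K0)) (Q *ℕ (K0 +ℕ K0))) (≤-reflexive (sym r0-is))

    module W1 = Window (geodetic-side K0 Base ne near S1 g1 Rc (edges S2 ++ edges S3) r0 (far-two S1 S2 S3 ap12 (λ _ → ap13)) fill1)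
    module W2 = Window (geodetic-side K0 Base ne near S2 g2 Rc (edges S1 ++ edges S3) r0
     (far-two S2 S1 S3 (apart-sym {S = S1} {S2} ap12) (λ i → ap23 (edges-positive S3 i))) fill2)
    module W3 (0<m3 : 0 <ℕ m3) = Window (geodetic-side K0 Base ne near S3 g3 Rc (edges S1 ++ edges S2) r0
     (far-two S3 S1 S2 (apart-sym {S = S1} {S3} ap13) (λ _ → apart-sym {S = S2} {S3} (ap23 0<m3))) fill3)

    around : ∀ {i p q} → W[ p , q ] i → E → Set
    around S e = Σ[ x ∈ V ] (OnWalk graph x S × Close (Q *ℕ (K0 +ℕ K0)) x (src e))

    apart-around : ∀ {i j p q p' q'} {S : W[ p , q ] i} {T : W[ p' , q' ] j} → Apart S T → ∀ {e} → around S e → around T e → ⊥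
    apart-around ap (x , o , c) (y , o' , c') = ap x y o o' (close-mono (≤-reflexive (sym r0-is)) (close-+ c (close-sym c')))

    u1 u2 u3 u23 : E → Bool
    u1 = W1.below' (Q *ℕ (K0 +ℕ K0))
    u2 = W2.below' (Q *ℕ (K0 +ℕ K0))
    u3 e = dec (Σ[ p ∈ 0 <ℕ m3 ] W3.below' p (Q *ℕ (K0 +ℕ K0)) e ≡ true)
    u23 e = u2 e ∨ u3 e

    around1 : ∀ {e} → u1 e ≡ true → around S1 e
    around1 eq = fst (dec-true eq)
    around2 : ∀ {e} → u2 e ≡ true → around S2 e
    around2 eq = fst (dec-true eq)
    around3 : ∀ {e} → u3 e ≡ true → 0 <ℕ m3 × around S3 e
    around3 eq = let (p , k) = dec-true eq in p , fst (dec-true k)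

    split-∨ : ∀ {a b} → a ∨ b ≡ true → a ≡ true ⊎ b ≡ true
    split-∨ {true} _ = inl refl
    split-∨ {false} eq = inr eq

    disjoint : cnt u1 ne +ℕ (cnt u2 ne +ℕ cnt u3 ne) ≤ℕ length ne
    disjoint = ≤-trans (+-monoʳ-≤ (cnt u1 ne) (cnt-disjoint u2 u3 u23 ne (λ e p → cong (_∨ u3 e) p)
     (λ e p → trans (cong (u2 e ∨_) p) (taut 1 (λ a → a ∨ true) (λ _ → true) refl (u2 e)))
     λ e p q → apart-around {S = S2} {S3} (ap23 (fst (around3 q))) (around2 p) (snd (around3 q))))
     (≤-trans (cnt-disjoint u1 u23 (λ _ → true) ne (λ _ _ → refl) (λ _ _ → refl)
      λ e p q → [ (λ k → apart-around {S = S1} {S2} ap12 (around1 p) (around2 k)) , (λ k → apart-around {S = S1} {S3} ap13 (around1 p) (snd (around3 k))) ]′ (split-∨ {u2 e} q))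
      (≤-reflexive (cnt-all ne)))

    third-side : ∀ m → (0 <ℕ m → Q *ℕ m ≤ℕ Q *ℕ length Rc +ℕ cnt u3 ne) → Q *ℕ m ≤ℕ Q *ℕ length Rc +ℕ cnt u3 ne
    third-side zero _ = ≤-trans (≤-reflexive (*-zeroʳ Q)) z≤n
    third-side (suc m) f = f (s≤s z≤n)

    size : suc m1 +ℕ m2 +ℕ m3 ≤ℕ M
    size = ≤-trans (arithmetic B Q (3 *ℕ r) (length Rc) (suc m1) m2 m3 (cnt u1 ne) (cnt u2 ne) (cnt u3 ne) Q-is
     (≤-trans (≤-reflexive (trans (length-++ (edges κ1)) (cong₂ _+ℕ_ (edges-length κ1) (trans (length-++ (edges κ2)) (cong₂ _+ℕ_ (edges-length κ2) (edges-length κ3))))))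
      (+-mono-≤ l1 (+-mono-≤ l2 (≤-trans l3 (m≤m+n r 0)))))
     (W1.windows Q h) (W2.windows Q h)
     (third-side m3 λ p → ≤-trans (W3.windows p Q h) (+-monoʳ-≤ (Q *ℕ length Rc) (cnt-mono (W3.below' p (Q *ℕ (K0 +ℕ K0))) u3 ne λ e k → dec-yes (p , k))))
     (≤-trans disjoint (≤-trans few (*-monoʳ-≤ B (s≤s (≤-trans (≤-reflexive (shuffle (suc m1) k2 m2 k3 m3 k1))
      (+-monoʳ-≤ (suc m1 +ℕ m2 +ℕ m3) (+-mono-≤ l1 (+-mono-≤ l2 (≤-trans l3 (m≤m+n r 0)))))))))))
     (≤-reflexive (sym M-is))
     where
     open +-*-Solver
     shuffle : ∀ a b c d e f → a +ℕ (b +ℕ (c +ℕ (d +ℕ (e +ℕ f)))) ≡ a +ℕ c +ℕ e +ℕ (f +ℕ (b +ℕ d))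
     shuffle = solve 6 (λ a b c d e f → a :+ (b :+ (c :+ (d :+ (e :+ f)))) := a :+ c :+ e :+ (f :+ (b :+ d))) refl

   r≤D : r ≤ℕ D
   r≤D = ≤-trans (m≤m+n r (11 *ℕ r)) (≤-reflexive (sym D-is))

   module Triangle {u v w} (α : Geodesic graph u v) (β : Geodesic graph v w) (γ : Geodesic graph w u) where
    module α = Geodesic α
    module β = Geodesic β
    module γ = Geodesic γ

    Other : V → Set
    Other y = OnWalk graph y β.walk ⊎ OnWalk graph y γ.walk

    -- The part of one of the other sides between `b` and `w`, directed towards `w`: both ends of a
    -- stretch of `α` are thus connected to the same corner, whichever sides they are close to.
    record Leg (b : V) : Set where
     field
      {len} : ℕ
      side : W[ b , w ] len
      geodetic : Geodetic side
      other : ∀ {y} → OnWalk graph y side → Other y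

    leg : ∀ {b} → Other b → Leg b
    leg (inl o) = go β.walk β.shortest inl (on-at o)
     where
     go : ∀ {n b} (W : W[ v , w ] n) → Geodetic W → (∀ {y} → OnWalk graph y W → Other y) → Σ[ i ∈ ℕ ] (i ≤ℕ n × at W i ≡ b) → Leg b
     go W g f (i , l , refl) with split-at W i l
     ... | split A C = subst Leg (sym (at-+ A C)) (record { side = C ; geodetic = geodetic-suffix A C g ; other = λ o → f (on-+ʳ A o) })
    leg (inr o) = go γ.walk γ.shortest inr (on-at o)
     where
     go : ∀ {n b} (W : W[ w , u ] n) → Geodetic W → (∀ {y} → OnWalk graph y W → Other y) → Σ[ i ∈ ℕ ] (i ≤ℕ n × at W i ≡ b) → Leg b
     go W g f (i , l , refl) with split-at W i l
     ... | split A C = subst Leg (sym (at-+ A C)) (record { side = rev A ; geodetic = λ k X → geodetic-prefix A C g k (rev X) ; other = λ o → f (on-+ˡ C (on-rev A o)) })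

    Near-side : ℕ → Set
    Near-side i = Σ[ y ∈ V ] (Other y × Close r (at α.walk i) y)

    module Stretch (i m : ℕ) (1≤m : 1 ≤ℕ m) (fits : i +ℕ suc m ≤ℕ α.len) (left : Near-side i) (right : Near-side (i +ℕ suc m))
     (between : ∀ j → j <ℕ m → ¬ Near-side (i +ℕ suc j)) where
     open Piece (piece α.walk i (suc m) fits) renaming (A to before; B to stretch; C to after)
     L1 = leg (fst (snd left))
     L2 = leg (fst (snd right))
     module L1 = Leg L1
     module L2 = Leg L2

     stretch-geodetic : Geodetic stretch
     stretch-geodetic k X = +-cancelʳ-≤ rest (suc m) k (+-cancelˡ-≤ i (suc m +ℕ rest) (k +ℕ rest) (subst (_≤ℕ i +ℕ (k +ℕ rest)) (sym total) (α.shortest _ (before +ʷ (X +ʷ after)))))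

     -- Inner vertices of the stretch are farther than `r` from the other sides. Each end is one
     -- step from an inner vertex, hence farther than `r0`, which is one less than `r`.
     apart-at : ∀ j → j ≤ℕ suc m → ∀ y → Other y → ¬ Close r0 (at α.walk (i +ℕ j)) y
     apart-at j j≤ y o c = go j j≤ c (m≤n⇒m<n∨m≡n j≤)
      where
      go : ∀ j → j ≤ℕ suc m → Close r0 (at α.walk (i +ℕ j)) y → j <ℕ suc m ⊎ j ≡ suc m → ⊥
      go zero _ c _ = between 0 1≤m (y , o , close-+ (close-sym (subst (λ k → Close 1 (at α.walk k) (at α.walk (i +ℕ 1))) (sym (+-identityʳ i))
       (at-close α.walk i 1 (≤-trans (+-monoʳ-≤ i (s≤s z≤n)) fits)))) (subst (λ k → Close r0 (at α.walk k) y) refl c))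
      go (suc j) _ c (inl (s≤s l)) = between j l (y , o , close-mono (n≤1+n r0) c)
      go (suc zero) _ c (inr refl) = case 1≤m of λ ()
      go (suc (suc j)) l c (inr refl) = between j (n<1+n j) (y , o , close-+ (subst (λ k → Close 1 (at α.walk (i +ℕ suc j)) (at α.walk k)) (sym (+-suc i (suc j)))
       (at-next α.walk (i +ℕ suc j) (≤-trans (≤-reflexive (sym (+-suc i (suc j)))) fits))) c)

     stretch-apart : ∀ {p q n} (T : W[ p , q ] n) → (∀ {y} → OnWalk graph y T → Other y) → Apart stretch T
     stretch-apart T f p q o o' c = let (j , l , eq) = on-at o in apart-at j l q (f o') (subst (λ z → Close r0 z q) (trans (sym eq) (sym (places j l))) c)

     Meets : ∀ {p q k l} → W[ p , w ] k → W[ q , w ] l → ℕ → Set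
     Meets S T j = Σ[ t ∈ V ] (OnWalk graph t T × Close r (at S j) t)

     -- The hexagon: the corner at w is cut off at the first point of S close to T.
     hexagon : ∀ {k l} (S : W[ fst left , w ] k) (T : W[ fst right , w ] l) → Geodetic S → Geodetic T →
      (∀ {y} → OnWalk graph y S → Other y) → (∀ {y} → OnWalk graph y T → Other y) →
      ∀ j → Meets S T j → (∀ i → Meets S T i → j ≤ℕ i) → j ≤ℕ k → suc m ≤ℕ M
     hexagon S T gS gT fS fT j (t , t-on , ct) min j≤ with on-at t-on
     ... | l , l≤ , refl with split-at S j j≤ | split-at T l l≤
     ...   | split A C | split A' C' = use (subst (λ z → Close r z (fst right)) at-y (snd (snd right)))
      (close-sym (subst₂ (Close r) (at-+ A C) (at-+ A' C') ct)) (close-sym (subst (λ z → Close r z (fst left)) at-x (snd (snd left))))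
      where
      short : ∀ i → i ≤ℕ j → 0 <ℕ j → ∀ p → OnWalk graph p A' → ¬ Close r0 (at (A +ʷ C) i) p
      short i i≤ (s≤s {n = j'} _) p o c = go (m≤n⇒m<n∨m≡n i≤) c
       where
       go : i <ℕ suc j' ⊎ i ≡ suc j' → Close r0 (at (A +ʷ C) i) p → ⊥
       go (inl l) c = <⇒≱ l (min i (p , on-+ˡ C' o , close-mono (n≤1+n r0) c))
       go (inr refl) c = <⇒≱ (n<1+n j') (min j' (p , on-+ˡ C' o , close-+ (at-next (A +ʷ C) j' j≤) c))
      far : 0 <ℕ j → Apart A' (rev A)
      far 0<j p q o o' c = let (i , i≤ , eq) = on-at (on-rev A o') in
       short i i≤ 0<j p o (close-sym (subst (Close r0 p) (trans (sym eq) (sym (at-+ˡ A C i i≤))) c))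
      use : Close r _ (fst right) → Close r _ _ → Close r (fst left) _ → suc m ≤ℕ M
      use (_ , l2 , κ2) (_ , l3 , κ3) (_ , l1 , κ1) = ≤-trans (≤-trans (m≤m+n (suc m) l) (m≤m+n (suc m +ℕ l) j))
       (Hexagon.size (sides stretch κ2 A' κ3 (rev A) κ1 stretch-geodetic (geodetic-prefix A' C' gT) (λ k X → geodetic-prefix A C gS k (rev X)) l1 l2 l3
        (stretch-apart A' (λ o → fT (on-+ˡ C' o))) (stretch-apart (rev A) (λ o → fS (on-+ˡ C (on-rev A o)))) far))

     size : suc m ≤ℕ M
     size = hexagon L1.side L2.side L1.geodetic L2.geodetic L1.other L2.other (fst corner) (fst (snd corner)) (snd (snd corner)) (snd (snd corner) L1.len end)
      where
      end : Meets L1.side L2.side L1.len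
      end = w , on-end L2.side , subst (λ z → Close r z w) (sym (at-end L1.side)) (0 , z≤n , [])
      corner : Σ[ j ∈ ℕ ] (Meets L1.side L2.side j × (∀ k → Meets L1.side L2.side k → j ≤ℕ k))
      corner = least (Meets L1.side L2.side) L1.len end

    module Far (x : V) (ix : ℕ) (ix≤ : ix ≤ℕ α.len) (at-ix : at α.walk ix ≡ x) (none : ∀ y → Other y → ¬ Close D x y) where
     not-here : ¬ Near-side ix
     not-here (y , o , c) = none y o (close-mono r≤D (subst (λ z → Close r z y) at-ix c))

     right-end : Near-side (ix +ℕ (α.len ∸ ix))
     right-end = v , inl start , subst (λ z → Close r z v) (sym (trans (cong (at α.walk) (m+[n∸m]≡n ix≤)) (at-end α.walk))) (0 , z≤n , [])
     left-end : Near-side (ix ∸ ix)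
     left-end = u , inr (on-end γ.walk) , subst (λ z → Close r z u) (sym (trans (cong (at α.walk) (n∸n≡0 ix)) (at-0 α.walk))) (0 , z≤n , [])

     Rightward : Σ[ k ∈ ℕ ] (Near-side (ix +ℕ k) × (∀ j → Near-side (ix +ℕ j) → k ≤ℕ j))
     Rightward = least (λ k → Near-side (ix +ℕ k)) (α.len ∸ ix) right-end
     Leftward : Σ[ k ∈ ℕ ] (Near-side (ix ∸ k) × (∀ j → Near-side (ix ∸ j) → k ≤ℕ j))
     Leftward = least (λ k → Near-side (ix ∸ k)) ix left-end

     stretched : ∀ k1 k2 → Near-side (ix ∸ k1) → (∀ j → Near-side (ix ∸ j) → k1 ≤ℕ j) → k1 ≤ℕ ix →
      Near-side (ix +ℕ k2) → (∀ j → Near-side (ix +ℕ j) → k2 ≤ℕ j) → ix +ℕ k2 ≤ℕ α.len → ⊥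
     stretched zero _ n _ _ _ _ _ = not-here n
     stretched _ zero _ _ _ n _ _ = not-here (subst Near-side (+-identityʳ ix) n)
     stretched (suc k1) (suc k2) n1 min1 k1≤ n2 min2 fits = too-long r (suc k1) (suc k2)
      (≰⇒> λ h → none y1 o1 (close-mono (subst (suc k1 +ℕ r ≤ℕ_) (sym D-is) h) (close-+ (close-sym (subst (Close (suc k1) (at α.walk i)) (trans (cong (at α.walk) i+k1) at-ix) (at-close α.walk i (suc k1) (subst (_≤ℕ α.len) (sym i+k1) ix≤)))) c1)))
      (≰⇒> λ h → none y2 o2 (close-mono (subst (suc k2 +ℕ r ≤ℕ_) (sym D-is) h) (close-+ (subst (λ z → Close (suc k2) z (at α.walk (ix +ℕ suc k2))) at-ix (at-close α.walk ix (suc k2) fits)) c2)))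
      (subst (suc k1 +ℕ suc k2 ≤ℕ_) M-is (Stretch.size i m0 1≤m (subst (_≤ℕ α.len) (sym total) fits) n1 (subst Near-side (sym total) n2) between))
      where
      i m0 : ℕ
      i = ix ∸ suc k1
      m0 = k1 +ℕ suc k2
      y1 = fst n1
      o1 = fst (snd n1)
      c1 = snd (snd n1)
      y2 = fst n2
      o2 = fst (snd n2)
      c2 = snd (snd n2)
      i+k1 : i +ℕ suc k1 ≡ ix
      i+k1 = m∸n+n≡m k1≤
      total : i +ℕ suc m0 ≡ ix +ℕ suc k2
      total = trans (sym (+-assoc i (suc k1) (suc k2))) (cong (_+ℕ suc k2) i+k1)
      1≤m : 1 ≤ℕ m0
      1≤m = ≤-trans (s≤s z≤n) (m≤n+m (suc k2) k1)
      between : ∀ j → j <ℕ m0 → ¬ Near-side (i +ℕ suc j)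
      between j j<m near = [ before-ix , after-ix ]′ (≤-total (i +ℕ suc j) ix)
       where
       p : ℕ
       p = i +ℕ suc j
       before-ix : p ≤ℕ ix → ⊥
       before-ix l = ℕP.<-irrefl refl (≤-trans (s≤s (+-monoʳ-≤ i (min1 (ix ∸ p) (subst Near-side (sym (m∸[m∸n]≡n l)) near))))
        (≤-trans (+-monoˡ-≤ (ix ∸ p) (≤-trans (s≤s (m≤m+n i j)) (≤-reflexive (sym (+-suc i j))))) (≤-reflexive (trans (m+[n∸m]≡n l) (sym i+k1)))))
       after-ix : ix ≤ℕ p → ⊥
       after-ix l = <⇒≱ (≤-trans (+-monoʳ-< i (s≤s j<m)) (≤-reflexive total))
        (≤-trans (+-monoʳ-≤ ix (min2 (p ∸ ix) (subst Near-side (sym (m+[n∸m]≡n l)) near))) (≤-reflexive (m+[n∸m]≡n l)))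

     absurd : ⊥
     absurd = stretched (fst Leftward) (fst Rightward) (fst (snd Leftward)) (snd (snd Leftward)) (snd (snd Leftward) ix left-end)
      (fst (snd Rightward)) (snd (snd Rightward)) (≤-trans (+-monoʳ-≤ ix (snd (snd Rightward) (α.len ∸ ix) right-end)) (≤-reflexive (m+[n∸m]≡n ix≤)))

   thin : Thin' D
   thin α β γ x o = by-contra λ none → let (i , i≤ , eq) = on-at o in
    Triangle.Far.absurd α β γ x i i≤ eq λ y y-on c → none (y , y-on , c)

 -- Hyperbolicity from non-amenability and bounded codegree

 module Hyperbolicity where
  open Fillings
  open ThinTriangles

  private variable
   u v : V
   m n : ℕ

  thin-exists : ∀ B K0 → (∀ {u n} (Z : W[ u , u ] (suc n)) → Area B K0 Z) → Σ[ D ∈ ℕ ] Thin' D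
  thin-exists B K0 area = 12 *ℕ suc r0 , Thinness.thin (scale B K0 area Q r0 (7 *ℕ (3 *ℕ suc r0) +ℕ 1) (12 *ℕ suc r0) refl refl refl refl)
   where
   Q r0 : ℕ
   Q = suc B +ℕ suc B
   r0 = Q *ℕ (K0 +ℕ K0) +ℕ Q *ℕ (K0 +ℕ K0)

  hyperbolic : ∀ {D} → Thin' D → Hyperbolic graph
  hyperbolic {D} thin = ι (pos D / 1) , (λ h → <-irrefl refl (<-≤-trans h (frac-mono 0 D 0 0 z≤n))) ,
   λ _ _ _ _ α β γ → (λ {x} → side (thin α β γ) x) , (λ {x} → side (thin β γ α) x) , λ {x} → side (thin γ α β) x
   where
   side : ∀ {P Q R : V → Set} → (∀ x → P x → Σ[ y ∈ V ] ((Q y ⊎ R y) × Σ[ n ∈ ℕ ] (n ≤ℕ D × W[ x , y ] n))) →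
    ∀ x → P x → Neighbourhood graph (ι (pos D / 1)) (Q ∪ R) x
   side h x p = let (y , q , n , n≤D , W) = h x p in y , q , dist x y , is-distance (n , W) ,
    λ l → <-irrefl refl (<-≤-trans l (frac-mono (dist x y) D 0 0 (*-monoˡ-≤ 1 (≤-trans (dist-≤ W) n≤D))))

  module Backward
   (noacc : NoVertexAccumulation G)
   (star : V → List E) (in-star : Stars star) (Δ : ℕ) (star-length : ∀ v → length (star v) ≤ℕ Δ)
   (faces : FaceLists)
   (Δ* : ℕ) (face-length : ∀ z c → length (fst (faces z c)) ≤ℕ Δ*)
   (C : ℕ) (iso : Isoperimetry (C *ℕ_)) where
   open Balls star in-star Δ star-length
   open Leaves star in-star Δ star-length (C *ℕ_) (*-zeroʳ C) iso using (leaves)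
   open Isoperimetric noacc (C *ℕ_) (*-monoʳ-≤ C) iso using (enclosed-bound)

   c K0 B : ℕ
   c = (4 +ℕ diameter Δ*) +ℕ (4 +ℕ diameter Δ*)
   K0 = c +ℕ (c +ℕ c) +ℕ c
   -- A closed walk of length l encloses at most (C + 1) (l + 1) vertices; the other factors bound
   -- the number of edges at the ball of radius `K0` around each.
   B = suc C *ℕ (growth ^ K0 *ℕ Δ)

   area : (Z : W[ u , u ] (suc n)) → Area B K0 Z
   area {u} {n} Z = go (has-size {P = Enclosed Z} (vertices Z ++ fst (inside-finite noacc Z))
    λ { (inl o) → ∈-++⁺ˡ (on-vertices o) ; {v} (inr h) → ∈-++⁺ʳ (vertices Z) (snd (inside-finite noacc Z) v h) })
    where
    go : Σ[ N ∈ ℕ ] HasSize (Enclosed Z) N → Area B K0 Z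
    go (_ , vs , un , f , refl) = record
     { Base = Enclosed Z ; ne = stars (ball K0 vs)
     ; few = ≤-trans (length-concatMap star star-length (ball K0 vs)) (≤-trans (*-monoˡ-≤ Δ (ball-length K0 vs))
      (≤-trans (≤-reflexive (*-assoc (length vs) (growth ^ K0) Δ)) (≤-trans (*-monoˡ-≤ g (enclosed-bound Z vs un λ {x} i → to (f x) i))
       (≤-reflexive (trans (*-assoc (suc C) (suc (suc n)) g) (trans (cong (suc C *ℕ_) (*-comm (suc (suc n)) g)) (sym (*-assoc (suc C) g (suc (suc n))))))))))
     ; near = λ {o} b (k , k≤ , P) → in-stars (inl refl) (in-ball K0 (from (f o) b) P k≤)
     ; fill = Filling.fillable (tiled (terrain noacc star in-star leaves) faces Δ* face-length) Z }
     where
     g : ℕ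
     g = growth ^ K0 *ℕ Δ

  -- The numerator is at least 1, so the reciprocal of the denominator will do.
  positive-bound : ∀ r → 0ℚ < r → Σ[ C ∈ ℕ ] pos 1 / suc C ≤ r
  positive-bound (mkℚ (pos zero) d _) (*<* (ℤ.+<+ ()))
  positive-bound (mkℚ -[1+ a ] d _) (*<* ())
  positive-bound (mkℚ (pos (suc a)) d _) _ = d , ℚP.toℚᵘ-cancel-≤ (ℚᵘP.≤-trans (ℚᵘP.≤-reflexive (ℚP.toℚᵘ-fromℚᵘ (mkℚᵘ (pos 1) d)))
   (*≤* (subst₂ ℤ._≤_ (ℤP.pos-* 1 (suc d)) (ℤP.pos-* (suc a) (suc d)) (ℤ.+≤+ (*-monoˡ-≤ (suc d) {1} {suc a} (s≤s z≤n))))))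

  backward : NoVertexAccumulation G → BoundedDegree graph → NoUnboundedFace G → NonAmenable graph → BoundedCodegree G → Hyperbolic graph × WeaklyNonAmenable graph
  backward noacc (Δ , deg) nuf (r , 0<r , inf) (Δ* , codeg) = go (positive-bound r 0<r)
   where
   go : Σ[ C ∈ ℕ ] pos 1 / suc C ≤ r → Hyperbolic graph × WeaklyNonAmenable graph
   go (C , C≤r) = hyperbolic (snd (thin-exists _ _ area)) , (suc C *ℕ_) , *-zeroʳ (suc C) , *-monoʳ-≤ (suc C) , (λ N → N , λ n h → ≤-trans h (m≤m+n n (C *ℕ n))) , iso
    where
    iso : Isoperimetry (suc C *ℕ_)
    iso S m n sz sz∂ = ≤-trans (≤-reflexive (sym (+-identityʳ (suc m)))) (≤-trans
     (frac-mono⁻ 1 n C m (ℚP.≤-trans C≤r (inf (pos n / suc m) (S , m , n , sz , sz∂ , refl)))) (≤-reflexive (*-comm n (suc C))))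
    open Backward noacc (λ v → fst (fst (snd (deg v)))) (λ {e} {v} i → from (fst (snd (snd (fst (snd (deg v))))) e) i) Δ
     (λ v → ≤-trans (≤-reflexive (snd (snd (snd (fst (snd (deg v))))))) (snd (snd (deg v))))
     (λ z c → fst (snd (nuf z c)) , fst (snd (snd (snd (nuf z c))))) Δ*
     (λ z c → codeg z _ c (fst (snd (nuf z c)) , fst (snd (snd (nuf z c))) , fst (snd (snd (snd (nuf z c)))) , refl)) (suc C) iso

theorem1p1 : (∀ ℓ → ExcludedMiddle ℓ) →
 (G : PlaneGraph) →
 NoVertexAccumulation G →
 BoundedDegree (PlaneGraph.graph G) →
 NoUnboundedFace G →
 (Hyperbolic (PlaneGraph.graph G) × WeaklyNonAmenable (PlaneGraph.graph G))
 ⇔ (NonAmenable (PlaneGraph.graph G) × BoundedCodegree G)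
theorem1p1 em G noacc degrees faces = mk⇔
 (λ (hyperbolic , amenable) → Planar.Codegree.forward (given em G) noacc degrees faces hyperbolic amenable)
 (λ (amenable , codegrees) → Planar.Hyperbolicity.backward (given em G) noacc degrees faces amenable codegrees)
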